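{- Let $t$, $\epsilon$, and $\epsilon'$ be positive constants. The (unbalanced) 3-HS Hypothesis implies that there exists no fully dynamic algorithm for $(3/2-\epsilon)$-approximate Radius on undirected, unweighted graphs with $n$ vertices and $\tilde{O}(n)$ edges which has preprocessing time $p(n)=O(n^t)$, amortized update time $u(n)=O(n^{2-\epsilon'})$, and amortized query time $q(n)=O(n^{2-\epsilon'})$. The same result holds for the incremental and decremental settings, but for worst-case update and query times.
   Context: $\tilde{O}$ suppresses polylogarithmic factors. For a graph $G=(V,E)$, $d(u,v)$ is the length of a shortest path from $u$ to $v$; the eccentricity of $v$ is $\varepsilon(v)=\max_{u\in V}d(v,u)$; the radius is $\min_v\varepsilon(v)$. A fully dynamic algorithm preprocesses an initial graph and then supports edge insertions and edge deletions (updates) as well as queries asking for (an estimate of) the parameter of the current graph; in the incremental (decremental) setting only edge insertions (only edge deletions) are supported. An $\alpha$-approximation algorithm answers each query about a parameter with current value $P$ by a value $\hat P$ with $P\le \hat P\le \alpha P$ (equivalently, after rescaling, $P/\alpha\le\hat P\le P$). Unbalanced 3-HS is the problem: given $U,V,W\subseteq\{0,1\}^d$ with $|U|=n$, $|V|=n^a$, $|W|=n^b$ for constants $a,b>0$, decide whether there are $u\in U$, $w\in W$ such that for all $v\in V$, $u\cdot v\cdot w:=\sum_{i=1}^d u[i]v[i]w[i]\neq 0$. The unbalanced 3-HS Hypothesis is that unbalanced 3-HS requires $(|U|\cdot|V|\cdot|W|)^{1-o(1)}=n^{1+a+b-o(1)}$ time in the word-RAM model with $O(\log n)$-bit words, even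 for randomized algorithms. -}

module Defs where

open import Data.Bool.Base using (Bool; true; false; if_then_else_; _∧_; _∨_; _xor_)
open import Data.Empty using (⊥)
open import Data.Fin.Base as Fin using (Fin; toℕ)
import Data.Fin.Properties as Fin
open import Data.Integer.Base as ℤ using (ℤ; +_; -[1+_])
open import Data.List.Base as List using (List; []; _∷_; _∷ʳ_; length; map; filter)
open import Data.List.Membership.Propositional using (_∈_; _∉_)
open import Data.List.Relation.Binary.Pointwise.Base using (Pointwise)
open import Data.List.Relation.Unary.All using (All)
open import Data.List.Relation.Unary.Unique.Propositional using (Unique)
open import Data.Nat.Base
open import Data.Nat.ListAction using (sum)
open import Data.Nat.Properties using (m^n≢0)
open import Data.Product.Base using (∃; _×_; _,_; proj₁; proj₂)
open import Data.Product.Properties using (≡-dec)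
open import Data.Rational.Base as ℚ using (ℚ; 0ℚ; 1ℚ)
open import Data.Sum.Base using (_⊎_)
open import Data.Unit.Base using (⊤)
open import Data.Vec.Base as Vec using (Vec)
import Data.Vec.Membership.Propositional as Vec
import Data.Vec.Relation.Unary.Unique.Propositional as Vec
open import Relation.Binary.PropositionalEquality using (_≡_; _≢_)
open import Relation.Nullary using (¬_; ¬?; does)

------------------------------------------------------------------------
-- Powers with rational exponents

posPart negPart : ℤ → ℕ
posPart (+ m)    = m
posPart -[1+ _ ] = 0
negPart (+ _)    = 0
negPart -[1+ m ] = suc m

-- x ≤ K · n ^ e for n ≥ 1: with e = z / q in lowest terms, the inequality is
-- raised to the q-th power and n ^ z moved to the side where its exponent is
-- nonnegative.
infix 4 _≤_·_^ℚ_
_≤_·_^ℚ_ : ℕ → ℕ → ℕ → ℚ → Set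
x ≤ K · n ^ℚ e =
  x ^ ℚ.↧ₙ e * n ^ negPart (ℚ.↥ e) ≤ K ^ ℚ.↧ₙ e * n ^ posPart (ℚ.↥ e)

-- k = ⌊ n ^ e ⌋
IsFloorPower : ℕ → ℚ → ℕ → Set
IsFloorPower n e k = (k ≤ 1 · n ^ℚ e) × ¬ (suc k ≤ 1 · n ^ℚ e)

-- f (n) = O (n ^ e).  Asking for the bound at every n ≥ 1 instead of every
-- sufficiently large n only changes the constant, since n ^ e > 0.
IsO : (ℕ → ℕ) → ℚ → Set
IsO f e = ∃ λ C → ∀ n → .{{NonZero n}} → f n ≤ C · n ^ℚ e

------------------------------------------------------------------------
-- The word RAM
--
-- Programs are structured programs over word variables and arrays, both
-- named by natural numbers; a program mentions only finitely many of them.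
-- Words are natural numbers.  That they have O(log N) bits is a restriction on
-- executions: every word computed must be smaller than a bound which the
-- users of Exec below take polynomial in N.

infix 6 _[_↦_]
_[_↦_] : {A : Set} → (ℕ → A) → ℕ → A → (ℕ → A)
(f [ i ↦ x ]) j = if i ≡ᵇ j then x else f j

at : {A : Set} → A → List A → ℕ → A
at default []       _       = default
at default (x ∷ _)  zero    = x
at default (_ ∷ xs) (suc i) = at default xs i

bit : Bool → ℕ
bit b = if b then 1 else 0

-- The first argument bounds the number of binary digits processed.
bitwise : ℕ → (Bool → Bool → Bool) → ℕ → ℕ → ℕ
bitwise zero    f x y = 0
bitwise (suc k) f x y =
  bit (f (x % 2 ≡ᵇ 1) (y % 2 ≡ᵇ 1)) + 2 * bitwise k f (x / 2) (y / 2)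

data BinOp : Set where
  add sub mul quo rem and or xor shl shr : BinOp

-- Subtraction is truncated, so `sub` also provides comparison.  Division and
-- remainder by zero return 0.
⟦_⟧ : BinOp → ℕ → ℕ → ℕ
⟦ add ⟧ x y       = x + y
⟦ sub ⟧ x y       = x ∸ y
⟦ mul ⟧ x y       = x * y
⟦ quo ⟧ x zero    = 0
⟦ quo ⟧ x (suc y) = x / suc y
⟦ rem ⟧ x zero    = 0
⟦ rem ⟧ x (suc y) = x % suc y
⟦ and ⟧ x y       = bitwise (x + y) _∧_ x y
⟦ or  ⟧ x y       = bitwise (x + y) _∨_ x y
⟦ xor ⟧ x y       = bitwise (x + y) _xor_ x y
⟦ shl ⟧ x y       = x * 2 ^ y
⟦ shr ⟧ x y       = _/_ x (2 ^ y) {{m^n≢0 2 y}}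

infixr 5 _⨾_
data Prog : Set where
  skip  : Prog
  const : (x c : ℕ) → Prog                 -- x := c
  op    : (x : ℕ) (o : BinOp) (y z : ℕ) → Prog  -- x := y o z
  load  : (x a y : ℕ) → Prog               -- x := a[y]
  store : (a y z : ℕ) → Prog               -- a[y] := z
  flip  : (x : ℕ) → Prog                   -- x := a fresh random bit
  _⨾_   : Prog → Prog → Prog
  cond  : (x : ℕ) → Prog → Prog → Prog     -- first branch iff x ≠ 0
  while : (x : ℕ) → Prog → Prog            -- repeat as long as x ≠ 0

record State : Set where
  constructor ⟨_,_⟩
  field
    var : ℕ → ℕ
    arr : ℕ → ℕ → ℕ

open State public

setVar : ℕ → ℕ → State → State
setVar x v ⟨ ρ , μ ⟩ = ⟨ ρ [ x ↦ v ] , μ ⟩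

setArr : ℕ → ℕ → ℕ → State → State
setArr a i v ⟨ ρ , μ ⟩ = ⟨ ρ , μ [ a ↦ μ a [ i ↦ v ] ] ⟩

-- Words 0, 1, … and arrays 0, 1, … hold the given contents; all else is 0.
initial : List ℕ → List (List ℕ) → State
initial vs as = ⟨ at 0 vs , (λ a → at 0 (at [] as a)) ⟩

-- The random bits not used yet.
Tape : Set
Tape = List Bool

-- Exec B p s ω s′ ω′ τ: with word bound B, program p started in state s on
-- tape ω halts in state s′ with remaining tape ω′ after τ steps.
data Exec (B : ℕ) : Prog → State → Tape → State → Tape → ℕ → Set where
  skip  : ∀ {s ω} → Exec B skip s ω s ω 1
  const : ∀ {x c s ω} → c < B →
          Exec B (const x c) s ω (setVar x c s) ω 1
  op    : ∀ {x o y z s ω} → ⟦ o ⟧ (var s y) (var s z) < B →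
          Exec B (op x o y z) s ω (setVar x (⟦ o ⟧ (var s y) (var s z)) s) ω 1
  load  : ∀ {x a y s ω} →
          Exec B (load x a y) s ω (setVar x (arr s a (var s y)) s) ω 1
  store : ∀ {a y z s ω} →
          Exec B (store a y z) s ω (setArr a (var s y) (var s z) s) ω 1
  flip  : ∀ {x b s ω} →
          Exec B (flip x) s (b ∷ ω) (setVar x (bit b) s) ω 1
  seq   : ∀ {p q s ω s′ ω′ s″ ω″ τ τ′} →
          Exec B p s ω s′ ω′ τ → Exec B q s′ ω′ s″ ω″ τ′ →
          Exec B (p ⨾ q) s ω s″ ω″ (τ + τ′)
  then′ : ∀ {x p q s ω s′ ω′ τ} → var s x ≢ 0 →
          Exec B p s ω s′ ω′ τ → Exec B (cond x p q) s ω s′ ω′ (suc τ)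
  else′ : ∀ {x p q s ω s′ ω′ τ} → var s x ≡ 0 →
          Exec B q s ω s′ ω′ τ → Exec B (cond x p q) s ω s′ ω′ (suc τ)
  stop  : ∀ {x p s ω} → var s x ≡ 0 →
          Exec B (while x p) s ω s ω 1
  loop  : ∀ {x p s ω s′ ω′ s″ ω″ τ τ′} → var s x ≢ 0 →
          Exec B p s ω s′ ω′ τ → Exec B (while x p) s′ ω′ s″ ω″ τ′ →
          Exec B (while x p) s ω s″ ω″ (suc (τ + τ′))

-- Randomized correctness is measured over the uniform distribution on tapes of
-- some finite length m.  A run halting on such a tape has not exhausted
-- it, so unread bits do not affect the probability.
-- Pr⅔ m P: a uniformly random tape of length m satisfies P with probability at
-- least 2/3.
Pr⅔ : (m : ℕ) → (Tape → Set) → Set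
Pr⅔ m P = ∃ λ (ωs : List (Vec Bool m)) →
  Unique ωs × All (λ ω → P (Vec.toList ω)) ωs × 2 * 2 ^ m ≤ 3 * length ωs

------------------------------------------------------------------------
-- Unbalanced 3-HS

Vector : ℕ → Set
Vector d = Vec (Fin 2) d

dot₃ : ∀ {d} → Vector d → Vector d → Vector d → ℕ
dot₃ u v w = Vec.sum (Vec.tabulate λ i →
  toℕ (Vec.lookup u i) * toℕ (Vec.lookup v i) * toℕ (Vec.lookup w i))

3HS : ∀ {d nᵤ nᵥ nᵥᵥ} →
      Vec (Vector d) nᵤ → Vec (Vector d) nᵥ → Vec (Vector d) nᵥᵥ → Set
3HS U V W = ∃ λ u → u Vec.∈ U × (∃ λ w → w Vec.∈ W × (∀ v → v Vec.∈ V → dot₃ u v w ≢ 0))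

-- Row-major: bit i of vector j is entry j * d + i.
flatten : ∀ {d k} → Vec (Vector d) k → List ℕ
flatten X = map toℕ (Vec.toList (Vec.concat X))

input3HS : ∀ {d nᵤ nᵥ nᵥᵥ} →
           Vec (Vector d) nᵤ → Vec (Vector d) nᵥ → Vec (Vector d) nᵥᵥ → State
input3HS {d} {nᵤ} {nᵥ} {nᵥᵥ} U V W =
  initial (nᵤ ∷ nᵥ ∷ nᵥᵥ ∷ d ∷ []) (flatten U ∷ flatten V ∷ flatten W ∷ [])

Decides3HS : ∀ {d nᵤ nᵥ nᵥᵥ} →
             Vec (Vector d) nᵤ → Vec (Vector d) nᵥ → Vec (Vector d) nᵥᵥ → ℕ → Set
Decides3HS U V W out = (3HS U V W → out ≡ 1) × (¬ 3HS U V W → out ≡ 0)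

-- A randomized algorithm with two-sided error at most 1/3 for |U| = n,
-- |V| = ⌊n ^ a⌋, |W| = ⌊n ^ b⌋, running in time O(n ^ (1+a+b-δ)) · poly(d).
-- (The hypothesis is usually stated for small d; admitting
-- only algorithms that work for every d, with a factor poly(d), makes the
-- hypothesis below the weakest of the customary variants.)
record Fast3HS (a b δ : ℚ) : Set where
  field
    prog         : Prog
    wordExponent : ℕ
    C k          : ℕ
    solves : ∀ n {d nᵥ nᵥᵥ} → .{{NonZero n}} →
      IsFloorPower n a nᵥ → IsFloorPower n b nᵥᵥ →
      (U : Vec (Vector d) n) (V : Vec (Vector d) nᵥ) (W : Vec (Vector d) nᵥᵥ) →
      Vec.Unique U → Vec.Unique V → Vec.Unique W →
      let Run = Exec ((2 + n + d) ^ wordExponent) prog (input3HS U V W) in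
      ∃ λ m →
        (∀ (ω : Vec Bool m) → ∃ λ s → ∃ λ ω′ → ∃ λ τ →
          Run (Vec.toList ω) s ω′ τ ×
          (τ ≤ C * suc d ^ k · n ^ℚ (1ℚ ℚ.+ a ℚ.+ b ℚ.- δ)))
        ×
        Pr⅔ m (λ ω → ∃ λ s → ∃ λ ω′ → ∃ λ τ →
          Run ω s ω′ τ × Decides3HS U V W (var s 0))

Unbalanced3HSHypothesis : Set
Unbalanced3HSHypothesis =
  ∀ a b δ → 0ℚ ℚ.< a → 0ℚ ℚ.< b → 0ℚ ℚ.< δ → ¬ Fast3HS a b δ

------------------------------------------------------------------------
-- Graphs and radius

-- The undirected edge {u , v} is written as (u , v) with u < v.
Edge : ℕ → Set
Edge n = Fin n × Fin n

Ordered : ∀ {n} → Edge n → Set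
Ordered (u , v) = u Fin.< v

EdgeList : ℕ → Set
EdgeList n = List (Edge n)

Simple : ∀ {n} → EdgeList n → Set
Simple G = Unique G × All Ordered G

module _ {n : ℕ} (G : EdgeList n) where

  Adjacent : Fin n → Fin n → Set
  Adjacent u v = (u , v) ∈ G ⊎ (v , u) ∈ G

  -- Vertices may repeat, which is immaterial for shortest paths.
  data Path : Fin n → Fin n → ℕ → Set where
    []  : ∀ {v} → Path v v 0
    _∷_ : ∀ {u v w l} → Adjacent u v → Path v w l → Path u w (suc l)

  IsDistance : Fin n → Fin n → ℕ → Set
  IsDistance u v l = Path u v l × (∀ l′ → Path u v l′ → l ≤ l′)

  IsEccentricity : Fin n → ℕ → Set
  IsEccentricity v e =
    (∀ u → ∃ λ l → IsDistance v u l × l ≤ e) × (∃ λ u → IsDistance v u e)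

  -- Satisfied by no r when G is disconnected.
  IsRadius : ℕ → Set
  IsRadius r =
    (∃ λ v → IsEccentricity v r) × (∀ v e → IsEccentricity v e → r ≤ e)

fromℕ : ℕ → ℚ
fromℕ k = + k ℚ./ 1

ApproximatesRadius : ∀ {n} → ℚ → EdgeList n → ℕ → Set
ApproximatesRadius α G P̂ =
  ∀ P → IsRadius G P → P ≤ P̂ × fromℕ P̂ ℚ.≤ α ℚ.* fromℕ P

------------------------------------------------------------------------
-- Dynamic algorithms

data Setting : Set where
  fullyDynamic incremental decremental : Setting

data Timing : Set where
  amortized worstCase : Timing

data Op (n : ℕ) : Set where
  insert delete : Edge n → Op n
  query         : Op n

Supports : ∀ {n} → Setting → Op n → Set
Supports incremental (delete _) = ⊥
Supports decremental (insert _) = ⊥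
Supports _           _          = ⊤

remove : ∀ {n} → Edge n → EdgeList n → EdgeList n
remove e = filter (λ e′ → ¬? (≡-dec Fin._≟_ Fin._≟_ e′ e))

-- Legal σ M G ops H: in setting σ, the operations ops lead from G to H, with
-- no insertion producing a graph with more than M edges.
data Legal (σ : Setting) (M : ℕ) {n : ℕ} : EdgeList n → List (Op n) → EdgeList n → Set where
  done : ∀ {G} → Legal σ M G [] G
  ins  : ∀ {G e ops H} → Supports σ (insert e) → Ordered e → e ∉ G → length G < M →
         Legal σ M (e ∷ G) ops H → Legal σ M G (insert e ∷ ops) H
  del  : ∀ {G e ops H} → Supports σ (delete e) → e ∈ G →
         Legal σ M (remove e G) ops H → Legal σ M G (delete e ∷ ops) H
  qry  : ∀ {G ops H} → Legal σ M G ops H → Legal σ M G (query ∷ ops) H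

-- One program for preprocessing and one for each kind of operation, sharing
-- their variables and arrays.
record DynamicProg : Set where
  field
    preprocess onInsert onDelete onQuery : Prog

open DynamicProg

inputGraph : ∀ {n} → EdgeList n → State
inputGraph {n} G = initial (n ∷ length G ∷ [])
  (map (λ e → toℕ (proj₁ e)) G ∷ map (λ e → toℕ (proj₂ e)) G ∷ [])

-- The endpoints of an inserted or deleted edge are passed in variables 0 and 1.
code : ∀ {n} → DynamicProg → Op n → Prog
code A (insert _) = onInsert A
code A (delete _) = onDelete A
code A query      = onQuery A

pass : ∀ {n} → Op n → State → State
pass (insert (u , v)) s = setVar 1 (toℕ v) (setVar 0 (toℕ u) s)
pass (delete (u , v)) s = setVar 1 (toℕ v) (setVar 0 (toℕ u) s)
pass query            s = s

-- The list contains the time of each operation.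
data ExecOps (B : ℕ) (A : DynamicProg) {n : ℕ} :
     List (Op n) → State → Tape → State → Tape → List ℕ → Set where
  []  : ∀ {s ω} → ExecOps B A [] s ω s ω []
  _∷_ : ∀ {o ops s ω s′ ω′ s″ ω″ τ τs} →
        Exec B (code A o) (pass o s) ω s′ ω′ τ → ExecOps B A ops s′ ω′ s″ ω″ τs →
        ExecOps B A (o ∷ ops) s ω s″ ω″ (τ ∷ τs)

-- Preprocessing G takes τ₀ steps, the operations take τs steps, s is the final state.
DynamicRun : ℕ → DynamicProg → ∀ {n} → EdgeList n → List (Op n) →
             Tape → State → ℕ → List ℕ → Set
DynamicRun B A G ops ω s τ₀ τs = ∃ λ s₀ → ∃ λ ω₀ → ∃ λ ω′ →
  Exec B (preprocess A) (inputGraph G) ω s₀ ω₀ τ₀ ×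
  ExecOps B A ops s₀ ω₀ s ω′ τs

-- Budget for one operation, given the update time u and query time q.
budget : ∀ {n} → ℕ → ℕ → Op n → ℕ
budget u q (insert _) = u
budget u q (delete _) = u
budget u q query      = q

WithinTime : Timing → (p u q : ℕ) → ∀ {n} → List (Op n) → ℕ → List ℕ → Set
WithinTime amortized p u q ops τ₀ τs = τ₀ + sum τs ≤ p + sum (map (budget u q) ops)
WithinTime worstCase p u q ops τ₀ τs = τ₀ ≤ p × Pointwise _≤_ τs (map (budget u q) ops)

-- A randomized dynamic α-approximation algorithm for radius on graphs with n vertices
-- and at most M n edges, with preprocessing time p n, update time u n and
-- query time q n.  Time bounds hold for all outcomes of the coins; each query
-- is answered correctly with probability at least 2/3, for every sequence
-- of operations fixed in advance (it suffices to say this for the last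
-- operation, since the algorithm is online).
-- Words have O(log (n + number of operations)) bits.
record DynamicRadius (σ : Setting) (T : Timing) (α : ℚ) (M p u q : ℕ → ℕ) : Set where
  field
    prog         : DynamicProg
    wordExponent : ℕ
    solves : ∀ n → .{{NonZero n}} → (G H : EdgeList n) (ops : List (Op n)) →
      Simple G → length G ≤ M n → Legal σ (M n) G ops H →
      let Run = DynamicRun ((2 + n + length ops) ^ wordExponent) prog G ops in
      ∃ λ m →
        (∀ (ω : Vec Bool m) → ∃ λ s → ∃ λ τ₀ → ∃ λ τs →
          Run (Vec.toList ω) s τ₀ τs × WithinTime T (p n) (u n) (q n) ops τ₀ τs)
        ×
        (∀ ops′ → ops ≡ ops′ ∷ʳ query →
          Pr⅔ m (λ ω → ∃ λ s → ∃ λ τ₀ → ∃ λ τs →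
            Run ω s τ₀ τs × ApproximatesRadius α H (var s 0)))

module Submission where

-- Let b exceed the exponent t of the preprocessing time.  From an instance of
-- 3-HS with |U| = |V| = n and |W| = n ^ b, build a graph on O (n · d) vertices in
-- which every vector of U, every vector of V and every coordinate has
-- vertices, joined by paths of a constant length L, and in which a vector w is
-- recorded by the presence of single edges C i – C′ i for the coordinates i in
-- w.  If some u ∈ U has u · v · w ≠ 0 for all v ∈ V, then the vertex of u reaches
-- everything within 4 L + 1; otherwise the radius is at least 6 L.  For L large in terms
-- of 1 / ε, a (3/2 − ε)-approximation tells these cases apart.  Going through all
-- w ∈ W takes O (d) updates and one query for each of them, hence
-- O (n ^ (2 + b − ε′)) · poly (d) time.  The updates for w are undone by opposite
-- updates in the fully dynamic setting; in the other two settings the memory is rolled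
-- back to its state after preprocessing, which time stamps on the memory cells make
-- possible with constant overhead.
--
-- Every answer is wrong with probability at most 1/3, so the whole computation is
-- repeated O (log |W|) times with independent coins: bounding the expectation
-- of 2 ^ (number of wrong answers) shows that, except with probability 1/3, all majority
-- votes are right.

open import Data.Bool.Base using (Bool; true; false; if_then_else_; _∧_; not; T; _∨_)
import Data.Bool.Properties as Boolₚ
open import Data.Bool.Properties using (T-≡; T?; ∧-zeroʳ)
open import Data.Empty using (⊥; ⊥-elim)
import Data.Fin.Base as Fin
open import Data.Fin.Base using (Fin; toℕ; zero; suc; fromℕ<; inject₁; lower₁; _↑ˡ_; _↑ʳ_; combine; remQuot; splitAt) renaming (fromℕ to lastFin)
open import Data.Fin.Induction using (<-weakInduction)
import Data.Fin.Properties as Finₚ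
import Data.Integer.Base as ℤ
open import Data.Integer.Base using (ℤ; -[1+_])
import Data.Integer.Properties as ℤₚ
open import Data.List.Base using (List; []; _∷_; _∷ʳ_; _++_; length; map; drop; take; concat; tabulate)
import Data.List.Membership.DecPropositional as DecMembership
open import Data.List.Membership.Propositional using (_∈_; _∉_)
open import Data.List.Membership.Propositional.Properties using (∈-++⁺ˡ; ∈-++⁺ʳ; ∈-++⁻; ∈-map⁺; ∈-map⁻; ∈-tabulate⁺; ∈-tabulate⁻; ∈-filter⁺; ∈-filter⁻)
import Data.List.Properties as Listₚ
open import Data.List.Properties using (++-assoc; ++-identityʳ; length-++; map-++; map-tabulate; tabulate-cong; map-∘; length-map)
open import Data.List.Relation.Binary.Pointwise.Base using (Pointwise; []; _∷_)
import Data.List.Relation.Unary.All as All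
open import Data.List.Relation.Unary.All using (All; []; _∷_)
import Data.List.Relation.Unary.All.Properties as Allₚ
import Data.List.Relation.Unary.AllPairs as AllPairs
open import Data.List.Relation.Unary.AllPairs using (AllPairs; []; _∷_)
import Data.List.Relation.Unary.AllPairs.Properties as AllPairsₚ
open import Data.List.Relation.Unary.Any using (here; there)
open import Data.List.Relation.Unary.Unique.Propositional using (Unique)
open import Data.Nat.Base
open import Data.Nat.Coprimality using (1-coprimeTo) renaming (sym to coprime-sym)
open import Data.Nat.DivMod using ([m+kn]%n≡m%n; m<n⇒m%n≡m; m%n<n; m<n*o⇒m/o<n; m<n⇒m/n≡0; m*n/n≡m; +-distrib-/-∣ʳ)
open import Data.Nat.Divisibility using (n∣m*n)
open import Data.Nat.ListAction using (sum)
open import Data.Nat.ListAction.Properties using (sum-++)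
open import Data.Nat.Logarithm using (⌊log₂_⌋)
open import Data.Nat.Properties
open import Data.Nat.Tactic.RingSolver using (solve-∀)
open import Data.Product.Base using (∃; ∃₂; _×_; _,_; proj₁; proj₂)
open import Data.Product.Properties using (≡-dec)
import Data.Rational.Base as ℚ
open import Data.Rational.Base using (ℚ; mkℚ; 0ℚ; 1ℚ; toℚᵘ)
import Data.Rational.Properties as ℚₚ
import Data.Rational.Unnormalised.Base as ℚᵘ
open import Data.Rational.Unnormalised.Base using (ℚᵘ; mkℚᵘ)
import Data.Rational.Unnormalised.Properties as ℚᵘₚ
open import Data.Sum.Base using (_⊎_; inj₁; inj₂; [_,_]′)
open import Data.Unit.Base using (tt)
import Data.Vec.Base as Vec
open import Data.Vec.Base using (Vec; []; _∷_)
import Data.Vec.Membership.Propositional.Properties as VecMembershipₚ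
import Data.Vec.Properties as Vecₚ
import Data.Vec.Relation.Unary.Any as VecAny
import Data.Vec.Relation.Unary.Any.Properties as VecAnyₚ
import Data.Vec.Relation.Unary.Unique.Propositional as VecUnique
import Data.Vec.Relation.Unary.Unique.Propositional.Properties as VecUniqueₚ
open import Defs
open import Function.Base using (_∘_; case_of_)
open import Relation.Binary.PropositionalEquality using (_≡_; _≢_; refl; sym; trans; cong; cong₂; subst; subst₂)
open import Relation.Nullary using (¬_; Dec; yes; no; does; contradiction; ¬?)
open import Relation.Nullary.Decidable using (_×-dec_; _⊎-dec_; map′; dec-false; dec-true)

-- A vertex outside U might be central. Hence U is shared by two copies of everything else, and one
-- copy is left only through U. Distances are bounded from below by 1-Lipschitz potentials instead
-- of an analysis of paths. Extra all-ones rows, with a separate one for U in each copy, and an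
-- extra coordinate in which the vectors of U are 0 keep the stage graphs connected; in a
-- disconnected graph the guarantee says nothing. An amortized bound does not survive rollback,
-- which could repeat an expensive operation at will; hence the two ways of undoing updates. The
-- number of coins of an algorithm is only promised to exist, and a program cannot compute it. So
-- repetition `r` owns the tape positions congruent to `r` modulo the number `R` of repetitions, and
-- coins drawn too early wait in a buffer. A rollback also rewinds the coins: the stages of a
-- repetition are then dependent, but a union bound over W tolerates that. No logarithm is computed:
-- the vectors of U are distinct, so `n ≤ 2 ^ d`, and a multiple of `d` repetitions is affordable
-- because factors poly (d) are.

-- Executions, frame conditions and accounting of time by credits

module Runs where

  -- Word bounds only restrict runs, and unread coins are never inspected, so both may grow. This
  -- brings runs granted under different bounds and tape lengths to a common bound and a common
  -- tape.
  Exec-extend : ∀ {B B′ p s ω s′ ω′ τ} → B ≤ B′ → (ζ : Tape) →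
                Exec B p s ω s′ ω′ τ → Exec B′ p s (ω ++ ζ) s′ (ω′ ++ ζ) τ
  Exec-extend B≤ ζ skip         = skip
  Exec-extend B≤ ζ (const c<)   = const (<-≤-trans c< B≤)
  Exec-extend B≤ ζ (op v<)      = op (<-≤-trans v< B≤)
  Exec-extend B≤ ζ load         = load
  Exec-extend B≤ ζ store        = store
  Exec-extend B≤ ζ flip         = flip
  Exec-extend B≤ ζ (seq d e)    = seq (Exec-extend B≤ ζ d) (Exec-extend B≤ ζ e)
  Exec-extend B≤ ζ (then′ x d)  = then′ x (Exec-extend B≤ ζ d)
  Exec-extend B≤ ζ (else′ x d)  = else′ x (Exec-extend B≤ ζ d)
  Exec-extend B≤ ζ (stop x)     = stop x
  Exec-extend B≤ ζ (loop x d e) = loop x (Exec-extend B≤ ζ d) (Exec-extend B≤ ζ e)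

  -- The bounds `B` and `B′` may differ because they decide which runs exist, never what is
  -- computed. Runs granted separately for different operation sequences are identified through this
  -- on their common part.
  Exec-deterministic : ∀ {B B′ p s ω s₁ ω₁ τ₁ s₂ ω₂ τ₂} →
    Exec B p s ω s₁ ω₁ τ₁ → Exec B′ p s ω s₂ ω₂ τ₂ → s₁ ≡ s₂ × ω₁ ≡ ω₂
  Exec-deterministic skip         skip           = refl , refl
  Exec-deterministic (const _)    (const _)      = refl , refl
  Exec-deterministic (op _)       (op _)         = refl , refl
  Exec-deterministic load         load           = refl , refl
  Exec-deterministic store        store          = refl , refl
  Exec-deterministic flip         flip           = refl , refl
  Exec-deterministic (seq d e)    (seq d′ e′)    with refl , refl ← Exec-deterministic d d′ =
    Exec-deterministic e e′
  Exec-deterministic (then′ _ d)  (then′ _ d′)   = Exec-deterministic d d′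
  Exec-deterministic (then′ x _)  (else′ y _)    = contradiction y x
  Exec-deterministic (else′ x _)  (then′ y _)    = contradiction x y
  Exec-deterministic (else′ _ d)  (else′ _ d′)   = Exec-deterministic d d′
  Exec-deterministic (stop _)     (stop _)       = refl , refl
  Exec-deterministic (stop x)     (loop y _ _)   = contradiction x y
  Exec-deterministic (loop x _ _) (stop y)       = contradiction y x
  Exec-deterministic (loop _ d e) (loop _ d′ e′) with refl , refl ← Exec-deterministic d d′ =
    Exec-deterministic e e′

  -- A syntactic check with Boolean value: for a concrete program and a concrete name, the premise
  -- of `frameVar` or `frameArr` is proved by `refl`.
  keepsVar keepsArr : ℕ → Prog → Bool
  keepsVar x skip         = true
  keepsVar x (const y _)  = not (y ≡ᵇ x)
  keepsVar x (op y _ _ _) = not (y ≡ᵇ x)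
  keepsVar x (load y _ _) = not (y ≡ᵇ x)
  keepsVar x (store _ _ _) = true
  keepsVar x (flip y)     = not (y ≡ᵇ x)
  keepsVar x (p ⨾ q)      = keepsVar x p ∧ keepsVar x q
  keepsVar x (cond _ p q) = keepsVar x p ∧ keepsVar x q
  keepsVar x (while _ p)  = keepsVar x p
  keepsArr a (store b _ _) = not (b ≡ᵇ a)
  keepsArr a (p ⨾ q)      = keepsArr a p ∧ keepsArr a q
  keepsArr a (cond _ p q) = keepsArr a p ∧ keepsArr a q
  keepsArr a (while _ p)  = keepsArr a p
  keepsArr a _            = true

  ∧-true : ∀ {x y} → x ∧ y ≡ true → x ≡ true × y ≡ true
  ∧-true {true} {true} _ = refl , refl

  ∧-intro : ∀ {x y} → x ≡ true → y ≡ true → x ∧ y ≡ true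
  ∧-intro refl refl = refl

  private
    assign-other : ∀ {A : Set} (f : ℕ → A) y x v → not (y ≡ᵇ x) ≡ true → (f [ y ↦ v ]) x ≡ f x
    assign-other f y x v k with y ≡ᵇ x
    ... | false = refl

  frameVar : ∀ {B p s ω s′ ω′ τ} x → keepsVar x p ≡ true → Exec B p s ω s′ ω′ τ → var s′ x ≡ var s x
  frameVar x k skip = refl
  frameVar x k (const {y} {s = s} _) = assign-other (var s) y x _ k
  frameVar x k (op {y} {s = s} _) = assign-other (var s) y x _ k
  frameVar x k (load {y} {s = s}) = assign-other (var s) y x _ k
  frameVar x k store = refl
  frameVar x k (flip {y} {s = s}) = assign-other (var s) y x _ k
  frameVar x k (seq d e) with k₁ , k₂ ← ∧-true k = trans (frameVar x k₂ e) (frameVar x k₁ d)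
  frameVar x k (then′ _ d) = frameVar x (proj₁ (∧-true k)) d
  frameVar x k (else′ {p = p} _ d) = frameVar x (proj₂ (∧-true {keepsVar x p} k)) d
  frameVar x k (stop _) = refl
  frameVar x k (loop _ d e) = trans (frameVar x k e) (frameVar x k d)

  frameArr : ∀ {B p s ω s′ ω′ τ} a → keepsArr a p ≡ true → Exec B p s ω s′ ω′ τ → arr s′ a ≡ arr s a
  frameArr a k skip = refl
  frameArr a k (const _) = refl
  frameArr a k (op _) = refl
  frameArr a k load = refl
  frameArr a k (store {b} {s = s}) = assign-other (arr s) b a _ k
  frameArr a k flip = refl
  frameArr a k (seq d e) with k₁ , k₂ ← ∧-true k = trans (frameArr a k₂ e) (frameArr a k₁ d)
  frameArr a k (then′ _ d) = frameArr a (proj₁ (∧-true k)) d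
  frameArr a k (else′ {p = p} _ d) = frameArr a (proj₂ (∧-true {keepsArr a p} k)) d
  frameArr a k (stop _) = refl
  frameArr a k (loop _ d e) = trans (frameArr a k e) (frameArr a k d)

  flipFree : Prog → Bool
  flipFree (flip _)     = false
  flipFree (p ⨾ q)      = flipFree p ∧ flipFree q
  flipFree (cond _ p q) = flipFree p ∧ flipFree q
  flipFree (while _ p)  = flipFree p
  flipFree _            = true

  flipFree-tape : ∀ {B} p {s ω s′ ω′ τ} → flipFree p ≡ true → Exec B p s ω s′ ω′ τ → ω′ ≡ ω
  flipFree-tape _ k skip = refl
  flipFree-tape _ k (const _) = refl
  flipFree-tape _ k (op _) = refl
  flipFree-tape _ k load = refl
  flipFree-tape _ k store = refl
  flipFree-tape (p ⨾ q) k (seq d e) with k₁ , k₂ ← ∧-true k = trans (flipFree-tape q k₂ e) (flipFree-tape p k₁ d)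
  flipFree-tape (cond _ p q) k (then′ _ d) = flipFree-tape p (proj₁ (∧-true k)) d
  flipFree-tape (cond _ p q) k (else′ _ d) = flipFree-tape q (proj₂ (∧-true {flipFree p} k)) d
  flipFree-tape _ k (stop _) = refl
  flipFree-tape (while x p) k (loop _ d e) = trans (flipFree-tape (while x p) k e) (flipFree-tape p k d)

  -- Time is accounted by credits: started with c credits, p halts and what is
  -- left of them is passed on to the postcondition.
  Assertion : Set₁
  Assertion = State → Tape → ℕ → Set

  data Run (B : ℕ) (p : Prog) (s : State) (ω : Tape) (c : ℕ) (Q : Assertion) : Set where
    run : ∀ {s′ ω′ τ} c′ → Exec B p s ω s′ ω′ τ → τ + c′ ≤ c → Q s′ ω′ c′ → Run B p s ω c Q

  module _ {B : ℕ} where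

    Run-seq : ∀ {p q s ω c Q} → Run B p s ω c (λ s′ ω′ c′ → Run B q s′ ω′ c′ Q) → Run B (p ⨾ q) s ω c Q
    Run-seq {c = c} (run {τ = τ} c₁ d le (run {τ = τ′} c₂ e le′ r)) =
      run c₂ (seq d e) (≤-trans (≤-reflexive (+-assoc τ τ′ c₂)) (≤-trans (+-monoʳ-≤ τ le′) le)) r

    Run-map : ∀ {p s ω c} {Q Q′ : Assertion} → (∀ {s′ ω′ c′} → Q s′ ω′ c′ → Q′ s′ ω′ c′) →
              Run B p s ω c Q → Run B p s ω c Q′
    Run-map f (run c′ d le r) = run c′ d le (f r)

    Run-credit : ∀ {p s ω c c₁ Q} → c ≤ c₁ → Run B p s ω c Q → Run B p s ω c₁ Q
    Run-credit le (run c′ d le′ r) = run c′ d (≤-trans le′ le) r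

    Run-frame : ∀ {p s ω c} {Q Q′ : Assertion} → Run B p s ω c Q →
      (∀ {s′ ω′ c′} → (∀ x → keepsVar x p ≡ true → var s′ x ≡ var s x) →
                      (∀ a → keepsArr a p ≡ true → arr s′ a ≡ arr s a) →
                      Q s′ ω′ c′ → Q′ s′ ω′ c′) → Run B p s ω c Q′
    Run-frame (run c′ d le r) f =
      run c′ d le (f (λ x k → frameVar x k d) (λ a k → frameArr a k d) r)

    Run-then : ∀ {x p q s ω c Q} → var s x ≢ 0 → Run B p s ω c Q → Run B (cond x p q) s ω (suc c) Q
    Run-then nz (run c′ d le r) = run c′ (then′ nz d) (s≤s le) r

    Run-else : ∀ {x p q s ω c Q} → var s x ≡ 0 → Run B q s ω c Q → Run B (cond x p q) s ω (suc c) Q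
    Run-else z (run c′ d le r) = run c′ (else′ z d) (s≤s le) r

  cost : Prog → ℕ
  cost (p ⨾ q)      = cost p + cost q
  cost (cond _ p q) = suc (cost p + cost q)
  cost _            = 1

  -- The value computed by an operation is a component of its weakest precondition, so
  -- that the states occurring in a proof stay small.
  wp : ℕ → Prog → (State → Set) → State → Set
  wp B skip         Q s = Q s
  wp B (const x c)  Q s = c < B × Q (setVar x c s)
  wp B (op x o y z) Q s = ∃ λ v → ⟦ o ⟧ (var s y) (var s z) ≡ v × v < B × Q (setVar x v s)
  wp B (load x a y) Q s = Q (setVar x (arr s a (var s y)) s)
  wp B (store a y z) Q s = Q (setArr a (var s y) (var s z) s)
  wp B (flip _)     Q s = ⊥
  wp B (p ⨾ q)      Q s = wp B p (wp B q Q) s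
  wp B (cond x p q) Q s = (var s x ≢ 0 → wp B p Q s) × (var s x ≡ 0 → wp B q Q s)
  wp B (while _ _)  Q s = ⊥

  wp-exec : ∀ {B} p {Q : State → Set} {s} ω → wp B p Q s →
            ∃₂ λ s′ τ → Exec B p s ω s′ ω τ × τ ≤ cost p × Q s′
  wp-exec skip          ω w        = _ , _ , skip , ≤-refl , w
  wp-exec (const x c)   ω (c< , w) = _ , _ , const c< , ≤-refl , w
  wp-exec (op x o y z)  ω (_ , refl , v< , w) = _ , _ , op v< , ≤-refl , w
  wp-exec (load x a y)  ω w        = _ , _ , load , ≤-refl , w
  wp-exec (store a y z) ω w        = _ , _ , store , ≤-refl , w
  wp-exec (p ⨾ q)       ω w        with _ , _ , d , d≤ , w′ ← wp-exec p ω w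
                                   with _ , _ , e , e≤ , r  ← wp-exec q ω w′ =
    _ , _ , seq d e , +-mono-≤ d≤ e≤ , r
  wp-exec (cond x p q) {s = s} ω (w₁ , w₂) with var s x ≟ 0
  ... | yes z with _ , _ , d , d≤ , r ← wp-exec q ω (w₂ z) =
    _ , _ , else′ z d , s≤s (≤-trans d≤ (m≤n+m _ (cost p))) , r
  ... | no nz with _ , _ , d , d≤ , r ← wp-exec p ω (w₁ nz) =
    _ , _ , then′ nz d , s≤s (≤-trans d≤ (m≤m+n _ (cost q))) , r

  ≡ᵇ-refl : ∀ x → (x ≡ᵇ x) ≡ true
  ≡ᵇ-refl zero    = refl
  ≡ᵇ-refl (suc x) = ≡ᵇ-refl x

  -- Variable 4 is assumed to hold 1.
  for : (x lim f : ℕ) → Prog → Prog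
  for x lim f body =
    const x 0 ⨾ op f sub lim x ⨾ while f (body ⨾ op x add x 4 ⨾ op f sub lim x)

  module _ {B : ℕ} (x lim f : ℕ) (body : Prog) {n t : ℕ} (I : ℕ → Assertion)
    (n<B   : n < B)
    (f≠x   : (f ≡ᵇ x) ≡ false) (x≠lim : (x ≡ᵇ lim) ≡ false) (f≠lim : (f ≡ᵇ lim) ≡ false)
    (x≠4   : (x ≡ᵇ 4) ≡ false) (f≠4 : (f ≡ᵇ 4) ≡ false)
    (body-x : keepsVar x body ≡ true) (body-lim : keepsVar lim body ≡ true)
    (body-4 : keepsVar 4 body ≡ true)
    (stable : ∀ {k s ω c} v v′ → I k s ω c → I k (setVar f v (setVar x v′ s)) ω c)
    (step : ∀ k {s ω c} → k < n → var s x ≡ k → var s lim ≡ n → var s 4 ≡ 1 → I k s ω c →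
            Run B body s ω (t + c) (I (suc k)))
    where

    private
      same : ∀ s y v → var (setVar y v s) y ≡ v
      same s y v rewrite ≡ᵇ-refl y = refl

      other : ∀ s y z v → (y ≡ᵇ z) ≡ false → var (setVar y v s) z ≡ var s z
      other s y z v eq rewrite eq = refl

      Body = body ⨾ op x add x 4 ⨾ op f sub lim x

      -- `m` counts the rounds left and is at the same time the value of the guard `f`, so the
      -- induction follows the test of the loop. A round costs `t` for the body and 3 for the two
      -- instructions and the test; the outer `suc` pays for the final test.
      iterate : ∀ m {k s ω c} → k + m ≡ n → var s x ≡ k → var s f ≡ m → var s lim ≡ n → var s 4 ≡ 1 →
                I k s ω c → Run B (while f Body) s ω (suc (m * (3 + t)) + c) (I n)
      iterate zero {k} eq xk fm ln on i with refl ← trans (sym (+-identityʳ k)) eq =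
        run _ (stop fm) ≤-refl i
      iterate (suc m) {k} {s} {ω} {c} eq xk fm ln on i
        with run {s′} {ω′} {τ} c₁ d le r ← Run-frame {Q′ = λ s′ ω′ c′ → var s′ x ≡ k × var s′ lim ≡ n × var s′ 4 ≡ 1 × I (suc k) s′ ω′ c′}
               (step k (≤-trans (≤-reflexive (+-comm 1 k)) (≤-trans (+-monoʳ-≤ k (s≤s z≤n)) (≤-reflexive eq))) xk ln on i)
               (λ kv _ r → trans (kv x body-x) xk , trans (kv lim body-lim) ln , trans (kv 4 body-4) on , r)
        with x₁ , l₁ , o₁ , i₁ ← r
        with run {τ = τ′} c₂ e le′ q ← iterate m {suc k} {setVar f m (setVar x (suc k) s′)} {ω′} {c₁}
               (trans (sym (+-suc k m)) eq)
               (trans (other (setVar x (suc k) s′) f x m f≠x) (same s′ x (suc k)))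
               (same (setVar x (suc k) s′) f m)
               (trans (other (setVar x (suc k) s′) f lim m f≠lim) (trans (other s′ x lim (suc k) x≠lim) l₁))
               (trans (other (setVar x (suc k) s′) f 4 m f≠4) (trans (other s′ x 4 (suc k) x≠4) o₁))
               (stable m (suc k) i₁) =
        run c₂ (loop (λ z → case trans (sym fm) z of λ ()) (seq d (seq e₁ e₂)) e) time q
        where
        k<n : suc k ≤ n
        k<n = ≤-trans (s≤s (m≤m+n k m)) (≤-reflexive (trans (sym (+-suc k m)) eq))
        v₁ : var s′ x + var s′ 4 ≡ suc k
        v₁ = trans (cong₂ _+_ x₁ o₁) (+-comm k 1)
        e₁ : Exec B (op x add x 4) s′ ω′ (setVar x (suc k) s′) ω′ 1
        e₁ = subst (λ v → Exec B (op x add x 4) s′ ω′ (setVar x v s′) ω′ 1) v₁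
               (op (subst (_< B) (sym v₁) (≤-<-trans k<n n<B)))
        v₂ : var (setVar x (suc k) s′) lim ∸ var (setVar x (suc k) s′) x ≡ m
        v₂ = trans (cong₂ _∸_ (trans (other s′ x lim (suc k) x≠lim) l₁) (same s′ x (suc k)))
               (trans (cong (_∸ suc k) (sym eq)) (trans (cong (_∸ suc k) (+-suc k m)) (m+n∸m≡n k m)))
        e₂ : Exec B (op f sub lim x) (setVar x (suc k) s′) ω′ (setVar f m (setVar x (suc k) s′)) ω′ 1
        e₂ = subst (λ v → Exec B (op f sub lim x) _ ω′ (setVar f v (setVar x (suc k) s′)) ω′ 1) v₂
               (op (subst (_< B) (sym v₂) (≤-<-trans (≤-trans (m≤n+m m (suc k)) (≤-reflexive (trans (sym (+-suc k m)) eq))) n<B)))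
        time : suc (τ + (1 + 1) + τ′) + c₂ ≤ suc (suc m * (3 + t)) + c
        time = begin
          suc (τ + (1 + 1) + τ′) + c₂          ≡⟨ arith₁ τ τ′ c₂ ⟩
          (τ′ + c₂) + (3 + τ)                  ≤⟨ +-monoˡ-≤ (3 + τ) le′ ⟩
          suc (m * (3 + t)) + c₁ + (3 + τ)     ≡⟨ arith₂ (m * (3 + t)) c₁ τ ⟩
          suc (m * (3 + t)) + (3 + (τ + c₁))   ≤⟨ +-monoʳ-≤ (suc (m * (3 + t))) (+-monoʳ-≤ 3 le) ⟩
          suc (m * (3 + t)) + (3 + (t + c))    ≡⟨ arith₃ (m * (3 + t)) t c ⟩
          suc (suc m * (3 + t)) + c            ∎
          where
          open ≤-Reasoning
          arith₁ : ∀ a b c → suc (a + (1 + 1) + b) + c ≡ (b + c) + (3 + a)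
          arith₁ = solve-∀
          arith₂ : ∀ a b c → suc a + b + (3 + c) ≡ suc a + (3 + (c + b))
          arith₂ = solve-∀
          arith₃ : ∀ a t c → suc a + (3 + (t + c)) ≡ suc ((3 + t) + a) + c
          arith₃ = solve-∀

    -- `stable` is asked of the invariant because the loop itself overwrites `x` and `f` between
    -- rounds. Credits beyond the fixed cost pass through `I`, so that rounds of varying cost, such
    -- as those running simulated code, can draw on a common reserve.
    Run-for : ∀ {s ω c} → var s lim ≡ n → var s 4 ≡ 1 → I 0 s ω c →
              Run B (for x lim f body) s ω (3 + n * (3 + t) + c) (I n)
    Run-for {s} {ω} {c} ln on i with run {τ = τ} c₁ d le q ← iterate n {0} {setVar f n (setVar x 0 s)} {ω} {c} refl
               (trans (other (setVar x 0 s) f x n f≠x) (same s x 0))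
               (same (setVar x 0 s) f n)
               (trans (other (setVar x 0 s) f lim n f≠lim) (trans (other s x lim 0 x≠lim) ln))
               (trans (other (setVar x 0 s) f 4 n f≠4) (trans (other s x 4 0 x≠4) on))
               (stable n 0 i) =
      run c₁ (seq (const (≤-<-trans z≤n n<B)) (seq e₀ d)) (s≤s (s≤s le)) q
      where
      v₀ : var (setVar x 0 s) lim ∸ var (setVar x 0 s) x ≡ n
      v₀ = cong₂ _∸_ (trans (other s x lim 0 x≠lim) ln) (same s x 0)
      e₀ : Exec B (op f sub lim x) (setVar x 0 s) ω (setVar f n (setVar x 0 s)) ω 1
      e₀ = subst (λ v → Exec B (op f sub lim x) _ ω (setVar f v (setVar x 0 s)) ω 1) v₀
             (op (subst (_< B) (sym v₀) n<B))

open Runs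

-- Memory with time stamps

module Tables where

  ≡ᵇ-false : ∀ {x y} → x ≢ y → (x ≡ᵇ y) ≡ false
  ≡ᵇ-false {x} {y} x≢y with x ≡ᵇ y in eq
  ... | false = refl
  ... | true  = contradiction (≡ᵇ⇒≡ x y (subst T (sym eq) tt)) x≢y

  pick : ∀ {A : Set} → ℕ → A → A → A
  pick zero    x y = x
  pick (suc _) x y = y

  pick-zero : ∀ {A : Set} {n} {x y : A} → n ≡ 0 → pick n x y ≡ x
  pick-zero refl = refl

  pick-suc : ∀ {A : Set} {n} {x y : A} → n ≢ 0 → pick n x y ≡ y
  pick-suc {n = zero}  n≢0 = contradiction refl n≢0
  pick-suc {n = suc _} n≢0 = refl

  update : (ℕ → ℕ → ℕ) → ℕ → ℕ → ℕ → ℕ → ℕ → ℕ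
  update f a i v = f [ a ↦ f a [ i ↦ v ] ]

  update-hit : ∀ f a i v → update f a i v a i ≡ v
  update-hit f a i v rewrite ≡ᵇ-refl a | ≡ᵇ-refl i = refl

  update-index : ∀ f a i i′ v → i ≢ i′ → update f a i v a i′ ≡ f a i′
  update-index f a i i′ v i≢ rewrite ≡ᵇ-refl a | ≡ᵇ-false i≢ = refl

  update-array : ∀ f a a′ i v i′ → a ≢ a′ → update f a i v a′ i′ ≡ f a′ i′
  update-array f a a′ i v i′ a≢ rewrite ≡ᵇ-false a≢ = refl

  -- A simulated memory cell lives in five tables: 0 its initial value,
  -- 1 and 2 its value and time stamp in the current repetition, 3 and 4 its value
  -- and time stamp in the current stage.  A value with an outdated time
  -- stamp does not count, so that advancing the clock restores the memory.
  slot : ℕ → ℕ → ℕ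
  slot j a = j + a * 5

  slot-injective : ∀ j j′ a a′ → j < 5 → j′ < 5 → slot j a ≡ slot j′ a′ → j ≡ j′ × a ≡ a′
  slot-injective j j′ a a′ j< j′< eq = j≡ , a≡
    where
    j≡ : j ≡ j′
    j≡ = trans (sym (m<n⇒m%n≡m j<)) (trans (sym ([m+kn]%n≡m%n j a 5))
           (trans (cong (_% 5) eq) (trans ([m+kn]%n≡m%n j′ a′ 5) (m<n⇒m%n≡m j′<))))
    a≡ : a ≡ a′
    a≡ = *-cancelʳ-≡ a a′ 5 (+-cancelˡ-≡ j _ _ (trans eq (cong (_+ a′ * 5) (sym j≡))))

  Table : Set
  Table = ℕ → ℕ → ℕ

  -- `now ∸ s` vanishes exactly if the stamp `s` has reached the clock. As stamps never exceed the
  -- clock, a value counts only if it was written at the present time. The stamp 0 of untouched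
  -- memory is outdated once the clock is positive, so the tables need no initialization.
  stamped : (now vt st : ℕ) → Table → Table → Table
  stamped now vt st fallback M a i = pick (now ∸ M (slot st a) i) (M (slot vt a) i) (fallback a i)

  write : (now vt st a i v : ℕ) → Table → Table
  write now vt st a i v M = update (update M (slot vt a) i v) (slot st a) i now

  module Write (now vt st a i v : ℕ) (M : Table) (vt<5 : vt < 5) (st<5 : st < 5) (vt≢st : vt ≢ st) where

    private
      M₁ M₂ : Table
      M₁ = update M (slot vt a) i v
      M₂ = write now vt st a i v M

      skip-stamp : ∀ j a′ i′ → j < 5 → j ≢ st → M₂ (slot j a′) i′ ≡ M₁ (slot j a′) i′
      skip-stamp j a′ i′ j< j≢ = update-array M₁ (slot st a) (slot j a′) i now i′
        (λ eq → j≢ (sym (proj₁ (slot-injective st j a a′ st<5 j< eq))))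

      skip-value : ∀ j a′ i′ → j < 5 → j ≢ vt → M₁ (slot j a′) i′ ≡ M (slot j a′) i′
      skip-value j a′ i′ j< j≢ = update-array M (slot vt a) (slot j a′) i v i′
        (λ eq → j≢ (sym (proj₁ (slot-injective vt j a a′ vt<5 j< eq))))

    other : ∀ j a′ i′ → j < 5 → j ≢ vt → j ≢ st → M₂ (slot j a′) i′ ≡ M (slot j a′) i′
    other j a′ i′ j< j≢vt j≢st = trans (skip-stamp j a′ i′ j< j≢st) (skip-value j a′ i′ j< j≢vt)

    stamps : ∀ a′ i′ → M₂ (slot st a′) i′ ≡ update (λ b → M (slot st b)) a i now a′ i′
    stamps a′ i′ with a ≟ a′
    ... | no a≢ = trans (update-array M₁ (slot st a) (slot st a′) i now i′
                           (λ eq → a≢ (proj₂ (slot-injective st st a a′ st<5 st<5 eq))))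
            (trans (skip-value st a′ i′ st<5 (λ eq → vt≢st (sym eq)))
                   (sym (update-array (λ b → M (slot st b)) a a′ i now i′ a≢)))
    ... | yes refl with i ≟ i′
    ...   | yes refl = trans (update-hit M₁ (slot st a) i now) (sym (update-hit (λ b → M (slot st b)) a i now))
    ...   | no i≢ = trans (update-index M₁ (slot st a) i i′ now i≢)
              (trans (skip-value st a i′ st<5 (λ eq → vt≢st (sym eq)))
                     (sym (update-index (λ b → M (slot st b)) a i i′ now i≢)))

    values : ∀ a′ i′ → M₂ (slot vt a′) i′ ≡ update (λ b → M (slot vt b)) a i v a′ i′
    values a′ i′ = trans (skip-stamp vt a′ i′ vt<5 vt≢st) lemma
      where
      lemma : M₁ (slot vt a′) i′ ≡ update (λ b → M (slot vt b)) a i v a′ i′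
      lemma with a ≟ a′
      ... | no a≢ = trans (update-array M (slot vt a) (slot vt a′) i v i′
                             (λ eq → a≢ (proj₂ (slot-injective vt vt a a′ vt<5 vt<5 eq))))
                          (sym (update-array (λ b → M (slot vt b)) a a′ i v i′ a≢))
      ... | yes refl with i ≟ i′
      ...   | yes refl = trans (update-hit M (slot vt a) i v) (sym (update-hit (λ b → M (slot vt b)) a i v))
      ...   | no i≢ = trans (update-index M (slot vt a) i i′ v i≢) (sym (update-index (λ b → M (slot vt b)) a i i′ v i≢))

    -- The fallback is itself read off the memory, so it may occur as `F` before the write and as
    -- `F′` after it; only their agreement at the cell in question is asked.
    stamped-write : ∀ F F′ a′ i′ → F′ a′ i′ ≡ F a′ i′ →
                    stamped now vt st F′ M₂ a′ i′ ≡ update (stamped now vt st F M) a i v a′ i′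
    stamped-write F F′ a′ i′ F≡ = trans (cong₂ (λ x y → pick (now ∸ x) y (F′ a′ i′)) (stamps a′ i′) (values a′ i′)) lemma
      where
      lemma : pick (now ∸ update (λ b → M (slot st b)) a i now a′ i′) (update (λ b → M (slot vt b)) a i v a′ i′) (F′ a′ i′)
              ≡ update (stamped now vt st F M) a i v a′ i′
      lemma with a ≟ a′
      ... | no a≢ rewrite ≡ᵇ-false a≢ | F≡ = refl
      ... | yes refl with i ≟ i′
      ...   | yes refl rewrite ≡ᵇ-refl a | ≡ᵇ-refl i | n∸n≡0 now = refl
      ...   | no i≢ rewrite ≡ᵇ-refl a | ≡ᵇ-false i≢ | F≡ = refl

  -- Variables and arrays of the simulated program share one family of tables: even cells are
  -- variables, kept at index 0, and odd cells are arrays.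
  cellVar cellArr : ℕ → ℕ
  cellVar x = 2 * x
  cellArr a = suc (2 * a)

  Holds : Table → State → Set
  Holds f σ = (∀ x → f (cellVar x) 0 ≡ var σ x) × (∀ a i → f (cellArr a) i ≡ arr σ a i)

  Holds-cong : ∀ {f g} σ → (∀ a i → g a i ≡ f a i) → Holds f σ → Holds g σ
  Holds-cong σ g≡f (v , a) = (λ x → trans (g≡f _ _) (v x)) , (λ b i → trans (g≡f _ _) (a b i))

  Holds-setVar : ∀ f σ x {i v w} → i ≡ 0 → v ≡ w → Holds f σ → Holds (update f (cellVar x) i v) (setVar x w σ)
  Holds-setVar f σ x {v = w} refl refl (hv , ha) = vars , arrs
    where
    vars : ∀ x′ → update f (cellVar x) 0 w (cellVar x′) 0 ≡ var (setVar x w σ) x′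
    vars x′ with x ≟ x′
    ... | yes refl = trans (update-hit f (cellVar x) 0 w) (sym hit)
      where
      hit : var (setVar x w σ) x ≡ w
      hit rewrite ≡ᵇ-refl x = refl
    ... | no x≢ = trans (update-array f (cellVar x) (cellVar x′) 0 w 0 (λ eq → x≢ (*-cancelˡ-≡ x x′ 2 eq))) (trans (hv x′) (sym miss))
      where
      miss : var (setVar x w σ) x′ ≡ var σ x′
      miss rewrite ≡ᵇ-false x≢ = refl
    arrs : ∀ a i → update f (cellVar x) 0 w (cellArr a) i ≡ arr σ a i
    arrs a i = trans (update-array f (cellVar x) (cellArr a) 0 w i (even≢odd x a)) (ha a i)

  Holds-setArr : ∀ f σ a {i j v w} → i ≡ j → v ≡ w → Holds f σ → Holds (update f (cellArr a) i v) (setArr a j w σ)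
  Holds-setArr f σ a {i} {v = w} refl refl (hv , ha) = vars , arrs
    where
    vars : ∀ x → update f (cellArr a) i w (cellVar x) 0 ≡ var σ x
    vars x = trans (update-array f (cellArr a) (cellVar x) i w 0 (λ eq → even≢odd x a (sym eq))) (hv x)
    arrs : ∀ a′ i′ → update f (cellArr a) i w (cellArr a′) i′ ≡ update (arr σ) a i w a′ i′
    arrs a′ i′ with a ≟ a′
    ... | no a≢ = trans (update-array f (cellArr a) (cellArr a′) i w i′ (λ eq → a≢ (*-cancelˡ-≡ a a′ 2 (suc-injective eq))))
                    (trans (ha a′ i′) (sym (update-array (arr σ) a a′ i w i′ a≢)))
    ... | yes refl with i ≟ i′
    ...   | yes refl = trans (update-hit f (cellArr a) i w) (sym (update-hit (arr σ) a i w))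
    ...   | no i≢ = trans (update-index f (cellArr a) i i′ w i≢) (trans (ha a i′) (sym (update-index (arr σ) a i i′ w i≢)))

  data Level : Set where
    base shadow : Level

  -- In shadow mode the memory σ₀ at the start of the stage is still present below
  -- the current one.
  data Mode : Set where
    base   : Mode
    shadow : State → Mode

  level : Mode → Level
  level base       = base
  level (shadow _) = shadow

  baseView view : (E P : ℕ) → Table → Table
  baseView E P M = stamped P 1 2 (λ a i → M (slot 0 a) i) M
  view E P M = stamped E 3 4 (baseView E P M) M

  -- In base mode the strict bound on the stamps of table 4 makes every shadow value outdated, so
  -- that `view` and `baseView` agree. In shadow mode `σ₀` is carried along because it is the memory
  -- that the next tick of the stage clock restores.
  Current : Mode → State → (E P : ℕ) → Table → Set
  Current base        σ E P M = (∀ a i → M (slot 4 a) i < E) × Holds (baseView E P M) σ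
  Current (shadow σ₀) σ E P M = Holds (baseView E P M) σ₀ × Holds (view E P M) σ

  record Represents (m : Mode) (σᵢ σ : State) (E P : ℕ) (M : Table) : Set where
    constructor represents
    field
      initials : Holds (λ a i → M (slot 0 a) i) σᵢ
      stamps₁  : ∀ a i → M (slot 2 a) i ≤ P
      stamps₂  : ∀ a i → M (slot 4 a) i ≤ E
      current  : Current m σ E P M

  open Represents

  current-view : ∀ m {σᵢ σ E P M} → Represents m σᵢ σ E P M → Holds (view E P M) σ
  current-view base {σ = σ} {E} {P} {M} rep =
    Holds-cong {baseView E P M} σ (λ a i → pick-suc {x = M (slot 3 a) i} (m>n⇒m∸n≢0 (proj₁ (current rep) a i))) (proj₂ (current rep))
  current-view (shadow _) rep = proj₂ (current rep)

  writeAt : Level → (E P a i v : ℕ) → Table → Table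
  writeAt base   E P a i v = write P 1 2 a i v
  writeAt shadow E P a i v = write E 3 4 a i v

  update-≤ : ∀ (f : Table) {a i v n} → v ≤ n → (∀ a i → f a i ≤ n) → ∀ a′ i′ → update f a i v a′ i′ ≤ n
  update-≤ f {a} {i} v≤ f≤ a′ i′ with a ≡ᵇ a′
  ... | false = f≤ a′ i′
  ... | true  with i ≡ᵇ i′
  ...   | true  = v≤
  ...   | false = f≤ a i′

  private
    lt : ∀ {m n} {_ : T (m <ᵇ n)} → m < n
    lt {m} {n} {t} = <ᵇ⇒< m n t

  -- `move` hides whether the cell belongs to a variable or to an array. In shadow mode tables 0, 1
  -- and 2 are untouched, which is why `σ₀` stays available.
  Represents-write : ∀ m {σᵢ σ σ′ E P M} a i v → Represents m σᵢ σ E P M →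
    (∀ f → Holds f σ → Holds (update f a i v) σ′) →
    Represents m σᵢ σ′ E P (writeAt (level m) E P a i v M)
  Represents-write base {σᵢ} {σ} {σ′} {E} {P} {M} a i v rep move = represents
    (Holds-cong {λ b j → M (slot 0 b) j} σᵢ (λ a′ i′ → other 0 a′ i′ lt (λ ()) (λ ())) (initials rep))
    (λ a′ i′ → ≤-trans (≤-reflexive (stamps a′ i′)) (update-≤ (λ b → M (slot 2 b)) {a} {i} ≤-refl (stamps₁ rep) a′ i′))
    (λ a′ i′ → ≤-trans (≤-reflexive (other 4 a′ i′ lt (λ ()) (λ ()))) (stamps₂ rep a′ i′))
    ((λ a′ i′ → ≤-<-trans (≤-reflexive (other 4 a′ i′ lt (λ ()) (λ ()))) (proj₁ (current rep) a′ i′)) ,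
     Holds-cong {update (baseView E P M) a i v} σ′
       (λ a′ i′ → stamped-write (λ b j → M (slot 0 b) j) (λ b j → write P 1 2 a i v M (slot 0 b) j) a′ i′ (other 0 a′ i′ lt (λ ()) (λ ())))
       (move (baseView E P M) (proj₂ (current rep))))
    where open Write P 1 2 a i v M lt lt (λ ())
  Represents-write (shadow σ₀) {σᵢ} {σ} {σ′} {E} {P} {M} a i v rep move = represents
    (Holds-cong {λ b j → M (slot 0 b) j} σᵢ (λ a′ i′ → other 0 a′ i′ lt (λ ()) (λ ())) (initials rep))
    (λ a′ i′ → ≤-trans (≤-reflexive (other 2 a′ i′ lt (λ ()) (λ ()))) (stamps₁ rep a′ i′))
    (λ a′ i′ → ≤-trans (≤-reflexive (stamps a′ i′)) (update-≤ (λ b → M (slot 4 b)) {a} {i} ≤-refl (stamps₂ rep) a′ i′))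
    (Holds-cong {baseView E P M} σ₀ below (proj₁ (current rep)) ,
     Holds-cong {update (view E P M) a i v} σ′
       (λ a′ i′ → stamped-write (baseView E P M) (baseView E P (write E 3 4 a i v M)) a′ i′ (below a′ i′))
       (move (view E P M) (proj₂ (current rep))))
    where
    open Write E 3 4 a i v M lt lt (λ ())
    below : ∀ a′ i′ → baseView E P (write E 3 4 a i v M) a′ i′ ≡ baseView E P M a′ i′
    below a′ i′ = trans
      (cong₂ (λ x y → pick (P ∸ x) y (write E 3 4 a i v M (slot 0 a′) i′)) (other 2 a′ i′ lt (λ ()) (λ ())) (other 1 a′ i′ lt (λ ()) (λ ())))
      (cong (pick (P ∸ M (slot 2 a′) i′) (M (slot 1 a′) i′)) (other 0 a′ i′ lt (λ ()) (λ ())))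

open Tables

-- Simulation of a program on stamped memory with interleaved coins

module Simulating where

  -- Demanding the credits `c` back makes the costs of consecutive pieces of code add up; `Run-step`
  -- is the resulting rule.
  Sure : ℕ → (State → Tape → Set) → Assertion
  Sure c Q s ω c′ = c ≤ c′ × Q s ω

  Run-step : ∀ {B p q s ω t c Q Q′} → Run B p s ω (t + c) (Sure c Q) →
             (∀ {s′ ω′} → Q s′ ω′ → Run B q s′ ω′ c Q′) → Run B (p ⨾ q) s ω (t + c) Q′
  Run-step r k = Run-seq (Run-map (λ (c≤ , q) → Run-credit c≤ (k q)) r)

  Run-sure-wp : ∀ {B} p {s ω c n} (Q : State → Tape → Set) → cost p ≤ n →
                wp B p (λ s′ → Q s′ ω) s → Run B p s ω (n + c) (Sure c Q)
  Run-sure-wp p {ω = ω} {c} Q le w with _ , _ , d , d≤ , r ← wp-exec p ω w =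
    run c d (+-monoˡ-≤ c (≤-trans d≤ le)) (≤-refl , r)

  wp-mono : ∀ {B} p {Q Q′ : State → Set} {s} → (∀ {s} → Q s → Q′ s) → wp B p Q s → wp B p Q′ s
  wp-mono skip          f w = f w
  wp-mono (const x c)   f (b , w) = b , f w
  wp-mono (op x o y z)  f (v , e , b , w) = v , e , b , f w
  wp-mono (load x a y)  f w = f w
  wp-mono (store a y z) f w = f w
  wp-mono (p ⨾ q)       f w = wp-mono p (wp-mono q f) w
  wp-mono (cond x p q)  f (w , w′) = (λ nz → wp-mono p f (w nz)) , (λ z → wp-mono q f (w′ z))

  -- Variables: 0, 1, 2 temporaries, 3 zero, 4 one, 5 clock of stages, 6 clock of
  -- repetitions, 7 number of repetitions, 8 index of the next coin, 9 number
  -- of coins drawn; the coins drawn so far are kept in array 4, and table a of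
  -- the simulated memory is array 5 + a.
  read : (t a y : ℕ) → Prog
  read t a y =
    load 2 (5 + slot 4 a) y ⨾ op 2 sub 5 2 ⨾
    cond 2 (load 2 (5 + slot 2 a) y ⨾ op 2 sub 6 2 ⨾
            cond 2 (load t (5 + slot 0 a) y) (load t (5 + slot 1 a) y))
           (op 2 sub 2 2 ⨾ op 2 sub 2 2 ⨾ load t (5 + slot 3 a) y)

  put : Level → (a y z : ℕ) → Prog
  put base   a y z = store (5 + slot 1 a) y z ⨾ store (5 + slot 2 a) y 6
  put shadow a y z = store (5 + slot 3 a) y z ⨾ store (5 + slot 4 a) y 5

  draw : Prog
  draw = flip 1 ⨾ store 4 9 1 ⨾ op 9 add 9 4 ⨾ op 2 sub 2 4

  -- The tape allows no jumps, so everything up to the wanted position is drawn into the buffer,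
  -- where coins of other repetitions wait for their turn. After a rollback a position is looked up
  -- again in the buffer and not drawn again.
  coin : Prog
  coin = (op 2 add 8 4 ⨾ op 2 sub 2 9) ⨾ while 2 draw ⨾ load 0 4 8 ⨾ op 8 add 8 7

  compile : Level → Prog → Prog
  compile l skip          = skip
  compile l (const x c)   = const 0 c ⨾ put l (cellVar x) 3 0
  compile l (op x o y z)  = read 0 (cellVar y) 3 ⨾ read 1 (cellVar z) 3 ⨾ op 0 o 0 1 ⨾ put l (cellVar x) 3 0
  compile l (load x a y)  = read 0 (cellVar y) 3 ⨾ read 0 (cellArr a) 0 ⨾ put l (cellVar x) 3 0
  compile l (store a y z) = read 0 (cellVar y) 3 ⨾ read 1 (cellVar z) 3 ⨾ put l (cellArr a) 0 1
  compile l (flip x)      = coin ⨾ put l (cellVar x) 3 0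
  compile l (p ⨾ q)       = compile l p ⨾ compile l q
  compile l (cond x p q)  = read 0 (cellVar x) 3 ⨾ cond 0 (compile l p) (compile l q)
  compile l (while x p)   = read 0 (cellVar x) 3 ⨾ while 0 (compile l p ⨾ read 0 (cellVar x) 3)

  -- Variables 0, 1, 2, 8 and 9 are those that compiled code may assign.
  Outside : ℕ → Set
  Outside x = (0 ≡ᵇ x) ≡ false × (1 ≡ᵇ x) ≡ false × (2 ≡ᵇ x) ≡ false × (8 ≡ᵇ x) ≡ false × (9 ≡ᵇ x) ≡ false

  put-keepsVar : ∀ l a y z x → keepsVar x (put l a y z) ≡ true
  put-keepsVar base   a y z x = refl
  put-keepsVar shadow a y z x = refl

  compile-keepsVar : ∀ l p x → Outside x → keepsVar x (compile l p) ≡ true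
  compile-keepsVar l skip x _ = refl
  compile-keepsVar l (const y _) x (e₀ , _) rewrite e₀ = put-keepsVar l _ _ _ x
  compile-keepsVar l (op y _ _ _) x (e₀ , e₁ , e₂ , _) rewrite e₀ | e₁ | e₂ = put-keepsVar l _ _ _ x
  compile-keepsVar l (load y _ _) x (e₀ , _ , e₂ , _) rewrite e₀ | e₂ = put-keepsVar l _ _ _ x
  compile-keepsVar l (store a _ _) x (e₀ , e₁ , e₂ , _) rewrite e₀ | e₁ | e₂ = put-keepsVar l _ _ _ x
  compile-keepsVar l (flip y) x (e₀ , e₁ , e₂ , e₈ , e₉) rewrite e₀ | e₁ | e₂ | e₈ | e₉ = put-keepsVar l _ _ _ x
  compile-keepsVar l (p ⨾ q) x e = ∧-intro (compile-keepsVar l p x e) (compile-keepsVar l q x e)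
  compile-keepsVar l (cond y p q) x e@(e₀ , _ , e₂ , _) rewrite e₀ | e₂ =
    ∧-intro (compile-keepsVar l p x e) (compile-keepsVar l q x e)
  compile-keepsVar l (while y p) x e@(e₀ , _ , e₂ , _) rewrite e₀ | e₂ =
    ∧-intro (compile-keepsVar l p x e) refl

  put-keepsArr : ∀ l b y z a → (∀ b → (5 + b ≡ᵇ a) ≡ false) → keepsArr a (put l b y z) ≡ true
  put-keepsArr base   b y z a e rewrite e (slot 1 b) | e (slot 2 b) = refl
  put-keepsArr shadow b y z a e rewrite e (slot 3 b) | e (slot 4 b) = refl

  compile-keepsArr : ∀ l p a → (4 ≡ᵇ a) ≡ false → (∀ b → (5 + b ≡ᵇ a) ≡ false) → keepsArr a (compile l p) ≡ true
  compile-keepsArr l skip a e₄ e = refl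
  compile-keepsArr l (const _ _) a e₄ e = put-keepsArr l _ 3 0 a e
  compile-keepsArr l (op _ _ _ _) a e₄ e = put-keepsArr l _ 3 0 a e
  compile-keepsArr l (load _ _ _) a e₄ e = put-keepsArr l _ 3 0 a e
  compile-keepsArr l (store _ _ _) a e₄ e = put-keepsArr l _ 0 1 a e
  compile-keepsArr l (flip _) a e₄ e rewrite e₄ = put-keepsArr l _ 3 0 a e
  compile-keepsArr l (p ⨾ q) a e₄ e = ∧-intro (compile-keepsArr l p a e₄ e) (compile-keepsArr l q a e₄ e)
  compile-keepsArr l (cond _ p q) a e₄ e = ∧-intro (compile-keepsArr l p a e₄ e) (compile-keepsArr l q a e₄ e)
  compile-keepsArr l (while _ p) a e₄ e = ∧-intro (compile-keepsArr l p a e₄ e) refl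

  drop-at : ∀ {A : Set} (x : A) xs n → n < length xs → drop n xs ≡ at x xs n ∷ drop (suc n) xs
  drop-at x (_ ∷ _)  zero    n< = refl
  drop-at x (_ ∷ xs) (suc n) (s≤s n<) = drop-at x xs n n<

  -- The coins of repetition r are those at the positions r, r + R, r + 2R, … of Ω.
  column : (R r : ℕ) → Tape → (i n : ℕ) → Tape
  column R r Ω i zero    = []
  column R r Ω i (suc n) = at false Ω (i * R + r) ∷ column R r Ω (suc i) n

  module Simulation (B R r : ℕ) (Ω : Tape) (lo : ℕ) (r<R : r < R) (σᵢ : State) where

    -- `fuel` bounds the number of coins that may still be needed, which
    -- keeps the index of the next coin below B.
    record Coins (ω : Tape) (fuel idx drawn : ℕ) (buffer : ℕ → ℕ) (ωc : Tape) : Set where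
      constructor coins
      field
        i n      : ℕ
        index    : idx ≡ i * R + r
        tape     : ω ≡ column R r Ω i n
        total    : (i + n) * R ≤ length Ω
        unread   : ωc ≡ drop drawn Ω
        drawn≤   : drawn ≤ length Ω
        buffered : ∀ q → q < drawn → buffer q ≡ bit (at false Ω q)
        close    : idx < drawn + R
        enough   : lo ≤ drawn
        fuelled  : idx + fuel * R < B

    Constants : State → Set
    Constants s = var s 3 ≡ 0 × var s 4 ≡ 1 × var s 7 ≡ R × var s 5 < B × var s 6 < B

    Memory : Mode → State → State → Set
    Memory m σ s = Represents m σᵢ σ (var s 5) (var s 6) (λ a → arr s (5 + a))

    Simulates : Mode → State → Tape → ℕ → State → Tape → Set
    Simulates m σ ω fuel s ωc =
      Memory m σ s × Coins ω fuel (var s 8) (var s 9) (arr s 4) ωc × Constants s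

    unfuel : ∀ {m σ ω k} j {s ωc} → Simulates m σ ω (j + k) s ωc → Simulates m σ ω k s ωc
    unfuel {k = k} j {s} {ωc} (M , C , K) = M , record { Coins C ; fuelled = ≤-<-trans (+-monoʳ-≤ _ (*-monoˡ-≤ R (m≤n+m k j))) (Coins.fuelled C) } , K

    refuel : ∀ {m σ ω k k′} → k ≡ k′ → ∀ {s ωc} → Simulates m σ ω k s ωc → Simulates m σ ω k′ s ωc
    refuel refl S = S

    -- Every branch of `read` assigns variable 2 exactly four times before the final load, the outer
    -- else branch by means of two padding subtractions. One form of final state therefore serves
    -- all branches.
    read-wp : ∀ t a y s (Q : State → Set) → (2 ≡ᵇ y) ≡ false → var s 5 < B → var s 6 < B →
      (∀ v₁ v₂ v₃ v₄ → Q (setVar t (view (var s 5) (var s 6) (λ b → arr s (5 + b)) a (var s y))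
                           (setVar 2 v₄ (setVar 2 v₃ (setVar 2 v₂ (setVar 2 v₁ s)))))) →
      wp B (read t a y) Q s
    read-wp t a y s Q e E< P< q rewrite e =
      v₂ , refl , ≤-<-trans (m∸n≤m (var s 5) v₁) E< ,
      (λ nz → v₄ , refl , ≤-<-trans (m∸n≤m (var s 6) v₃) P< ,
        (λ nz′ → subst (F v₁ v₂ v₃ v₄) (trans (pick-suc nz) (pick-suc nz′)) (q v₁ v₂ v₃ v₄)) ,
        (λ z′ → subst (F v₁ v₂ v₃ v₄) (trans (pick-suc nz) (pick-zero z′)) (q v₁ v₂ v₃ v₄))) ,
      (λ z → w₃ , refl , small v₂ , w₄ , refl , small w₃ , subst (F v₁ v₂ w₃ w₄) (pick-zero z) (q v₁ v₂ w₃ w₄))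
      where
      v₁ v₂ v₃ v₄ w₃ w₄ : ℕ
      v₁ = arr s (5 + slot 4 a) (var s y)
      v₂ = var s 5 ∸ v₁
      v₃ = arr s (5 + slot 2 a) (var s y)
      v₄ = var s 6 ∸ v₃
      w₃ = v₂ ∸ v₂
      w₄ = w₃ ∸ w₃
      F : (x₁ x₂ x₃ x₄ v : ℕ) → Set
      F x₁ x₂ x₃ x₄ v = Q (setVar t v (setVar 2 x₄ (setVar 2 x₃ (setVar 2 x₂ (setVar 2 x₁ s)))))
      small : ∀ v → v ∸ v < B
      small v rewrite n∸n≡0 v = ≤-<-trans z≤n E<

    put-wp : ∀ m a y z {σ σ′ ω k s ωc} → Simulates m σ ω k s ωc →
      (∀ f → Holds f σ → Holds (update f a (var s y) (var s z)) σ′) →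
      wp B (put (level m) a y z) (λ s′ → Simulates m σ′ ω k s′ ωc) s
    put-wp base       a y z {s = s} (M , C , K) move = Represents-write base a (var s y) (var s z) M move , C , K
    put-wp (shadow σ₀) a y z {s = s} (M , C , K) move = Represents-write (shadow σ₀) a (var s y) (var s z) M move , C , K

    -- The slowdown per simulated step. The summand 60 covers the memory accesses of any
    -- instruction, with room to spare; the multiple of `R` covers a `flip`, which may have to
    -- buffer up to `R` coins at 5 steps each.
    κ : ℕ
    κ = 60 + 10 * R

    private
      60≤κ : 60 ≤ κ * 1
      60≤κ = ≤-trans (m≤m+n 60 (10 * R)) (≤-reflexive (sym (*-identityʳ κ)))

      lit : ∀ {m n} {_ : T (m ≤ᵇ n)} → m ≤ n
      lit {m} {n} {t} = ≤ᵇ⇒≤ m n t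

      R>0 : 0 < R
      R>0 = ≤-<-trans z≤n r<R

    Filling : (m : Mode) (σ : State) (idx f g : ℕ) → State → Tape → Set
    Filling m σ idx f g s ωc = Memory m σ s × Constants s × var s 8 ≡ idx × var s 9 ≡ f × var s 2 ≡ g ×
      ωc ≡ drop f Ω × (∀ q → q < f → arr s 4 q ≡ bit (at false Ω q))

    -- The word bound is asked only if a coin is to be drawn. It comes from the position of the next
    -- coin, whereas nothing is recorded about the size of the number of coins already drawn.
    fill : ∀ {m σ idx c} g {f s ωc} → Filling m σ idx f g s ωc → f + g ≤ length Ω → (0 < g → f + g < B) →
           Run B (while 2 draw) s ωc (suc (g * 5) + c) (Sure c (Filling m σ idx (f + g) 0))
    fill {m} {σ} {idx} zero {f} {s} {ωc} F@(_ , _ , _ , _ , g≡ , _) f≤ f< =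
      run _ (stop g≡) ≤-refl (≤-refl , subst (λ f → Filling m σ idx f 0 s ωc) (sym (+-identityʳ f)) F)
    fill {m} {σ} {idx} {c} (suc g) {f} {s} {ωc} (M , K@(_ , one , _ , E< , _) , i≡ , refl , g≡ , refl , bf) f≤ f<
      = finish (fill {c = c} g {suc f} {s₁} {drop (suc f) Ω} filled
          (≤-trans (≤-reflexive (sym (+-suc f g))) f≤) (λ _ → ≤-<-trans (≤-reflexive (sym (+-suc f g))) (f< (s≤s z≤n))))
      where
      b = at false Ω f
      s₁ : State
      s₁ = setVar 2 (var s 2 ∸ var s 4) (setVar 9 (f + var s 4) (setArr 4 f (bit b) (setVar 1 (bit b) s)))
      f<len : f < length Ω
      f<len = ≤-trans (s≤s (m≤m+n f g)) (≤-trans (≤-reflexive (sym (+-suc f g))) f≤)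
      f+1 : f + var s 4 ≡ suc f
      f+1 = trans (cong (f +_) one) (+-comm f 1)
      v<B : ∀ {v} → v ≤ f + suc g → v < B
      v<B le = ≤-<-trans le (f< (s≤s z≤n))
      once : Exec B draw s (drop f Ω) s₁ (drop (suc f) Ω) (1 + (1 + (1 + 1)))
      once rewrite drop-at false Ω f f<len = seq flip (seq store (seq
        (op (v<B (≤-trans (≤-reflexive f+1) (≤-trans (s≤s (m≤m+n f g)) (≤-reflexive (sym (+-suc f g)))))))
        (op (v<B (≤-trans (m∸n≤m (var s 2) (var s 4)) (≤-trans (≤-reflexive g≡) (m≤n+m (suc g) f)))))))
      buffer : ∀ q → q < suc f → (arr s 4 [ f ↦ bit b ]) q ≡ bit (at false Ω q)
      buffer q q< with f ≟ q
      ... | yes refl rewrite ≡ᵇ-refl f = refl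
      ... | no f≢q rewrite ≡ᵇ-false f≢q = bf q (≤∧≢⇒< (s≤s⁻¹ q<) (λ eq → f≢q (sym eq)))
      filled : Filling m σ idx (suc f) g s₁ (drop (suc f) Ω)
      filled = M , K , i≡ , f+1 , trans (cong₂ _∸_ g≡ one) refl , refl , buffer
      finish : Run B (while 2 draw) s₁ (drop (suc f) Ω) (suc (g * 5) + c) (Sure c (Filling m σ idx (suc f + g) 0)) →
               Run B (while 2 draw) s (drop f Ω) (suc (suc g * 5) + c) (Sure c (Filling m σ idx (f + suc g) 0))
      finish (run {s′} {ω′} c′ d le q) = run c′ (loop (λ z → case trans (sym g≡) z of λ ()) once d) (+-monoʳ-≤ 5 le)
        (proj₁ q , subst (λ f → Filling m σ idx f 0 s′ ω′) (sym (+-suc f g)) (proj₂ q))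

    -- By `close` the wanted position exceeds the number of drawn coins by less than `R`, so at most
    -- `R` draws are due; afterwards the position is drawn, and adding `R` to the index restores
    -- `close`.
    coin-run : ∀ {m σ b ω k s ωc c} → Simulates m σ (b ∷ ω) (suc k) s ωc →
      Run B coin s ωc ((7 + 5 * R) + c) (Sure c (λ s′ ω′ → Simulates m σ ω k s′ ω′ × var s′ 0 ≡ bit b))
    coin-run {k = k} {s = s} (M , coins i zero _ () _ _ _ _ _ _ _ , K)
    coin-run {m} {σ} {b} {k = k} {s = s} {c = c} (M , coins i (suc n) index refl total refl drawn≤ buffered close enough fuelled , K@(_ , one , rr , E< , _)) =
      Run-credit afford (Run-step {t = 2} (Run-sure-wp (op 2 add 8 4 ⨾ op 2 sub 2 9)
          (λ s′ ω′ → Filling m σ idx f g s′ ω′) ≤-refl (idx + var s 4 , refl , v<B , _ , refl , ≤-<-trans (m∸n≤m (idx + var s 4) f) v<B , M , K , refl , refl , cong (_∸ f) (trans (cong (idx +_) one) (+-comm idx 1)) , refl , buffered))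
        (λ F → Run-step {t = suc (g * 5)} (fill g F f+g≤ f+g<) after))
      where
      f idx g : ℕ
      f = var s 9
      idx = var s 8
      g = suc idx ∸ f
      idx<len : idx < length Ω
      idx<len = ≤-trans (≤-reflexive (cong suc index)) (≤-trans (≤-trans (≤-trans (≤-reflexive (sym (+-suc (i * R) r))) (+-monoʳ-≤ (i * R) r<R))
        (≤-trans (≤-reflexive (+-comm (i * R) R)) (*-monoˡ-≤ R (≤-trans (s≤s (m≤m+n i n)) (≤-reflexive (sym (+-suc i n))))))) total)
      suc-idx<B : suc idx < B
      suc-idx<B = ≤-<-trans (≤-trans (≤-reflexive (+-comm 1 idx)) (+-monoʳ-≤ idx (≤-trans R>0 (m≤m+n R (k * R))))) fuelled
      v<B : idx + var s 4 < B
      v<B = ≤-<-trans (≤-reflexive (trans (cong (idx +_) one) (+-comm idx 1))) suc-idx<B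
      f+g≤ : f + g ≤ length Ω
      f+g≤ with ≤-total f (suc idx)
      ... | inj₁ f≤ = ≤-trans (≤-reflexive (m+[n∸m]≡n f≤)) idx<len
      ... | inj₂ f≥ = ≤-trans (≤-reflexive (trans (cong (f +_) (m≤n⇒m∸n≡0 f≥)) (+-identityʳ f))) drawn≤
      f+g< : 0 < g → f + g < B
      f+g< g> = ≤-<-trans (≤-reflexive (m+[n∸m]≡n {f} {suc idx} (<⇒≤ (m∸n≢0⇒n<m {suc idx} {f} (λ z → <⇒≢ g> (sym z)))))) suc-idx<B
      g≤R : g ≤ R
      g≤R = m≤n+o⇒m∸n≤o (suc idx) f close
      afford : 2 + (suc (g * 5) + (2 + c)) ≤ (7 + 5 * R) + c
      afford = ≤-trans (+-monoʳ-≤ 2 (s≤s (+-monoˡ-≤ (2 + c) (*-monoˡ-≤ 5 g≤R)))) (≤-trans (m≤n+m _ 2) (≤-reflexive (arith R c)))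
        where
        arith : ∀ R c → 2 + (2 + suc (R * 5 + (2 + c))) ≡ (7 + 5 * R) + c
        arith = solve-∀
      after : ∀ {s′ ω′} → Filling m σ idx (f + g) 0 s′ ω′ →
        Run B (load 0 4 8 ⨾ op 8 add 8 7) s′ ω′ (2 + c) (Sure c (λ s′ ω′ → Simulates m σ _ k s′ ω′ × var s′ 0 ≡ bit b))
      after {s′} {ω′} (M , K@(_ , _ , rr , _) , i≡ , f≡ , _ , refl , bf) = Run-sure-wp (load 0 4 8 ⨾ op 8 add 8 7) {ω = drop (f + g) Ω}
        (λ s′ ω′ → Simulates m σ _ k s′ ω′ × var s′ 0 ≡ bit b) ≤-refl
        ( _ , refl , ≤-<-trans (≤-reflexive next) (≤-<-trans (+-monoʳ-≤ idx (m≤m+n R (k * R))) fuelled)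
        , (M , C′ , K) , trans (cong (arr s′ 4) i≡) (trans (bf idx idx<) (cong (λ i → bit (at false Ω i)) index)))
        where
        next : var s′ 8 + var s′ 7 ≡ idx + R
        next = cong₂ _+_ i≡ rr
        idx< : idx < f + g
        idx< = m≤n+m∸n (suc idx) f
        C′ : Coins (column R r Ω (suc i) n) k (var s′ 8 + var s′ 7) (var s′ 9) (arr s′ 4) (drop (f + g) Ω)
        C′ = coins (suc i) n
          (trans next (trans (cong (_+ R) index) (trans (+-assoc (i * R) r R) (trans (cong (i * R +_) (+-comm r R)) (trans (sym (+-assoc (i * R) R r)) (cong (_+ r) (+-comm (i * R) R)))))))
          refl (subst (λ j → j * R ≤ length Ω) (+-suc i n) total)
          (cong (λ f → drop f Ω) (sym f≡)) (≤-trans (≤-reflexive f≡) f+g≤)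
          (λ q q< → bf q (≤-trans q< (≤-reflexive f≡)))
          (subst₂ (λ x y → x < y + R) (sym next) (sym f≡) (+-monoˡ-< R idx<))
          (≤-trans enough (≤-trans (m≤m+n f g) (≤-reflexive (sym f≡))))
          (≤-<-trans (≤-reflexive (trans (cong (_+ k * R) next) (+-assoc idx R (k * R)))) fuelled)

    private
      Sim-step : ∀ {p m σ ω k s ωc c} n → n ≤ 60 → Run B p s ωc (n + c) (Sure c (Simulates m σ ω k)) →
                 Run B p s ωc (κ * 1 + c) (Sure c (Simulates m σ ω k))
      Sim-step {c = c} n n≤ = Run-credit (+-monoˡ-≤ c (≤-trans n≤ 60≤κ))

      view-of : State → Table
      view-of s = view (var s 5) (var s 6) (λ b → arr s (5 + b))

      viewed : ∀ m {σ ω k s ωc} → Simulates m σ ω k s ωc → Holds (view-of s) σ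
      viewed m {s = s} (M , _) = current-view m {M = λ b → arr s (5 + b)} M

    read-var : ∀ m x {σ ω k s ωc c} → Simulates m σ ω k s ωc →
      Run B (read 0 (cellVar x) 3) s ωc (11 + c) (Sure c (λ s′ ω′ → Simulates m σ ω k s′ ω′ × var s′ 0 ≡ var σ x))
    read-var m x {σ} {ω} {k} {s} {ωc} S@(_ , _ , z , _ , _ , E< , P<) =
      Run-sure-wp (read 0 (cellVar x) 3) (λ s′ ω′ → Simulates m σ ω k s′ ω′ × var s′ 0 ≡ var σ x) ≤-refl
        (read-wp 0 (cellVar x) 3 s (λ s′ → Simulates m σ ω k s′ ωc × var s′ 0 ≡ var σ x) refl E< P<
          (λ _ _ _ _ → S , trans (cong (view-of s (cellVar x)) z) (proj₁ (viewed m {s = s} S) x)))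

    read-second : ∀ m x {σ ω k s ωc c v} → Simulates m σ ω k s ωc → var s 0 ≡ v →
      Run B (read 1 (cellVar x) 3) s ωc (11 + c)
        (Sure c (λ s′ ω′ → Simulates m σ ω k s′ ω′ × var s′ 0 ≡ v × var s′ 1 ≡ var σ x))
    read-second m x {σ} {ω} {k} {s} {ωc} {v = v} S@(_ , _ , z , _ , _ , E< , P<) v≡ =
      Run-sure-wp (read 1 (cellVar x) 3) (λ s′ ω′ → Simulates m σ ω k s′ ω′ × var s′ 0 ≡ v × var s′ 1 ≡ var σ x) ≤-refl
        (read-wp 1 (cellVar x) 3 s (λ s′ → Simulates m σ ω k s′ ωc × var s′ 0 ≡ v × var s′ 1 ≡ var σ x) refl E< P<
          (λ _ _ _ _ → S , v≡ , trans (cong (view-of s (cellVar x)) z) (proj₁ (viewed m {s = s} S) x)))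

    read-arr : ∀ m a {σ ω k s ωc c j} → Simulates m σ ω k s ωc → var s 0 ≡ j →
      Run B (read 0 (cellArr a) 0) s ωc (11 + c) (Sure c (λ s′ ω′ → Simulates m σ ω k s′ ω′ × var s′ 0 ≡ arr σ a j))
    read-arr m a {σ} {ω} {k} {s} {ωc} {j = j} S@(_ , _ , z , _ , _ , E< , P<) j≡ =
      Run-sure-wp (read 0 (cellArr a) 0) (λ s′ ω′ → Simulates m σ ω k s′ ω′ × var s′ 0 ≡ arr σ a j) ≤-refl
        (read-wp 0 (cellArr a) 0 s (λ s′ → Simulates m σ ω k s′ ωc × var s′ 0 ≡ arr σ a j) refl E< P<
          (λ _ _ _ _ → S , trans (cong (view-of s (cellArr a)) j≡) (proj₂ (viewed m {s = s} S) a j)))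

    put-var : ∀ m x {σ v ω k s ωc} → Simulates m σ ω k s ωc → var s 0 ≡ v →
      wp B (put (level m) (cellVar x) 3 0) (λ s′ → Simulates m (setVar x v σ) ω k s′ ωc) s
    put-var m x {σ} {s = s} S@(_ , _ , z , _) v≡ = put-wp m (cellVar x) 3 0 {s = s} S (λ f → Holds-setVar f σ x z v≡)

    put-cost : ∀ l a y z → cost (put l a y z) ≤ 2
    put-cost base   a y z = ≤-refl
    put-cost shadow a y z = ≤-refl

    put-var-run : ∀ m x {σ v ω k s ωc c} → Simulates m σ ω k s ωc → var s 0 ≡ v →
      Run B (put (level m) (cellVar x) 3 0) s ωc (2 + c) (Sure c (Simulates m (setVar x v σ) ω k))
    put-var-run m x {σ} {v} {ω} {k} {s} S v≡ =
      Run-sure-wp (put (level m) (cellVar x) 3 0) (Simulates m (setVar x v σ) ω k) (put-cost (level m) (cellVar x) 3 0)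
        (put-var m x {s = s} S v≡)

    -- The simulated time also serves as fuel: a run of `τ` steps flips at most `τ` coins, and each
    -- of them moves the index by `R`.
    simulate : ∀ m p {σ ω σ′ ω′ τ} → Exec B p σ ω σ′ ω′ τ → ∀ {s ωc k c} → Simulates m σ ω (τ + k) s ωc →
               Run B (compile (level m) p) s ωc (κ * τ + c) (Sure c (Simulates m σ′ ω′ k))

    -- The guard is read before the loop and again at the end of every round. The 11 credits kept
    -- apart from `c₁` pay for the read made just before, at the outset as well as in the recursion.
    simulate-while : ∀ m x p {σ ω σ′ ω′ τ} → Exec B (while x p) σ ω σ′ ω′ τ → ∀ {s ωc k c} →
      Simulates m σ ω (τ + k) s ωc → var s 0 ≡ var σ x →
      ∃ λ c₁ → 11 + c₁ ≤ κ * τ + c ×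
      Run B (while 0 (compile (level m) p ⨾ read 0 (cellVar x) 3)) s ωc c₁ (Sure c (Simulates m σ′ ω′ k))
    simulate-while m x p {σ} {ω} (stop z) {s} {ωc} {k} {c} S v≡ = 1 + c , +-monoˡ-≤ c (≤-trans {12} lit 60≤κ) ,
      run _ (stop (trans v≡ z)) ≤-refl (≤-refl , unfuel 1 {s} {ωc} S)
    simulate-while m x p (loop {τ = τ} {τ′} nz d e) {s} {ωc} {k} {c} S v≡ =
      1 + (κ * τ + (κ * τ′ + c)) , ≤-trans (≤-trans (≤-reflexive (arith₁ (κ * τ) (κ * τ′) c)) (+-monoˡ-≤ (κ * τ + (κ * τ′ + c)) (≤-trans {12} lit 60≤κ))) (≤-reflexive (arith₂ κ τ τ′ c)) ,
      join (simulate m p d {k = τ′ + k} {c = κ * τ′ + c} (refuel (+-assoc τ τ′ k) {s} {ωc} (unfuel 1 {s} {ωc} S)))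
      where
      arith₁ : ∀ a b c → 11 + (1 + (a + (b + c))) ≡ 12 + (a + (b + c))
      arith₁ a b c = refl
      arith₂ : ∀ κ a b c → κ * 1 + (κ * a + (κ * b + c)) ≡ κ * suc (a + b) + c
      arith₂ = solve-∀
      join : Run B (compile (level m) p) s ωc (κ * τ + (κ * τ′ + c)) (Sure (κ * τ′ + c) (Simulates m _ _ (τ′ + k))) →
             Run B (while 0 (compile (level m) p ⨾ read 0 (cellVar x) 3)) s ωc (1 + (κ * τ + (κ * τ′ + c))) (Sure c (Simulates m _ _ k))
      join (run {s₁} {ω₁} {τ₁} c₁ d₁ le₁ (c₁≥ , S₁)) = join₂ (read-var m x {c = c₁ ∸ 11} S₁)
        where
        join₂ : Run B (read 0 (cellVar x) 3) s₁ ω₁ (11 + (c₁ ∸ 11)) (Sure (c₁ ∸ 11) _) → _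
        join₂ (run {s₂} {ω₂} {τ₂} c₂ d₂ le₂ (c₂≥ , S₂ , v₂)) with simulate-while m x p e {s₂} {ω₂} {k} {c} S₂ v₂
        ... | c₃ , le₃ , run {τ = τ₃} c₄ d₃ le₄ q =
          run c₄ (loop (λ z → nz (trans (sym v≡) z)) (seq d₁ d₂) d₃) (s≤s time) q
          where
          11≤c₁ : 11 ≤ c₁
          11≤c₁ = ≤-trans (m+n≤o⇒m≤o 11 le₃) c₁≥
          time : τ₁ + τ₂ + τ₃ + c₄ ≤ κ * τ + (κ * τ′ + c)
          time = begin
            τ₁ + τ₂ + τ₃ + c₄        ≡⟨ arith τ₁ τ₂ τ₃ c₄ ⟩
            τ₁ + (τ₂ + (τ₃ + c₄))    ≤⟨ +-monoʳ-≤ τ₁ (+-monoʳ-≤ τ₂ (≤-trans le₄ (≤-trans (m+n≤o⇒n≤o∸m 11 (≤-trans le₃ c₁≥)) c₂≥))) ⟩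
            τ₁ + (τ₂ + c₂)           ≤⟨ +-monoʳ-≤ τ₁ (≤-trans le₂ (≤-reflexive (m+[n∸m]≡n 11≤c₁))) ⟩
            τ₁ + c₁                  ≤⟨ le₁ ⟩
            κ * τ + (κ * τ′ + c)     ∎
            where
            open ≤-Reasoning
            arith : ∀ a b c d → a + b + c + d ≡ a + (b + (c + d))
            arith = solve-∀
            m+n≤o⇒n≤o∸m : ∀ m {n o} → m + n ≤ o → n ≤ o ∸ m
            m+n≤o⇒n≤o∸m m {n} le = ≤-trans (≤-reflexive (sym (m+n∸m≡n m n))) (∸-monoˡ-≤ m le)

    simulate m skip skip {s} {ωc} {k} {c} S =
      Sim-step {s = s} 1 lit (Run-sure-wp skip (Simulates m _ _ k) ≤-refl (unfuel 1 {s} {ωc} S))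
    simulate m (const x v) (const {s = σ} v<) {s} {ωc} {k} S = Sim-step {s = s} 3 lit
      (Run-step {t = 1} (Run-sure-wp (const 0 v) (λ s′ ω′ → Simulates m σ _ k s′ ω′ × var s′ 0 ≡ v) ≤-refl (v< , unfuel 1 {s} {ωc} S , refl))
        (λ (S′ , v≡) → put-var-run m x S′ v≡))
    simulate m (op x o y z) (op {s = σ} v<) {s} {ωc} {k} S = Sim-step {s = s} 25 lit
      (Run-step {t = 11} (read-var m y (unfuel 1 {s} {ωc} S)) (λ (S₁ , y≡) →
       Run-step {t = 11} (read-second m z S₁ y≡) (λ {s₂} {ω₂} (S₂ , y≡ , z≡) →
       Run-step {t = 1} (Run-sure-wp (op 0 o 0 1) (λ s′ ω′ → Simulates m σ _ k s′ ω′ × var s′ 0 ≡ ⟦ o ⟧ (var σ y) (var σ z)) ≤-refl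
         (_ , refl , subst (_< B) (sym (cong₂ ⟦ o ⟧ y≡ z≡)) v< , S₂ , cong₂ ⟦ o ⟧ y≡ z≡)) (λ (S₃ , v≡) →
       put-var-run m x S₃ v≡))))
    simulate m (load x a y) (load {s = σ}) {s} {ωc} S = Sim-step {s = s} 24 lit
      (Run-step {t = 11} (read-var m y (unfuel 1 {s} {ωc} S)) (λ (S₁ , y≡) →
       Run-step {t = 11} (read-arr m a S₁ y≡) (λ (S₂ , v≡) →
       put-var-run m x S₂ v≡)))
    simulate m (store a y z) (store {s = σ}) {s} {ωc} {k} S = Sim-step {s = s} 24 lit
      (Run-step {t = 11} (read-var m y (unfuel 1 {s} {ωc} S)) (λ (S₁ , y≡) →
       Run-step {t = 11} (read-second m z S₁ y≡) (λ {s₂} {ω₂} (S₂ , y≡ , z≡) →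
       Run-sure-wp (put (level m) (cellArr a) 0 1) (Simulates m (setArr a (var σ y) (var σ z) σ) _ k) (put-cost (level m) (cellArr a) 0 1)
         (put-wp m (cellArr a) 0 1 {s = s₂} S₂ (λ f → Holds-setArr f σ a y≡ z≡)))))
    simulate m (flip x) flip {s} {ωc} {k} {c} S = Run-credit
      (≤-trans (≤-reflexive (sym (+-assoc (7 + 5 * R) 2 c))) (+-monoˡ-≤ c (≤-trans (≤-trans (≤-reflexive (+-comm (7 + 5 * R) 2)) (+-mono-≤ {9} {60} lit (*-monoˡ-≤ R {5} {10} lit))) (≤-reflexive (sym (*-identityʳ κ))))))
      (Run-step {t = 7 + 5 * R} (coin-run S) (λ (S′ , e) → put-var-run m x S′ e))
    simulate m (p ⨾ q) (seq {τ = τ} {τ′} d e) {s} {ωc} {k} {c} S = Run-credit (≤-reflexive (arith κ τ τ′ c))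
      (Run-step {t = κ * τ} (simulate m p d {k = τ′ + k} {c = κ * τ′ + c} (refuel (+-assoc τ τ′ k) {s} {ωc} S)) (simulate m q e))
      where
      arith : ∀ κ a b c → κ * a + (κ * b + c) ≡ κ * (a + b) + c
      arith = solve-∀
    simulate m (cond x p q) (then′ {τ = τ} nz d) {s} {ωc} {k} {c} S = Run-credit
      (≤-trans (+-monoˡ-≤ (κ * τ + c) {12} (≤-trans lit 60≤κ)) (≤-reflexive (arith κ τ c)))
      (Run-step {t = 11} (read-var m x {c = 1 + (κ * τ + c)} (unfuel 1 {s} {ωc} S))
        (λ (S′ , v≡) → Run-then (λ z → nz (trans (sym v≡) z)) (simulate m p d S′)))
      where
      arith : ∀ κ t c → κ * 1 + (κ * t + c) ≡ κ * suc t + c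
      arith = solve-∀
    simulate m (cond x p q) (else′ {τ = τ} z d) {s} {ωc} {k} {c} S = Run-credit
      (≤-trans (+-monoˡ-≤ (κ * τ + c) {12} (≤-trans lit 60≤κ)) (≤-reflexive (arith κ τ c)))
      (Run-step {t = 11} (read-var m x {c = 1 + (κ * τ + c)} (unfuel 1 {s} {ωc} S))
        (λ (S′ , v≡) → Run-else (trans v≡ z) (simulate m q d S′)))
      where
      arith : ∀ κ t c → κ * 1 + (κ * t + c) ≡ κ * suc t + c
      arith = solve-∀
    simulate m (while x p) {τ = τ} d {s} {ωc} {k} {c} S = join (read-var m x {c = κ * τ + c ∸ 11} S)
      where
      join : Run B (read 0 (cellVar x) 3) s ωc (11 + (κ * τ + c ∸ 11)) (Sure (κ * τ + c ∸ 11) _) → _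
      join (run {s₁} {ω₁} {τ₁} c₁ d₁ le₁ (c₁≥ , S₁ , v₁)) with simulate-while m x p d {s₁} {ω₁} {k} {c} S₁ v₁
      ... | c₂ , le₂ , run {τ = τ₂} c₃ d₂ le₃ q = run c₃ (seq d₁ d₂) time q
        where
        time : τ₁ + τ₂ + c₃ ≤ κ * τ + c
        time = begin
          τ₁ + τ₂ + c₃      ≡⟨ +-assoc τ₁ τ₂ c₃ ⟩
          τ₁ + (τ₂ + c₃)    ≤⟨ +-monoʳ-≤ τ₁ (≤-trans le₃ (≤-trans (≤-trans (≤-reflexive (sym (m+n∸m≡n 11 c₂))) (∸-monoˡ-≤ 11 le₂)) c₁≥)) ⟩
          τ₁ + c₁           ≤⟨ le₁ ⟩
          11 + (κ * τ + c ∸ 11) ≡⟨ m+[n∸m]≡n (m+n≤o⇒m≤o 11 le₂) ⟩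
          κ * τ + c         ∎
          where open ≤-Reasoning

open Simulating

-- The list of edges and the code that emits paths

module Construction where

  RawEdges : Set
  RawEdges = List (ℕ × ℕ)

  pathE : (l b : ℕ) → RawEdges
  pathE zero    b = []
  pathE (suc l) b = (b , suc b) ∷ pathE l (suc b)

  -- A path of l + 2 edges from h to t through the new vertices b, …, b + l; its
  -- last edge is left out if f = 0.
  chainE : (l h t f b : ℕ) → RawEdges
  chainE l h t f b = (h , b) ∷ pathE l b ++ pick f [] ((t , b + l) ∷ [])

  module Layout (n d l : ℕ) where

    -- In the order of their numbers: `4 * D` vertices C and C′, two hubs Y, the vectors of U with
    -- two extra rows, V with an extra row in two copies, the midpoints M, the pendants S, and from
    -- `iBase` on the inner vertices of five paths for each of the `X` triples of copy, row and
    -- coordinate. `D` makes room for the extra coordinate.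
    D uBase vBase mBase sBase X iBase N : ℕ
    D     = suc d
    X     = 2 * suc n * D
    uBase = 4 * D + 2
    vBase = uBase + (n + 2)
    mBase = vBase + 2 * suc n
    sBase = mBase + X
    iBase = sBase + X
    N     = iBase + X * (5 * suc l)

    uNode : (k a : ℕ) → ℕ
    uNode k a = uBase + pick (n ∸ a) (n + k) a

    module Bits (Ul Vl : List ℕ) where

      -- In the extra row every bit is 1. In the extra coordinate the vectors of V have 1, which
      -- gives every vector of V a way out in every stage, and those of U have 0, so that no hit of
      -- a vector of U arises there.
      uBit vBit : (a i : ℕ) → ℕ
      uBit a i = pick (n ∸ a) 1 (pick (d ∸ i) 0 (at 0 Ul (a * d + i)))
      vBit a i = pick (n ∸ a) 1 (pick (d ∸ i) 1 (at 0 Vl (a * d + i)))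

      -- The paths join Y to M, M to the row of U, M to C if the bit of U is 1, V to C′ if the bit
      -- of V is 1, and V to S. A coordinate where u, v and w are all 1 becomes a route U - M - C -
      -- C′ - V - S in whose middle a single edge stands for w, while Y connects all midpoints at
      -- moderate length. A bit 0 leaves a path dangling instead of removing it, so the vertex
      -- numbers do not depend on the bits.
      block : (k a i x : ℕ) → RawEdges
      block k a i x =
        chainE l (4 * D + k) (mBase + x) 1 b ++
        chainE l (mBase + x) (uNode k a) 1 (b + suc l) ++
        chainE l (mBase + x) (D * k + i) (uBit a i) (b + 2 * suc l) ++
        chainE l (vBase + x / D) (2 * D + (D * k + i)) (vBit a i) (b + 3 * suc l) ++
        chainE l (vBase + x / D) (sBase + x) 1 (b + 4 * suc l)
        where b = iBase + x * (5 * suc l)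

      blockE : ℕ → RawEdges
      blockE x = block (x / D / suc n) (x / D % suc n) (x % D) x

      dynamicE : ℕ → RawEdges
      dynamicE zero    = []
      dynamicE (suc q) = dynamicE q ∷ʳ (q , 2 * D + q)

      staticE : (q x : ℕ) → RawEdges
      staticE q zero    = dynamicE q
      staticE q (suc x) = staticE q x ++ blockE x

  emit : (u v : ℕ) → Prog
  emit u v = store 10 22 u ⨾ store 20 22 v ⨾ op 22 add 22 4

  emitPath : ℕ → Prog
  emitPath zero    = skip
  emitPath (suc l) = (op 32 add 23 4 ⨾ emit 23 32 ⨾ op 23 add 23 4) ⨾ emitPath l

  emitChain : (l h t f : ℕ) → Prog
  emitChain l h t f = emit h 23 ⨾ emitPath l ⨾ cond f (emit t 23) skip ⨾ op 23 add 23 4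

  -- The variables that emitChain changes are 22, 23 and 32.
  Unchanged : State → State → Set
  Unchanged s s′ = ∀ x → (22 ≡ᵇ x) ≡ false → (23 ≡ᵇ x) ≡ false → (32 ≡ᵇ x) ≡ false → var s′ x ≡ var s x

  at-∷ʳ : ∀ xs v k → (at 0 xs [ length xs ↦ v ]) k ≡ at 0 (xs ∷ʳ v) k
  at-∷ʳ []       v zero    = refl
  at-∷ʳ []       v (suc k) = refl
  at-∷ʳ (x ∷ xs) v zero    = refl
  at-∷ʳ (x ∷ xs) v (suc k) = at-∷ʳ xs v k

  -- Arrays 10 and 20 are the tables of initial values of the arrays 0 and 1 of
  -- the simulated program.
  record Emitted (es : RawEdges) (b : ℕ) (s : State) : Set where
    constructor emitted
    field
      sources  : ∀ k → arr s 10 k ≡ at 0 (map proj₁ es) k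
      targets  : ∀ k → arr s 20 k ≡ at 0 (map proj₂ es) k
      count    : var s 22 ≡ length es
      next     : var s 23 ≡ b
      one      : var s 4 ≡ 1

  open Emitted

  module _ {B : ℕ} where

    emit-run : ∀ u v es b {s ω c} → Emitted es b s → length es + 1 < B →
      Run B (emit u v) s ω (3 + c) (Sure c (λ s′ _ → Emitted (es ∷ʳ (var s u , var s v)) b s′ ×
        (∀ x → (22 ≡ᵇ x) ≡ false → var s′ x ≡ var s x)))
    emit-run u v es b {s} (emitted src dst len nxt on) len< =
      Run-sure-wp (emit u v) (λ s′ _ → Emitted (es ∷ʳ (var s u , var s v)) b s′ × (∀ x → (22 ≡ᵇ x) ≡ false → var s′ x ≡ var s x)) ≤-refl
        ( _ , refl , ≤-<-trans (≤-reflexive (cong₂ _+_ len on)) len<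
        , emitted (extend proj₁ 10 (var s u) src refl) (extend proj₂ 20 (var s v) dst refl) (trans (cong₂ _+_ len on) (sym (length-++ es))) nxt on
        , λ x e → unchanged x e)
      where
      extend : ∀ (π : ℕ × ℕ → ℕ) a w → (∀ k → arr s a k ≡ at 0 (map π es) k) → π (var s u , var s v) ≡ w →
               ∀ k → (arr s a [ var s 22 ↦ w ]) k ≡ at 0 (map π (es ∷ʳ (var s u , var s v))) k
      extend π a w h refl k = trans (cong₂ (λ i x → if i ≡ᵇ k then w else x) (trans len (sym (length-map π es))) (h k))
        (trans (at-∷ʳ (map π es) w k) (cong (λ xs → at 0 xs k) (sym (map-++ π es _))))
        where open import Data.List.Properties using (length-map)
      unchanged : ∀ x → (22 ≡ᵇ x) ≡ false → (if 22 ≡ᵇ x then var s 22 + var s 4 else var s x) ≡ var s x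
      unchanged x e rewrite e = refl

    emitPath-run : ∀ l es b {s ω c} → Emitted es b s → length es + l < B → b + l < B →
      Run B (emitPath l) s ω (1 + 5 * l + c) (Sure c (λ s′ _ → Emitted (es ++ pathE l b) (b + l) s′ × Unchanged s s′))
    emitPath-run zero es b {s} E _ _ = Run-sure-wp skip (λ s′ _ → Emitted (es ++ []) (b + 0) s′ × Unchanged s s′) ≤-refl
      (subst₂ (λ es b → Emitted es b s) (sym (++-identityʳ es)) (sym (+-identityʳ b)) E , λ _ _ _ _ → refl)
    emitPath-run (suc l) es b {s} {ω} {c} E@(emitted src dst len nxt on) len< b< =
      Run-credit (≤-reflexive (arith l c)) (Run-step {t = 5} first (λ {s₁} {ω₁} (E₁ , u₁) →
        Run-map (λ {s₂} (le , E₂ , u₂) → le , subst₂ (λ es b → Emitted es b s₂) (++-assoc es _ _) (sym (+-suc b l)) E₂ ,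
                   λ x e₁ e₂ e₃ → trans (u₂ x e₁ e₂ e₃) (u₁ x e₁ e₂ e₃))
          (emitPath-run l (es ∷ʳ (b , suc b)) (suc b) E₁
            (≤-<-trans (≤-reflexive (trans (cong (_+ l) (length-++ es)) (+-assoc (length es) 1 l))) len<)
            (≤-<-trans (≤-reflexive (sym (+-suc b l))) b<))))
      where
      arith : ∀ l c → 5 + (1 + 5 * l + c) ≡ 1 + 5 * suc l + c
      arith = solve-∀
      next+1 : var s 23 + var s 4 ≡ suc b
      next+1 = trans (cong₂ _+_ nxt on) (+-comm b 1)
      b+1< : suc b < B
      b+1< = ≤-<-trans (≤-trans (s≤s (m≤m+n b l)) (≤-reflexive (sym (+-suc b l)))) b<
      first : Run B (op 32 add 23 4 ⨾ emit 23 32 ⨾ op 23 add 23 4) s ω (5 + (1 + 5 * l + c))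
                (Sure (1 + 5 * l + c) (λ s′ _ → Emitted (es ∷ʳ (b , suc b)) (suc b) s′ × Unchanged s s′))
      first = Run-step {t = 1} (Run-sure-wp (op 32 add 23 4)
          (λ s′ _ → Emitted es b s′ × var s′ 32 ≡ suc b × Unchanged s s′) ≤-refl
          (_ , refl , ≤-<-trans (≤-reflexive next+1) b+1< , emitted src dst len nxt on , next+1 , λ x _ _ e → skip-32 x e))
        (λ {s₁} (E₁@(emitted _ _ _ next₁ _) , q , u₁) → Run-step {t = 3} (emit-run 23 32 es b E₁
            (≤-<-trans (+-monoʳ-≤ (length es) (s≤s z≤n)) len<))
        (λ {s₂} (emitted src₂ dst₂ len₂ next₂ one₂ , u₂) → Run-sure-wp (op 23 add 23 4) (λ s′ _ → Emitted (es ∷ʳ (b , suc b)) (suc b) s′ × Unchanged s s′) ≤-refl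
            ( _ , refl , ≤-<-trans (≤-reflexive (trans (cong₂ _+_ next₂ one₂) (+-comm b 1))) b+1<
            , emitted (subst (λ e → (∀ k → arr s₂ 10 k ≡ at 0 (map proj₁ (es ∷ʳ e)) k)) (cong₂ _,_ next₁ q) src₂)
                (subst (λ e → (∀ k → arr s₂ 20 k ≡ at 0 (map proj₂ (es ∷ʳ e)) k)) (cong₂ _,_ next₁ q) dst₂)
                (trans len₂ (trans (length-++ es) (sym (length-++ es))))
                (trans (cong₂ _+_ next₂ one₂) (+-comm b 1)) one₂
            , λ x e₁ e₂ e₃ → trans (skip-23 s₂ x e₂) (trans (u₂ x e₁) (u₁ x e₁ e₂ e₃)))))
        where
        skip-32 : ∀ x → (32 ≡ᵇ x) ≡ false → (if 32 ≡ᵇ x then var s 23 + var s 4 else var s x) ≡ var s x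
        skip-32 x e rewrite e = refl
        skip-23 : ∀ s x → (23 ≡ᵇ x) ≡ false → (if 23 ≡ᵇ x then var s 23 + var s 4 else var s x) ≡ var s x
        skip-23 s x e rewrite e = refl

    emitChain-run : ∀ l h t f es b {s ω c h₀ t₀ f₀} → Emitted es b s →
      (23 ≡ᵇ t) ≡ false → (22 ≡ᵇ t) ≡ false → (32 ≡ᵇ t) ≡ false →
      (23 ≡ᵇ f) ≡ false → (22 ≡ᵇ f) ≡ false → (32 ≡ᵇ f) ≡ false →
      var s h ≡ h₀ → var s t ≡ t₀ → var s f ≡ f₀ →
      length es + (2 + l) < B → b + suc l < B →
      Run B (emitChain l h t f) s ω (10 + 5 * l + c)
        (Sure c (λ s′ _ → Emitted (es ++ chainE l h₀ t₀ f₀ b) (b + suc l) s′ × Unchanged s s′))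
    emitChain-run l h t f es b {s} {ω} {c} {h₀} {t₀} {f₀} E t₂₃ t₂₂ t₃₂ f₂₃ f₂₂ f₃₂ refl refl refl len< b< =
      Run-credit (≤-reflexive (arith l c))
      (Run-step {t = 3} (emit-run h 23 es b E (≤-<-trans (+-monoʳ-≤ (length es) (s≤s z≤n)) len<)) (λ {s₁} (E₁ , u₁) →
       Run-step {t = 1 + 5 * l} (emitPath-run l (es ∷ʳ (h₀ , b)) b (subst (λ v → Emitted (es ∷ʳ (h₀ , v)) b s₁) (next E) E₁)
          (≤-<-trans (≤-trans (≤-reflexive (trans (cong (_+ l) (length-++ es)) (+-assoc (length es) 1 l))) (+-monoʳ-≤ (length es) (n≤1+n (suc l)))) len<)
          (≤-<-trans (+-monoʳ-≤ b (n≤1+n l)) b<)) (λ {s₂} {ω₂} (E₂ , u₂) →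
       Run-step {t = 5} (closing s₂ {ω₂} {1 + c} E₂ (trans (u₂ t t₂₂ t₂₃ t₃₂) (u₁ t t₂₂)) (trans (u₂ f f₂₂ f₂₃ f₃₂) (u₁ f f₂₂))) (λ {s₃} (emitted src dst len nxt on , u₃) →
       Run-sure-wp (op 23 add 23 4) (λ s′ _ → Emitted (es ++ chainE l h₀ t₀ f₀ b) (b + suc l) s′ × Unchanged s s′) ≤-refl
         ( _ , refl , ≤-<-trans (≤-reflexive (bump nxt on)) b<
         , emitted src dst len (bump nxt on) on
         , λ x e₁ e₂ e₃ → trans (skip-23 s₃ x e₂) (trans (u₃ x e₁) (trans (u₂ x e₁ e₂ e₃) (u₁ x e₁))))))))
      where
      arith : ∀ l c → 3 + (1 + 5 * l + (5 + (1 + c))) ≡ 10 + 5 * l + c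
      arith = solve-∀
      bump : ∀ {x y} → x ≡ b + l → y ≡ 1 → x + y ≡ b + suc l
      bump refl refl = trans (+-assoc b l 1) (cong (b +_) (+-comm l 1))
      skip-23 : ∀ s x → (23 ≡ᵇ x) ≡ false → (if 23 ≡ᵇ x then var s 23 + var s 4 else var s x) ≡ var s x
      skip-23 s x e rewrite e = refl
      es′ : RawEdges
      es′ = (es ∷ʳ (h₀ , b)) ++ pathE l b
      regroup : ∀ zs → es′ ++ zs ≡ es ++ (h₀ , b) ∷ pathE l b ++ zs
      regroup zs = trans (cong (_++ zs) (++-assoc es _ _)) (++-assoc es _ zs)
      length-pathE : ∀ l b → length (pathE l b) ≡ l
      length-pathE zero    b = refl
      length-pathE (suc l) b = cong suc (length-pathE l (suc b))
      closing : ∀ s₂ {ω c} → Emitted es′ (b + l) s₂ → var s₂ t ≡ t₀ → var s₂ f ≡ f₀ →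
        Run B (cond f (emit t 23) skip) s₂ ω (5 + c)
          (Sure c (λ s′ _ → Emitted (es ++ chainE l h₀ t₀ f₀ b) (b + l) s′ × (∀ x → (22 ≡ᵇ x) ≡ false → var s′ x ≡ var s₂ x)))
      closing s₂ E₂ t≡ f≡ with var s f in eq
      ... | zero  = Run-credit (s≤s (m≤n+m _ 3)) (Run-else f≡ (Run-sure-wp skip (λ s′ _ → Emitted (es ++ chainE l h₀ t₀ 0 b) (b + l) s′ × (∀ x → (22 ≡ᵇ x) ≡ false → var s′ x ≡ var s₂ x)) ≤-refl
            (subst (λ es → Emitted es (b + l) s₂) (trans (sym (++-identityʳ es′)) (regroup [])) E₂ , λ _ _ → refl)))
      ... | suc f₁ = Run-credit (n≤1+n _) (Run-then (λ z → case trans (sym f≡) z of λ ()) (Run-map (λ {s₃} (le , E₃ , u₃) → le ,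
              subst (λ es → Emitted es (b + l) s₃) (trans (cong₂ (λ x y → es′ ∷ʳ (x , y)) t≡ (next E₂)) (regroup _)) E₃ , u₃)
            (emit-run t 23 es′ (b + l) E₂ (≤-<-trans (≤-reflexive (trans (cong (_+ 1) (trans (length-++ (es ∷ʳ (h₀ , b))) (cong₂ _+_ (length-++ es) (length-pathE l b)))) (arith′ (length es) l))) len<))))
        where
        arith′ : ∀ e l → e + 1 + l + 1 ≡ e + (2 + l)
        arith′ = solve-∀

open Construction

-- Code computing the vertex numbers of the graph

module Building where

  -- Variables 49, 4 and 3 hold the number of edges C–C′ present from the start,
  -- 1 and 0.
  setup₁ setup₂ : Prog
  setup₁ = op 10 add 0 60 ⨾ op 11 add 2 60 ⨾ op 12 add 3 60 ⨾ const 3 0 ⨾ const 4 1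
  setup₂ = op 13 add 12 4 ⨾ op 14 add 10 4 ⨾ op 15 add 13 13 ⨾ op 16 add 15 15

  setup₃ setup₄ : Prog
  setup₃ = const 46 2 ⨾ op 17 add 16 46 ⨾ op 18 add 10 46 ⨾ op 18 add 17 18 ⨾ op 47 add 14 14
  setup₄ = op 19 add 18 47 ⨾ op 20 mul 47 13 ⨾ op 21 add 19 20 ⨾ op 23 add 21 20 ⨾ const 22 0

  setup₅ : Bool → Prog
  setup₅ dyn = op 49 mul 15 (if dyn then 4 else 3)

  blockIndices blockVertices blockBits : Prog
  blockIndices  = op 42 rem 24 13 ⨾ op 43 quo 24 13 ⨾ op 44 rem 43 14 ⨾ op 45 quo 43 14 ⨾
                  op 46 sub 10 44 ⨾ op 47 sub 12 42
  blockVertices = op 33 add 16 45 ⨾ op 34 add 19 24 ⨾ op 36 mul 13 45 ⨾ op 36 add 36 42 ⨾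
                  op 39 add 15 36 ⨾ op 38 add 18 43 ⨾ op 41 add 21 24 ⨾
                  cond 46 (op 35 add 17 44) (op 35 add 10 45 ⨾ op 35 add 17 35)
  blockBits     = op 48 mul 44 12 ⨾ op 48 add 48 42 ⨾
                  cond 46 (cond 47 (load 37 0 48 ⨾ load 40 1 48) (const 37 0 ⨾ const 40 1))
                          (const 37 1 ⨾ const 40 1)

  blockBody : ℕ → Prog
  blockBody l = blockIndices ⨾ blockVertices ⨾ blockBits ⨾
    emitChain l 33 34 4 ⨾ emitChain l 34 35 4 ⨾ emitChain l 34 36 37 ⨾ emitChain l 38 39 40 ⨾ emitChain l 38 41 4

  build : Bool → ℕ → Prog
  build dyn l =
    (setup₁ ⨾ setup₂ ⨾ setup₃ ⨾ setup₄ ⨾ setup₅ dyn) ⨾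
    for 50 49 51 (op 52 add 15 50 ⨾ emit 50 52) ⨾
    for 24 20 25 (blockBody l) ⨾
    store 5 3 23 ⨾ store 15 3 22

  emitPath-keepsArr : ∀ l a → (10 ≡ᵇ a) ≡ false → (20 ≡ᵇ a) ≡ false → keepsArr a (emitPath l) ≡ true
  emitPath-keepsArr zero    a e f = refl
  emitPath-keepsArr (suc l) a e f rewrite e | f = emitPath-keepsArr l a e f

  emitPath-keepsVar : ∀ l x → (22 ≡ᵇ x) ≡ false → (23 ≡ᵇ x) ≡ false → (32 ≡ᵇ x) ≡ false → keepsVar x (emitPath l) ≡ true
  emitPath-keepsVar zero    x e f g = refl
  emitPath-keepsVar (suc l) x e f g rewrite e | f | g = emitPath-keepsVar l x e f g

  blockBody-keepsArr : ∀ l a → (10 ≡ᵇ a) ≡ false → (20 ≡ᵇ a) ≡ false → keepsArr a (blockBody l) ≡ true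
  blockBody-keepsArr l a e f rewrite e | f | emitPath-keepsArr l a e f = refl

  build-keepsArr : ∀ dyn l a → (10 ≡ᵇ a) ≡ false → (20 ≡ᵇ a) ≡ false → (5 ≡ᵇ a) ≡ false → (15 ≡ᵇ a) ≡ false →
                   keepsArr a (build dyn l) ≡ true
  build-keepsArr dyn l a e f g h rewrite e | f | emitPath-keepsArr l a e f | g | h = refl

  build-keepsVar : ∀ dyn l x → (22 ≡ᵇ x) ≡ false → (23 ≡ᵇ x) ≡ false → (32 ≡ᵇ x) ≡ false →
                   keepsVar x ((setup₁ ⨾ setup₂ ⨾ setup₃ ⨾ setup₄ ⨾ setup₅ dyn) ⨾ for 50 49 51 (op 52 add 15 50 ⨾ emit 50 52)) ≡ true →
                   keepsVar x (for 24 20 25 (blockIndices ⨾ blockVertices ⨾ blockBits)) ≡ true → keepsVar x (build dyn l) ≡ true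
  build-keepsVar dyn l x e f g h k
    with h₁ , h₂ ← ∧-true {keepsVar x (setup₁ ⨾ setup₂ ⨾ setup₃ ⨾ setup₄ ⨾ setup₅ dyn)} h
    with k₁ , k₂ ← ∧-true {keepsVar x (const 24 0)} k
    with k₃ , k₄ ← ∧-true {keepsVar x (op 25 sub 20 24)} k₂
    with k₅ , k₆ ← ∧-true {keepsVar x (blockIndices ⨾ blockVertices ⨾ blockBits)} k₄
    with k₇ , k₈ ← ∧-true {keepsVar x blockIndices} k₅
    with k₉ , k₁₀ ← ∧-true {keepsVar x blockVertices} k₈ =
    ∧-intro h₁ (∧-intro h₂ (∧-intro (∧-intro k₁ (∧-intro k₃ (∧-intro (∧-intro k₇ (∧-intro k₉ (∧-intro k₁₀ chains))) k₆))) refl))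
    where
    chains : keepsVar x (emitChain l 33 34 4 ⨾ emitChain l 34 35 4 ⨾ emitChain l 34 36 37 ⨾ emitChain l 38 39 40 ⨾ emitChain l 38 41 4) ≡ true
    chains rewrite e | f | emitPath-keepsVar l x e f g = refl

  emitPath-flipFree : ∀ l → flipFree (emitPath l) ≡ true
  emitPath-flipFree zero    = refl
  emitPath-flipFree (suc l) = emitPath-flipFree l

  build-flipFree : ∀ dyn l → flipFree (build dyn l) ≡ true
  build-flipFree dyn l rewrite emitPath-flipFree l = refl

  module Build (B n J d l : ℕ) (Ul Vl : List ℕ) where
    open Layout n d l
    open Bits Ul Vl

    record Env (s : State) : Set where
      constructor env
      field
        zero≡ : var s 3 ≡ 0
        one≡  : var s 4 ≡ 1
        n≡    : var s 10 ≡ n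
        J≡    : var s 11 ≡ J
        d≡    : var s 12 ≡ d
        D≡    : var s 13 ≡ D
        n+1≡  : var s 14 ≡ suc n
        2D≡   : var s 15 ≡ 2 * D
        4D≡   : var s 16 ≡ 4 * D
        u≡    : var s 17 ≡ uBase
        v≡    : var s 18 ≡ vBase
        m≡    : var s 19 ≡ mBase
        X≡    : var s 20 ≡ X
        s≡    : var s 21 ≡ sBase

    open Env

    Env-unchanged : ∀ {s s′} → Unchanged s s′ → Env s → Env s′
    Env-unchanged u (env a b c d e f g h i j k l m o) = env
      (trans (u 3 refl refl refl) a) (trans (u 4 refl refl refl) b) (trans (u 10 refl refl refl) c)
      (trans (u 11 refl refl refl) d) (trans (u 12 refl refl refl) e) (trans (u 13 refl refl refl) f)
      (trans (u 14 refl refl refl) g) (trans (u 15 refl refl refl) h) (trans (u 16 refl refl refl) i)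
      (trans (u 17 refl refl refl) j) (trans (u 18 refl refl refl) k) (trans (u 19 refl refl refl) l)
      (trans (u 20 refl refl refl) m) (trans (u 21 refl refl refl) o)

    module _ (N<B : N < B) where

      iBase≤N : iBase ≤ N
      iBase≤N = m≤m+n _ _
      sBase+X≤N : sBase + X ≤ N
      sBase+X≤N = iBase≤N
      mBase+X≤N : mBase + X ≤ N
      mBase+X≤N = ≤-trans (m≤m+n _ _) iBase≤N
      mBase≤N : mBase ≤ N
      mBase≤N = ≤-trans (m≤m+n _ _) mBase+X≤N
      vBase≤N : vBase ≤ N
      vBase≤N = ≤-trans (m≤m+n _ _) mBase≤N
      uBase≤N : uBase ≤ N
      uBase≤N = ≤-trans (m≤m+n _ _) vBase≤N
      4D≤N : 4 * D ≤ N
      4D≤N = ≤-trans (m≤m+n _ _) uBase≤N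
      2D≤N : 2 * D ≤ N
      2D≤N = ≤-trans (*-monoˡ-≤ D {2} {4} (s≤s (s≤s z≤n))) 4D≤N
      D≤N : D ≤ N
      D≤N = ≤-trans (m≤m+n D _) 2D≤N
      n+2≤N : n + 2 ≤ N
      n+2≤N = ≤-trans (m≤n+m _ uBase) vBase≤N
      X≤N : X ≤ N
      X≤N = ≤-trans (m≤n+m _ mBase) mBase+X≤N
      2≤N : 2 ≤ N
      2≤N = ≤-trans (m≤n+m 2 n) n+2≤N
      fits : ∀ {v} → v ≤ N → v < B
      fits le = ≤-<-trans le N<B

      -- There is no copy instruction, so `setup₁` adds variable 60, still 0; variable 3 cannot
      -- serve as zero at that moment because it holds the input `d`.
      setup-run : ∀ dyn {s ω c} → var s 0 ≡ n → var s 2 ≡ J → var s 3 ≡ d → var s 60 ≡ 0 → J < B →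
        Run B (setup₁ ⨾ setup₂ ⨾ setup₃ ⨾ setup₄ ⨾ setup₅ dyn) s ω (20 + c)
          (Sure c (λ s′ _ → Env s′ × var s′ 22 ≡ 0 × var s′ 23 ≡ iBase × var s′ 49 ≡ (if dyn then 2 * D else 0)))
      setup-run dyn {s} {ω} {c} e₀ e₂ e₃ e₆₀ J<B =
        Run-step {t = 5} (Run-sure-wp setup₁ (λ s _ → var s 10 ≡ n × var s 11 ≡ J × var s 12 ≡ d × var s 3 ≡ 0 × var s 4 ≡ 1) ≤-refl
          ( n , trans (cong₂ _+_ e₀ e₆₀) (+-identityʳ n) , fits (≤-trans (m≤m+n n 2) n+2≤N)
          , J , trans (cong₂ _+_ e₂ e₆₀) (+-identityʳ J) , J<B
          , d , trans (cong₂ _+_ e₃ e₆₀) (+-identityʳ d) , fits (≤-trans (n≤1+n d) D≤N) , fits z≤n , fits (≤-trans (s≤s z≤n) 2≤N)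
          , refl , refl , refl , refl , refl)) (λ { {s₁} (en , eJ , ed , ez , eo) →
        Run-step {t = 4} (Run-sure-wp setup₂ (λ s _ → var s 10 ≡ n × var s 11 ≡ J × var s 12 ≡ d × var s 3 ≡ 0 × var s 4 ≡ 1 ×
             var s 13 ≡ D × var s 14 ≡ suc n × var s 15 ≡ 2 * D × var s 16 ≡ 4 * D) ≤-refl
          ( D , trans (cong₂ _+_ ed eo) (+-comm d 1) , fits D≤N
          , suc n , trans (cong₂ _+_ en eo) (+-comm n 1) , fits (≤-trans (≤-trans (n≤1+n (suc n)) (≤-reflexive (+-comm 2 n))) n+2≤N)
          , 2 * D , cong (D +_) (sym (+-identityʳ D)) , fits 2D≤N , 4 * D , double D , fits 4D≤N
          , en , eJ , ed , ez , eo , refl , refl , refl , refl)) (λ { {s₂} (en , eJ , ed , ez , eo , eD , en1 , e2D , e4D) →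
        Run-step {t = 5} (Run-sure-wp setup₃ (λ s _ → var s 10 ≡ n × var s 11 ≡ J × var s 12 ≡ d × var s 3 ≡ 0 × var s 4 ≡ 1 ×
             var s 13 ≡ D × var s 14 ≡ suc n × var s 15 ≡ 2 * D × var s 16 ≡ 4 * D × var s 17 ≡ uBase × var s 18 ≡ vBase × var s 47 ≡ 2 * suc n) ≤-refl
          ( fits 2≤N , uBase , cong (_+ 2) e4D , fits uBase≤N , n + 2 , cong (_+ 2) en , fits n+2≤N , vBase , refl , fits vBase≤N
          , 2 * suc n , trans (cong₂ _+_ en1 en1) (cong (suc n +_) (sym (+-identityʳ (suc n)))) , fits (≤-trans (m≤n+m _ vBase) mBase≤N)
          , en , eJ , ed , ez , eo , eD , en1 , e2D , e4D , refl , refl , refl)) (λ { {s₃} (en , eJ , ed , ez , eo , eD , en1 , e2D , e4D , eu , ev , e2n) →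
        Run-step {t = 5} (Run-sure-wp setup₄ (λ s _ → Env s × var s 22 ≡ 0 × var s 23 ≡ iBase) ≤-refl
          ( mBase , cong₂ _+_ ev e2n , fits mBase≤N , X , cong₂ _*_ e2n eD , fits X≤N , sBase , refl , fits mBase+X≤N
          , iBase , refl , fits sBase+X≤N , fits z≤n
          , env ez eo en eJ ed eD en1 e2D e4D eu ev refl refl refl , refl , refl)) (λ { {s₄} (E , e22 , e23) →
        last dyn E e22 e23 }) }) }) })
        where
        double : ∀ D → 2 * D + 2 * D ≡ 4 * D
        double = solve-∀
        last : ∀ dyn {s ω c} → Env s → var s 22 ≡ 0 → var s 23 ≡ iBase →
          Run B (setup₅ dyn) s ω (1 + c) (Sure c (λ s′ _ → Env s′ × var s′ 22 ≡ 0 × var s′ 23 ≡ iBase × var s′ 49 ≡ (if dyn then 2 * D else 0)))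
        last true  {s} (env a b c d e f g h i j k l m o) e22 e23 = Run-sure-wp (setup₅ true) _ ≤-refl
          (2 * D , trans (cong₂ _*_ h b) (*-identityʳ (2 * D)) , fits 2D≤N , env a b c d e f g h i j k l m o , e22 , e23 , refl)
        last false {s} (env a b c d e f g h i j k l m o) e22 e23 = Run-sure-wp (setup₅ false) _ ≤-refl
          (0 , trans (cong₂ _*_ h a) (*-zeroʳ (2 * D)) , fits z≤n , env a b c d e f g h i j k l m o , e22 , e23 , refl)

      length-pathE : ∀ l b → length (pathE l b) ≡ l
      length-pathE zero    b = refl
      length-pathE (suc l) b = cong suc (length-pathE l (suc b))

      length-chainE : ∀ h t f b → length (chainE l h t f b) ≤ 2 + l
      length-chainE h t f b = s≤s (≤-trans (≤-reflexive (length-++ (pathE l b)))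
        (≤-trans (+-mono-≤ (≤-reflexive (length-pathE l b)) (closing f)) (≤-reflexive (+-comm l 1))))
        where
        closing : ∀ f → length (pick f [] ((t , b + l) ∷ [])) ≤ 1
        closing zero    = z≤n
        closing (suc _) = ≤-refl

      length-block : ∀ k a i x → length (block k a i x) ≤ 5 * (2 + l)
      length-block k a i x =
        add₂ (chainE l (4 * D + k) (mBase + x) 1 b) (length-chainE (4 * D + k) (mBase + x) 1 b)
        (add₂ (chainE l (mBase + x) (uNode k a) 1 (b + suc l)) (length-chainE (mBase + x) (uNode k a) 1 (b + suc l))
        (add₂ (chainE l (mBase + x) (D * k + i) (uBit a i) (b + 2 * suc l)) (length-chainE (mBase + x) (D * k + i) (uBit a i) (b + 2 * suc l))
        (add₂ (chainE l (vBase + x / D) (2 * D + (D * k + i)) (vBit a i) (b + 3 * suc l)) (length-chainE (vBase + x / D) (2 * D + (D * k + i)) (vBit a i) (b + 3 * suc l))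
          (≤-trans (length-chainE (vBase + x / D) (sBase + x) 1 (b + 4 * suc l)) (≤-reflexive (sym (+-identityʳ (2 + l))))))))
        where
        b : ℕ
        b = iBase + x * (5 * suc l)
        add₂ : ∀ xs {ys : RawEdges} {m n} → length xs ≤ m → length ys ≤ n → length (xs ++ ys) ≤ m + n
        add₂ xs p q = ≤-trans (≤-reflexive (length-++ xs)) (+-mono-≤ p q)

      length-dynamicE : ∀ q → length (dynamicE q) ≡ q
      length-dynamicE zero    = refl
      length-dynamicE (suc q) = trans (length-++ (dynamicE q)) (trans (+-comm _ 1) (cong suc (length-dynamicE q)))

      length-staticE : ∀ q x → length (staticE q x) ≤ q + x * (5 * (2 + l))
      length-staticE q zero    = ≤-trans (≤-reflexive (length-dynamicE q)) (m≤m+n q 0)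
      length-staticE q (suc x) = ≤-trans (≤-reflexive (length-++ (staticE q x)))
        (≤-trans (+-mono-≤ (length-staticE q x) (length-block (x / D / suc n) (x / D % suc n) (x % D) x)) (≤-reflexive (arith q (x * (5 * (2 + l))) (5 * (2 + l)))))
        where
        arith : ∀ q y z → q + y + z ≡ q + (z + y)
        arith = solve-∀

      -- The edges C - C′ number at most `N`. A block has at most `5 * (2 + l)` edges, no more than
      -- twice the number of its own inner vertices, so all blocks together have at most `2 * N`.
      static-room : ∀ {q x} → q ≤ 2 * D → x ≤ X → q + x * (5 * (2 + l)) ≤ 3 * N
      static-room {q} {x} q≤ x≤ = +-mono-≤ (≤-trans q≤ 2D≤N) step
        where
        step : x * (5 * (2 + l)) ≤ N + (N + 0)
        step = ≤-trans (*-mono-≤ x≤ (*-monoʳ-≤ 5 (≤-trans (+-monoʳ-≤ 1 (m≤n+m (suc l) l)) (≤-reflexive (cong suc (+-suc l l)))))) (≤-trans (≤-reflexive (arith X l))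
          (≤-trans (+-mono-≤ (m≤n+m _ iBase) (m≤n+m _ iBase)) (≤-reflexive (cong (N +_) (sym (+-identityʳ N))))))
          where
          arith : ∀ X l → X * (5 * suc (suc (l + l))) ≡ X * (5 * suc l) + X * (5 * suc l)
          arith = solve-∀

      staticE-bound : ∀ {q x} → q ≤ 2 * D → x ≤ X → length (staticE q x) ≤ 3 * N
      staticE-bound {q} {x} q≤ x≤ = ≤-trans (length-staticE q x) (static-room q≤ x≤)

      record Block (x : ℕ) (s : State) : Set where
        constructor blockvars
        field
          y-  : var s 33 ≡ 4 * D + x / D / suc n
          m-  : var s 34 ≡ mBase + x
          u-  : var s 35 ≡ uNode (x / D / suc n) (x / D % suc n)
          c-  : var s 36 ≡ D * (x / D / suc n) + x % D
          ub- : var s 37 ≡ uBit (x / D % suc n) (x % D)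
          v-  : var s 38 ≡ vBase + x / D
          c′- : var s 39 ≡ 2 * D + (D * (x / D / suc n) + x % D)
          vb- : var s 40 ≡ vBit (x / D % suc n) (x % D)
          s-  : var s 41 ≡ sBase + x

      Block-unchanged : ∀ {x s s′} → Unchanged s s′ → Block x s → Block x s′
      Block-unchanged u (blockvars a b c d e f g h i) = blockvars
        (trans (u 33 refl refl refl) a) (trans (u 34 refl refl refl) b) (trans (u 35 refl refl refl) c)
        (trans (u 36 refl refl refl) d) (trans (u 37 refl refl refl) e) (trans (u 38 refl refl refl) f)
        (trans (u 39 refl refl refl) g) (trans (u 40 refl refl refl) h) (trans (u 41 refl refl refl) i)

      Inputs : State → Set
      Inputs s = (∀ k → arr s 0 k ≡ at 0 Ul k) × (∀ k → arr s 1 k ≡ at 0 Vl k)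

      module Index {x} (x<X : x < X) where
        i q a k : ℕ
        i = x % D
        q = x / D
        a = q % suc n
        k = q / suc n
        i≤d : i ≤ d
        i≤d = s≤s⁻¹ (m%n<n x D)
        q< : q < 2 * suc n
        q< = m<n*o⇒m/o<n x<X
        a≤n : a ≤ n
        a≤n = s≤s⁻¹ (m%n<n q (suc n))
        k≤1 : k ≤ 1
        k≤1 = s≤s⁻¹ (m<n*o⇒m/o<n q<)
        c≤2D : D * k + i ≤ 2 * D
        c≤2D = ≤-trans (+-mono-≤ (*-monoʳ-≤ D k≤1) (≤-trans i≤d (n≤1+n d))) (≤-reflexive (arith D))
          where
          arith : ∀ D → D * 1 + D ≡ 2 * D
          arith = solve-∀
        bit≤ : a * d + i ≤ N
        bit≤ = ≤-trans (+-mono-≤ (*-mono-≤ a≤n (n≤1+n d)) (≤-trans i≤d (n≤1+n d))) (≤-trans (≤-reflexive (+-comm (n * D) D)) (≤-trans (*-monoˡ-≤ D (m≤m+n (suc n) _)) X≤N))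

      blockVars-run : ∀ {x s ω c} → x < X → Env s → Inputs s → var s 24 ≡ x →
        Run B (blockIndices ⨾ blockVertices ⨾ blockBits) s ω (32 + c)
          (Sure c (λ s′ _ → Env s′ × Block x s′ × var s′ 22 ≡ var s 22 × var s′ 23 ≡ var s 23 ×
                            arr s′ 10 ≡ arr s 10 × arr s′ 20 ≡ arr s 20))
      blockVars-run {x} {s} {ω} {c} x<X E@(env e3 e4 e10 e11 e12 e13 e14 e15 e16 e17 e18 e19 e20 e21) (inU , inV) ex =
        Run-step {t = 6} (Run-sure-wp blockIndices (λ s₁ _ → Indices s₁ × Rest s₁) ≤-refl
          ( i , cong₂ ⟦ rem ⟧ ex e13 , fits (≤-trans i≤d (≤-trans (n≤1+n d) D≤N))
          , q , cong₂ ⟦ quo ⟧ ex e13 , fits (≤-trans (<⇒≤ q<) (≤-trans (m≤n+m _ vBase) mBase≤N))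
          , a , cong (⟦ rem ⟧ q) e14 , fits (≤-trans a≤n n≤N)
          , k , cong (⟦ quo ⟧ q) e14 , fits (≤-trans k≤1 (≤-trans (s≤s z≤n) 2≤N))
          , n ∸ a , cong (_∸ a) e10 , fits (≤-trans (m∸n≤m n a) n≤N)
          , d ∸ i , cong (_∸ i) e12 , fits (≤-trans (m∸n≤m d i) (≤-trans (n≤1+n d) D≤N))
          , (refl , refl , refl , refl , refl , refl) , (ex , env e3 e4 e10 e11 e12 e13 e14 e15 e16 e17 e18 e19 e20 e21 , inU , inV , refl , refl , refl , refl)))
        (λ { {s₁} (I₁@(i′ , q′ , a′ , k′ , na , di) , ex , E₁@(env e3 e4 e10 e11 e12 e13 e14 e15 e16 e17 e18 e19 e20 e21) , inU , inV , r22 , r23 , r10 , r20) →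
        Run-step {t = 11} (Run-sure-wp blockVertices (λ s₂ _ → Vertices s₂ × Indices s₂ × Rest s₂) ≤-refl
          ( 4 * D + k , cong₂ _+_ e16 k′ , fits (≤-trans (+-monoʳ-≤ (4 * D) (≤-trans k≤1 (s≤s z≤n))) uBase≤N)
          , mBase + x , cong₂ _+_ e19 ex , fits (≤-trans (+-monoʳ-≤ mBase (<⇒≤ x<X)) mBase+X≤N)
          , D * k , cong₂ _*_ e13 k′ , fits (≤-trans (m≤m+n _ i) (≤-trans c≤2D 2D≤N))
          , D * k + i , cong (D * k +_) i′ , fits (≤-trans c≤2D 2D≤N)
          , 2 * D + (D * k + i) , cong (_+ (D * k + i)) e15 , fits (≤-trans (≤-trans (+-monoʳ-≤ (2 * D) c≤2D) (≤-reflexive (double D))) 4D≤N)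
          , vBase + q , cong₂ _+_ e18 q′ , fits (≤-trans (+-monoʳ-≤ vBase (<⇒≤ q<)) mBase≤N)
          , sBase + x , cong₂ _+_ e21 ex , fits (≤-trans (+-monoʳ-≤ sBase (<⇒≤ x<X)) sBase+X≤N)
          , (λ nz → uNode k a , trans (cong₂ _+_ e17 a′) (cong (uBase +_) (sym (pick-suc {x = n + k} (λ z → nz (trans na z))))) ,
               subst (_< B) (cong (uBase +_) (sym (pick-suc {x = n + k} (λ z → nz (trans na z))))) (fits (≤-trans (+-monoʳ-≤ uBase (≤-trans a≤n (m≤m+n n 2))) vBase≤N)) ,
               (refl , refl , refl , refl , refl , refl , refl) , I₁ , ex , env e3 e4 e10 e11 e12 e13 e14 e15 e16 e17 e18 e19 e20 e21 , inU , inV , r22 , r23 , r10 , r20)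
          , (λ z → n + k , cong₂ _+_ e10 k′ , fits (≤-trans (m≤n+m _ uBase) u≤) ,
               uNode k a , trans (cong (_+ (n + k)) e17) (cong (uBase +_) (sym (pick-zero {y = a} (trans (sym na) z)))) ,
               subst (_< B) (cong (uBase +_) (sym (pick-zero {y = a} (trans (sym na) z)))) (fits u≤) ,
               (refl , refl , refl , refl , refl , refl , refl) , I₁ , ex , env e3 e4 e10 e11 e12 e13 e14 e15 e16 e17 e18 e19 e20 e21 , inU , inV , r22 , r23 , r10 , r20)))
        (λ { {s₂} ((y′ , m′ , u′ , c′ , v′ , cc , s′) , (i′ , q′ , a′ , k′ , na , di) , ex , E₂@(env e3 e4 e10 e11 e12 e13 e14 e15 e16 e17 e18 e19 e20 e21) , inU , inV , r22 , r23 , r10 , r20) →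
        Run-sure-wp blockBits (λ s₃ _ → Env s₃ × Block x s₃ × var s₃ 22 ≡ var s 22 × var s₃ 23 ≡ var s 23 × arr s₃ 10 ≡ arr s 10 × arr s₃ 20 ≡ arr s 20) (≤ᵇ⇒≤ _ 15 tt)
          ( a * d , cong₂ _*_ a′ e12 , fits (≤-trans (m≤m+n _ i) bit≤)
          , a * d + i , cong (a * d +_) i′ , fits bit≤
          , (λ nz → let n≢ = λ z → nz (trans na z) in
              (λ nz₂ → let d≢ = λ z → nz₂ (trans di z) in
                 env e3 e4 e10 e11 e12 e13 e14 e15 e16 e17 e18 e19 e20 e21 , blockvars y′ m′ u′ c′ (trans (inU (a * d + i)) (sym (trans (pick-suc n≢) (pick-suc d≢))))
                      v′ cc (trans (inV (a * d + i)) (sym (trans (pick-suc n≢) (pick-suc d≢)))) s′ , r22 , r23 , r10 , r20) ,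
              (λ z₂ → let d≡0 = trans (sym di) z₂ in fits z≤n , fits (≤-trans (s≤s z≤n) 2≤N) ,
                 env e3 e4 e10 e11 e12 e13 e14 e15 e16 e17 e18 e19 e20 e21 , blockvars y′ m′ u′ c′ (sym (trans (pick-suc n≢) (pick-zero d≡0))) v′ cc (sym (trans (pick-suc n≢) (pick-zero d≡0))) s′ , r22 , r23 , r10 , r20)) ,
           (λ z → let n≡0 = trans (sym na) z in fits (≤-trans (s≤s z≤n) 2≤N) , fits (≤-trans (s≤s z≤n) 2≤N) ,
              env e3 e4 e10 e11 e12 e13 e14 e15 e16 e17 e18 e19 e20 e21 , blockvars y′ m′ u′ c′ (sym (pick-zero n≡0)) v′ cc (sym (pick-zero n≡0)) s′ , r22 , r23 , r10 , r20)) }) })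
        where
        open Index x<X
        n≤N : n ≤ N
        n≤N = ≤-trans (m≤m+n n 2) n+2≤N
        u≤ : uBase + (n + k) ≤ N
        u≤ = ≤-trans (+-monoʳ-≤ uBase (+-monoʳ-≤ n (≤-trans k≤1 (s≤s z≤n)))) vBase≤N
        double : ∀ D → 2 * D + 2 * D ≡ 4 * D
        double = solve-∀
        Indices Vertices Rest : State → Set
        Indices t = var t 42 ≡ i × var t 43 ≡ q × var t 44 ≡ a × var t 45 ≡ k × var t 46 ≡ n ∸ a × var t 47 ≡ d ∸ i
        Vertices t = var t 33 ≡ 4 * D + k × var t 34 ≡ mBase + x × var t 35 ≡ uNode k a × var t 36 ≡ D * k + i ×
                     var t 38 ≡ vBase + q × var t 39 ≡ 2 * D + (D * k + i) × var t 41 ≡ sBase + x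
        Rest t = var t 24 ≡ x × Env t × (∀ j → arr t 0 j ≡ at 0 Ul j) × (∀ j → arr t 1 j ≡ at 0 Vl j) ×
                 var t 22 ≡ var s 22 × var t 23 ≡ var s 23 × arr t 10 ≡ arr s 10 × arr t 20 ≡ arr s 20

open Building

-- Correctness and running time of the building phase

module BuildTime where

  module BuildRun (B n J d l : ℕ) (Ul Vl : List ℕ) (4N<B : 4 * Layout.N n d l < B) where
    open Layout n d l
    open Bits Ul Vl
    open Build B n J d l Ul Vl using (Env; env; zero≡; one≡; n≡; J≡; d≡; D≡; n+1≡; 2D≡; 4D≡; u≡; v≡; m≡; X≡; s≡; Env-unchanged; 4D≤N; 2D≤N; X≤N; fits; setup-run; double; length-chainE; b; length-dynamicE; length-staticE; arith; static-room; Block; y-; m-; u-; c-; ub-; v-; c′-; vb-; s-; Block-unchanged; Inputs; i; q; a; k; q<; blockVars-run; module Env; module Block)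
    open Env
    open Block

    private
      N<B : N < B
      N<B = ≤-<-trans (m≤m+n N _) 4N<B

    chains-run : ∀ {x es s ω c} → x < X → Env s → Block N<B x s → Emitted es (iBase + x * (5 * suc l)) s →
      length es + 5 * (2 + l) < B →
      Run B (emitChain l 33 34 4 ⨾ emitChain l 34 35 4 ⨾ emitChain l 34 36 37 ⨾ emitChain l 38 39 40 ⨾ emitChain l 38 41 4)
        s ω (5 * (10 + 5 * l) + c) (Sure c (λ s′ _ → Env s′ × Emitted (es ++ blockE x) (iBase + suc x * (5 * suc l)) s′))
    chains-run {x} {es} {s} {ω} {c} x<X E bl M len< =
      Run-credit (≤-reflexive (arith₀ (10 + 5 * l) c))
      (Run-step {t = 10 + 5 * l} (emitChain-run l 33 34 4 es b M refl refl refl refl refl refl (y- bl) (m- bl) (one≡ E) (room₀) (base₀)) (λ {s₁} (M₁ , u₁) →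
        let bl₁ = Block-unchanged N<B {x} {s} {s₁} u₁ bl ; E₁ = Env-unchanged {s} {s₁} u₁ E in
       Run-step {t = 10 + 5 * l} (emitChain-run l 34 35 4 es₁ (b + suc l) M₁ refl refl refl refl refl refl (m- bl₁) (u- bl₁) (one≡ E₁) (room₁ (len+ es e₁) 1 (lenE e₁≤)) (base-suc)) (λ {s₂} (M₂ , u₂) →
        let bl₂ = Block-unchanged N<B {x} {s₁} {s₂} u₂ bl₁ ; E₂ = Env-unchanged {s₁} {s₂} u₂ E₁ in
       Run-step {t = 10 + 5 * l} (emitChain-run l 34 36 37 es₂ (b + 2 * suc l) (at-base (trans (cong (λ v → b + v + suc l) (sym (*-identityˡ (suc l)))) (shift 1)) M₂) refl refl refl refl refl refl (m- bl₂) (c- bl₂) (ub- bl₂) (room₁ (len+ es₁ e₂) 2 (lenE₂ e₁≤ e₂≤)) (base₁ 2 (s≤s (s≤s (s≤s z≤n))))) (λ {s₃} (M₃ , u₃) →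
        let bl₃ = Block-unchanged N<B {x} {s₂} {s₃} u₃ bl₂ ; E₃ = Env-unchanged {s₂} {s₃} u₃ E₂ in
       Run-step {t = 10 + 5 * l} (emitChain-run l 38 39 40 es₃ (b + 3 * suc l) (at-base (shift 2) M₃) refl refl refl refl refl refl (v- bl₃) (c′- bl₃) (vb- bl₃) (room₁ (len+ es₂ e₃) 3 (lenE₃ e₁≤ e₂≤ e₃≤)) (base₁ 3 (s≤s (s≤s (s≤s (s≤s z≤n)))))) (λ {s₄} (M₄ , u₄) →
        let bl₄ = Block-unchanged N<B {x} {s₃} {s₄} u₄ bl₃ ; E₄ = Env-unchanged {s₃} {s₄} u₄ E₃ in
       Run-map (λ {s₅} (le , M₅ , u₅) → le , Env-unchanged {s₄} {s₅} u₅ E₄ , subst₂ (λ es b → Emitted es b s₅) regroup next M₅)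
         (emitChain-run l 38 41 4 es₄ (b + 4 * suc l) (at-base (shift 3) M₄) refl refl refl refl refl refl (v- bl₄) (s- bl₄) (one≡ E₄) (room₁ (len+ es₃ e₄) 4 (lenE₄ e₁≤ e₂≤ e₃≤ e₄≤)) (base₁ 4 (s≤s (s≤s (s≤s (s≤s (s≤s z≤n))))))))))))
      where
      b k a i : ℕ
      b = iBase + x * (5 * suc l)
      k = x / D / suc n
      a = x / D % suc n
      i = x % D
      e₁ e₂ e₃ e₄ e₅ es₁ es₂ es₃ es₄ : RawEdges
      e₁ = chainE l (4 * D + k) (mBase + x) 1 b
      e₂ = chainE l (mBase + x) (uNode k a) 1 (b + suc l)
      e₃ = chainE l (mBase + x) (D * k + i) (uBit a i) (b + 2 * suc l)
      e₄ = chainE l (vBase + x / D) (2 * D + (D * k + i)) (vBit a i) (b + 3 * suc l)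
      e₅ = chainE l (vBase + x / D) (sBase + x) 1 (b + 4 * suc l)
      es₁ = es ++ e₁
      es₂ = es₁ ++ e₂
      es₃ = es₂ ++ e₃
      es₄ = es₃ ++ e₄
      e₁≤ : length e₁ ≤ 2 + l
      e₁≤ = length-chainE N<B (4 * D + k) (mBase + x) 1 b
      e₂≤ : length e₂ ≤ 2 + l
      e₂≤ = length-chainE N<B (mBase + x) (uNode k a) 1 (b + suc l)
      e₃≤ : length e₃ ≤ 2 + l
      e₃≤ = length-chainE N<B (mBase + x) (D * k + i) (uBit a i) (b + 2 * suc l)
      e₄≤ : length e₄ ≤ 2 + l
      e₄≤ = length-chainE N<B (vBase + x / D) (2 * D + (D * k + i)) (vBit a i) (b + 3 * suc l)
      arith₀ : ∀ t c → t + (t + (t + (t + (t + c)))) ≡ 5 * t + c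
      arith₀ = solve-∀
      len+ : ∀ (xs ys : RawEdges) → length (xs ++ ys) ≡ length xs + length ys
      len+ xs ys = length-++ xs
      lenE : length e₁ ≤ 2 + l → length es + length e₁ ≤ length es + 1 * (2 + l)
      lenE p = +-monoʳ-≤ (length es) (≤-trans p (≤-reflexive (sym (+-identityʳ (2 + l)))))
      more : ∀ {y z} j → y ≤ length es + j * (2 + l) → z ≤ 2 + l → y + z ≤ length es + suc j * (2 + l)
      more j p q = ≤-trans (+-mono-≤ p q) (≤-reflexive (arith (length es) (j * (2 + l)) (2 + l)))
        where
        arith : ∀ a b c → a + b + c ≡ a + (c + b)
        arith = solve-∀
      via : ∀ {xs y} (ys : RawEdges) → length xs ≤ y → length (xs ++ ys) ≤ y + length ys
      via {xs} ys p = ≤-trans (≤-reflexive (length-++ xs)) (+-monoˡ-≤ (length ys) p)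
      lenE₁ : length es₁ ≤ length es + 1 * (2 + l)
      lenE₁ = ≤-trans (≤-reflexive (length-++ es)) (lenE e₁≤)
      lenE₂ : length e₁ ≤ 2 + l → length e₂ ≤ 2 + l → length es₁ + length e₂ ≤ length es + 2 * (2 + l)
      lenE₂ _ q = more 1 lenE₁ q
      lenE₃ : length e₁ ≤ 2 + l → length e₂ ≤ 2 + l → length e₃ ≤ 2 + l → length es₂ + length e₃ ≤ length es + 3 * (2 + l)
      lenE₃ p q r = more 2 (≤-trans (≤-reflexive (length-++ es₁)) (lenE₂ p q)) r
      lenE₄ : length e₁ ≤ 2 + l → length e₂ ≤ 2 + l → length e₃ ≤ 2 + l → length e₄ ≤ 2 + l → length es₃ + length e₄ ≤ length es + 4 * (2 + l)
      lenE₄ p q r t = more 3 (≤-trans (≤-reflexive (length-++ es₂)) (lenE₃ p q r)) t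
      room₁ : ∀ {y z} → y ≡ z → ∀ j {_ : T (j ≤ᵇ 4)} → z ≤ length es + j * (2 + l) → y + (2 + l) < B
      room₁ refl j {j≤4} p = ≤-<-trans (≤-trans (more j p ≤-refl) (+-monoʳ-≤ (length es) (*-monoˡ-≤ (2 + l) (s≤s (≤ᵇ⇒≤ j 4 j≤4))))) len<
      base₁ : ∀ j → suc j ≤ 5 → b + j * suc l + suc l < B
      base₁ j p = ≤-<-trans (≤-trans (≤-reflexive (trans (+-assoc b _ _) (cong (b +_) (+-comm (j * suc l) (suc l)))))
         (≤-trans (+-monoʳ-≤ b (*-monoˡ-≤ (suc l) p)) (≤-trans (≤-reflexive next′) (+-monoʳ-≤ iBase (*-monoˡ-≤ (5 * suc l) x<X))))) N<B
        where
        next′ : b + 5 * suc l ≡ iBase + suc x * (5 * suc l)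
        next′ = trans (+-assoc iBase _ _) (cong (iBase +_) (+-comm (x * (5 * suc l)) (5 * suc l)))
      room₀ : length es + (2 + l) < B
      room₀ = room₁ refl 0 (m≤m+n (length es) 0)
      base₀ : b + suc l < B
      base₀ = subst (λ v → v + suc l < B) (+-identityʳ b) (base₁ 0 (s≤s z≤n))
      base-suc : b + suc l + suc l < B
      base-suc = subst (λ v → b + v + suc l < B) (*-identityˡ (suc l)) (base₁ 1 (s≤s (s≤s z≤n)))
      shift : ∀ j → b + j * suc l + suc l ≡ b + suc j * suc l
      shift j = trans (+-assoc b _ _) (cong (b +_) (+-comm (j * suc l) (suc l)))
      at-base : ∀ {es b b′ s} → b ≡ b′ → Emitted es b s → Emitted es b′ s
      at-base refl M = M
      next : b + 4 * suc l + suc l ≡ iBase + suc x * (5 * suc l)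
      next = trans (shift 4) (trans (+-assoc iBase _ _) (cong (iBase +_) (+-comm (x * (5 * suc l)) (5 * suc l))))
      regroup : es₄ ++ e₅ ≡ es ++ blockE x
      regroup = trans (++-assoc es₃ e₄ e₅) (trans (++-assoc es₂ e₃ _) (trans (++-assoc es₁ e₂ _) (++-assoc es e₁ _)))

    private
      Env-temporary : ∀ x f {_ : T ((21 <ᵇ x) ∧ (21 <ᵇ f))} v v′ {s} → Env s → Env (setVar f v (setVar x v′ s))
      Env-temporary x f {t} v v′ {s} (env e3 e4 e10 e11 e12 e13 e14 e15 e16 e17 e18 e19 e20 e21) =
        env (keep 3 e3) (keep 4 e4) (keep 10 e10) (keep 11 e11) (keep 12 e12) (keep 13 e13) (keep 14 e14) (keep 15 e15)
            (keep 16 e16) (keep 17 e17) (keep 18 e18) (keep 19 e19) (keep 20 e20) (keep 21 e21)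
        where
        bounds : (21 <ᵇ x) ≡ true × (21 <ᵇ f) ≡ true
        bounds = ∧-true (Function.Equivalence.to T-≡ t)
          where import Function
        distinct : ∀ {x y} → (21 <ᵇ x) ≡ true → T (y ≤ᵇ 21) → (x ≡ᵇ y) ≡ false
        distinct {x} {y} h t′ = ≡ᵇ-false (λ eq → <⇒≢ (≤-<-trans (≤ᵇ⇒≤ y 21 t′) (<ᵇ⇒< 21 x (subst T (sym h) tt))) (sym eq))
        keep : ∀ y {w} {t′ : T (y ≤ᵇ 21)} → var s y ≡ w → var (setVar f v (setVar x v′ s)) y ≡ w
        keep y {t′ = t′} e rewrite distinct {f} {y} (proj₂ bounds) t′ | distinct {x} {y} (proj₁ bounds) t′ = e

    blockTime : ℕ
    blockTime = 32 + 5 * (10 + 5 * l)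

    buildTime : ℕ → ℕ
    buildTime q = 28 + q * 7 + X * (3 + blockTime)

    Built : Bool → State → Set
    Built dyn s = Env s × (∀ k → arr s 10 k ≡ at 0 (map proj₁ Es) k) × (∀ k → arr s 20 k ≡ at 0 (map proj₂ Es) k) ×
                  arr s 5 0 ≡ N × arr s 15 0 ≡ length Es
      where Es = staticE (if dyn then 2 * D else 0) X

    build-run : ∀ dyn {s ω c} → var s 0 ≡ n → var s 2 ≡ J → var s 3 ≡ d → var s 60 ≡ 0 → J < B → Inputs N<B s →
      (∀ k → arr s 10 k ≡ 0) → (∀ k → arr s 20 k ≡ 0) →
      Run B (build dyn l) s ω (buildTime (if dyn then 2 * D else 0) + c) (Sure c (λ s′ _ → Built dyn s′))
    build-run dyn {s} {ω} {c} e₀ e₂ e₃ e₆₀ J<B inputs z₁₀ z₂₀ =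
      Run-credit (≤-reflexive (arith (Q * 7) (X * (3 + blockTime)) c))
      (Run-step {t = 20} first (λ {s₁} (E₁ , e22 , e23 , e49 , in₁ , M₁) →
       Run-step {t = 3 + Q * 7} (second E₁ e49 in₁ M₁) (λ {s₂} (M₂ , E₂ , in₂) →
       Run-step {t = 3 + X * (3 + blockTime)} (third M₂ E₂ in₂) (λ {s₃} (emitted src dst cnt nxt on , E₃ , in₃) →
       Run-sure-wp (store 5 3 23 ⨾ store 15 3 22) (λ s _ → Built dyn s) ≤-refl
         (env (zero≡ E₃) (one≡ E₃) (n≡ E₃) (J≡ E₃) (d≡ E₃) (D≡ E₃) (n+1≡ E₃) (2D≡ E₃) (4D≡ E₃) (u≡ E₃) (v≡ E₃) (m≡ E₃) (X≡ E₃) (s≡ E₃) , src , dst ,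
          hit (arr s₃ 5) (zero≡ E₃) nxt , hit (arr s₃ 15) (zero≡ E₃) cnt)))))
      where
      Q : ℕ
      Q = if dyn then 2 * D else 0
      Q≤ : Q ≤ 2 * D
      Q≤ = bounded dyn
        where
        bounded : ∀ dyn → (if dyn then 2 * D else 0) ≤ 2 * D
        bounded true  = ≤-refl
        bounded false = z≤n
      arith : ∀ q x c → 20 + (3 + q + (3 + x + (2 + c))) ≡ 28 + q + x + c
      arith = solve-∀
      hit : ∀ f {i v w} → i ≡ 0 → v ≡ w → (f [ i ↦ v ]) 0 ≡ w
      hit f refl refl = refl
      first : Run B (setup₁ ⨾ setup₂ ⨾ setup₃ ⨾ setup₄ ⨾ setup₅ dyn) s ω (20 + (3 + Q * 7 + (3 + X * (3 + blockTime) + (2 + c))))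
        (Sure (3 + Q * 7 + (3 + X * (3 + blockTime) + (2 + c))) (λ s′ _ → Env s′ × var s′ 22 ≡ 0 × var s′ 23 ≡ iBase × var s′ 49 ≡ Q × Inputs N<B s′ × Emitted [] iBase s′))
      first = Run-frame (setup-run N<B dyn e₀ e₂ e₃ e₆₀ J<B) (λ {s′} _ ka (le , E , e22 , e23 , e49) → le , E , e22 , e23 , e49 ,
        ((λ k → trans (cong (λ f → f k) (ka 0 refl)) (proj₁ inputs k)) , (λ k → trans (cong (λ f → f k) (ka 1 refl)) (proj₂ inputs k))) ,
        emitted (λ k → trans (cong (λ f → f k) (ka 10 refl)) (z₁₀ k)) (λ k → trans (cong (λ f → f k) (ka 20 refl)) (z₂₀ k)) e22 e23 (one≡ E))
      second : ∀ {s₁ ω₁ c} → Env s₁ → var s₁ 49 ≡ Q → Inputs N<B s₁ → Emitted [] iBase s₁ →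
        Run B (for 50 49 51 (op 52 add 15 50 ⨾ emit 50 52)) s₁ ω₁ (3 + Q * 7 + c) (Sure c (λ s′ _ → Emitted (staticE Q 0) iBase s′ × Env s′ × Inputs N<B s′))
      second {s₁} {ω₁} {c} E₁ e49 in₁ M₁ = Run-for 50 49 51 (op 52 add 15 50 ⨾ emit 50 52) {Q} {4} I
        (≤-<-trans (≤-trans Q≤ (2D≤N N<B)) N<B) refl refl refl refl refl refl refl refl
        (λ v v′ (le , emitted a b c d e , E , i) → le , emitted a b c d e , Env-temporary 50 51 v v′ E , i) body e49 (one≡ E₁) (≤-refl , M₁ , E₁ , in₁)
        where
        I : ℕ → Assertion
        I q s ω c′ = c ≤ c′ × Emitted (dynamicE q) iBase s × Env s × Inputs N<B s
        body : ∀ q {s ω c′} → q < Q → var s 50 ≡ q → var s 49 ≡ Q → var s 4 ≡ 1 → I q s ω c′ → Run B (op 52 add 15 50 ⨾ emit 50 52) s ω (4 + c′) (I (suc q))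
        body q {s} {ω} {c′} q< x≡ _ _ (le , emitted a b cc d e , E@(env e3 e4 e10 e11 e12 e13 e14 e15 e16 e17 e18 e19 e20 e21) , i) = Run-step {t = 1}
          (Run-sure-wp (op 52 add 15 50) (λ s′ _ → Emitted (dynamicE q) iBase s′ × Env s′ × Inputs N<B s′ × var s′ 50 ≡ q × var s′ 52 ≡ 2 * D + q) ≤-refl
            ( 2 * D + q , cong₂ _+_ (2D≡ E) x≡ , fits N<B (≤-trans (+-monoʳ-≤ (2 * D) (≤-trans (<⇒≤ q<) Q≤)) (≤-trans (≤-reflexive (double D)) (4D≤N N<B)))
            , emitted a b cc d e , env e3 e4 e10 e11 e12 e13 e14 e15 e16 e17 e18 e19 e20 e21 , i , x≡ , refl))
          (λ {s₁} (M , E₁ , i₁ , x≡₁ , y≡₁) → Run-frame (emit-run 50 52 (dynamicE q) iBase M (≤-<-trans (≤-trans (≤-reflexive (trans (+-comm _ 1) (cong suc (length-dynamicE N<B q)))) (≤-trans q< (≤-trans Q≤ (2D≤N N<B)))) N<B))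
            (λ {s₂} kv ka (le₂ , M₂ , u₂) → ≤-trans le le₂ ,
              subst (λ e → Emitted (dynamicE q ∷ʳ e) iBase s₂) (cong₂ _,_ x≡₁ y≡₁) M₂ , Env-unchanged (λ x e _ _ → u₂ x e) E₁ ,
              ((λ k → trans (cong (λ f → f k) (ka 0 refl)) (proj₁ i₁ k)) , (λ k → trans (cong (λ f → f k) (ka 1 refl)) (proj₂ i₁ k)))))
          where
          double : ∀ D → 2 * D + 2 * D ≡ 4 * D
          double = solve-∀
      third : ∀ {s₁ ω₁ c} → Emitted (staticE Q 0) iBase s₁ → Env s₁ → Inputs N<B s₁ →
        Run B (for 24 20 25 (blockBody l)) s₁ ω₁ (3 + X * (3 + blockTime) + c) (Sure c (λ s′ _ → Emitted (staticE Q X) N s′ × Env s′ × Inputs N<B s′))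
      third {s₁} {ω₁} {c} M₁ E₁ in₁ = Run-for 24 20 25 (blockBody l) {X} {blockTime} I
        (≤-<-trans (X≤N N<B) N<B) refl refl refl refl refl (keep 24 refl refl refl refl) (keep 20 refl refl refl refl) (keep 4 refl refl refl refl)
        (λ v v′ (le , emitted a b c d e , E , i) → le , emitted a b c d e , Env-temporary 24 25 v v′ E , i) body (X≡ E₁) (one≡ E₁)
        (≤-refl , subst (λ b → Emitted (dynamicE Q) b s₁) (sym (+-identityʳ iBase)) M₁ , E₁ , in₁)
        where
        I : ℕ → Assertion
        I x s ω c′ = c ≤ c′ × Emitted (staticE Q x) (iBase + x * (5 * suc l)) s × Env s × Inputs N<B s
        keep : ∀ x → (22 ≡ᵇ x) ≡ false → (23 ≡ᵇ x) ≡ false → (32 ≡ᵇ x) ≡ false →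
               keepsVar x (blockIndices ⨾ blockVertices ⨾ blockBits) ≡ true → keepsVar x (blockBody l) ≡ true
        keep x e₁ e₂ e₃ e with a₁ , a₂ ← ∧-true {keepsVar x blockIndices} e with a₃ , a₄ ← ∧-true {keepsVar x blockVertices} a₂ =
          ∧-intro a₁ (∧-intro a₃ (∧-intro a₄ chains))
          where
          chains : keepsVar x (emitChain l 33 34 4 ⨾ emitChain l 34 35 4 ⨾ emitChain l 34 36 37 ⨾ emitChain l 38 39 40 ⨾ emitChain l 38 41 4) ≡ true
          chains rewrite e₁ | e₂ | emitPath-keepsVar l x e₁ e₂ e₃ = refl
        body : ∀ x {s ω c′} → x < X → var s 24 ≡ x → var s 20 ≡ X → var s 4 ≡ 1 → I x s ω c′ → Run B (blockBody l) s ω (blockTime + c′) (I (suc x))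
        body x {s} {ω} {c′} x< x≡ _ _ (le , M , E , i) = Run-frame {Q = Sure c′ (λ s′ _ → Env s′ × Emitted (staticE Q (suc x)) (iBase + suc x * (5 * suc l)) s′)}
          (assoc₃ (Run-credit (≤-reflexive (sym (+-assoc 32 (5 * (10 + 5 * l)) c′))) (Run-step {t = 32} (blockVars-run N<B x< E i x≡)
            (λ {s₁} (E₁ , bl , e22 , e23 , e10 , e20) → chains-run x< E₁ bl
              (emitted (λ k → trans (cong (λ f → f k) e10) (Emitted.sources M k)) (λ k → trans (cong (λ f → f k) e20) (Emitted.targets M k)) (trans e22 (Emitted.count M)) (trans e23 (Emitted.next M)) (one≡ E₁))
              (≤-<-trans room (≤-<-trans (*-monoˡ-≤ N {3} {4} (n≤1+n 3)) 4N<B))))))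
          (λ {s₁} kv ka (le₁ , E₁ , M₁) → ≤-trans le le₁ , M₁ , E₁ ,
            ((λ k → trans (cong (λ f → f k) (ka 0 (blockBody-keepsArr l 0 refl refl))) (proj₁ i k)) , (λ k → trans (cong (λ f → f k) (ka 1 (blockBody-keepsArr l 1 refl refl))) (proj₂ i k))))
          where
          -- `blockBody` nests to the right, whereas `blockVars-run` treats its first three pieces
          -- as one program; regrouping leaves the time as it is.
          assoc₃ : ∀ {p q r t s ω c Q} → Run B ((p ⨾ q ⨾ r) ⨾ t) s ω c Q → Run B (p ⨾ q ⨾ r ⨾ t) s ω c Q
          assoc₃ (run {τ = τ} c′ (seq {τ′ = τt} (seq {τ = τp} dp (seq {τ = τq} {τ′ = τr} dq dr)) dt) le q) =
            run c′ (seq dp (seq dq (seq dr dt))) (≤-trans (≤-reflexive (cong (_+ c′) (arith₄ τp τq τr τt))) le) q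
            where
            arith₄ : ∀ a b c d → a + (b + (c + d)) ≡ a + (b + c) + d
            arith₄ = solve-∀
          room : length (staticE Q x) + 5 * (2 + l) ≤ 3 * N
          room = ≤-trans (+-monoˡ-≤ _ (length-staticE N<B Q x)) (≤-trans (≤-reflexive (arith₅ Q (x * (5 * (2 + l))) (5 * (2 + l)))) (static-room N<B {Q} {suc x} Q≤ x<))
            where
            arith₅ : ∀ a b c → a + b + c ≡ a + (c + b)
            arith₅ = solve-∀

open BuildTime

-- One stage for each vector of W

module StageRuns where

  open DynamicProg

  data Variant : Set where
    fully incr decr : Variant

  rollsBack decremental? undoes : Variant → Bool
  rollsBack fully = false
  rollsBack _     = true
  decremental? decr = true
  decremental? _    = false
  undoes fully = true
  undoes _     = false

  -- In the decremental setting all edges C - C′ are present at first, and it is the coordinates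
  -- outside w whose edges have to go.
  trigger : Bool → ℕ → ℕ
  trigger decrementing w = if decrementing then 1 ∸ w else w

  opProg : DynamicProg → Bool → Prog
  opProg A deleting = if deleting then onDelete A else onInsert A

  mkOp : ∀ {N} → Bool → Edge N → Op N
  mkOp deleting e = if deleting then delete e else insert e

  invert : Bool → Prog
  invert decrementing = if decrementing then op 70 sub 4 70 else skip

  -- `z` is variable 3 or 13, which hold 0 and `D`; this selects the copy. The endpoints go to the
  -- simulated variables 0 and 1, as `pass` prescribes.
  act : DynamicProg → Bool → ℕ → Prog
  act A deleting z =
    op 0 add 67 z ⨾ put shadow (cellVar 0) 3 0 ⨾
    (op 0 add 67 z ⨾ op 0 add 0 15) ⨾ put shadow (cellVar 1) 3 0 ⨾
    compile shadow (opProg A deleting)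

  wBitCode : Bool → Prog
  wBitCode decrementing =
    (op 69 sub 12 67 ⨾ cond 69 (op 70 mul 65 12 ⨾ op 70 add 70 67 ⨾ load 70 2 70) (const 70 1)) ⨾ invert decrementing

  opBody : DynamicProg → (decrementing deleting : Bool) → Prog
  opBody A decrementing deleting = wBitCode decrementing ⨾ cond 70 (act A deleting 3 ⨾ act A deleting 13) skip

  opLoop : DynamicProg → (decrementing deleting : Bool) → Prog
  opLoop A decrementing deleting = for 67 13 68 (opBody A decrementing deleting)

  -- Truncated subtraction leaves a nonzero value exactly if the answer is below the threshold,
  -- which is a vote for a suitable u.
  vote : ℕ → Prog
  vote threshold = (const 1 threshold ⨾ op 0 sub 1 0) ⨾ cond 0 (load 1 3 65 ⨾ op 1 add 1 4 ⨾ store 3 65 1) skip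

  -- A tick of the stage clock forgets all shadow writes. The coin index returns as well, to its
  -- value after preprocessing, so each stage is run as if it were the first one and on the same
  -- coins.
  restart : Prog
  restart = op 5 add 5 4 ⨾ op 8 add 64 3

  stageCode : DynamicProg → Variant → ℕ → Prog
  stageCode A v threshold =
    (if rollsBack v then restart else skip) ⨾
    opLoop A (decremental? v) (decremental? v) ⨾
    compile shadow (onQuery A) ⨾ read 0 (cellVar 0) 3 ⨾ vote threshold ⨾
    (if undoes v then opLoop A (decremental? v) true else skip)

  opLoop-keepsVar : ∀ A b c x → Outside x → (67 ≡ᵇ x) ≡ false → (68 ≡ᵇ x) ≡ false → (69 ≡ᵇ x) ≡ false → (70 ≡ᵇ x) ≡ false →
                    keepsVar x (opLoop A b c) ≡ true
  opLoop-keepsVar A b c x o@(e₀ , _) e₆₇ e₆₈ e₆₉ e₇₀ rewrite e₀ | e₆₇ | e₆₈ | e₆₉ | e₇₀ | compile-keepsVar shadow (opProg A c) x o with b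
  ... | true  rewrite e₇₀ = refl
  ... | false = refl

  opLoop-keepsArr : ∀ A b c a → (4 ≡ᵇ a) ≡ false → (∀ i → (5 + i ≡ᵇ a) ≡ false) → keepsArr a (opLoop A b c) ≡ true
  opLoop-keepsArr A b c a e₄ e rewrite e (slot 3 (cellVar 0)) | e (slot 4 (cellVar 0)) | e (slot 3 (cellVar 1)) | e (slot 4 (cellVar 1)) | compile-keepsArr shadow (opProg A c) a e₄ e with b
  ... | true  = refl
  ... | false = refl

  stageCode-keepsVar : ∀ A v threshold x → Outside x → (5 ≡ᵇ x) ≡ false → (67 ≡ᵇ x) ≡ false → (68 ≡ᵇ x) ≡ false →
                       (69 ≡ᵇ x) ≡ false → (70 ≡ᵇ x) ≡ false → keepsVar x (stageCode A v threshold) ≡ true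
  stageCode-keepsVar A v threshold x o@(e₀ , e₁ , e₂ , e₈ , e₉) e₅ e₆₇ e₆₈ e₆₉ e₇₀ =
    ∧-intro (begins (rollsBack v)) (∧-intro (opLoop-keepsVar A (decremental? v) (decremental? v) x o e₆₇ e₆₈ e₆₉ e₇₀) (∧-intro (compile-keepsVar shadow (onQuery A) x o)
      (∧-intro reads (∧-intro votes (undo (undoes v))))))
    where
    begins : ∀ b → keepsVar x (if b then restart else skip) ≡ true
    begins true rewrite e₅ | e₈ = refl
    begins false = refl
    reads : keepsVar x (read 0 (cellVar 0) 3) ≡ true
    reads rewrite e₀ | e₂ = refl
    votes : keepsVar x (vote threshold) ≡ true
    votes rewrite e₀ | e₁ = refl
    undo : ∀ b → keepsVar x (if b then opLoop A (decremental? v) true else skip) ≡ true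
    undo true  = opLoop-keepsVar A (decremental? v) true x o e₆₇ e₆₈ e₆₉ e₇₀
    undo false = refl

  stageCode-keepsW : ∀ A v threshold → keepsArr 2 (stageCode A v threshold) ≡ true
  stageCode-keepsW A v threshold = ∧-intro (begins (rollsBack v)) (∧-intro (opLoop-keepsArr A (decremental? v) (decremental? v) 2 refl (λ _ → refl))
    (∧-intro (compile-keepsArr shadow (onQuery A) 2 refl (λ _ → refl)) (undo (undoes v))))
    where
    begins : ∀ b → keepsArr 2 (if b then restart else skip) ≡ true
    begins true  = refl
    begins false = refl
    undo : ∀ b → keepsArr 2 (if b then opLoop A (decremental? v) true else skip) ≡ true
    undo true  = opLoop-keepsArr A (decremental? v) true 2 refl (λ _ → refl)
    undo false = refl

  module Stages (B : ℕ) (A : DynamicProg) (v : Variant) (d : ℕ) (Wl : List ℕ) {N : ℕ} (fin : ℕ → Fin N)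
                (toℕ-fin : ∀ x → x < 4 * suc d → toℕ (fin x) ≡ x) where

    D : ℕ
    D = suc d

    wBit : (j i : ℕ) → ℕ
    wBit j i = pick (d ∸ i) 1 (at 0 Wl (j * d + i))

    dynamicEdge : (z i : ℕ) → Edge N
    dynamicEdge z i = fin (i + z) , fin (i + z + 2 * D)

    triggered : (j i : ℕ) → ℕ
    triggered j i = trigger (decremental? v) (wBit j i)

    opsAt : Bool → (j i : ℕ) → List (Op N)
    opsAt deleting j i = pick (triggered j i) [] (mkOp deleting (dynamicEdge 0 i) ∷ mkOp deleting (dynamicEdge D i) ∷ [])

    opsFrom : Bool → (j i c : ℕ) → List (Op N)
    opsFrom deleting j i zero    = []
    opsFrom deleting j i (suc c) = opsAt deleting j i ++ opsFrom deleting j (suc i) c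

    pre post : ℕ → List (Op N)
    pre j  = opsFrom (decremental? v) j 0 D
    post j = if undoes v then opsFrom true j 0 D else []

    -- The stages j, …, j + c − 1 after preprocessing has led to σ₀ and ω₀,
    -- with the answers to their queries and the total time.
    data Session (σ₀ : State) (ω₀ : Tape) : (j c : ℕ) → State → Tape → List ℕ → ℕ → Set where
      []    : ∀ {j σ ω} → Session σ₀ ω₀ j 0 σ ω [] 0
      stage : ∀ {j c σ ω σ₁ ω₁ τs σ₂ ω₂ τ σ₃ ω₃ τs′ outs t} →
              ExecOps B A (pre j) (if rollsBack v then σ₀ else σ) (if rollsBack v then ω₀ else ω) σ₁ ω₁ τs →
              Exec B (onQuery A) σ₁ ω₁ σ₂ ω₂ τ →
              ExecOps B A (post j) σ₂ ω₂ σ₃ ω₃ τs′ →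
              Session σ₀ ω₀ (suc j) c σ₃ ω₃ outs t →
              Session σ₀ ω₀ j (suc c) σ ω (var σ₂ 0 ∷ outs) (sum τs + (τ + (sum τs′ + t)))

    ExecOps-++ : ∀ xs {ys : List (Op N)} {σ ω σ′ ω′ τs} → ExecOps B A (xs ++ ys) σ ω σ′ ω′ τs →
      ∃ λ σ₁ → ∃ λ ω₁ → ∃ λ τs₁ → ∃ λ τs₂ → ExecOps B A xs σ ω σ₁ ω₁ τs₁ × ExecOps B A ys σ₁ ω₁ σ′ ω′ τs₂ × τs ≡ τs₁ ++ τs₂
    ExecOps-++ []       e       = _ , _ , _ , _ , [] , e , refl
    ExecOps-++ (x ∷ xs) (d ∷ e) with _ , _ , _ , _ , e₁ , e₂ , refl ← ExecOps-++ xs e = _ , _ , _ , _ , d ∷ e₁ , e₂ , refl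

    module Run-stages (R r : ℕ) (Ω : Tape) (lo : ℕ) (r<R : r < R) (σᵢ : State) (4D<B : 4 * D < B) where
      open Simulation B R r Ω lo r<R σᵢ using (coins; i; n; index; tape; total; unread; drawn≤; buffered; close; enough; fuelled; Simulates; unfuel; refuel; v₁; v₃; v₄; F; small; κ; s₁; finish; f; g; arith; after; read-var; put-var-run; simulate; arith₂; time)

      record StageEnv (J j : ℕ) (s : State) : Set where
        constructor stageEnv
        field
          J≡  : var s 11 ≡ J
          d≡  : var s 12 ≡ d
          D≡  : var s 13 ≡ D
          2D≡ : var s 15 ≡ 2 * D
          j≡  : var s 65 ≡ j
          W≡  : ∀ k → arr s 2 k ≡ at 0 Wl k

      open StageEnv

      StageEnv-frame : ∀ {J j s s′} → (∀ x → x ≡ 11 ⊎ x ≡ 12 ⊎ x ≡ 13 ⊎ x ≡ 15 ⊎ x ≡ 65 → var s′ x ≡ var s x) →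
                       arr s′ 2 ≡ arr s 2 → StageEnv J j s → StageEnv J j s′
      StageEnv-frame f g (stageEnv a b c e h w) = stageEnv
        (trans (f 11 (inj₁ refl)) a) (trans (f 12 (inj₂ (inj₁ refl))) b) (trans (f 13 (inj₂ (inj₂ (inj₁ refl)))) c)
        (trans (f 15 (inj₂ (inj₂ (inj₂ (inj₁ refl))))) e) (trans (f 65 (inj₂ (inj₂ (inj₂ (inj₂ refl))))) h)
        (λ k → trans (cong (λ t → t k) g) (w k))

      compile-frame : ∀ p {J j s s′} → (∀ x → keepsVar x (compile shadow p) ≡ true → var s′ x ≡ var s x) →
                      (∀ a → keepsArr a (compile shadow p) ≡ true → arr s′ a ≡ arr s a) → StageEnv J j s → StageEnv J j s′
      compile-frame p kv ka = StageEnv-frame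
        (λ { x (inj₁ refl) → kv 11 (compile-keepsVar shadow p 11 (refl , refl , refl , refl , refl))
           ; x (inj₂ (inj₁ refl)) → kv 12 (compile-keepsVar shadow p 12 (refl , refl , refl , refl , refl))
           ; x (inj₂ (inj₂ (inj₁ refl))) → kv 13 (compile-keepsVar shadow p 13 (refl , refl , refl , refl , refl))
           ; x (inj₂ (inj₂ (inj₂ (inj₁ refl)))) → kv 15 (compile-keepsVar shadow p 15 (refl , refl , refl , refl , refl))
           ; x (inj₂ (inj₂ (inj₂ (inj₂ refl)))) → kv 65 (compile-keepsVar shadow p 65 (refl , refl , refl , refl , refl)) })
        (ka 2 (compile-keepsArr shadow p 2 refl (λ _ → refl)))

      private
        pass-mkOp : ∀ b (e : Edge N) σ → pass (mkOp b e) σ ≡ setVar 1 (toℕ (proj₂ e)) (setVar 0 (toℕ (proj₁ e)) σ)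
        pass-mkOp true  e σ = refl
        pass-mkOp false e σ = refl
        code-mkOp : ∀ b (e : Edge N) → code A (mkOp b e) ≡ opProg A b
        code-mkOp true  e = refl
        code-mkOp false e = refl
        small : ∀ {x} → x ≤ 4 * D → x < B
        small le = ≤-<-trans le 4D<B

      Sim : State → State → Tape → ℕ → State → Tape → Set
      Sim σ₀ = Simulates (shadow σ₀)

      act-run : ∀ {σ₀ σ ω σ′ ω′ τ k J j s ωc c i} b z w → var s z ≡ w → i ≤ d → w ≤ D → (0 ≡ᵇ z) ≡ false →
        Exec B (code A (mkOp b (dynamicEdge w i))) (pass (mkOp b (dynamicEdge w i)) σ) ω σ′ ω′ τ →
        Sim σ₀ σ ω (τ + k) s ωc → StageEnv J j s → var s 67 ≡ i →
        Run B (act A b z) s ωc (7 + (κ * τ + c)) (Sure c (λ s′ ω′c → Sim σ₀ σ′ ω′ k s′ ω′c × StageEnv J j s′))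
      act-run {σ₀} {σ} {ω} {σ′} {ω′} {τ} {k} {J} {j} {s} {ωc} {c} {i} b z w z≡ i≤d w≤D e₀ ex S en i≡ =
        Run-step {t = 1} (Run-sure-wp (op 0 add 67 z) (λ s′ ω′ → Sim σ₀ σ ω (τ + k) s′ ω′ × StageEnv J j s′ × var s′ 0 ≡ i + w × var s′ z ≡ w × var s′ 67 ≡ i) ≤-refl
          (i + w , cong₂ _+_ i≡ z≡ , small i+w≤′ , S , env′ en , refl , keep₀ s z≡ , i≡)) (λ {s₁} (S₁ , en₁ , v₁ , z₁ , i₁) →
        Run-step {t = 2} (Run-frame {Q′ = Sure _ (λ s′ ω′ → Sim σ₀ (setVar 0 (i + w) σ) ω (τ + k) s′ ω′ × StageEnv J j s′ × var s′ z ≡ w × var s′ 67 ≡ i)}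
            (put-var-run (shadow σ₀) 0 S₁ v₁) (λ {s₂} kv ka (le , S₂) → le , S₂ ,
              StageEnv-frame (λ x _ → kv x refl) (ka 2 refl) en₁ , trans (kv z refl) z₁ , trans (kv 67 refl) i₁)) (λ {s₂} (S₂ , en₂ , z₂ , i₂) →
        Run-step {t = 2} (Run-sure-wp (op 0 add 67 z ⨾ op 0 add 0 15) (λ s′ ω′ → Sim σ₀ (setVar 0 (i + w) σ) ω (τ + k) s′ ω′ × StageEnv J j s′ × var s′ 0 ≡ i + w + 2 * D) ≤-refl
          (i + w , cong₂ _+_ i₂ z₂ , small i+w≤′ , i + w + 2 * D , cong (i + w +_) (2D≡ en₂) , small i+w+2D≤ , S₂ , env′ (env′ en₂) , refl)) (λ {s₃} (S₃ , en₃ , v₃) →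
        Run-step {t = 2} (Run-frame {Q′ = Sure _ (λ s′ ω′ → Sim σ₀ (setVar 1 (i + w + 2 * D) (setVar 0 (i + w) σ)) ω (τ + k) s′ ω′ × StageEnv J j s′)}
            (put-var-run (shadow σ₀) 1 S₃ v₃) (λ {s₄} kv ka (le , S₄) → le , S₄ , StageEnv-frame (λ x _ → kv x refl) (ka 2 refl) en₃)) (λ {s₄} (S₄ , en₄) →
        Run-frame (simulate (shadow σ₀) (opProg A b) ex′ S₄) (λ kv ka (le , S₅) → le , S₅ , compile-frame (opProg A b) kv ka en₄)))))
        where
        env′ : ∀ {s v} → StageEnv J j s → StageEnv J j (setVar 0 v s)
        env′ (stageEnv a b c e h w) = stageEnv a b c e h w
        keep₀ : ∀ s {v} → var s z ≡ w → (if 0 ≡ᵇ z then v else var s z) ≡ w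
        keep₀ s h rewrite e₀ = h
        i+w≤ : i + w ≤ 2 * D
        i+w≤ = ≤-trans (+-mono-≤ (≤-trans i≤d (n≤1+n d)) w≤D) (≤-reflexive (cong (D +_) (sym (+-identityʳ D))))
        i+w≤′ : i + w ≤ 4 * D
        i+w≤′ = ≤-trans i+w≤ (*-monoˡ-≤ D {2} {4} (s≤s (s≤s z≤n)))
        i+w+2D≤ : i + w + 2 * D ≤ 4 * D
        i+w+2D≤ = ≤-trans (+-monoˡ-≤ (2 * D) i+w≤) (≤-reflexive (double D))
          where
          double : ∀ D → 2 * D + 2 * D ≡ 4 * D
          double = solve-∀
        i+w+2D< : i + w + 2 * D < 4 * D
        i+w+2D< = ≤-trans (+-monoˡ-≤ (2 * D) (≤-trans (+-mono-≤ (s≤s i≤d) w≤D) (≤-reflexive (cong (D +_) (sym (+-identityʳ D)))))) (≤-reflexive (double D))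
          where
          double : ∀ D → 2 * D + 2 * D ≡ 4 * D
          double = solve-∀
        ex′ : Exec B (opProg A b) (setVar 1 (i + w + 2 * D) (setVar 0 (i + w) σ)) ω σ′ ω′ τ
        ex′ = subst₂ (λ p σ → Exec B p σ ω σ′ ω′ τ) (code-mkOp b (dynamicEdge w i))
          (trans (pass-mkOp b (dynamicEdge w i) σ) (cong₂ (λ x y → setVar 1 y (setVar 0 x σ)) (toℕ-fin (i + w) (≤-<-trans (m≤m+n _ _) i+w+2D<)) (toℕ-fin (i + w + 2 * D) i+w+2D<))) ex

      wBitCode-run : ∀ {σ₀ σ ω k J j s ωc c i} → j * d + d < B → i ≤ d → Sim σ₀ σ ω k s ωc → StageEnv J j s → var s 67 ≡ i →
        Run B (wBitCode (decremental? v)) s ωc (8 + c)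
          (Sure c (λ s′ ω′c → Sim σ₀ σ ω k s′ ω′c × StageEnv J j s′ × var s′ 67 ≡ i × var s′ 70 ≡ triggered j i))
      wBitCode-run {σ₀} {σ} {ω} {k} {J} {j} {s} {ωc} {c} {i} jd< i≤d S en@(stageEnv a b e f h W) i≡ =
        Run-step {t = 7} (Run-sure-wp (op 69 sub 12 67 ⨾ cond 69 (op 70 mul 65 12 ⨾ op 70 add 70 67 ⨾ load 70 2 70) (const 70 1))
          (λ s′ ω′ → Sim σ₀ σ ω k s′ ω′ × StageEnv J j s′ × var s′ 67 ≡ i × var s′ 70 ≡ wBit j i) (n≤1+n 6)
          ( d ∸ i , cong₂ _∸_ b i≡ , small (≤-trans (m∸n≤m d i) (≤-trans (n≤1+n d) (m≤m+n D _)))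
          , (λ nz → j * d , cong₂ _*_ h b , ≤-<-trans (m≤m+n _ d) jd< , j * d + i , cong (j * d +_) i≡ , ≤-<-trans (+-monoʳ-≤ (j * d) i≤d) jd< ,
               S , stageEnv a b e f h W , i≡ , trans (W (j * d + i)) (sym (pick-suc nz)))
          , (λ z → small (s≤s z≤n) , S , stageEnv a b e f h W , i≡ , sym (pick-zero z))))
        (λ (S′ , en′ , i≡′ , w≡) → inverted v S′ en′ i≡′ w≡)
        where
        inverted : ∀ v {s′ ω′ w} → Sim σ₀ σ ω k s′ ω′ → StageEnv J j s′ → var s′ 67 ≡ i → var s′ 70 ≡ w →
          Run B (invert (decremental? v)) s′ ω′ (1 + c) (Sure c (λ s′ ω′c → Sim σ₀ σ ω k s′ ω′c × StageEnv J j s′ × var s′ 67 ≡ i × var s′ 70 ≡ trigger (decremental? v) w))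
        inverted fully {w = w} S en i≡ w≡ = Run-sure-wp skip (λ s′ ω′c → Sim σ₀ σ ω k s′ ω′c × StageEnv J j s′ × var s′ 67 ≡ i × var s′ 70 ≡ w) ≤-refl (S , en , i≡ , w≡)
        inverted incr {w = w} S en i≡ w≡ = Run-sure-wp skip (λ s′ ω′c → Sim σ₀ σ ω k s′ ω′c × StageEnv J j s′ × var s′ 67 ≡ i × var s′ 70 ≡ w) ≤-refl (S , en , i≡ , w≡)
        inverted decr {w = w} S@(_ , _ , _ , one , _) (stageEnv a b e f h W) i≡ w≡ =
          Run-sure-wp (op 70 sub 4 70) (λ s′ ω′c → Sim σ₀ σ ω k s′ ω′c × StageEnv J j s′ × var s′ 67 ≡ i × var s′ 70 ≡ 1 ∸ w) ≤-refl
            (1 ∸ w , cong₂ _∸_ one w≡ , small (≤-trans (m∸n≤m 1 w) (s≤s z≤n)) , S , stageEnv a b e f h W , i≡ , refl)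

      opLoop-run : ∀ b {σ₀ σ ω σ′ ω′ τs k J j s ωc c} → j * d + d < B →
        ExecOps B A (opsFrom b j 0 D) σ ω σ′ ω′ τs → Sim σ₀ σ ω (sum τs + k) s ωc → StageEnv J j s →
        Run B (opLoop A (decremental? v) b) s ωc (3 + D * 27 + (κ * sum τs + c)) (Sure c (λ s′ ω′c → Sim σ₀ σ′ ω′ k s′ ω′c × StageEnv J j s′))
      opLoop-run b {σ₀} {σ} {ω} {σ′} {ω′} {τs} {k} {J} {j} {s} {ωc} {c} jd< ex S en =
        Run-map finish (Run-for 67 13 68 (opBody A (decremental? v) b) {D} {24} I (small (m≤m+n D _)) refl refl refl refl refl
          (keep 67 (refl , refl , refl , refl , refl) refl refl) (keep 13 (refl , refl , refl , refl , refl) refl refl) (keep 4 (refl , refl , refl , refl , refl) refl refl)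
          (λ { v v′ (σ₁ , ω₁ , τs₁ , S₁ , ex₁ , stageEnv a b e f h W , le) → σ₁ , ω₁ , τs₁ , S₁ , ex₁ , stageEnv a b e f h W , le })
          (λ i i< i≡ _ _ → body i i< i≡) (D≡ en) (proj₁ (proj₂ (proj₂ (proj₂ S)))) (σ , ω , τs , S , ex , en , ≤-refl))
        where
        I : ℕ → Assertion
        I i s ωc c′ = ∃ λ σ₁ → ∃ λ ω₁ → ∃ λ τs₁ → Sim σ₀ σ₁ ω₁ (sum τs₁ + k) s ωc ×
          ExecOps B A (opsFrom b j i (D ∸ i)) σ₁ ω₁ σ′ ω′ τs₁ × StageEnv J j s × κ * sum τs₁ + c ≤ c′
        finish : ∀ {s ωc c′} → I D s ωc c′ → Sure c (λ s′ ω′c → Sim σ₀ σ′ ω′ k s′ ω′c × StageEnv J j s′) s ωc c′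
        finish {s} {ωc} (σ₁ , ω₁ , τs₁ , S₁ , ex₁ , en₁ , le) with ex₂ ← subst (λ m → ExecOps B A (opsFrom b j D m) σ₁ ω₁ σ′ ω′ τs₁) (n∸n≡0 D) ex₁
          with [] ← ex₂ = ≤-trans (≤-reflexive (cong (_+ c) (sym (*-zeroʳ κ)))) le , S₁ , en₁
        keep : ∀ x → Outside x → (69 ≡ᵇ x) ≡ false → (70 ≡ᵇ x) ≡ false → keepsVar x (opBody A (decremental? v) b) ≡ true
        keep x o@(e₀ , _) e₆₉ e₇₀ with decremental? v
        ... | true  rewrite e₀ | e₆₉ | e₇₀ | compile-keepsVar shadow (opProg A b) x o = refl
        ... | false rewrite e₀ | e₆₉ | e₇₀ | compile-keepsVar shadow (opProg A b) x o = refl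
        act-67 : ∀ z → keepsVar 67 (act A b z) ≡ true
        act-67 z rewrite compile-keepsVar shadow (opProg A b) 67 (refl , refl , refl , refl , refl) = refl
        body : ∀ i {s ωc c′} → i < D → var s 67 ≡ i → I i s ωc c′ → Run B (opBody A (decremental? v) b) s ωc (24 + c′) (I (suc i))
        body i {s} {ωc} {c′} i< i≡ (σ₁ , ω₁ , τs₁ , S₁ , ex₁ , en₁ , le) = Run-step {t = 8} (wBitCode-run jd< (s≤s⁻¹ i<) S₁ en₁ i≡)
          (λ (S₂ , en₂ , i≡₂ , t≡) → branch (triggered j i) t≡ (subst (λ m → ExecOps B A (opsFrom b j i m) σ₁ ω₁ σ′ ω′ τs₁) (+-∸-assoc 1 (s≤s⁻¹ i<)) ex₁) refl S₂ en₂ i≡₂)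
          where
          branch : ∀ w {s₂ ω₂} → var s₂ 70 ≡ w → ExecOps B A (opsAt b j i ++ opsFrom b j (suc i) (d ∸ i)) σ₁ ω₁ σ′ ω′ τs₁ → w ≡ triggered j i →
            Sim σ₀ σ₁ ω₁ (sum τs₁ + k) s₂ ω₂ → StageEnv J j s₂ → var s₂ 67 ≡ i →
            Run B (cond 70 (act A b 3 ⨾ act A b 13) skip) s₂ ω₂ (16 + c′) (I (suc i))
          branch zero {s₂} {ω₂} t≡ ex₂ w≡ S₂ en₂ i≡₂ = Run-credit (m≤n+m (2 + c′) 14) (Run-else t≡ (Run-map (λ {s′} {ω″} {c″} (le′ , S , en) → σ₁ , ω₁ , τs₁ , S , ex₃ , en , ≤-trans le le′) (Run-sure-wp skip (λ s′ ω′ → Sim σ₀ σ₁ ω₁ (sum τs₁ + k) s′ ω′ × StageEnv J j s′) ≤-refl (S₂ , en₂))))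
            where
            ex₃ : ExecOps B A (opsFrom b j (suc i) (d ∸ i)) σ₁ ω₁ σ′ ω′ τs₁
            ex₃ = subst (λ w → ExecOps B A (pick w [] (mkOp b (dynamicEdge 0 i) ∷ mkOp b (dynamicEdge D i) ∷ []) ++ opsFrom b j (suc i) (d ∸ i)) σ₁ ω₁ σ′ ω′ τs₁) (sym w≡) ex₂
          branch (suc w) {s₂} {ω₂} t≡ ex₂ w≡ S₂ en₂ i≡₂
            with subst (λ w → ExecOps B A (pick w [] (mkOp b (dynamicEdge 0 i) ∷ mkOp b (dynamicEdge D i) ∷ []) ++ opsFrom b j (suc i) (d ∸ i)) σ₁ ω₁ σ′ ω′ τs₁) (sym w≡) ex₂
          ... | _∷_ {τ = τ₁} x₁ (_∷_ {τ = τ₂} {τs = τs₂} x₂ ex₃) = Run-credit (≤-trans (s≤s (+-monoʳ-≤ 14 (≤-trans (≤-reflexive (arith κ τ₁ τ₂ (sum τs₂) c)) le))) (n≤1+n (15 + c′)))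
            (Run-then (λ z → case trans (sym t≡) z of λ ())
              (Run-credit (≤-reflexive (arith₂ (κ * τ₁) (κ * τ₂) (κ * sum τs₂ + c)))
              (Run-step {t = 7 + κ * τ₁} (Run-credit (≤-reflexive (sym (+-assoc 7 (κ * τ₁) _))) (Run-frame {Q′ = Sure (7 + (κ * τ₂ + (κ * sum τs₂ + c))) (λ s′ ω′c → Sim σ₀ _ _ (τ₂ + (sum τs₂ + k)) s′ ω′c × StageEnv J j s′ × var s′ 67 ≡ i)} (act-run b 3 0 (proj₁ (proj₂ (proj₂ S₂))) (s≤s⁻¹ i<) z≤n refl x₁ (refuel (arith₃ τ₁ τ₂ (sum τs₂) k) {s₂} {ω₂} S₂) en₂ i≡₂)
                 (λ kv ka (le , S₃ , en₃) → le , S₃ , en₃ , trans (kv 67 (act-67 3)) i≡₂)))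
              (λ {s₃} (S₃ , en₃ , i≡₃) → Run-map (λ (le , S₄ , en₄) → _ , _ , τs₂ , S₄ , ex₃ , en₄ , le) (act-run b 13 D (D≡ en₃) (s≤s⁻¹ i<) ≤-refl refl x₂ S₃ en₃ i≡₃)))))
            where
            arith : ∀ κ a b e c → κ * a + (κ * b + (κ * e + c)) ≡ κ * (a + (b + e)) + c
            arith = solve-∀
            arith₂ : ∀ a b e → 7 + a + (7 + (b + e)) ≡ 14 + (a + (b + e))
            arith₂ = solve-∀
            arith₃ : ∀ a b e k → a + (b + e) + k ≡ a + (b + (e + k))
            arith₃ = solve-∀

      unfuel-≤ : ∀ {m σ ω k k′} → k′ ≤ k → ∀ {s ωc} → Simulates m σ ω k s ωc → Simulates m σ ω k′ s ωc
      unfuel-≤ {k = k} {k′} le {s} {ωc} S = unfuel (k ∸ k′) {s} {ωc} (refuel (sym (m∸n+n≡m le)) {s} {ωc} S)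

      -- The coins at the end of preprocessing, when `lo` of them had been drawn. Nothing here
      -- refers to the present state, so it holds throughout all stages.
      record Start (ω₀ : Tape) (F idx₀ : ℕ) : Set where
        constructor start
        field
          i n     : ℕ
          index   : idx₀ ≡ i * R + r
          tape    : ω₀ ≡ column R r Ω i n
          total   : (i + n) * R ≤ length Ω
          close   : idx₀ < lo + R
          fuelled : idx₀ + F * R < B

      -- After the tick all stamps of table 4 are below the clock, so `view` shows `σ₀` again. Only
      -- the coin index moves back; since the number of drawn coins never falls below `lo`, the
      -- index stays within `R` of it.
      restart-sim : ∀ {m σ₀ ω₀ σ ω k s ωc F idx₀} → Simulates m σ ω k s ωc →
        Holds (baseView (var s 5) (var s 6) (λ a → arr s (5 + a))) σ₀ → Start ω₀ F idx₀ → suc (var s 5) < B →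
        Sim σ₀ σ₀ ω₀ F (setVar 8 idx₀ (setVar 5 (suc (var s 5)) s)) ωc
      restart-sim {σ₀ = σ₀} {s = s} (M , coins _ _ _ _ _ unread drawn≤ buffered _ enough _ , (z , o , rr , E< , P<)) h (start i n index tape total close fuelled) E+1< =
        represents (Represents.initials M) (Represents.stamps₁ M) (λ a i → ≤-trans (Represents.stamps₂ M a i) (n≤1+n _))
          (h , Holds-cong {baseView (var s 5) (var s 6) (λ a → arr s (5 + a))} σ₀ (λ a i → pick-suc {x = arr s (5 + slot 3 a) i} (m>n⇒m∸n≢0 (s≤s (Represents.stamps₂ M a i)))) h) ,
        coins i n index tape total unread drawn≤ buffered (<-≤-trans close (+-monoˡ-≤ R enough)) enough fuelled ,
        (z , o , rr , E+1< , P<)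

      begin-run : ∀ b {σ₀ ω₀ σ ω s ωc c f t F J j} → Sim σ₀ σ ω f s ωc → Start ω₀ F (var s 64) → suc (var s 5) < B →
        (b ≡ false → t ≤ f) → t ≤ F → StageEnv J j s →
        Run B (if b then restart else skip) s ωc (2 + c) (Sure c (λ s′ ω′c →
          Sim σ₀ (if b then σ₀ else σ) (if b then ω₀ else ω) t s′ ω′c × StageEnv J j s′ ×
          var s′ 64 ≡ var s 64 × var s′ 5 ≤ suc (var s 5) × arr s′ 3 ≡ arr s 3))
      begin-run false {σ₀} {ω₀} {σ} {ω} {s} {ωc} {c} {f} {t} {F} {J} {j} S st E< tf tF en = Run-credit (n≤1+n _) (Run-sure-wp skip
        (λ s′ ω′c → Sim σ₀ σ ω t s′ ω′c × StageEnv J j s′ × var s′ 64 ≡ var s 64 × var s′ 5 ≤ suc (var s 5) × arr s′ 3 ≡ arr s 3) ≤-refl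
        (unfuel-≤ (tf refl) {s} {ωc} S , en , refl , n≤1+n _ , refl))
      begin-run true {σ₀} {ω₀} {σ} {ω} {s} {ωc} {c} {f} {t} {F} {J} {j} S@(M , C , (z , o , rr , E<′ , P<)) st E< tf tF (stageEnv a b e g h W) = Run-sure-wp restart
        (λ s′ ω′c → Sim σ₀ σ₀ ω₀ t s′ ω′c × StageEnv J j s′ × var s′ 64 ≡ var s 64 × var s′ 5 ≤ suc (var s 5) × arr s′ 3 ≡ arr s 3) ≤-refl
        ( suc (var s 5) , trans (cong (var s 5 +_) o) (+-comm _ 1) , E<
        , var s 64 , trans (cong (var s 64 +_) z) (+-identityʳ _) , ≤-<-trans (m≤m+n _ _) (Start.fuelled st)
        , unfuel-≤ tF {setVar 8 (var s 64) (setVar 5 (suc (var s 5)) s)} {ωc} (restart-sim {shadow σ₀} {s = s} S (proj₁ (Represents.current M)) st E<)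
        , stageEnv a b e g h W , refl , ≤-refl , refl)

      ballot : (threshold out : ℕ) → ℕ
      ballot threshold out = pick (threshold ∸ out) 0 1

      vote-run : ∀ {σ₀ σ ω k J j s ωc c} threshold out → Sim σ₀ σ ω k s ωc → StageEnv J j s → var s 0 ≡ out →
        threshold < B → suc (arr s 3 j) < B →
        Run B (vote threshold) s ωc (7 + c) (Sure c (λ s′ ω′c → Sim σ₀ σ ω k s′ ω′c × StageEnv J j s′ ×
          arr s′ 3 j ≡ arr s 3 j + ballot threshold out × (∀ j′ → j′ ≢ j → arr s′ 3 j′ ≡ arr s 3 j′) ×
          var s′ 64 ≡ var s 64 × var s′ 5 ≡ var s 5))
      vote-run {σ₀} {σ} {ω} {k} {J} {j} {s} {ωc} {c} threshold out S@(_ , _ , _ , one , _) en@(stageEnv a b e g h W) out≡ thr< cnt< =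
        Run-sure-wp (vote threshold) (λ s′ ω′c → Sim σ₀ σ ω k s′ ω′c × StageEnv J j s′ ×
          arr s′ 3 j ≡ arr s 3 j + ballot threshold out × (∀ j′ → j′ ≢ j → arr s′ 3 j′ ≡ arr s 3 j′) ×
          var s′ 64 ≡ var s 64 × var s′ 5 ≡ var s 5) ≤-refl
          ( thr< , threshold ∸ out , cong (threshold ∸_) out≡ , ≤-<-trans (m∸n≤m threshold out) thr<
          , (λ nz → suc (arr s 3 j) , trans (cong₂ _+_ (cong (arr s 3) h) one) (+-comm _ 1) , cnt< ,
               S , stageEnv a b e g h W ,
               trans (hit (arr s 3) h) (trans (+-comm 1 _) (cong (arr s 3 j +_) (sym (pick-suc nz)))) , (λ j′ j′≢ → miss (arr s 3) h (λ eq → j′≢ (sym eq))) , refl , refl)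
          , (λ z → S , stageEnv a b e g h W , trans (sym (+-identityʳ _)) (cong (arr s 3 j +_) (sym (pick-zero z))) , (λ _ _ → refl) , refl , refl))
        where
        hit : ∀ f {i v} → i ≡ j → (f [ i ↦ v ]) j ≡ v
        hit f refl rewrite ≡ᵇ-refl j = refl
        miss : ∀ f {i v j′} → i ≡ j → j ≢ j′ → (f [ i ↦ v ]) j′ ≡ f j′
        miss f refl j≢ rewrite ≡ᵇ-false j≢ = refl

      undo-run : ∀ b {σ₀ σ ω σ′ ω′ τs k J j s ωc c} → j * d + d < B →
        ExecOps B A (if b then opsFrom true j 0 D else []) σ ω σ′ ω′ τs → Sim σ₀ σ ω (sum τs + k) s ωc → StageEnv J j s →
        Run B (if b then opLoop A (decremental? v) true else skip) s ωc (3 + D * 27 + (κ * sum τs + c))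
          (Sure c (λ s′ ω′c → Sim σ₀ σ′ ω′ k s′ ω′c × StageEnv J j s′ × var s′ 64 ≡ var s 64 × var s′ 5 ≡ var s 5 × arr s′ 3 ≡ arr s 3))
      undo-run true jd< ex S en = Run-frame (opLoop-run true jd< ex S en) (λ kv ka (le , S′ , en′) → le , S′ , en′ ,
        kv 64 (opLoop-keepsVar A (decremental? v) true 64 (refl , refl , refl , refl , refl) refl refl refl refl) ,
        kv 5 (opLoop-keepsVar A (decremental? v) true 5 (refl , refl , refl , refl , refl) refl refl refl refl) ,
        ka 3 (opLoop-keepsArr A (decremental? v) true 3 refl (λ _ → refl)))
      undo-run false {σ₀} {σ} {ω} {k = k} {J} {j} {s} {ωc} {c} jd< [] S en = Run-credit (s≤s (≤-trans (≤-reflexive (cong (_+ c) (sym (*-zeroʳ κ)))) (m≤n+m _ (2 + D * 27))))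
        (Run-sure-wp skip (λ s′ ω′c → Sim σ₀ σ ω k s′ ω′c × StageEnv J j s′ × var s′ 64 ≡ var s 64 × var s′ 5 ≡ var s 5 × arr s′ 3 ≡ arr s 3) ≤-refl (S , en , refl , refl , refl))

      record Mid (s₀ σ₀ σ : State) (ω : Tape) (f J j : ℕ) (s : State) (ωc : Tape) : Set where
        constructor mid
        field
          sim      : Sim σ₀ σ ω f s ωc
          stageenv : StageEnv J j s
          saved    : var s 64 ≡ var s₀ 64
          clock    : var s 5 ≤ suc (var s₀ 5)
          votes    : arr s 3 ≡ arr s₀ 3

      open Mid

      mid-begin : ∀ {σ₀ ω₀ σ ω s ωc c f t F J j} → Sim σ₀ σ ω f s ωc → Start ω₀ F (var s 64) → suc (var s 5) < B →
        (rollsBack v ≡ false → t ≤ f) → t ≤ F → StageEnv J j s →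
        Run B (if rollsBack v then restart else skip) s ωc (2 + c)
          (Sure c (Mid s σ₀ (if rollsBack v then σ₀ else σ) (if rollsBack v then ω₀ else ω) t J j))
      mid-begin S st E< tf tF en = Run-map (λ (le , S₁ , en₁ , i₁ , E₁ , c₁) → le , mid S₁ en₁ i₁ E₁ c₁) (begin-run (rollsBack v) S st E< tf tF en)

      mid-ops : ∀ {s₀ σ₀ σ ω σ′ ω′ τs k J j s ωc c} → j * d + d < B →
        ExecOps B A (opsFrom (decremental? v) j 0 D) σ ω σ′ ω′ τs → Mid s₀ σ₀ σ ω (sum τs + k) J j s ωc →
        Run B (opLoop A (decremental? v) (decremental? v)) s ωc (3 + D * 27 + (κ * sum τs + c)) (Sure c (Mid s₀ σ₀ σ′ ω′ k J j))
      mid-ops {s₀} {σ₀} {σ′ = σ′} {ω′} {k = k} {J} {j} {c = c} jd< x (mid S en i E cs) =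
        Run-frame {Q′ = Sure c (Mid s₀ σ₀ σ′ ω′ k J j)} (opLoop-run (decremental? v) jd< x S en) (λ kv ka (le , S₂ , en₂) → le , mid S₂ en₂
          (trans (kv 64 (opLoop-keepsVar A (decremental? v) (decremental? v) 64 (refl , refl , refl , refl , refl) refl refl refl refl)) i)
          (≤-trans (≤-reflexive (kv 5 (opLoop-keepsVar A (decremental? v) (decremental? v) 5 (refl , refl , refl , refl , refl) refl refl refl refl))) E)
          (trans (ka 3 (opLoop-keepsArr A (decremental? v) (decremental? v) 3 refl (λ _ → refl))) cs))

      mid-query : ∀ {s₀ σ₀ σ ω σ′ ω′ τ k J j s ωc c} → Exec B (onQuery A) σ ω σ′ ω′ τ → Mid s₀ σ₀ σ ω (τ + k) J j s ωc →
        Run B (compile shadow (onQuery A)) s ωc (κ * τ + c) (Sure c (Mid s₀ σ₀ σ′ ω′ k J j))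
      mid-query {s₀} {σ₀} {σ′ = σ′} {ω′} {k = k} {J} {j} {s} {c = c} x (mid S en i E cs) =
        Run-frame {Q′ = Sure c (Mid s₀ σ₀ σ′ ω′ k J j)} (simulate (shadow σ₀) (onQuery A) x S) (λ {s₃} kv ka (le , S₃) → le , mid S₃
          (compile-frame (onQuery A) {s = s} {s₃} kv ka en)
          (trans (kv 64 (compile-keepsVar shadow (onQuery A) 64 (refl , refl , refl , refl , refl))) i)
          (≤-trans (≤-reflexive (kv 5 (compile-keepsVar shadow (onQuery A) 5 (refl , refl , refl , refl , refl)))) E)
          (trans (ka 3 (compile-keepsArr shadow (onQuery A) 3 refl (λ _ → refl))) cs))

      mid-read : ∀ {s₀ σ₀ σ ω k J j s ωc c} → Mid s₀ σ₀ σ ω k J j s ωc →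
        Run B (read 0 (cellVar 0) 3) s ωc (11 + c) (Sure c (λ s′ ω′ → Mid s₀ σ₀ σ ω k J j s′ ω′ × var s′ 0 ≡ var σ 0))
      mid-read {s₀} {σ₀} {σ} {ω} {k} {J} {j} {s} {c = c} (mid S en i E cs) =
        Run-frame {Q′ = Sure c (λ s′ ω′ → Mid s₀ σ₀ σ ω k J j s′ ω′ × var s′ 0 ≡ var σ 0)} (read-var (shadow σ₀) 0 S) (λ {s₄} kv ka (le , S₄ , v₄) → le , mid S₄
          (StageEnv-frame {s = s} {s₄} (λ { x (inj₁ refl) → kv 11 refl ; x (inj₂ (inj₁ refl)) → kv 12 refl ; x (inj₂ (inj₂ (inj₁ refl))) → kv 13 refl
                             ; x (inj₂ (inj₂ (inj₂ (inj₁ refl)))) → kv 15 refl ; x (inj₂ (inj₂ (inj₂ (inj₂ refl)))) → kv 65 refl }) (ka 2 refl) en)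
          (trans (kv 64 refl) i) (≤-trans (≤-reflexive (kv 5 refl)) E) (trans (ka 3 refl) cs) , v₄)

      stageTime : ℕ
      stageTime = 26 + 2 * (D * 27)

      module Loop (σ₀ : State) (ω₀ : Tape) (F idx₀ J threshold E₀ : ℕ) (counts : ℕ → ℕ) (O : List ℕ)
        (st : Start ω₀ F idx₀) (jd< : ∀ j → j < J → j * d + d < B) (J<B : J < B) (E< : suc (E₀ + J) < B)
        (thr< : threshold < B) (counts< : ∀ j → j < J → suc (counts j) < B) where

        Counts : ℕ → (ℕ → ℕ) → Set
        Counts j f = (∀ j′ → j′ < j → f j′ ≡ counts j′ + ballot threshold (at 0 O j′)) × (∀ j′ → j ≤ j′ → f j′ ≡ counts j′)

        Counts-step : ∀ {j out : ℕ} {f g h k : ℕ → ℕ} → Counts j k → out ≡ at 0 O j → (∀ j′ → f j′ ≡ g j′) → g j ≡ h j + ballot threshold out →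
                      (∀ j′ → j′ ≢ j → g j′ ≡ h j′) → (∀ j′ → h j′ ≡ k j′) → Counts (suc j) f
        Counts-step {j} {out} {f} (old , new) out≡ fg gj go hk = below , above
          where
          below : ∀ j′ → j′ < suc j → f j′ ≡ counts j′ + ballot threshold (at 0 O j′)
          below j′ j′< with j′ ≟ j
          ... | yes refl = trans (fg j) (trans gj (cong₂ (λ x y → x + ballot threshold y) (trans (hk j) (new j ≤-refl)) out≡))
          ... | no j′≢ = trans (fg j′) (trans (go j′ j′≢) (trans (hk j′) (old j′ (≤∧≢⇒< (s≤s⁻¹ j′<) j′≢))))
          above : ∀ j′ → suc j ≤ j′ → f j′ ≡ counts j′
          above j′ j< = trans (fg j′) (trans (go j′ (λ eq → <⇒≢ j< (sym eq))) (trans (hk j′) (new j′ (<⇒≤ j<))))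

        -- `t` is the simulated time still to come and must be covered by fuel. Without rollback the
        -- present fuel `f` has to last for all remaining stages; with rollback every restart renews
        -- it to `F`. The reserve `κ * t` shrinks together with `t`.
        I : ℕ → ℕ → Assertion
        I c j s ωc c′ = ∃ λ σ → ∃ λ ω → ∃ λ f → ∃ λ t → ∃ λ outs → Sim σ₀ σ ω f s ωc × Session σ₀ ω₀ j (J ∸ j) σ ω outs t ×
          ((rollsBack v ≡ false → t ≤ f) × t ≤ F) × StageEnv J (var s 65) s × var s 64 ≡ idx₀ × var s 5 ≤ E₀ + j ×
          Counts j (arr s 3) × (∀ x → at 0 outs x ≡ at 0 O (j + x)) × κ * t + c ≤ c′

        body : ∀ c j {s ωc c′} → j < J → var s 65 ≡ j → I c j s ωc c′ → Run B (stageCode A v threshold) s ωc (stageTime + c′) (I c (suc j))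
        body c j {s} {ωc} {c′} j< j≡ (σ , ω , f , t , outs , S , ses , (tf , tF) , en , idx≡ , E≤ , cnts , outs≡ , le)
          with subst (λ m → Session σ₀ ω₀ j m σ ω outs t) (+-∸-assoc 1 j<) ses
        ... | stage {σ₁ = σ₁} {ω₁} {τs} {σ₂} {ω₂} {τ} {σ₃} {ω₃} {τs′} {outs′} {t′} x₁ x₂ x₃ ses′ =
          Run-credit (≤-trans (≤-reflexive (arith D (κ * sum τs) (κ * τ) (κ * sum τs′) (κ * t′ + c))) (+-monoʳ-≤ stageTime (≤-trans (≤-reflexive (arith₂ κ (sum τs) τ (sum τs′) t′ c)) le)))
          (Run-step {t = 2} (mid-begin S (subst (Start ω₀ F) (sym idx≡) st) (≤-<-trans (s≤s (≤-trans E≤ (+-monoʳ-≤ E₀ (<⇒≤ j<)))) E<) tf tF (subst (λ j → StageEnv J j s) j≡ en)) (λ M₁ →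
           Run-step {t = 3 + D * 27 + κ * sum τs} (Run-credit (≤-reflexive (sym (+-assoc (3 + D * 27) (κ * sum τs) _))) (mid-ops (jd< j j<) x₁ M₁)) (λ M₂ →
           Run-step {t = κ * τ} (mid-query x₂ M₂) (λ M₃ →
           Run-step {t = 11} (mid-read M₃) (λ {s₄} (M₄ , v₄) →
           Run-step {t = 7} (vote-run threshold (var σ₂ 0) (sim M₄) (stageenv M₄) v₄ thr< (subst (λ f → suc (f j) < B) (sym (votes M₄)) (subst (λ m → suc m < B) (sym (proj₂ cnts j ≤-refl)) (counts< j j<)))) (λ {s₅} (S₅ , en₅ , hit₅ , miss₅ , i₅ , E₅) →
           Run-map (λ {s₆} (le , S₆ , en₆ , i₆ , E₆ , c₆) → σ₃ , ω₃ , t′ , t′ , outs′ , S₆ , ses′ ,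
               ((λ _ → ≤-refl) , ≤-trans (≤-trans (m≤n+m t′ (sum τs′)) (≤-trans (m≤n+m _ τ) (m≤n+m _ (sum τs)))) tF) ,
               subst (λ j → StageEnv J j s₆) (sym (j≡′ en₆)) en₆ , trans i₆ (trans i₅ (trans (saved M₄) idx≡)) ,
               ≤-trans (≤-reflexive (trans E₆ E₅)) (≤-trans (clock M₄) (≤-trans (s≤s E≤) (≤-reflexive (sym (+-suc E₀ j))))) ,
               Counts-step {j} {var σ₂ 0} {arr s₆ 3} {arr s₅ 3} {arr s₄ 3} {arr s 3} cnts (trans (outs≡ 0) (cong (at 0 O) (+-identityʳ j))) (λ j′ → cong (λ f → f j′) c₆) hit₅ miss₅ (λ j′ → cong (λ f → f j′) (votes M₄)) ,
               (λ x → trans (outs≡ (suc x)) (cong (at 0 O) (+-suc j x))) , le)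
             (undo-run (undoes v) (jd< j j<) x₃ S₅ en₅)))))))
          where
          j≡′ : ∀ {s} → StageEnv J j s → var s 65 ≡ j
          j≡′ = StageEnv.j≡
          arith : ∀ D a b e z → 2 + (3 + D * 27 + a + (b + (11 + (7 + (3 + D * 27 + (e + z)))))) ≡ (26 + 2 * (D * 27)) + (a + (b + (e + z)))
          arith = solve-∀
          arith₂ : ∀ κ a b e t c → κ * a + (κ * b + (κ * e + (κ * t + c))) ≡ κ * (a + (b + (e + t))) + c
          arith₂ = solve-∀

        stages-run : ∀ {σ ω f t s ωc c} → Sim σ₀ σ ω f s ωc → Session σ₀ ω₀ 0 J σ ω O t → (rollsBack v ≡ false → t ≤ f) → t ≤ F →
          var s 11 ≡ J → var s 12 ≡ d → var s 13 ≡ D → var s 15 ≡ 2 * D → (∀ k → arr s 2 k ≡ at 0 Wl k) → var s 64 ≡ idx₀ → var s 5 ≤ E₀ →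
          (∀ j → arr s 3 j ≡ counts j) →
          Run B (for 65 11 66 (stageCode A v threshold)) s ωc (3 + J * (3 + stageTime) + (κ * t + c)) (Sure c (λ s′ ω′c →
            (∃ λ σ′ → ∃ λ ω′ → ∃ λ f′ → Sim σ₀ σ′ ω′ f′ s′ ω′c) × var s′ 5 ≤ E₀ + J × (∀ j → j < J → arr s′ 3 j ≡ counts j + ballot threshold (at 0 O j))))
        stages-run {σ} {ω} {f} {t} {s} {ωc} {c} S ses tf tF eJ ed eD e2D W i E cs =
          Run-map (λ {s′} (σ , ω , f , t , outs , S , ses , _ , _ , _ , E≤ , cnts , _ , le) → ≤-trans (m≤n+m c (κ * t)) le , (σ , ω , f , S) , E≤ , proj₁ cnts)
            (Run-for 65 11 66 (stageCode A v threshold) {J} {stageTime} (I c) J<B refl refl refl refl refl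
              (stageCode-keepsVar A v threshold 65 (refl , refl , refl , refl , refl) refl refl refl refl refl)
              (stageCode-keepsVar A v threshold 11 (refl , refl , refl , refl , refl) refl refl refl refl refl)
              (stageCode-keepsVar A v threshold 4 (refl , refl , refl , refl , refl) refl refl refl refl refl)
              (λ { v v′ (σ , ω , f , t , outs , S , ses , le , stageEnv a b e g h w , i , E , cnts , outs≡ , le′) →
                   σ , ω , f , t , outs , S , ses , le , stageEnv a b e g refl w , i , E , cnts , outs≡ , le′ })
              (λ j j< j≡ _ _ → body c j j< j≡) eJ (proj₁ (proj₂ (proj₂ (proj₂ S))))
              (σ , ω , f , t , O , S , ses , (tf , tF) , stageEnv eJ ed eD e2D refl W , i , ≤-trans E (m≤m+n E₀ 0) , ((λ _ ()) , (λ j _ → cs j)) , (λ _ → refl) , ≤-refl))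

open StageRuns

-- The program for 3-HS

module Solving where

  open DynamicProg

  repetition : DynamicProg → Variant → ℕ → Prog
  repetition A v threshold =
    (op 6 add 6 4 ⨾ op 5 add 5 4 ⨾ op 8 add 62 3) ⨾ compile base (preprocess A) ⨾ (op 64 add 8 3 ⨾ restart) ⨾
    for 65 11 66 (stageCode A v threshold)

  tally : Prog
  tally = load 69 3 62 ⨾ op 69 add 69 69 ⨾ op 69 sub 69 7 ⨾ cond 69 (const 0 1) skip

  -- Variable 7 becomes `12 * (d * b + 2)`, an even number of repetitions. As `n ≤ 2 ^ d`, the
  -- product `d * b` is at least the logarithm of `n ^ b`, which is what the union bound over W asks
  -- for.
  solver : DynamicProg → Variant → (l b threshold : ℕ) → Prog
  solver A v l b threshold =
    build (decremental? v) l ⨾ (const 61 (12 * b) ⨾ op 7 mul 12 61 ⨾ const 61 24 ⨾ op 7 add 7 61) ⨾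
    for 62 7 63 (repetition A v threshold) ⨾ const 0 0 ⨾ for 62 11 63 tally

  module Solver (B : ℕ) (A : DynamicProg) (v : Variant) (n J d l b threshold : ℕ) (Ul Vl Wl : List ℕ) where
    open Layout n d l using (N; X)
    open Layout.Bits n d l Ul Vl using (staticE)

    R : ℕ
    R = d * (12 * b) + 24

    R>0 : 0 < R
    R>0 = ≤-trans (s≤s z≤n) (m≤n+m 24 (d * (12 * b)))

    Es : RawEdges
    Es = staticE (if decremental? v then 2 * suc d else 0) X

    module Execution (fin : ℕ → Fin N) (toℕ-fin : ∀ x → x < 4 * suc d → toℕ (fin x) ≡ x)
      (σᵢ : State) (σᵢ-N : var σᵢ 0 ≡ N) (σᵢ-M : var σᵢ 1 ≡ length Es) (σᵢ-var : ∀ x → var σᵢ (2 + x) ≡ 0)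
      (σᵢ-src : ∀ k → arr σᵢ 0 k ≡ at 0 (map proj₁ Es) k) (σᵢ-dst : ∀ k → arr σᵢ 1 k ≡ at 0 (map proj₂ Es) k)
      (σᵢ-arr : ∀ a k → arr σᵢ (2 + a) k ≡ 0)
      (T m : ℕ) (Ω : Tape) (length-Ω : length Ω ≡ m * R) (O : ℕ → List ℕ)
      (4N<B : 4 * N < B) (JD<B : J * d + d < B) (J<B : J < B) (thr<B : threshold < B) (b<B : 12 * b + 24 < B)
      (R<B : 2 * R < B) (E<B : suc (R * (J + 2)) < B) (fuel<B : R + T * R < B)
      where

      open Stages B A v d Wl fin toℕ-fin using (Session; Run-stages; r; J≡; d≡; D≡; 2D≡; j≡; W≡; Sim; I; keep; body; arith; Start; start; i; n; index; tape; total; close; fuelled; restart-sim; Loop; stages-run; module Run-stages; module Loop)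

      -- What the dynamic algorithm promises on the coins of repetition `r`. The verification of
      -- `solver` rests on the existence and the time of such runs; whether the answers `O r` are
      -- right is a separate, probabilistic matter.
      record Repetition (r : ℕ) : Set where
        field
          {σ₀}    : State
          {ω₀}    : Tape
          {τ₀ t}  : ℕ
          pre-run : Exec B (preprocess A) σᵢ (column R r Ω 0 m) σ₀ ω₀ τ₀
          session : Session σ₀ ω₀ 0 J σ₀ ω₀ (O r) t
          within  : τ₀ + t ≤ T

      4D<B : 4 * suc d < B
      4D<B = ≤-<-trans (≤-trans (≤-trans (m≤m+n _ 2) (≤-trans (m≤m+n _ (n + 2)) (≤-trans (m≤m+n _ (2 * suc n)) (≤-trans (m≤m+n _ X) (≤-trans (m≤m+n _ X) (m≤m+n _ _)))))) (m≤m+n N _)) 4N<B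

      κ : ℕ
      κ = 60 + 10 * R

      stageTime′ : ℕ
      stageTime′ = 26 + 2 * (suc d * 27)

      ballot′ : (out : ℕ) → ℕ
      ballot′ out = pick (threshold ∸ out) 0 1

      tallied : (r j : ℕ) → ℕ
      tallied zero    j = 0
      tallied (suc r) j = tallied r j + ballot′ (at 0 (O r) j)

      tallied≤ : ∀ r j → tallied r j ≤ r
      tallied≤ zero    j = z≤n
      tallied≤ (suc r) j = ≤-trans (+-mono-≤ (tallied≤ r j) (single (threshold ∸ at 0 (O r) j))) (≤-reflexive (+-comm r 1))
        where
        single : ∀ x → pick x 0 1 ≤ 1
        single zero    = z≤n
        single (suc _) = ≤-refl

      -- What survives from one repetition to the next: initial values, bounded stamps, the coin
      -- buffer and the tallies. A repetition advances the stage clock by at most `J + 2`, namely at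
      -- its start, after preprocessing and at most once per stage.
      record Idle (r : ℕ) (s : State) (ωc : Tape) : Set where
        constructor idle
        field
          initials : Holds (λ a i → arr s (5 + slot 0 a) i) σᵢ
          stamps₁  : ∀ a i → arr s (5 + slot 2 a) i ≤ var s 6
          stamps₂  : ∀ a i → arr s (5 + slot 4 a) i ≤ var s 5
          unread   : ωc ≡ drop (var s 9) Ω
          drawn≤   : var s 9 ≤ length Ω
          buffered : ∀ q → q < var s 9 → arr s 4 q ≡ bit (at false Ω q)
          zero≡    : var s 3 ≡ 0
          one≡     : var s 4 ≡ 1
          R≡       : var s 7 ≡ R
          J≡       : var s 11 ≡ J
          d≡       : var s 12 ≡ d
          D≡       : var s 13 ≡ suc d
          2D≡      : var s 15 ≡ 2 * suc d
          W≡       : ∀ k → arr s 2 k ≡ at 0 Wl k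
          clock₁   : var s 6 ≤ r
          clock₂   : var s 5 ≤ r * (J + 2)
          counts   : ∀ j → j < J → arr s 3 j ≡ tallied r j

      record Kept (r : ℕ) (s : State) : Set where
        constructor kept
        field
          J≡ : var s 11 ≡ J
          d≡ : var s 12 ≡ d
          D≡ : var s 13 ≡ suc d
          2D≡ : var s 15 ≡ 2 * suc d
          W≡ : ∀ k → arr s 2 k ≡ at 0 Wl k
          clock₁ : var s 6 ≤ suc r
          clock₂ : var s 5 ≤ suc (r * (J + 2))
          counts : ∀ j → j < J → arr s 3 j ≡ tallied r j
      Kept-frame : ∀ {r s s′} → (∀ x → Outside x → var s′ x ≡ var s x) → (∀ a → (4 ≡ᵇ a) ≡ false → (∀ i → (5 + i ≡ᵇ a) ≡ false) → arr s′ a ≡ arr s a) → Kept r s → Kept r s′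
      Kept-frame f g (kept a b e h w c₁ c₂ ct) = kept (trans (f 11 out) a) (trans (f 12 out) b) (trans (f 13 out) e) (trans (f 15 out) h)
        (λ k → trans (cong (λ q → q k) (g 2 refl (λ _ → refl))) (w k)) (≤-trans (≤-reflexive (f 6 out)) c₁) (≤-trans (≤-reflexive (f 5 out)) c₂)
        (λ j j< → trans (cong (λ q → q j) (g 3 refl (λ _ → refl))) (ct j j<))
        where
        out : false ≡ false × false ≡ false × false ≡ false × false ≡ false × false ≡ false
        out = refl , refl , refl , refl , refl

      repTime : ℕ
      repTime = 9 + J * (3 + stageTime′) + κ * T

      repetition-run : ∀ r {s ωc c} → r < R → var s 62 ≡ r → Repetition r → Idle r s ωc →
        Run B (repetition A v threshold) s ωc (repTime + c) (Sure c (Idle (suc r)))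
      repetition-run r {s} {ωc} {c} r<R r≡ rep (idle ini st₁ st₂ unread drawn≤ buffered z o rr eJ ed eD e2D W clk₁ clk₂ cnt) =
        Run-credit (≤-trans (≤-reflexive (arith (κ * τ₀) (J * (3 + stageTime′)) (κ * t) c)) (+-monoˡ-≤ c (+-monoʳ-≤ (9 + J * (3 + stageTime′))
            (≤-trans (≤-reflexive (sym (*-distribˡ-+ κ τ₀ t))) (*-monoʳ-≤ κ within)))))
        (Run-step {t = 3} begin (λ {s₁} (S₁ , K₁) →
         Run-step {t = κ * τ₀} (Run-frame {Q′ = Sure _ (λ s′ ω′ → Simulation.Simulates B R r Ω 0 r<R σᵢ base σ₀ ω₀ t s′ ω′ × Kept r s′)} (S0.simulate base (preprocess A) pre-run S₁)
           (λ {s₂} kv ka (le , S₂) → le , S₂ , Kept-frame {r} {s₁} {s₂} (λ x o → kv x (compile-keepsVar base (preprocess A) x o)) (λ a e₄ e → ka a (compile-keepsArr base (preprocess A) a e₄ e)) K₁)) (λ {s₂} {ω₂} (S₂ , K₂) →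
         after S₂ K₂)))
        where
        open Repetition rep
        module S0 = Simulation B R r Ω 0 r<R σᵢ using (Coins; coins; i; n; index; tape; total; unread; drawn≤; buffered; close; fuelled; Simulates; κ; R>0; s₁; f; g; arith; after; C′; simulate; module Coins)
        arith : ∀ a b e c → 3 + (a + (3 + (3 + b + (e + c)))) ≡ 9 + b + (a + e) + c
        arith = solve-∀
        clk : suc (r * (J + 2)) < B
        clk = ≤-<-trans (s≤s (*-monoˡ-≤ (J + 2) (<⇒≤ r<R))) E<B
        R<B′ : R < B
        R<B′ = ≤-<-trans (m≤m+n R _) R<B
        begin : Run B (op 6 add 6 4 ⨾ op 5 add 5 4 ⨾ op 8 add 62 3) s ωc (3 + (κ * τ₀ + (3 + (3 + J * (3 + stageTime′) + (κ * t + c)))))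
          (Sure (κ * τ₀ + (3 + (3 + J * (3 + stageTime′) + (κ * t + c)))) (λ s′ ω′ → S0.Simulates base σᵢ (column R r Ω 0 m) (τ₀ + t) s′ ω′ × Kept r s′))
        begin = Run-sure-wp (op 6 add 6 4 ⨾ op 5 add 5 4 ⨾ op 8 add 62 3) (λ s′ ω′ → S0.Simulates base σᵢ (column R r Ω 0 m) (τ₀ + t) s′ ω′ × Kept r s′) ≤-refl
          ( suc (var s 6) , trans (cong (var s 6 +_) o) (+-comm _ 1) , ≤-<-trans (≤-trans (s≤s clk₁) r<R) R<B′
          , suc (var s 5) , trans (cong (var s 5 +_) o) (+-comm _ 1) , ≤-<-trans (s≤s clk₂) clk
          , r , trans (cong₂ _+_ r≡ z) (+-identityʳ r) , <-trans r<R R<B′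
          , ( represents ini (λ a i → ≤-trans (st₁ a i) (n≤1+n _)) (λ a i → ≤-trans (st₂ a i) (n≤1+n _))
                ((λ a i → s≤s (st₂ a i)) , Holds-cong {λ a i → arr s (5 + slot 0 a) i} σᵢ (λ a i → pick-suc {x = arr s (5 + slot 1 a) i} (m>n⇒m∸n≢0 (s≤s (st₁ a i)))) ini)
            , S0.coins 0 m refl refl (≤-reflexive (sym length-Ω)) unread drawn≤ buffered (≤-trans r<R (m≤n+m R (var s 9))) z≤n
                (≤-<-trans (+-mono-≤ (<⇒≤ r<R) (*-monoˡ-≤ R within)) fuel<B)
            , z , o , rr , ≤-<-trans (s≤s clk₂) clk , ≤-<-trans (≤-trans (s≤s clk₁) r<R) R<B′ )
          , kept eJ ed eD e2D W (s≤s clk₁) (s≤s clk₂) cnt )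
        after : ∀ {s₂ ω₂} → S0.Simulates base σ₀ ω₀ t s₂ ω₂ → Kept r s₂ →
          Run B ((op 64 add 8 3 ⨾ restart) ⨾ for 65 11 66 (stageCode A v threshold)) s₂ ω₂ (3 + (3 + J * (3 + stageTime′) + (κ * t + c))) (Sure c (Idle (suc r)))
        after {s₂} {ω₂} (M , C , K@(z , o , rr , E< , P<)) (kept eJ ed eD e2D W clk₁ clk₂ cnt) =
          Run-step {t = 3} (Run-sure-wp (op 64 add 8 3 ⨾ restart) (λ s′ ω′ → Sim σ₀ σ₀ ω₀ t s′ ω′ × var s′ 11 ≡ J × var s′ 12 ≡ d × var s′ 13 ≡ suc d × var s′ 15 ≡ 2 * suc d ×
               (∀ k → arr s′ 2 k ≡ at 0 Wl k) × var s′ 64 ≡ idx₀ × var s′ 5 ≤ suc (suc (r * (J + 2))) × arr s′ 3 ≡ arr s₂ 3 × var s′ 6 ≤ suc r) ≤-refl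
            ( idx₀ , trans (cong (idx₀ +_) z) (+-identityʳ idx₀) , idx<B , suc (var s₂ 5) , trans (cong (var s₂ 5 +_) o) (+-comm _ 1) , E+1<
            , idx₀ , trans (cong (idx₀ +_) z) (+-identityʳ idx₀) , idx<B
            , restart-sim {base} {s = s₂} (M , C′ , K) (proj₂ (Represents.current M)) st E+1<
            , eJ , ed , eD , e2D , W , refl , s≤s clk₂ , refl , clk₁))
          (λ {s₃} {ω₃} (S₃ , eJ , ed , eD , e2D , W , i≡ , E₃ , c₃ , P₃) →
            Run-frame {Q′ = Sure c (Idle (suc r))} (stages-run S₃ session (λ _ → ≤-refl) ≤-refl eJ ed eD e2D W i≡ E₃ (λ j → cong (λ f → f j) c₃))
              (λ {s₄} {ω₄} kv ka (le , (σ′ , ω′ , f′ , (M₄ , C₄ , (z₄ , o₄ , rr₄ , _))) , E₄ , cnt₄) → le ,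
                idle (Represents.initials M₄) (Represents.stamps₁ M₄) (Represents.stamps₂ M₄)
                  (S1.Coins.unread C₄) (S1.Coins.drawn≤ C₄) (S1.Coins.buffered C₄) z₄ o₄ rr₄
                  (trans (kv 11 (keep 11 (refl , refl , refl , refl , refl) refl refl refl refl refl refl refl)) eJ)
                  (trans (kv 12 (keep 12 (refl , refl , refl , refl , refl) refl refl refl refl refl refl refl)) ed)
                  (trans (kv 13 (keep 13 (refl , refl , refl , refl , refl) refl refl refl refl refl refl refl)) eD)
                  (trans (kv 15 (keep 15 (refl , refl , refl , refl , refl) refl refl refl refl refl refl refl)) e2D)
                  (λ k → trans (cong (λ f → f k) (ka 2 keepW)) (W k))
                  (≤-trans (≤-reflexive (kv 6 (keep 6 (refl , refl , refl , refl , refl) refl refl refl refl refl refl refl))) P₃)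
                  (≤-trans E₄ (≤-reflexive (arithE J (r * (J + 2)))))
                  (λ j j< → trans (cnt₄ j j<) (cong (_+ ballot′ (at 0 (O r) j)) (cnt j j<)))))
          where
          idx₀ lo : ℕ
          idx₀ = var s₂ 8
          lo = var s₂ 9
          module S1 = Simulation B R r Ω lo r<R σᵢ
          open Stages.Run-stages B A v d Wl fin toℕ-fin R r Ω lo r<R σᵢ 4D<B using (J≡; d≡; D≡; 2D≡; j≡; W≡; Sim; I; keep; body; arith; Start; start; i; n; index; tape; total; close; fuelled; restart-sim; Loop; stages-run; module Loop)
          C′ : S1.Coins ω₀ t (var s₂ 8) (var s₂ 9) (arr s₂ 4) ω₂
          C′ = S1.coins (S0.Coins.i C) (S0.Coins.n C) (S0.Coins.index C) (S0.Coins.tape C) (S0.Coins.total C) (S0.Coins.unread C) (S0.Coins.drawn≤ C)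
                 (S0.Coins.buffered C) (S0.Coins.close C) ≤-refl (S0.Coins.fuelled C)
          st : Start ω₀ t idx₀
          st = start (S0.Coins.i C) (S0.Coins.n C) (S0.Coins.index C) (S0.Coins.tape C) (S0.Coins.total C) (S0.Coins.close C) (S0.Coins.fuelled C)
          idx<B : idx₀ < B
          idx<B = ≤-<-trans (m≤m+n idx₀ (t * R)) (S0.Coins.fuelled C)
          r+2 : suc (suc (r * (J + 2))) ≤ R * (J + 2)
          r+2 = ≤-trans (≤-trans (+-monoˡ-≤ (r * (J + 2)) (m≤n+m 2 J)) ≤-refl) (*-monoˡ-≤ (J + 2) r<R)
          E+1< : suc (var s₂ 5) < B
          E+1< = ≤-<-trans (≤-trans (s≤s clk₂) (≤-trans r+2 (n≤1+n _))) E<B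
          arithE : ∀ J x → suc (suc x) + J ≡ J + 2 + x
          arithE = solve-∀
          keep : ∀ x → Outside x → (5 ≡ᵇ x) ≡ false → (65 ≡ᵇ x) ≡ false → (66 ≡ᵇ x) ≡ false → (67 ≡ᵇ x) ≡ false → (68 ≡ᵇ x) ≡ false → (69 ≡ᵇ x) ≡ false → (70 ≡ᵇ x) ≡ false →
                 keepsVar x (for 65 11 66 (stageCode A v threshold)) ≡ true
          keep x o e₅ e₆₅ e₆₆ e₆₇ e₆₈ e₆₉ e₇₀ rewrite e₆₅ | e₆₆ | stageCode-keepsVar A v threshold x o e₅ e₆₇ e₆₈ e₆₉ e₇₀ = refl
          keepW : keepsArr 2 (for 65 11 66 (stageCode A v threshold)) ≡ true
          keepW rewrite stageCode-keepsW A v threshold = refl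
          open Loop σ₀ ω₀ t idx₀ J threshold (suc (suc (r * (J + 2)))) (arr s₂ 3) (O r) st
            (λ j j< → ≤-<-trans (+-monoˡ-≤ d (*-monoˡ-≤ d (<⇒≤ j<))) JD<B) J<B
            (≤-<-trans (s≤s (≤-trans (≤-reflexive (arithE J (r * (J + 2)))) (*-monoˡ-≤ (J + 2) r<R))) E<B) thr<B
            (λ j j< → ≤-<-trans (≤-trans (s≤s (≤-reflexive (cnt j j<))) (≤-trans (s≤s (tallied≤ r j)) r<R)) R<B′)

      -- Truncated subtraction again: an index counts if strictly more than half of the `R` votes
      -- are in its favour.
      verdict : ℕ → ℕ
      verdict zero    = 0
      verdict (suc j) = pick (tallied R j + tallied R j ∸ R) (verdict j) 1

      repetitions-run : ∀ {s ωc c} → (∀ r → r < R → Repetition r) → Idle 0 s ωc →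
        Run B (for 62 7 63 (repetition A v threshold)) s ωc (3 + R * (3 + repTime) + c) (Sure c (Idle R))
      repetitions-run {s} {ωc} {c} reps I₀ = Run-for 62 7 63 (repetition A v threshold) {R} {repTime} (λ r s ω c′ → c ≤ c′ × Idle r s ω)
        (≤-<-trans (m≤m+n R _) R<B) refl refl refl refl refl
        (keep 62 (refl , refl , refl , refl , refl) refl refl refl refl refl refl refl refl refl)
        (keep 7 (refl , refl , refl , refl , refl) refl refl refl refl refl refl refl refl refl)
        (keep 4 (refl , refl , refl , refl , refl) refl refl refl refl refl refl refl refl refl)
        (λ { v v′ (le , idle a b c d e f g h i j k l m n o p q) → le , idle a b c d e f g h i j k l m n o p q })
        (λ r r< r≡ _ _ (le , I) → Run-map (λ (le′ , I′) → ≤-trans le le′ , I′) (repetition-run r r< r≡ (reps r r<) I))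
        (Idle.R≡ I₀) (Idle.one≡ I₀) (≤-refl , I₀)
        where
        keep : ∀ x → Outside x → (5 ≡ᵇ x) ≡ false → (6 ≡ᵇ x) ≡ false → (64 ≡ᵇ x) ≡ false → (65 ≡ᵇ x) ≡ false → (66 ≡ᵇ x) ≡ false → (67 ≡ᵇ x) ≡ false →
               (68 ≡ᵇ x) ≡ false → (69 ≡ᵇ x) ≡ false → (70 ≡ᵇ x) ≡ false → keepsVar x (repetition A v threshold) ≡ true
        keep x o@(_ , _ , _ , e₈ , _) e₅ e₆ e₆₄ e₆₅ e₆₆ e₆₇ e₆₈ e₆₉ e₇₀
          rewrite e₅ | e₆ | e₈ | e₆₄ | e₆₅ | e₆₆ | compile-keepsVar base (preprocess A) x o | stageCode-keepsVar A v threshold x o e₅ e₆₇ e₆₈ e₆₉ e₇₀ = refl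

      tally-run : ∀ {s ω c} → var s 0 ≡ 0 → var s 4 ≡ 1 → var s 7 ≡ R → var s 11 ≡ J → (∀ j → j < J → arr s 3 j ≡ tallied R j) →
        Run B (for 62 11 63 tally) s ω (3 + J * 9 + c) (Sure c (λ s′ _ → var s′ 0 ≡ verdict J))
      tally-run {s} {ω} {c} z o rr eJ cnt = Run-map (λ (le , v≡ , _) → le , v≡)
        (Run-for 62 11 63 tally {J} {6} I J<B refl refl refl refl refl refl refl refl (λ _ _ i → i) body eJ o (≤-refl , z , rr , cnt))
        where
        I : ℕ → Assertion
        I j s _ c′ = c ≤ c′ × var s 0 ≡ verdict j × var s 7 ≡ R × (∀ j → j < J → arr s 3 j ≡ tallied R j)
        body : ∀ j {s ω c′} → j < J → var s 62 ≡ j → var s 11 ≡ J → var s 4 ≡ 1 → I j s ω c′ → Run B tally s ω (6 + c′) (I (suc j))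
        body j {s} {ω} {c′} j< j≡ _ _ (le , v≡ , rr , cnt) = Run-map (λ (le′ , q) → ≤-trans le le′ , q) (Run-sure-wp tally
          (λ s′ _ → var s′ 0 ≡ verdict (suc j) × var s′ 7 ≡ R × (∀ j → j < J → arr s′ 3 j ≡ tallied R j)) ≤-refl
          ( w + w , cong₂ _+_ t≡ t≡ , ≤-<-trans w+w≤ R<B
          , w + w ∸ R , cong (w + w ∸_) rr , ≤-<-trans (≤-trans (m∸n≤m (w + w) R) w+w≤) R<B
          , (λ nz → ≤-<-trans (≤-trans R>0 (m≤m+n R _)) R<B , sym (pick-suc nz) , rr , cnt)
          , (λ z → trans v≡ (sym (pick-zero z)) , rr , cnt)))
          where
          w : ℕ
          w = tallied R j
          t≡ : arr s 3 (var s 62) ≡ w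
          t≡ = trans (cong (arr s 3) j≡) (cnt j j<)
          w+w≤ : w + w ≤ 2 * R
          w+w≤ = +-mono-≤ (tallied≤ R j) (≤-trans (tallied≤ R j) (m≤m+n R 0))

      solverTime : ℕ
      solverTime = BuildRun.buildTime B n J d l Ul Vl 4N<B (if decremental? v then 2 * suc d else 0) + (4 + (3 + R * (3 + repTime) + (1 + (3 + J * 9))))

      solver-run : ∀ {s} → (∀ r → r < R → Repetition r) →
        var s 0 ≡ n → var s 2 ≡ J → var s 3 ≡ d → (∀ x → var s (4 + x) ≡ 0) →
        (∀ k → arr s 0 k ≡ at 0 Ul k) → (∀ k → arr s 1 k ≡ at 0 Vl k) → (∀ k → arr s 2 k ≡ at 0 Wl k) → (∀ a k → arr s (3 + a) k ≡ 0) →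
        ∃ λ s′ → ∃ λ ω′ → ∃ λ τ → Exec B (solver A v l b threshold) s Ω s′ ω′ τ × τ ≤ solverTime × var s′ 0 ≡ verdict J
      solver-run {s} reps e₀ e₂ e₃ ez inU inV inW inZ = conclude (
        Run-step {t = buildTime Q} (Run-frame {Q′ = Sure rest (λ s′ ω′ → ω′ ≡ Ω × Idle₀ s′)} (keepTape (build-run dyn e₀ e₂ e₃ (ez 56) J<B (inU , inV) (inZ 7) (inZ 17))) (λ {s₁} kv ka (le , built , ω≡) → le , ω≡ , idle₀ s₁ built kv ka))
        (λ { {s₁} (refl , i₁) →
        Run-step {t = 4} (Run-sure-wp (const 61 (12 * b) ⨾ op 7 mul 12 61 ⨾ const 61 24 ⨾ op 7 add 7 61) (Idle 0) ≤-refl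
          ( ≤-<-trans (m≤m+n (12 * b) 24) b<B , d * (12 * b) , cong (_* (12 * b)) (proj₁ (proj₂ (proj₂ (proj₂ (proj₂ i₁))))) , ≤-<-trans (m≤m+n _ 24) R<B′
          , ≤-<-trans (m≤n+m 24 (12 * b)) b<B , R , refl , R<B′
          , ready i₁ )) (λ {s₂} {ω₂} I₂ →
        Run-step {t = 3 + R * (3 + repTime)} (repetitions-run reps I₂) (λ {s₃} {ω₃} I₃ →
        Run-step {t = 1} (Run-sure-wp (const 0 0) (λ s′ _ → var s′ 0 ≡ 0 × var s′ 4 ≡ 1 × var s′ 7 ≡ R × var s′ 11 ≡ J × (∀ j → j < J → arr s′ 3 j ≡ tallied R j)) ≤-refl
          (≤-<-trans z≤n J<B , refl , Idle.one≡ I₃ , Idle.R≡ I₃ , Idle.J≡ I₃ , Idle.counts I₃)) (λ (z , o , rr , eJ , cnt) →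
        tally-run z o rr eJ cnt))) }))
        where
        open BuildRun B n J d l Ul Vl 4N<B using (buildTime; Built; build-run)
        open Build.Env
        dyn : Bool
        dyn = decremental? v
        Q rest : ℕ
        Q = if dyn then 2 * suc d else 0
        rest = 4 + (3 + R * (3 + repTime) + (1 + (3 + J * 9 + 0)))
        R<B′ : R < B
        R<B′ = ≤-<-trans (m≤m+n R _) R<B
        Table₀ : State → Set
        Table₀ s = Holds (λ a i → arr s (5 + slot 0 a) i) σᵢ × (∀ a i → arr s (5 + slot 2 a) i ≡ 0) × (∀ a i → arr s (5 + slot 4 a) i ≡ 0)
        Idle₀ : State → Set
        Idle₀ s = Table₀ s × (var s 5 ≡ 0 × var s 6 ≡ 0 × var s 9 ≡ 0) × (var s 3 ≡ 0 × var s 4 ≡ 1) × var s 11 ≡ J × var s 12 ≡ d × var s 13 ≡ suc d × var s 15 ≡ 2 * suc d ×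
          (∀ k → arr s 2 k ≡ at 0 Wl k) × (∀ j → arr s 3 j ≡ 0)
        ready : ∀ {s₁} → Idle₀ s₁ → Idle 0 (setVar 7 R (setVar 61 24 (setVar 7 (d * (12 * b)) (setVar 61 (12 * b) s₁)))) Ω
        ready ((ini , st₁ , st₂) , (e₅ , e₆ , e₉) , (z , o) , eJ , ed , eD , e2D , W , cnt) =
          idle ini (λ a i → ≤-trans (≤-reflexive (st₁ a i)) z≤n) (λ a i → ≤-trans (≤-reflexive (st₂ a i)) z≤n)
            (cong (λ f → drop f Ω) (sym e₉)) (≤-trans (≤-reflexive e₉) z≤n) (λ q q< → contradiction (<-≤-trans q< (≤-reflexive e₉)) λ ())
            z o refl eJ ed eD e2D W (≤-reflexive e₆) (≤-reflexive e₅) (λ j _ → cnt j)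
        keepTape : ∀ {c} {Q : State → Set} → Run B (build dyn l) s Ω c (Sure rest (λ s′ _ → Q s′)) → Run B (build dyn l) s Ω c (Sure rest (λ s′ ω′ → Q s′ × ω′ ≡ Ω))
        keepTape (run c′ d le (r , q)) = run c′ d le (r , q , flipFree-tape (build dyn l) (build-flipFree dyn l) d)
        idle₀ : ∀ s₁ → Built dyn s₁ → (∀ x → keepsVar x (build dyn l) ≡ true → var s₁ x ≡ var s x) → (∀ a → keepsArr a (build dyn l) ≡ true → arr s₁ a ≡ arr s a) → Idle₀ s₁
        idle₀ s₁ (E , src , dst , eN , eM) kv ka =
          ((vars , arrs) , (λ a i → untouched 2 a i (s≤s (s≤s (s≤s z≤n))) (λ ())) , (λ a i → untouched 4 a i ≤-refl (λ ()))) ,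
          (trans (kv 5 (build-keepsVar dyn l 5 refl refl refl refl refl)) (ez 1) , trans (kv 6 (build-keepsVar dyn l 6 refl refl refl refl refl)) (ez 2) , trans (kv 9 (build-keepsVar dyn l 9 refl refl refl refl refl)) (ez 5)) ,
          (zero≡ E , one≡ E) , J≡ E , d≡ E , D≡ E , 2D≡ E ,
          (λ k → trans (cong (λ f → f k) (ka 2 (build-keepsArr dyn l 2 refl refl refl refl))) (inW k)) ,
          (λ k → trans (cong (λ f → f k) (ka 3 (build-keepsArr dyn l 3 refl refl refl refl))) (inZ 0 k))
          where
          -- Among the tables, the building phase writes only arrays 5, 10, 15 and 20. These are the
          -- initial values of cells 0 to 3, that is, of variables 0 and 1 and arrays 0 and 1 of the
          -- simulated program.
          untouched : ∀ j a i → j < 5 → (j ≡ 0 → 4 ≤ a) → arr s₁ (5 + slot j a) i ≡ 0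
          untouched j a i j< a≥ = trans (cong (λ f → f i) (ka (5 + slot j a) (build-keepsArr dyn l (5 + slot j a)
              (away 1 (s≤s (s≤s z≤n))) (away 3 (s≤s (s≤s (s≤s (s≤s z≤n))))) (away 0 (s≤s z≤n)) (away 2 (s≤s (s≤s (s≤s z≤n))))))) (inZ (2 + slot j a) i)
            where
            away : ∀ a′ → a′ < 4 → (slot 0 a′ ≡ᵇ slot j a) ≡ false
            away a′ a′< = ≡ᵇ-false (λ eq → let (p , q) = slot-injective 0 j a′ a (s≤s z≤n) j< eq in <⇒≱ a′< (≤-trans (a≥ (sym p)) (≤-reflexive (sym q))))
          vars : ∀ x → arr s₁ (5 + slot 0 (cellVar x)) 0 ≡ var σᵢ x
          vars 0 = trans eN (sym σᵢ-N)
          vars 1 = trans eM (sym σᵢ-M)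
          vars (suc (suc x)) = trans (untouched 0 (cellVar (2 + x)) 0 (s≤s z≤n) (λ _ → *-monoʳ-≤ 2 (s≤s (s≤s z≤n)))) (sym (σᵢ-var x))
          arrs : ∀ a i → arr s₁ (5 + slot 0 (cellArr a)) i ≡ arr σᵢ a i
          arrs 0 i = trans (src i) (sym (σᵢ-src i))
          arrs 1 i = trans (dst i) (sym (σᵢ-dst i))
          arrs (suc (suc a)) i = trans (untouched 0 (cellArr (2 + a)) i (s≤s z≤n) (λ _ → ≤-trans (*-monoʳ-≤ 2 (s≤s (s≤s (z≤n {a})))) (n≤1+n _))) (sym (σᵢ-arr a i))
        conclude : Run B (solver A v l b threshold) s Ω (buildTime Q + rest) (Sure 0 (λ s′ _ → var s′ 0 ≡ verdict J)) → _
        conclude (run {s′} {ω′} {τ} c′ d le (_ , v≡)) = s′ , ω′ , τ , d , ≤-trans (m+n≤o⇒m≤o τ le) (+-monoʳ-≤ (buildTime Q) (≤-reflexive (cong (λ x → 4 + (3 + R * (3 + repTime) + (1 + x))) (+-identityʳ (3 + J * 9))))) , v≡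

open Solving

-- Distances, eccentricities and the radius

module Radius where

  least : ∀ {P : ℕ → Set} → (∀ k → Dec (P k)) → ∀ k → P k → ∃ λ m → P m × (∀ m′ → P m′ → m ≤ m′)
  least P? zero p = zero , p , λ _ _ → z≤n
  least P? (suc k) p with P? zero
  ... | yes q = zero , q , λ _ _ → z≤n
  ... | no ¬q with m , q , m≤ ← least (λ k → P? (suc k)) k p =
    suc m , q , λ { zero q′ → contradiction q′ ¬q ; (suc m′) q′ → s≤s (m≤ m′ q′) }

  argmax : ∀ {n} (f : Fin (suc n) → ℕ) → ∃ λ u → ∀ v → f v ≤ f u
  argmax {zero}  f = zero , λ { zero → ≤-refl }
  argmax {suc n} f with u , max ← argmax (λ i → f (suc i)) with ≤-total (f zero) (f (suc u))
  ... | inj₁ le = suc u , λ { zero → le ; (suc v) → max v }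
  ... | inj₂ ge = zero , λ { zero → ≤-refl ; (suc v) → ≤-trans (max v) ge }

  argmin : ∀ {n} (f : Fin (suc n) → ℕ) → ∃ λ u → ∀ v → f u ≤ f v
  argmin {zero}  f = zero , λ { zero → ≤-refl }
  argmin {suc n} f with u , min ← argmin (λ i → f (suc i)) with ≤-total (f zero) (f (suc u))
  ... | inj₁ le = zero , λ { zero → ≤-refl ; (suc v) → ≤-trans le (min v) }
  ... | inj₂ ge = suc u , λ { zero → ge ; (suc v) → min v }

  module _ {N : ℕ} (G : EdgeList N) where

    Adjacent-sym : ∀ {x y} → Adjacent G x y → Adjacent G y x
    Adjacent-sym (inj₁ e) = inj₂ e
    Adjacent-sym (inj₂ e) = inj₁ e

    _◅◅_ : ∀ {x y z k l} → Path G x y k → Path G y z l → Path G x z (k + l)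
    []      ◅◅ q = q
    (a ∷ p) ◅◅ q = a ∷ (p ◅◅ q)

    Path-sym : ∀ {x y k} → Path G x y k → Path G y x k
    Path-sym [] = []
    Path-sym {k = suc k} (a ∷ p) = subst (Path G _ _) (+-comm k 1) (Path-sym p ◅◅ (Adjacent-sym a ∷ []))

    -- Applied with potential 0 at the end vertex, this bounds all distances to it from below
    -- without a case analysis of paths.
    Path-potential : (φ : Fin N → ℕ) → (∀ {x y} → Adjacent G x y → φ x ≤ suc (φ y)) → ∀ {x y k} → Path G x y k → φ x ≤ k + φ y
    Path-potential φ lip []      = ≤-refl
    Path-potential φ lip (a ∷ p) = ≤-trans (lip a) (s≤s (Path-potential φ lip p))

    Adjacent? : ∀ x y → Dec (Adjacent G x y)
    Adjacent? x y = (DecMembership._∈?_ (≡-dec Finₚ._≟_ Finₚ._≟_) (x , y) G) ⊎-dec (DecMembership._∈?_ (≡-dec Finₚ._≟_ Finₚ._≟_) (y , x) G)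

    -- Decidability lets `least` find shortest paths by search. A radius has to be exhibited before
    -- `ApproximatesRadius`, which is conditional on `IsRadius`, yields anything.
    Path? : ∀ k x y → Dec (Path G x y k)
    Path? zero    x y = map′ (λ { refl → [] }) (λ { [] → refl }) (x Finₚ.≟ y)
    Path? (suc k) x y = map′ (λ (_ , a , p) → a ∷ p) (λ { (a ∷ p) → _ , a , p })
                          (Finₚ.any? (λ z → Adjacent? x z ×-dec Path? k z y))

    Connected : Set
    Connected = ∀ x y → ∃ λ k → Path G x y k

    distance : Connected → ∀ x y → ∃ λ k → IsDistance G x y k
    distance conn x y with k , p ← conn x y = least (λ k → Path? k x y) k p

  module _ {N : ℕ} (G : EdgeList (suc N)) (conn : Connected G) where

    eccentricity : ∀ v → ∃ λ e → IsEccentricity G v e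
    eccentricity v with u , max ← argmax (λ u → proj₁ (distance G conn v u)) =
      _ , (λ u′ → _ , proj₂ (distance G conn v u′) , max u′) , (u , proj₂ (distance G conn v u))

    IsEccentricity-unique : ∀ {v e e′} → IsEccentricity G v e → IsEccentricity G v e′ → e ≤ e′
    IsEccentricity-unique (_ , u , p , min) (far , _) with l , (q , _) , l≤ ← far u = ≤-trans (min l q) l≤

    radius : ∃ λ r → IsRadius G r
    radius with v , min ← argmin (λ v → proj₁ (eccentricity v)) =
      _ , (v , proj₂ (eccentricity v)) , λ w e ecc → ≤-trans (min w) (IsEccentricity-unique (proj₂ (eccentricity w)) ecc)

    radius-upper : ∀ {r v b} → IsRadius G r → (∀ u → ∃ λ k → Path G v u k × k ≤ b) → r ≤ b
    radius-upper {v = v} (_ , min) near with e , ecc@(_ , u , _ , le) ← eccentricity v with k , p , k≤ ← near u =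
      ≤-trans (min v e ecc) (≤-trans (le k p) k≤)

  radius-lower : ∀ {N} (G : EdgeList N) {r b} → IsRadius G r → (∀ v → ∃ λ u → ∀ k → Path G v u k → b ≤ k) → b ≤ r
  radius-lower G ((v , all , _) , _) far with u , le ← far v with k , (p , _) , k≤ ← all u = ≤-trans (le k p) k≤

open Radius

-- Named vertices and their numbers

module Vertices where

  split-case : ∀ m n (P : Fin (m + n) → Set) → (∀ i → P (i ↑ˡ n)) → (∀ j → P (m ↑ʳ j)) → ∀ x → P x
  split-case m n P p q x with splitAt m x in eq
  ... | inj₁ i = subst P (Finₚ.splitAt⁻¹-↑ˡ eq) (p i)
  ... | inj₂ j = subst P (Finₚ.splitAt⁻¹-↑ʳ {m} eq) (q j)

  combine-case : ∀ m n (P : Fin (m * n) → Set) → (∀ i j → P (combine i j)) → ∀ x → P x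
  combine-case m n P p x = subst P (Finₚ.combine-remQuot {m} n x) (p (proj₁ (remQuot {m} n x)) (proj₂ (remQuot {m} n x)))

  quotient-of : ∀ D .{{_ : NonZero D}} q {i} → i < D → (D * q + i) / D ≡ q
  quotient-of D q {i} i< = trans (cong (_/ D) (trans (+-comm (D * q) i) (cong (i +_) (*-comm D q))))
    (trans (+-distrib-/-∣ʳ i (n∣m*n q)) (cong₂ _+_ (m<n⇒m/n≡0 i<) (m*n/n≡m q D)))

  remainder-of : ∀ D .{{_ : NonZero D}} q {i} → i < D → (D * q + i) % D ≡ i
  remainder-of D q {i} i< = trans (cong (_% D) (trans (+-comm (D * q) i) (cong (i +_) (*-comm D q))))
    (trans ([m+kn]%n≡m%n i q D) (m<n⇒m%n≡m i<))

  module Graph (n d l : ℕ) (Ul Vl : List ℕ) where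
    open Layout n d l
    open Bits Ul Vl

    -- C k i and C′ k i are cc k i and cc (2 + k) i; ff k is the extra row of U
    -- in copy k.
    data Vtx : Set where
      cc    : Fin 4 → Fin D → Vtx
      yy ff : Fin 2 → Vtx
      uu    : Fin n → Vtx
      vv    : Fin 2 → Fin (suc n) → Vtx
      mm ss : Fin 2 → Fin (suc n) → Fin D → Vtx
      ii    : Fin 2 → Fin (suc n) → Fin D → Fin 5 → Fin (suc l) → Vtx

    index : Fin 2 → Fin (suc n) → Fin D → Fin X
    index k a i = combine (combine k a) i

    Iₙ : ℕ
    Iₙ = X * (5 * suc l)

    enc : Vtx → Fin N
    enc (cc κ i)       = (((((combine κ i ↑ˡ 2) ↑ˡ (n + 2)) ↑ˡ (2 * suc n)) ↑ˡ X) ↑ˡ X) ↑ˡ Iₙ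
    enc (yy k)         = (((((4 * D ↑ʳ k) ↑ˡ (n + 2)) ↑ˡ (2 * suc n)) ↑ˡ X) ↑ˡ X) ↑ˡ Iₙ
    enc (uu a)         = ((((uBase ↑ʳ (a ↑ˡ 2)) ↑ˡ (2 * suc n)) ↑ˡ X) ↑ˡ X) ↑ˡ Iₙ
    enc (ff k)         = ((((uBase ↑ʳ (n ↑ʳ k)) ↑ˡ (2 * suc n)) ↑ˡ X) ↑ˡ X) ↑ˡ Iₙ
    enc (vv k a)       = (((vBase ↑ʳ combine k a) ↑ˡ X) ↑ˡ X) ↑ˡ Iₙ
    enc (mm k a i)     = ((mBase ↑ʳ index k a i) ↑ˡ X) ↑ˡ Iₙ
    enc (ss k a i)     = (sBase ↑ʳ index k a i) ↑ˡ Iₙ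
    enc (ii k a i κ s) = iBase ↑ʳ combine (index k a i) (combine κ s)

    private
      triple : (Fin 2 → Fin (suc n) → Fin D → Vtx) → Fin X → Vtx
      triple f x = let (q , i) = remQuot D x ; (k , a) = remQuot (suc n) q in f k a i

      triple-index : ∀ f k a i → triple f (index k a i) ≡ f k a i
      triple-index f k a i = trans
        (cong (λ p → let (k , a) = remQuot (suc n) (proj₁ p) in f k a (proj₂ p)) (Finₚ.remQuot-combine (combine k a) i))
        (cong (λ p → f (proj₁ p) (proj₂ p) i) (Finₚ.remQuot-combine k a))

      decA : Fin uBase → Vtx
      decA x = [ (λ c → let (κ , i) = remQuot D c in cc κ i) , yy ]′ (splitAt (4 * D) x)
      decB : Fin vBase → Vtx
      decB x = [ decA , (λ y → [ uu , ff ]′ (splitAt n y)) ]′ (splitAt uBase x)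
      decC : Fin mBase → Vtx
      decC x = [ decB , (λ q → let (k , a) = remQuot (suc n) q in vv k a) ]′ (splitAt vBase x)
      decD : Fin sBase → Vtx
      decD x = [ decC , triple mm ]′ (splitAt mBase x)
      decE : Fin iBase → Vtx
      decE x = [ decD , triple ss ]′ (splitAt sBase x)

    -- Potentials are given by cases on named vertices; composition with `dec` turns them into
    -- functions on the numbered ones.
    dec : Fin N → Vtx
    dec x = [ decE , (λ z → let (y , r) = remQuot (5 * suc l) z ; (κ , s) = remQuot (suc l) r in triple (λ k a i → ii k a i κ s) y) ]′ (splitAt iBase x)

    dec-enc : ∀ v → dec (enc v) ≡ v
    dec-enc (cc κ i)
      rewrite Finₚ.splitAt-↑ˡ iBase (((((combine κ i ↑ˡ 2) ↑ˡ (n + 2)) ↑ˡ (2 * suc n)) ↑ˡ X) ↑ˡ X) Iₙ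
            | Finₚ.splitAt-↑ˡ sBase ((((combine κ i ↑ˡ 2) ↑ˡ (n + 2)) ↑ˡ (2 * suc n)) ↑ˡ X) X
            | Finₚ.splitAt-↑ˡ mBase (((combine κ i ↑ˡ 2) ↑ˡ (n + 2)) ↑ˡ (2 * suc n)) X
            | Finₚ.splitAt-↑ˡ vBase ((combine κ i ↑ˡ 2) ↑ˡ (n + 2)) (2 * suc n)
            | Finₚ.splitAt-↑ˡ uBase (combine κ i ↑ˡ 2) (n + 2)
            | Finₚ.splitAt-↑ˡ (4 * D) (combine κ i) 2
            = cong (λ p → cc (proj₁ p) (proj₂ p)) (Finₚ.remQuot-combine κ i)
    dec-enc (yy k)
      rewrite Finₚ.splitAt-↑ˡ iBase (((((4 * D ↑ʳ k) ↑ˡ (n + 2)) ↑ˡ (2 * suc n)) ↑ˡ X) ↑ˡ X) Iₙ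
            | Finₚ.splitAt-↑ˡ sBase ((((4 * D ↑ʳ k) ↑ˡ (n + 2)) ↑ˡ (2 * suc n)) ↑ˡ X) X
            | Finₚ.splitAt-↑ˡ mBase (((4 * D ↑ʳ k) ↑ˡ (n + 2)) ↑ˡ (2 * suc n)) X
            | Finₚ.splitAt-↑ˡ vBase ((4 * D ↑ʳ k) ↑ˡ (n + 2)) (2 * suc n)
            | Finₚ.splitAt-↑ˡ uBase (4 * D ↑ʳ k) (n + 2)
            | Finₚ.splitAt-↑ʳ (4 * D) 2 k = refl
    dec-enc (uu a)
      rewrite Finₚ.splitAt-↑ˡ iBase ((((uBase ↑ʳ (a ↑ˡ 2)) ↑ˡ (2 * suc n)) ↑ˡ X) ↑ˡ X) Iₙ
            | Finₚ.splitAt-↑ˡ sBase (((uBase ↑ʳ (a ↑ˡ 2)) ↑ˡ (2 * suc n)) ↑ˡ X) X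
            | Finₚ.splitAt-↑ˡ mBase ((uBase ↑ʳ (a ↑ˡ 2)) ↑ˡ (2 * suc n)) X
            | Finₚ.splitAt-↑ˡ vBase (uBase ↑ʳ (a ↑ˡ 2)) (2 * suc n)
            | Finₚ.splitAt-↑ʳ uBase (n + 2) (a ↑ˡ 2)
            | Finₚ.splitAt-↑ˡ n a 2 = refl
    dec-enc (ff k)
      rewrite Finₚ.splitAt-↑ˡ iBase ((((uBase ↑ʳ (n ↑ʳ k)) ↑ˡ (2 * suc n)) ↑ˡ X) ↑ˡ X) Iₙ
            | Finₚ.splitAt-↑ˡ sBase (((uBase ↑ʳ (n ↑ʳ k)) ↑ˡ (2 * suc n)) ↑ˡ X) X
            | Finₚ.splitAt-↑ˡ mBase ((uBase ↑ʳ (n ↑ʳ k)) ↑ˡ (2 * suc n)) X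
            | Finₚ.splitAt-↑ˡ vBase (uBase ↑ʳ (n ↑ʳ k)) (2 * suc n)
            | Finₚ.splitAt-↑ʳ uBase (n + 2) (n ↑ʳ k)
            | Finₚ.splitAt-↑ʳ n 2 k = refl
    dec-enc (vv k a)
      rewrite Finₚ.splitAt-↑ˡ iBase (((vBase ↑ʳ combine k a) ↑ˡ X) ↑ˡ X) Iₙ
            | Finₚ.splitAt-↑ˡ sBase ((vBase ↑ʳ combine k a) ↑ˡ X) X
            | Finₚ.splitAt-↑ˡ mBase (vBase ↑ʳ combine k a) X
            | Finₚ.splitAt-↑ʳ vBase (2 * suc n) (combine k a)
            = cong (λ p → vv (proj₁ p) (proj₂ p)) (Finₚ.remQuot-combine k a)
    dec-enc (mm k a i)
      rewrite Finₚ.splitAt-↑ˡ iBase ((mBase ↑ʳ index k a i) ↑ˡ X) Iₙ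
            | Finₚ.splitAt-↑ˡ sBase (mBase ↑ʳ index k a i) X
            | Finₚ.splitAt-↑ʳ mBase X (index k a i) = triple-index mm k a i
    dec-enc (ss k a i)
      rewrite Finₚ.splitAt-↑ˡ iBase (sBase ↑ʳ index k a i) Iₙ
            | Finₚ.splitAt-↑ʳ sBase X (index k a i) = triple-index ss k a i
    dec-enc (ii k a i κ s)
      rewrite Finₚ.splitAt-↑ʳ iBase Iₙ (combine (index k a i) (combine κ s))
            = trans (cong (λ p → let (κ , s) = remQuot (suc l) (proj₂ p) in triple (λ k a i → ii k a i κ s) (proj₁ p)) (Finₚ.remQuot-combine (index k a i) (combine κ s)))
                (trans (cong (λ p → triple (λ k a i → ii k a i (proj₁ p) (proj₂ p)) (index k a i)) (Finₚ.remQuot-combine κ s))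
                  (triple-index (λ k a i → ii k a i κ s) k a i))

    private
      index-case : (P : Fin X → Set) → (∀ k a i → P (index k a i)) → ∀ x → P x
      index-case P p = combine-case (2 * suc n) D P (λ q i → combine-case 2 (suc n) (λ q → P (combine q i)) (λ k a → p k a i) q)

      Encoded : Fin N → Set
      Encoded x = ∃ λ v → enc v ≡ x
      EncodedE : Fin iBase → Set
      EncodedE x = Encoded (x ↑ˡ Iₙ)
      EncodedD : Fin sBase → Set
      EncodedD x = EncodedE (x ↑ˡ X)
      EncodedC : Fin mBase → Set
      EncodedC x = EncodedD (x ↑ˡ X)
      EncodedB : Fin vBase → Set
      EncodedB x = EncodedC (x ↑ˡ (2 * suc n))
      EncodedA : Fin uBase → Set
      EncodedA x = EncodedB (x ↑ˡ (n + 2))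

    enc-surjective : ∀ x → ∃ λ v → enc v ≡ x
    enc-surjective =
      split-case iBase Iₙ Encoded
        (split-case sBase X EncodedE
          (split-case mBase X EncodedD
            (split-case vBase (2 * suc n) EncodedC
              (split-case uBase (n + 2) EncodedB
                (split-case (4 * D) 2 EncodedA
                  (combine-case 4 D (λ x → EncodedA (x ↑ˡ 2)) (λ κ i → cc κ i , refl))
                  (λ k → yy k , refl))
                (split-case n 2 (λ x → EncodedB (uBase ↑ʳ x)) (λ a → uu a , refl) (λ k → ff k , refl)))
              (combine-case 2 (suc n) (λ x → EncodedC (vBase ↑ʳ x)) (λ k a → vv k a , refl)))
            (index-case (λ x → EncodedD (mBase ↑ʳ x)) (λ k a i → mm k a i , refl)))
          (index-case (λ x → EncodedE (sBase ↑ʳ x)) (λ k a i → ss k a i , refl)))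
        (combine-case X (5 * suc l) (λ x → Encoded (iBase ↑ʳ x)) (λ y r →
          index-case (λ y → Encoded (iBase ↑ʳ combine y r)) (λ k a i →
            combine-case 5 (suc l) (λ r → Encoded (iBase ↑ʳ combine (index k a i) r)) (λ κ s → ii k a i κ s , refl) r) y))

    num : Vtx → ℕ
    num v = toℕ (enc v)

    indexℕ : Fin 2 → Fin (suc n) → Fin D → ℕ
    indexℕ k a i = D * (suc n * toℕ k + toℕ a) + toℕ i

    toℕ-index : ∀ k a i → toℕ (index k a i) ≡ indexℕ k a i
    toℕ-index k a i = trans (Finₚ.toℕ-combine (combine k a) i) (cong (λ q → D * q + toℕ i) (Finₚ.toℕ-combine k a))

    num-cc : ∀ κ i → num (cc κ i) ≡ D * toℕ κ + toℕ i
    num-cc κ i rewrite Finₚ.toℕ-↑ˡ (((((combine κ i ↑ˡ 2) ↑ˡ (n + 2)) ↑ˡ (2 * suc n)) ↑ˡ X) ↑ˡ X) Iₙ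
      | Finₚ.toℕ-↑ˡ ((((combine κ i ↑ˡ 2) ↑ˡ (n + 2)) ↑ˡ (2 * suc n)) ↑ˡ X) X
      | Finₚ.toℕ-↑ˡ (((combine κ i ↑ˡ 2) ↑ˡ (n + 2)) ↑ˡ (2 * suc n)) X
      | Finₚ.toℕ-↑ˡ ((combine κ i ↑ˡ 2) ↑ˡ (n + 2)) (2 * suc n)
      | Finₚ.toℕ-↑ˡ (combine κ i ↑ˡ 2) (n + 2) | Finₚ.toℕ-↑ˡ (combine κ i) 2 = Finₚ.toℕ-combine κ i

    num-yy : ∀ k → num (yy k) ≡ 4 * D + toℕ k
    num-yy k rewrite Finₚ.toℕ-↑ˡ (((((4 * D ↑ʳ k) ↑ˡ (n + 2)) ↑ˡ (2 * suc n)) ↑ˡ X) ↑ˡ X) Iₙ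
      | Finₚ.toℕ-↑ˡ ((((4 * D ↑ʳ k) ↑ˡ (n + 2)) ↑ˡ (2 * suc n)) ↑ˡ X) X
      | Finₚ.toℕ-↑ˡ (((4 * D ↑ʳ k) ↑ˡ (n + 2)) ↑ˡ (2 * suc n)) X
      | Finₚ.toℕ-↑ˡ ((4 * D ↑ʳ k) ↑ˡ (n + 2)) (2 * suc n)
      | Finₚ.toℕ-↑ˡ (4 * D ↑ʳ k) (n + 2) = Finₚ.toℕ-↑ʳ (4 * D) k

    num-uu : ∀ a → num (uu a) ≡ uBase + toℕ a
    num-uu a rewrite Finₚ.toℕ-↑ˡ ((((uBase ↑ʳ (a ↑ˡ 2)) ↑ˡ (2 * suc n)) ↑ˡ X) ↑ˡ X) Iₙ
      | Finₚ.toℕ-↑ˡ (((uBase ↑ʳ (a ↑ˡ 2)) ↑ˡ (2 * suc n)) ↑ˡ X) X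
      | Finₚ.toℕ-↑ˡ ((uBase ↑ʳ (a ↑ˡ 2)) ↑ˡ (2 * suc n)) X
      | Finₚ.toℕ-↑ˡ (uBase ↑ʳ (a ↑ˡ 2)) (2 * suc n)
      | Finₚ.toℕ-↑ʳ uBase (a ↑ˡ 2) | Finₚ.toℕ-↑ˡ a 2 = refl

    num-ff : ∀ k → num (ff k) ≡ uBase + (n + toℕ k)
    num-ff k rewrite Finₚ.toℕ-↑ˡ ((((uBase ↑ʳ (n ↑ʳ k)) ↑ˡ (2 * suc n)) ↑ˡ X) ↑ˡ X) Iₙ
      | Finₚ.toℕ-↑ˡ (((uBase ↑ʳ (n ↑ʳ k)) ↑ˡ (2 * suc n)) ↑ˡ X) X
      | Finₚ.toℕ-↑ˡ ((uBase ↑ʳ (n ↑ʳ k)) ↑ˡ (2 * suc n)) X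
      | Finₚ.toℕ-↑ˡ (uBase ↑ʳ (n ↑ʳ k)) (2 * suc n)
      | Finₚ.toℕ-↑ʳ uBase (n ↑ʳ k) | Finₚ.toℕ-↑ʳ n k = refl

    num-vv : ∀ k a → num (vv k a) ≡ vBase + (suc n * toℕ k + toℕ a)
    num-vv k a rewrite Finₚ.toℕ-↑ˡ (((vBase ↑ʳ combine k a) ↑ˡ X) ↑ˡ X) Iₙ
      | Finₚ.toℕ-↑ˡ ((vBase ↑ʳ combine k a) ↑ˡ X) X
      | Finₚ.toℕ-↑ˡ (vBase ↑ʳ combine k a) X
      | Finₚ.toℕ-↑ʳ vBase (combine k a) | Finₚ.toℕ-combine k a = refl

    num-mm : ∀ k a i → num (mm k a i) ≡ mBase + indexℕ k a i
    num-mm k a i rewrite Finₚ.toℕ-↑ˡ ((mBase ↑ʳ index k a i) ↑ˡ X) Iₙ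
      | Finₚ.toℕ-↑ˡ (mBase ↑ʳ index k a i) X | Finₚ.toℕ-↑ʳ mBase (index k a i) | toℕ-index k a i = refl

    num-ss : ∀ k a i → num (ss k a i) ≡ sBase + indexℕ k a i
    num-ss k a i rewrite Finₚ.toℕ-↑ˡ (sBase ↑ʳ index k a i) Iₙ | Finₚ.toℕ-↑ʳ sBase (index k a i) | toℕ-index k a i = refl

    num-ii : ∀ k a i κ s → num (ii k a i κ s) ≡ iBase + indexℕ k a i * (5 * suc l) + toℕ κ * suc l + toℕ s
    num-ii k a i κ s rewrite Finₚ.toℕ-↑ʳ iBase (combine (index k a i) (combine κ s))
      | Finₚ.toℕ-combine (index k a i) (combine κ s) | Finₚ.toℕ-combine κ s | toℕ-index k a i = arith iBase (suc l) (indexℕ k a i) (toℕ κ) (toℕ s)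
      where
      arith : ∀ b m x κ s → b + (5 * m * x + (m * κ + s)) ≡ b + x * (5 * m) + κ * m + s
      arith = solve-∀

open Vertices

-- Edges between named vertices and the emitted list

module EdgeSets where

  chainE-cong : ∀ {l h h′ t t′ f f′ b b′} → h ≡ h′ → t ≡ t′ → f ≡ f′ → b ≡ b′ → chainE l h t f b ≡ chainE l h′ t′ f′ b′
  chainE-cong refl refl refl refl = refl

  tabulate-pathE : ∀ l b (g : Fin l → ℕ × ℕ) → (∀ s → g s ≡ (b + toℕ s , suc (b + toℕ s))) → tabulate g ≡ pathE l b
  tabulate-pathE zero    b g eq = refl
  tabulate-pathE (suc l) b g eq = cong₂ _∷_ (trans (eq zero) (cong (λ x → x , suc x) (+-identityʳ b)))
    (tabulate-pathE l (suc b) (g ∘ suc) (λ s → trans (eq (suc s)) (cong (λ x → x , suc x) (+-suc b (toℕ s)))))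

  -- New edges are listed in the order of their larger endpoints, which lie in
  -- the interval [ lo , hi ).
  Span : (lo hi : ℕ) → RawEdges → Set
  Span lo hi es = Unique es × All (λ e → proj₁ e < proj₂ e × lo ≤ proj₂ e × proj₂ e < hi) es

  Span-[] : ∀ {a b} → Span a b []
  Span-[] = [] , []

  Span-++ : ∀ {a b c xs ys} → a ≤ b → b ≤ c → Span a b xs → Span b c ys → Span a c (xs ++ ys)
  Span-++ a≤b b≤c (ux , ax) (uy , ay) =
    AllPairsₚ.++⁺ ux uy (All.map (λ (_ , _ , <b) → All.map (λ { (_ , b≤ , _) refl → <⇒≱ <b b≤ }) ay) ax) ,
    Allₚ.++⁺ (All.map (λ (o , a≤ , <b) → o , a≤ , <-≤-trans <b b≤c) ax) (All.map (λ (o , b≤ , <c) → o , ≤-trans a≤b b≤ , <c) ay)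

  pathE-All : ∀ l b → All (λ e → b ≤ proj₁ e × proj₁ e < proj₂ e × b < proj₂ e × proj₂ e ≤ b + l) (pathE l b)
  pathE-All zero    b = []
  pathE-All (suc l) b = (≤-refl , n<1+n b , n<1+n b , ≤-trans (s≤s (m≤m+n b l)) (≤-reflexive (sym (+-suc b l)))) ∷
    All.map (λ (b≤ , o , b< , ≤l) → <⇒≤ b≤ , o , <-trans (n<1+n b) b< , ≤-trans ≤l (≤-reflexive (sym (+-suc b l)))) (pathE-All l (suc b))

  pathE-Unique : ∀ l b → Unique (pathE l b)
  pathE-Unique zero    b = []
  pathE-Unique (suc l) b = All.map (λ { (b≤ , _) refl → <-irrefl refl b≤ }) (pathE-All l (suc b)) ∷ pathE-Unique l (suc b)

  -- `1 ≤ l` separates the larger endpoints `b` and `b + l` of the first and the last edge, which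
  -- would be one edge listed twice if `l` were 0 and `h` equal to `t`.
  chainE-Span : ∀ l h t f b → 1 ≤ l → h < b → t < b → Span b (b + suc l) (chainE l h t f b)
  chainE-Span l h t f b 1≤l h< t< = unique , all
    where
    last : Span b (b + suc l) (pick f [] ((t , b + l) ∷ []))
    last = closing f
      where
      closing : ∀ f → Span b (b + suc l) (pick f [] ((t , b + l) ∷ []))
      closing zero    = Span-[]
      closing (suc _) = [] ∷ [] , (<-≤-trans t< (m≤m+n b l) , m≤m+n b l , +-monoʳ-< b (n<1+n l)) ∷ []
    last-t : All (λ e → e ≡ (t , b + l)) (pick f [] ((t , b + l) ∷ []))
    last-t = closing f
      where
      closing : ∀ f → All (λ e → e ≡ (t , b + l)) (pick f [] ((t , b + l) ∷ []))
      closing zero    = []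
      closing (suc _) = refl ∷ []
    unique : Unique (chainE l h t f b)
    unique = Allₚ.++⁺ (All.map (λ { (_ , _ , b< , _) refl → <-irrefl refl b< }) (pathE-All l b))
                      (All.map (λ { refl eq → <⇒≢ (≤-trans (≤-reflexive (+-comm 1 b)) (+-monoʳ-≤ b 1≤l)) (cong proj₂ eq) }) last-t) ∷
      AllPairsₚ.++⁺ (pathE-Unique l b) (proj₁ last) (All.map (λ (b≤ , _) → All.map (λ { refl refl → <⇒≱ t< b≤ }) last-t) (pathE-All l b))
    all : All (λ e → proj₁ e < proj₂ e × b ≤ proj₂ e × proj₂ e < b + suc l) (chainE l h t f b)
    all = (h< , ≤-refl , m<m+n b (s≤s z≤n)) ∷ Allₚ.++⁺ (All.map (λ (_ , o , b< , ≤l) → o , <⇒≤ b< , ≤-<-trans ≤l (+-monoʳ-< b (n<1+n l))) (pathE-All l b)) (proj₂ last)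

  module Edges (n d l : ℕ) (Ul Vl : List ℕ) where
    open Layout n d l
    open Bits Ul Vl
    open Graph n d l Ul Vl

    C C′ : Fin 2 → Fin D → Vtx
    C  k i = cc (k ↑ˡ 2) i
    C′ k i = cc (2 ↑ʳ k) i

    -- The vertices `uu a` do not depend on `k` and are the only link between the copies. The extra
    -- row is kept separate, since a shared row of ones would open a short route from one copy to
    -- the other.
    row : Fin 2 → Fin (suc n) → Vtx
    row k a with n ≟ toℕ a
    ... | yes _ = ff k
    ... | no n≢ = uu (lower₁ a n≢)

    num-C : ∀ k i → num (C k i) ≡ D * toℕ k + toℕ i
    num-C k i = trans (num-cc (k ↑ˡ 2) i) (cong (λ x → D * x + toℕ i) (Finₚ.toℕ-↑ˡ k 2))

    num-C′ : ∀ k i → num (C′ k i) ≡ 2 * D + (D * toℕ k + toℕ i)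
    num-C′ k i = trans (num-cc (2 ↑ʳ k) i) (trans (cong (λ x → D * x + toℕ i) (Finₚ.toℕ-↑ʳ 2 k)) (arith D (toℕ k) (toℕ i)))
      where
      arith : ∀ D k i → D * (2 + k) + i ≡ 2 * D + (D * k + i)
      arith = solve-∀

    num-row : ∀ k a → num (row k a) ≡ uNode (toℕ k) (toℕ a)
    num-row k a with n ≟ toℕ a
    ... | yes n≡ = trans (num-ff k) (cong (uBase +_) (sym (pick-zero {y = toℕ a} (trans (cong (_∸ toℕ a) n≡) (n∸n≡0 (toℕ a))))))
    ... | no n≢ = trans (num-uu (lower₁ a n≢)) (cong (uBase +_) (trans (Finₚ.toℕ-lower₁ a n≢)
            (sym (pick-suc {x = n + toℕ k} (m>n⇒m∸n≢0 (≤∧≢⇒< (s≤s⁻¹ (Finₚ.toℕ<n a)) (λ eq → n≢ (sym eq))))))))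

    chainS : Fin 2 → Fin (suc n) → Fin D → Fin 5 → (h t : Vtx) → ℕ → List (Vtx × Vtx)
    chainS k a i κ h t f =
      (h , ii k a i κ zero) ∷ tabulate (λ (s : Fin l) → ii k a i κ (inject₁ s) , ii k a i κ (suc s)) ++
      pick f [] ((t , ii k a i κ (lastFin l)) ∷ [])

    heads tails : Fin 2 → Fin (suc n) → Fin D → Fin 5 → Vtx
    heads k a i zero                         = yy k
    heads k a i (suc zero)                   = mm k a i
    heads k a i (suc (suc zero))             = mm k a i
    heads k a i (suc (suc (suc zero)))       = vv k a
    heads k a i (suc (suc (suc (suc zero)))) = vv k a
    tails k a i zero                         = mm k a i
    tails k a i (suc zero)                   = row k a
    tails k a i (suc (suc zero))             = C k i
    tails k a i (suc (suc (suc zero)))       = C′ k i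
    tails k a i (suc (suc (suc (suc zero)))) = ss k a i

    closed : Fin (suc n) → Fin D → Fin 5 → ℕ
    closed a i zero                         = 1
    closed a i (suc zero)                   = 1
    closed a i (suc (suc zero))             = uBit (toℕ a) (toℕ i)
    closed a i (suc (suc (suc zero)))       = vBit (toℕ a) (toℕ i)
    closed a i (suc (suc (suc (suc zero)))) = 1

    chain : Fin 2 → Fin (suc n) → Fin D → Fin 5 → List (Vtx × Vtx)
    chain k a i κ = chainS k a i κ (heads k a i κ) (tails k a i κ) (closed a i κ)

    κ₁ κ₂ κ₃ κ₄ : Fin 5
    κ₁ = suc zero
    κ₂ = suc (suc zero)
    κ₃ = suc (suc (suc zero))
    κ₄ = suc (suc (suc (suc zero)))

    blockS : Fin 2 → Fin (suc n) → Fin D → List (Vtx × Vtx)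
    blockS k a i = chain k a i zero ++ chain k a i κ₁ ++ chain k a i κ₂ ++ chain k a i κ₃ ++ chain k a i κ₄

    raw : Vtx × Vtx → ℕ × ℕ
    raw (v , w) = num v , num w

    chainBase : Fin 2 → Fin (suc n) → Fin D → Fin 5 → ℕ
    chainBase k a i κ = iBase + indexℕ k a i * (5 * suc l) + toℕ κ * suc l

    chainS-raw : ∀ k a i κ h t f → map raw (chainS k a i κ h t f) ≡ chainE l (num h) (num t) f (chainBase k a i κ)
    chainS-raw k a i κ h t f = cong₂ _∷_ (cong (num h ,_) (trans (num-ii k a i κ zero) (+-identityʳ _)))
      (trans (map-++ raw (tabulate (λ (s : Fin l) → ii k a i κ (inject₁ s) , ii k a i κ (suc s))) _)
        (cong₂ _++_ (trans (map-tabulate _ raw) (tabulate-pathE l (chainBase k a i κ) _ (λ s →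
            cong₂ _,_ (trans (num-ii k a i κ (inject₁ s)) (cong (chainBase k a i κ +_) (Finₚ.toℕ-inject₁ s)))
                      (trans (num-ii k a i κ (suc s)) (+-suc (chainBase k a i κ) (toℕ s))))))
          (closing f)))
      where
      closing : ∀ f → map raw (pick f [] ((t , ii k a i κ (lastFin l)) ∷ [])) ≡ pick f [] ((num t , chainBase k a i κ + l) ∷ [])
      closing zero    = refl
      closing (suc _) = cong (λ x → (num t , x) ∷ []) (trans (num-ii k a i κ (lastFin l)) (cong (chainBase k a i κ +_) (Finₚ.toℕ-fromℕ l)))

    blockS-raw : ∀ k a i → map raw (blockS k a i) ≡ blockE (indexℕ k a i)
    blockS-raw k a i =
      trans (split (chain k a i zero)) (cong₂ _++_ (piece zero (num-yy′) (num-mm k a i) refl (+-identityʳ _))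
      (trans (split (chain k a i κ₁)) (cong₂ _++_ (piece κ₁ (num-mm k a i) row′ refl (cong (b +_) (*-identityˡ (suc l))))
      (trans (split (chain k a i κ₂)) (cong₂ _++_ (piece κ₂ (num-mm k a i) C-num (cong₂ uBit (sym a≡) (sym i≡)) refl)
      (trans (split (chain k a i κ₃)) (cong₂ _++_ (piece κ₃ vv-num C′-num (cong₂ vBit (sym a≡) (sym i≡)) refl)
      (piece κ₄ vv-num (num-ss k a i) refl refl))))))))
      where
      x q b : ℕ
      x = indexℕ k a i
      q = suc n * toℕ k + toℕ a
      b = iBase + x * (5 * suc l)
      q≡ : x / D ≡ q
      q≡ = quotient-of D q (Finₚ.toℕ<n i)
      i≡ : x % D ≡ toℕ i
      i≡ = remainder-of D q (Finₚ.toℕ<n i)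
      k≡ : x / D / suc n ≡ toℕ k
      k≡ = trans (cong (_/ suc n) q≡) (quotient-of (suc n) (toℕ k) (Finₚ.toℕ<n a))
      a≡ : x / D % suc n ≡ toℕ a
      a≡ = trans (cong (_% suc n) q≡) (remainder-of (suc n) (toℕ k) (Finₚ.toℕ<n a))
      split : ∀ xs {ys} → map raw (xs ++ ys) ≡ map raw xs ++ map raw ys
      split xs = map-++ raw xs _
      piece : ∀ κ {h t f b′} → num (heads k a i κ) ≡ h → num (tails k a i κ) ≡ t → closed a i κ ≡ f → chainBase k a i κ ≡ b′ →
              map raw (chain k a i κ) ≡ chainE l h t f b′
      piece κ p q r s = trans (chainS-raw k a i κ (heads k a i κ) (tails k a i κ) (closed a i κ)) (chainE-cong {l} p q r s)
      num-yy′ : num (yy k) ≡ 4 * D + x / D / suc n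
      num-yy′ = trans (num-yy k) (cong (4 * D +_) (sym k≡))
      row′ : num (row k a) ≡ uNode (x / D / suc n) (x / D % suc n)
      row′ = trans (num-row k a) (cong₂ uNode (sym k≡) (sym a≡))
      C-num : num (C k i) ≡ D * (x / D / suc n) + x % D
      C-num = trans (num-C k i) (cong₂ (λ k i → D * k + i) (sym k≡) (sym i≡))
      C′-num : num (C′ k i) ≡ 2 * D + (D * (x / D / suc n) + x % D)
      C′-num = trans (num-C′ k i) (cong₂ (λ k i → 2 * D + (D * k + i)) (sym k≡) (sym i≡))
      vv-num : num (vv k a) ≡ vBase + x / D
      vv-num = trans (num-vv k a) (cong (vBase +_) (sym q≡))

open EdgeSets

-- The graph given to the preprocessing

module StartGraph where

  module InitialGraph (n d l : ℕ) (1≤l : 1 ≤ l) (Ul Vl : List ℕ) where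
    open Layout n d l
    open Bits Ul Vl
    open Graph n d l Ul Vl using (Vtx; yy; ii; index; Iₙ; enc; num; indexℕ; toℕ-index; arith)
    open Edges n d l Ul Vl using (row; arith; heads; tails; closed; chain; κ₁; κ₂; κ₃; κ₄; blockS; raw; chainBase; chainS-raw; closing; blockS-raw; x; q; b; q≡; i≡; k≡; a≡; split)

    private
      branch< : (z : Fin iBase) → toℕ (z ↑ˡ Iₙ) < iBase
      branch< z = ≤-trans (s≤s (≤-reflexive (Finₚ.toℕ-↑ˡ z Iₙ))) (Finₚ.toℕ<n z)

      heads< : ∀ k a i κ → num (heads k a i κ) < iBase
      heads< k a i zero                         = branch< _
      heads< k a i (suc zero)                   = branch< _
      heads< k a i (suc (suc zero))             = branch< _
      heads< k a i (suc (suc (suc zero)))       = branch< _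
      heads< k a i (suc (suc (suc (suc zero)))) = branch< _

      row< : ∀ k a → num (row k a) < iBase
      row< k a with n ≟ toℕ a
      ... | yes _ = branch< _
      ... | no _  = branch< _

      tails< : ∀ k a i κ → num (tails k a i κ) < iBase
      tails< k a i zero                         = branch< _
      tails< k a i (suc zero)                   = row< k a
      tails< k a i (suc (suc zero))             = branch< _
      tails< k a i (suc (suc (suc zero)))       = branch< _
      tails< k a i (suc (suc (suc (suc zero)))) = branch< _

      chain-Span : ∀ k a i κ → Span (chainBase k a i κ) (chainBase k a i κ + suc l) (map raw (chain k a i κ))
      chain-Span k a i κ = subst (Span (chainBase k a i κ) (chainBase k a i κ + suc l)) (sym (chainS-raw k a i κ (heads k a i κ) (tails k a i κ) (closed a i κ)))
        (chainE-Span l _ _ (closed a i κ) (chainBase k a i κ) 1≤l (<-≤-trans (heads< k a i κ) iBase≤) (<-≤-trans (tails< k a i κ) iBase≤))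
        where
        iBase≤ : iBase ≤ chainBase k a i κ
        iBase≤ = ≤-trans (m≤m+n iBase _) (m≤m+n _ _)

      blockS-Span : ∀ k a i → Span (iBase + indexℕ k a i * (5 * suc l)) (iBase + suc (indexℕ k a i) * (5 * suc l)) (map raw (blockS k a i))
      blockS-Span k a i = subst₂ (λ x y → Span x y (map raw (blockS k a i))) (+-identityʳ b) (trans (+-assoc b _ _) (trans (+-assoc iBase _ _) (cong (iBase +_) (arith (indexℕ k a i) (suc l)))))
        (split (chain k a i zero) (mono 0 1 z≤n) (top 1 (s≤s z≤n)) (step zero)
        (split (chain k a i κ₁) (mono 1 2 (s≤s z≤n)) (top 2 (s≤s (s≤s z≤n))) (step κ₁)
        (split (chain k a i κ₂) (mono 2 3 (s≤s (s≤s z≤n))) (top 3 (s≤s (s≤s (s≤s z≤n)))) (step κ₂)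
        (split (chain k a i κ₃) (mono 3 4 (s≤s (s≤s (s≤s z≤n)))) (top 4 (s≤s (s≤s (s≤s (s≤s z≤n))))) (step κ₃)
          (chain-Span k a i κ₄)))))
        where
        b : ℕ
        b = iBase + indexℕ k a i * (5 * suc l)
        arith : ∀ x m → x * (5 * m) + (4 * m + m) ≡ suc x * (5 * m)
        arith = solve-∀
        step : ∀ κ → Span (chainBase k a i κ) (b + suc (toℕ κ) * suc l) (map raw (chain k a i κ))
        step κ = subst (λ x → Span (chainBase k a i κ) x (map raw (chain k a i κ))) (trans (+-assoc b _ _) (cong (b +_) (+-comm (toℕ κ * suc l) (suc l)))) (chain-Span k a i κ)
        mono : ∀ j j′ → j ≤ j′ → b + j * suc l ≤ b + j′ * suc l
        mono j j′ le = +-monoʳ-≤ b (*-monoˡ-≤ (suc l) le)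
        top : ∀ j → j ≤ 4 → b + j * suc l ≤ b + 4 * suc l + suc l
        top j le = ≤-trans (mono j 4 le) (m≤m+n _ _)
        split : ∀ {x y z} xs {ys} → x ≤ y → y ≤ z → Span x y (map raw xs) → Span y z (map raw ys) → Span x z (map raw (xs ++ ys))
        split {x} {y} {z} xs x≤y y≤z p q = subst (Span x z) (sym (map-++ raw xs _)) (Span-++ x≤y y≤z p q)

    fin : ℕ → Fin N
    fin x with x <? N
    ... | yes x<N = fromℕ< x<N
    -- An arbitrary vertex makes `fin` total; `toℕ-fin` speaks of numbers below `N`.
    ... | no _    = enc (yy zero)

    toℕ-fin : ∀ {x} → x < N → toℕ (fin x) ≡ x
    toℕ-fin {x} x<N with x <? N
    ... | yes x<N′ = Finₚ.toℕ-fromℕ< x<N′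
    ... | no x≮N   = contradiction x<N x≮N

    fin-num : ∀ v → fin (num v) ≡ enc v
    fin-num v = Finₚ.toℕ-injective (toℕ-fin (Finₚ.toℕ<n (enc v)))

    4D≤iBase : 4 * D ≤ iBase
    4D≤iBase = ≤-trans (m≤m+n _ 2) (≤-trans (m≤m+n _ (n + 2)) (≤-trans (m≤m+n _ (2 * suc n)) (≤-trans (m≤m+n _ X) (m≤m+n _ X))))

    4D≤N : 4 * D ≤ N
    4D≤N = ≤-trans 4D≤iBase (m≤m+n iBase _)

    dynamicF : ℕ → EdgeList N
    dynamicF zero    = []
    dynamicF (suc q) = dynamicF q ∷ʳ (fin q , fin (2 * D + q))

    encE : Vtx × Vtx → Edge N
    encE (v , w) = enc v , enc w

    blockAt : ℕ → List (Vtx × Vtx)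
    blockAt x with x <? X
    ... | yes x<X = let (q , i) = remQuot {2 * suc n} D (fromℕ< x<X) ; (k , a) = remQuot {2} (suc n) q in blockS k a i
    ... | no _    = []

    staticF : (q x : ℕ) → EdgeList N
    staticF q zero    = dynamicF q
    staticF q (suc x) = staticF q x ++ map encE (blockAt x)

    blockAt-block : ∀ {x} → x < X → ∃ λ k → ∃ λ a → ∃ λ i → indexℕ k a i ≡ x × blockAt x ≡ blockS k a i
    blockAt-block {x} x<X with x <? X
    ... | no x≮X = contradiction x<X x≮X
    ... | yes x<X′ = k , a , i , trans (sym (toℕ-index k a i)) (trans (cong toℕ eq) (Finₚ.toℕ-fromℕ< x<X′)) , refl
      where
      q : Fin (2 * suc n)
      q = proj₁ (remQuot {2 * suc n} D (fromℕ< x<X′))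
      i : Fin D
      i = proj₂ (remQuot {2 * suc n} D (fromℕ< x<X′))
      k : Fin 2
      k = proj₁ (remQuot {2} (suc n) q)
      a : Fin (suc n)
      a = proj₂ (remQuot {2} (suc n) q)
      eq : index k a i ≡ fromℕ< x<X′
      eq = trans (cong (λ q → combine q i) (Finₚ.combine-remQuot {2} (suc n) q)) (Finₚ.combine-remQuot {2 * suc n} D (fromℕ< x<X′))

    index-injective : ∀ {k a i k′ a′ i′} → indexℕ k a i ≡ indexℕ k′ a′ i′ → k ≡ k′ × a ≡ a′ × i ≡ i′
    index-injective {k} {a} {i} {k′} {a′} {i′} eq
      with q≡ , i≡ ← Finₚ.combine-injective (combine k a) i (combine k′ a′) i′ (Finₚ.toℕ-injective (trans (toℕ-index k a i) (trans eq (sym (toℕ-index k′ a′ i′)))))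
      with k≡ , a≡ ← Finₚ.combine-injective k a k′ a′ q≡ = k≡ , a≡ , i≡

    indexℕ<X : ∀ k a i → indexℕ k a i < X
    indexℕ<X k a i = ≤-trans (s≤s (≤-reflexive (sym (toℕ-index k a i)))) (Finₚ.toℕ<n (index k a i))

    rawE : Edge N → ℕ × ℕ
    rawE (x , y) = toℕ x , toℕ y

    private
      2D+q<4D : ∀ {q} → q < 2 * D → 2 * D + q < 4 * D
      2D+q<4D q< = ≤-trans (+-monoʳ-< (2 * D) q<) (≤-reflexive (arith D))
        where
        arith : ∀ D → 2 * D + 2 * D ≡ 4 * D
        arith = solve-∀

    dynamicF-raw : ∀ q → q ≤ 2 * D → map rawE (dynamicF q) ≡ dynamicE q
    dynamicF-raw zero    q≤ = refl
    dynamicF-raw (suc q) q≤ = trans (map-++ rawE (dynamicF q) _) (cong₂ _++_ (dynamicF-raw q (<⇒≤ q≤))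
      (cong₂ (λ x y → (x , y) ∷ []) (toℕ-fin (≤-trans (≤-trans (s≤s (m≤n+m q (2 * D))) (2D+q<4D q≤)) 4D≤N)) (toℕ-fin (≤-trans (2D+q<4D q≤) 4D≤N))))

    staticF-raw : ∀ q x → q ≤ 2 * D → x ≤ X → map rawE (staticF q x) ≡ staticE q x
    staticF-raw q zero    q≤ x≤ = dynamicF-raw q q≤
    staticF-raw q (suc x) q≤ x≤ with k , a , i , refl , eq ← blockAt-block x≤ =
      trans (map-++ rawE (staticF q x) _) (cong₂ _++_ (staticF-raw q x q≤ (<⇒≤ x≤))
        (trans (sym (map-∘ (blockAt x))) (trans (cong (map raw) eq) (blockS-raw k a i))))

    private
      dynamicE-Span : ∀ q → q ≤ 2 * D → Span (2 * D) (2 * D + q) (dynamicE q)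
      dynamicE-Span zero    q≤ = Span-[]
      dynamicE-Span (suc q) q≤ = Span-++ (m≤m+n _ q) (+-monoʳ-≤ (2 * D) (n≤1+n q)) (dynamicE-Span q (<⇒≤ q≤))
        ([] ∷ [] , (≤-trans (s≤s (m≤n+m q d)) (≤-trans (+-monoˡ-≤ q (m≤m+n D (D + 0))) ≤-refl) , ≤-refl , +-monoʳ-< (2 * D) (n<1+n q)) ∷ [])

      staticE-Span : ∀ q x → q ≤ 2 * D → x ≤ X → Span 0 (iBase + x * (5 * suc l)) (staticE q x)
      staticE-Span q zero    q≤ x≤ = subst (Span 0 (iBase + 0)) (++-identityʳ (dynamicE q)) (Span-++ z≤n (≤-trans (≤-trans (≤-trans (+-monoʳ-≤ (2 * D) q≤) (≤-reflexive (arith D))) 4D≤iBase) (m≤m+n iBase 0))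
        (lower (dynamicE-Span q q≤)) Span-[])
        where
        arith : ∀ D → 2 * D + 2 * D ≡ 4 * D
        arith = solve-∀
        lower : ∀ {a b xs} → Span a b xs → Span 0 b xs
        lower (u , al) = u , All.map (λ (o , _ , <b) → o , z≤n , <b) al
      staticE-Span q (suc x) q≤ x≤ with k , a , i , refl , eq ← blockAt-block x≤ =
        Span-++ z≤n (+-monoʳ-≤ iBase (*-monoˡ-≤ (5 * suc l) (n≤1+n x))) (staticE-Span q x q≤ (<⇒≤ x≤))
          (subst (Span _ _) (blockS-raw k a i) (blockS-Span k a i))

    initialGraph : ℕ → EdgeList N
    initialGraph q = staticF q X

    initialGraph-raw : ∀ {q} → q ≤ 2 * D → map rawE (initialGraph q) ≡ staticE q X
    initialGraph-raw q≤ = staticF-raw _ X q≤ ≤-refl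

    -- Distinctness is seen on pairs of numbers, where the listing by larger endpoints makes it a
    -- matter of disjoint intervals, and is pulled back along `rawE`.
    initialGraph-simple : ∀ {q} → q ≤ 2 * D → Simple (initialGraph q)
    initialGraph-simple {q} q≤ with u , al ← subst (Span 0 N) (sym (initialGraph-raw q≤)) (staticE-Span q X q≤ ≤-refl) =
      AllPairs.map (λ ne eq → ne (cong rawE eq)) (AllPairsₚ.map⁻ u) , All.map proj₁ (Allₚ.map⁻ al)

    ∈-dynamicF⁻ : ∀ q {e} → e ∈ dynamicF q → ∃ λ y → y < q × e ≡ (fin y , fin (2 * D + y))
    ∈-dynamicF⁻ (suc q) e∈ with ∈-++⁻ (dynamicF q) e∈
    ... | inj₁ e∈′ with y , y< , eq ← ∈-dynamicF⁻ q e∈′ = y , m≤n⇒m≤1+n y< , eq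
    ... | inj₂ (here eq) = q , ≤-refl , eq

    ∈-dynamicF⁺ : ∀ q {y} → y < q → (fin y , fin (2 * D + y)) ∈ dynamicF q
    ∈-dynamicF⁺ (suc q) {y} y< with y ≟ q
    ... | yes refl = ∈-++⁺ʳ (dynamicF q) (here refl)
    ... | no y≢    = ∈-++⁺ˡ (∈-dynamicF⁺ q (≤∧≢⇒< (s≤s⁻¹ y<) y≢))

    ∈-staticF⁻ : ∀ q x {e} → x ≤ X → e ∈ staticF q x → e ∈ dynamicF q ⊎ (∃ λ k → ∃ λ a → ∃ λ i → ∃ λ f → f ∈ blockS k a i × e ≡ encE f)
    ∈-staticF⁻ q zero    x≤ e∈ = inj₁ e∈
    ∈-staticF⁻ q (suc x) x≤ e∈ with ∈-++⁻ (staticF q x) e∈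
    ... | inj₁ e∈′ = ∈-staticF⁻ q x (<⇒≤ x≤) e∈′
    ... | inj₂ e∈′ with f , f∈ , eq ← ∈-map⁻ encE e∈′ with k , a , i , _ , bl ← blockAt-block x≤ =
      inj₂ (k , a , i , f , subst (f ∈_) bl f∈ , eq)

    ∈-staticF-dynamic : ∀ q x {e} → e ∈ dynamicF q → e ∈ staticF q x
    ∈-staticF-dynamic q zero    e∈ = e∈
    ∈-staticF-dynamic q (suc x) e∈ = ∈-++⁺ˡ (∈-staticF-dynamic q x e∈)

    ∈-staticF-block : ∀ q x k a i {f} → x ≤ X → indexℕ k a i < x → f ∈ blockS k a i → encE f ∈ staticF q x
    ∈-staticF-block q (suc x) k a i {f} x≤ i< f∈ with indexℕ k a i ≟ x
    ... | no i≢ = ∈-++⁺ˡ (∈-staticF-block q x k a i (<⇒≤ x≤) (≤∧≢⇒< (s≤s⁻¹ i<) i≢) f∈)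
    ... | yes eq with k′ , a′ , i′ , eq′ , bl ← blockAt-block x≤ with refl , refl , refl ← index-injective {k} {a} {i} {k′} {a′} {i′} (trans eq (sym eq′)) =
      ∈-++⁺ʳ (staticF q x) (∈-map⁺ encE (subst (f ∈_) (sym bl) f∈))

    private
      chain-target : ∀ k a i κ {e} → e ∈ chain k a i κ → ∃ λ κ → ∃ λ s → proj₂ e ≡ ii k a i κ s
      chain-target k a i κ (here refl) = κ , zero , refl
      chain-target k a i κ (there e∈) with ∈-++⁻ (tabulate (λ (s : Fin l) → ii k a i κ (inject₁ s) , ii k a i κ (suc s))) e∈
      ... | inj₁ e∈′ with s , refl ← ∈-tabulate⁻ e∈′ = κ , suc s , refl
      ... | inj₂ e∈′ = closing (closed a i κ) e∈′
        where
        closing : ∀ f {e t s} → e ∈ pick f [] ((t , ii k a i κ s) ∷ []) → ∃ λ κ → ∃ λ s → proj₂ e ≡ ii k a i κ s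
        closing (suc _) (here refl) = κ , _ , refl

    -- The second endpoint of a static edge is an inner vertex, that of an edge C - C′ never is.
    -- This is how the two kinds are told apart.
    block-target : ∀ k a i {e} → e ∈ blockS k a i → ∃ λ κ → ∃ λ s → proj₂ e ≡ ii k a i κ s
    block-target k a i e∈ with ∈-++⁻ (chain k a i zero) e∈
    ... | inj₁ e₀ = chain-target k a i zero e₀
    ... | inj₂ e∈ with ∈-++⁻ (chain k a i κ₁) e∈
    ...   | inj₁ e₁ = chain-target k a i κ₁ e₁
    ...   | inj₂ e∈ with ∈-++⁻ (chain k a i κ₂) e∈
    ...     | inj₁ e₂ = chain-target k a i κ₂ e₂
    ...     | inj₂ e∈ with ∈-++⁻ (chain k a i κ₃) e∈
    ...       | inj₁ e₃ = chain-target k a i κ₃ e₃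
    ...       | inj₂ e₄ = chain-target k a i κ₄ e₄

open StartGraph

-- Potentials bounding distances in a stage graph from below

module StageGraphs where

  nonzero : ℕ → Bool
  nonzero zero    = false
  nonzero (suc _) = true

  -- The potential of the s-th inner vertex of a path of length l + 2 whose end
  -- vertices have potentials A and B.
  between : (l A B s : ℕ) → ℕ
  between l A B s = (A + suc s) ⊓ (B + (suc l ∸ s))

  module Between (l A B : ℕ) (A≤ : A ≤ suc (suc l) + B) (B≤ : B ≤ suc (suc l) + A) where

    first-up : between l A B 0 ≤ suc A
    first-up = ≤-trans (m⊓n≤m _ _) (≤-reflexive (+-comm A 1))

    first-down : A ≤ suc (between l A B 0)
    first-down = ⊓-glb (≤-trans (m≤m+n A 1) (n≤1+n _)) (≤-trans A≤ (≤-reflexive (cong suc (+-comm (suc l) B))))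

    step-down : ∀ s → between l A B s ≤ suc (between l A B (suc s))
    step-down s = ⊓-mono-≤ (≤-trans (+-monoʳ-≤ A (n≤1+n (suc s))) (n≤1+n _))
      (≤-trans (+-monoʳ-≤ B (∸-suc≤ l s)) (≤-reflexive (+-suc B (l ∸ s))))
      where
      ∸-suc≤ : ∀ l s → suc l ∸ s ≤ suc (l ∸ s)
      ∸-suc≤ l zero          = ≤-refl
      ∸-suc≤ zero (suc s)    = ≤-trans (m∸n≤m 0 s) z≤n
      ∸-suc≤ (suc l) (suc s) = ∸-suc≤ l s

    step-up : ∀ s → between l A B (suc s) ≤ suc (between l A B s)
    step-up s = ⊓-mono-≤ (≤-reflexive (+-suc A (suc s))) (≤-trans (+-monoʳ-≤ B (∸-monoˡ-≤ s (n≤1+n l))) (n≤1+n _))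

    last-up : between l A B l ≤ suc B
    last-up = ≤-trans (m⊓n≤n (A + suc l) _) (≤-reflexive (trans (cong (B +_) (m+n∸n≡m 1 l)) (+-comm B 1)))

    last-down : B ≤ suc (between l A B l)
    last-down = ⊓-glb (≤-trans B≤ (≤-reflexive (cong suc (+-comm (suc l) A)))) (≤-trans (m≤m+n B _) (n≤1+n _))

  module StageGraph (n d l : ℕ) (1≤l : 1 ≤ l) (Ul Vl : List ℕ) (wb : ℕ → ℕ) where
    open Layout n d l
    open Bits Ul Vl
    open Graph n d l Ul Vl using (Vtx; cc; yy; ff; uu; vv; mm; ss; ii; enc; dec; dec-enc)
    open Edges n d l Ul Vl using (C; C′; row; chainS; heads; tails; closed; chain; κ₁; κ₂; κ₃; κ₄; blockS; x; b)
    open InitialGraph n d l 1≤l Ul Vl using (encE)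

    L : ℕ
    L = suc (suc l)

    -- Only membership is recorded: insertions and deletions lead to lists in different orders, but
    -- to the same set of edges.
    record IsStageGraph (H : EdgeList N) : Set where
      field
        sound   : ∀ {e} → e ∈ H → (∃ λ k → ∃ λ i → wb (toℕ i) ≢ 0 × e ≡ encE (C k i , C′ k i)) ⊎
                                  (∃ λ k → ∃ λ a → ∃ λ i → ∃ λ f → f ∈ blockS k a i × e ≡ encE f)
        dynamic : ∀ k i → wb (toℕ i) ≢ 0 → encE (C k i , C′ k i) ∈ H
        blocks  : ∀ k a i {f} → f ∈ blockS k a i → encE f ∈ H

    -- A lower bound for the distance to `ss k₀ j zero`, in units of `L` and capped at 6. On the
    -- branch vertices of copy `k₀` it is 1 at the V vertex of `j`, 2 at C′ for coordinates of that
    -- vector, about 2 at C if w has the coordinate too, 3 at M if the row has it as well, 4 at Y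
    -- and 5 at the remaining M. A vector of U has 4 if it hits `j` and 6 if it misses it. The other
    -- copy has 6 throughout, except for 5 at the midpoints of vectors that hit `j`.
    module Potential (k₀ : Fin 2) (j : Fin (suc n)) where

      own : Fin 2 → Bool
      own k = does (k Finₚ.≟ k₀)

      vw : Fin D → Bool
      vw i = nonzero (vBit (toℕ j) (toℕ i)) ∧ nonzero (wb (toℕ i))

      uvw : ℕ → Fin D → Bool
      uvw a i = nonzero (uBit a (toℕ i)) ∧ vw i

      good : ℕ → Bool
      good a = does (Finₚ.any? (λ i → T? (uvw a i)))

      good-false : ∀ a → (∀ i → uvw a i ≡ false) → good a ≡ false
      good-false a bad = dec-false (Finₚ.any? (λ i → T? (uvw a i))) (λ (i , t) → subst T (bad i) t)

      uvw-false : ∀ a i → good a ≡ false → uvw a i ≡ false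
      uvw-false a i eq = T-false (does-false (Finₚ.any? (λ i → T? (uvw a i))) eq ∘ (i ,_))
        where
        does-false : ∀ {A : Set} (a? : Dec A) → does a? ≡ false → ¬ A
        does-false (no ¬a) _ = ¬a
        T-false : ∀ {b} → ¬ T b → b ≡ false
        T-false {false} _ = refl
        T-false {true}  ¬t = contradiction tt ¬t

      fU : Bool → ℕ
      fU g = (if g then 4 else 6) * L

      -- The 1 added at `C` is the edge C - C′. It is dropped again at M, so that all other values
      -- at branch vertices are multiples of `L` and most Lipschitz checks compare small numbers.
      fC fC′ : Bool → Bool → ℕ
      fC  o c = if o then (if c then suc (2 * L) else 4 * L) else 6 * L
      fC′ o c = (if o then (if c then 2 else 4) else 6) * L

      fY : Bool → ℕ
      fY o = (if o then 4 else 6) * L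

      fV : Bool → Bool → ℕ
      fV o e = (if o then (if e then 1 else 3) else 6) * L

      fS : Bool → Bool → Bool → ℕ
      fS o e z = (if o then (if e then (if z then 0 else 1) else 3) else 6) * L

      fM : (o c g : Bool) → ℕ
      fM o c g = (if o then (if c then 3 else 5) else (if g then 5 else 6)) * L

      fake : Fin (suc n) → Bool
      fake a = does (n ≟ toℕ a)

      goodRow : Fin (suc n) → Bool
      goodRow a = not (fake a) ∧ good (toℕ a)

      fRow : (o e g : Bool) → ℕ
      fRow o e g = if e then fY o else fU g

      φM : Fin 2 → Fin (suc n) → Fin D → ℕ
      φM k a i = fM (own k) (uvw (toℕ a) i) (goodRow a)

      φV : Fin 2 → Fin (suc n) → ℕ
      φV k a = fV (own k) (does (a Finₚ.≟ j))

      φRow : Fin 2 → Fin (suc n) → ℕ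
      φRow k a = fRow (own k) (fake a) (good (toℕ a))

      φC φC′ : Fin 2 → Fin D → ℕ
      φC  k i = fC (own k) (vw i)
      φC′ k i = fC′ (own k) (nonzero (vBit (toℕ j) (toℕ i)))

      φS : Fin 2 → Fin (suc n) → Fin D → ℕ
      φS k a i = fS (own k) (does (a Finₚ.≟ j)) (does (i Finₚ.≟ zero))

      headφ tailφ : Fin 2 → Fin (suc n) → Fin D → Fin 5 → ℕ
      headφ k a i zero                         = fY (own k)
      headφ k a i (suc zero)                   = φM k a i
      headφ k a i (suc (suc zero))             = φM k a i
      headφ k a i (suc (suc (suc zero)))       = φV k a
      headφ k a i (suc (suc (suc (suc zero)))) = φV k a
      tailφ k a i zero                         = φM k a i
      tailφ k a i (suc zero)                   = φRow k a
      tailφ k a i (suc (suc zero))             = φC k i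
      tailφ k a i (suc (suc (suc zero)))       = φC′ k i
      tailφ k a i (suc (suc (suc (suc zero)))) = φS k a i

      -- A dangling path constrains nothing at its far end, so the potential of its head is
      -- continued along it. A complete path needs interpolation between both ends.
      φI : Fin 2 → Fin (suc n) → Fin D → Fin 5 → ℕ → ℕ
      φI k a i κ s = pick (closed a i κ) (headφ k a i κ) (between l (headφ k a i κ) (tailφ k a i κ) s)

      φ : Vtx → ℕ
      φ (cc κ i)       = [ (λ k → φC k i) , (λ k → φC′ k i) ]′ (splitAt 2 κ)
      φ (yy k)         = fY (own k)
      φ (ff k)         = fY (own k)
      φ (uu a)         = fU (good (toℕ a))
      φ (vv k a)       = φV k a
      φ (mm k a i)     = φM k a i
      φ (ss k a i)     = φS k a i
      φ (ii k a i κ s) = φI k a i κ (toℕ s)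

      φ-C : ∀ k i → φ (C k i) ≡ φC k i
      φ-C k i rewrite Finₚ.splitAt-↑ˡ 2 k 2 = refl

      φ-C′ : ∀ k i → φ (C′ k i) ≡ φC′ k i
      φ-C′ k i rewrite Finₚ.splitAt-↑ʳ 2 2 k = refl

      φ-row : ∀ k a → φ (row k a) ≡ φRow k a
      φ-row k a with n ≟ toℕ a
      ... | yes n≡ = cong (λ e → fRow (own k) e (good (toℕ a))) (sym (dec-true (n ≟ toℕ a) n≡))
      ... | no n≢ = trans (cong (λ x → fU (good x)) (Finₚ.toℕ-lower₁ a n≢)) (cong (λ e → fRow (own k) e (good (toℕ a))) (sym (dec-false (n ≟ toℕ a) n≢)))

      φ-head : ∀ k a i κ → φ (heads k a i κ) ≡ headφ k a i κ
      φ-head k a i zero                         = refl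
      φ-head k a i (suc zero)                   = refl
      φ-head k a i (suc (suc zero))             = refl
      φ-head k a i (suc (suc (suc zero)))       = refl
      φ-head k a i (suc (suc (suc (suc zero)))) = refl

      φ-tail : ∀ k a i κ → φ (tails k a i κ) ≡ tailφ k a i κ
      φ-tail k a i zero                         = refl
      φ-tail k a i (suc zero)                   = φ-row k a
      φ-tail k a i (suc (suc zero))             = φ-C k i
      φ-tail k a i (suc (suc (suc zero)))       = φ-C′ k i
      φ-tail k a i (suc (suc (suc (suc zero)))) = refl

      Close : ℕ → ℕ → ℕ → Set
      Close r x y = x ≤ r + y × y ≤ r + x

      private
        Close-* : ∀ x y {_ : T ((x ≤ᵇ suc y) ∧ (y ≤ᵇ suc x))} → Close L (x * L) (y * L)
        Close-* x y {t} with x ≤ᵇ suc y in e₁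
        ... | true = *-monoˡ-≤ L (≤ᵇ⇒≤ x (suc y) (subst T (sym e₁) tt)) , *-monoˡ-≤ L (≤ᵇ⇒≤ y (suc x) t)

      private
        close-YM : ∀ o c g → Close L (fY o) (fM o c g)
        close-YM true  true  _     = Close-* 4 3
        close-YM true  false _     = Close-* 4 5
        close-YM false _     true  = Close-* 6 5
        close-YM false _     false = Close-* 6 6

        close-MRow : ∀ o c e g → (g ≡ false → c ≡ false) → Close L (fM o c (not e ∧ g)) (fRow o e g)
        close-MRow true  true  true  _     _ = Close-* 3 4
        close-MRow true  false true  _     _ = Close-* 5 4
        close-MRow false _     true  _     _ = Close-* 6 6
        close-MRow true  true  false true  _ = Close-* 3 4
        close-MRow true  false false true  _ = Close-* 5 4
        close-MRow false _     false true  _ = Close-* 5 4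
        close-MRow false _     false false _ = Close-* 6 6
        close-MRow true  true  false false h = contradiction (h refl) λ ()
        close-MRow true  false false false _ = Close-* 5 6

        close-MC : ∀ o u c g → u ≢ 0 → Close L (fM o (nonzero u ∧ c) g) (fC o c)
        close-MC o     zero    c     g     u≢0 = contradiction refl u≢0
        close-MC true  (suc _) true  g     _ = +-monoʳ-≤ L (n≤1+n (2 * L)) , ≤-trans (+-monoˡ-≤ (2 * L) (s≤s (z≤n {suc l}))) (m≤n+m (3 * L) L)
        close-MC true  (suc _) false g     _ = Close-* 5 4
        close-MC false (suc _) c     true  _ = Close-* 5 6
        close-MC false (suc _) c     false _ = Close-* 6 6

        close-VC′ : ∀ o e v → (e ≡ true → nonzero v ≡ true) → Close L (fV o e) (fC′ o (nonzero v))
        close-VC′ false e     v       h = Close-* 6 6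
        close-VC′ true  true  zero    h = contradiction (h refl) λ ()
        close-VC′ true  true  (suc _) h = Close-* 1 2
        close-VC′ true  false zero    h = Close-* 3 4
        close-VC′ true  false (suc _) h = Close-* 3 2

        close-VS : ∀ o e z → Close L (fV o e) (fS o e z)
        close-VS true  true  true  = Close-* 1 0
        close-VS true  true  false = Close-* 1 1
        close-VS true  false _     = Close-* 3 3
        close-VS false _     _     = Close-* 6 6

        close-CC′ : ∀ o v w → w ≢ 0 → Close 1 (fC o (nonzero v ∧ nonzero w)) (fC′ o (nonzero v))
        close-CC′ o     v       zero    w≢0 = contradiction refl w≢0
        close-CC′ false v       (suc _) _ = n≤1+n _ , n≤1+n _
        close-CC′ true  zero    (suc _) _ = n≤1+n _ , n≤1+n _
        close-CC′ true  (suc _) (suc _) _ = ≤-refl , ≤-trans (n≤1+n _) (n≤1+n _)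

        nonzero-true : ∀ {v} → v ≢ 0 → nonzero v ≡ true
        nonzero-true {zero}  v≢0 = contradiction refl v≢0
        nonzero-true {suc _} _   = refl

        does-true : ∀ {A : Set} (a? : Dec A) → does a? ≡ true → A
        does-true (yes a) _ = a

      -- The ends of a complete path may differ by at most its length `L`. `uvw-false` enters on the
      -- path to a row: a hit at a single coordinate makes the row good, so a midpoint at `3 * L`
      -- never meets a vector of U at `6 * L`.
      chain-close : ∀ k a i κ → closed a i κ ≢ 0 → Close L (headφ k a i κ) (tailφ k a i κ)
      chain-close k a i zero                         _   = close-YM (own k) (uvw (toℕ a) i) (goodRow a)
      chain-close k a i (suc zero)                   _   = close-MRow (own k) (uvw (toℕ a) i) (fake a) (good (toℕ a)) (uvw-false (toℕ a) i)
      chain-close k a i (suc (suc zero))             u≢0 = close-MC (own k) (uBit (toℕ a) (toℕ i)) (vw i) (goodRow a) u≢0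
      chain-close k a i (suc (suc (suc zero)))       v≢0 = close-VC′ (own k) (does (a Finₚ.≟ j)) (vBit (toℕ j) (toℕ i))
        (λ eq → nonzero-true (λ v≡0 → v≢0 (trans (cong (λ a → vBit (toℕ a) (toℕ i)) (does-true (a Finₚ.≟ j) eq)) v≡0)))
      chain-close k a i (suc (suc (suc (suc zero)))) _   = close-VS (own k) (does (a Finₚ.≟ j)) (does (i Finₚ.≟ zero))

      dynamic-close : ∀ k i → wb (toℕ i) ≢ 0 → Close 1 (φ (C k i)) (φ (C′ k i))
      dynamic-close k i w≢0 = subst₂ (Close 1) (sym (φ-C k i)) (sym (φ-C′ k i)) (close-CC′ (own k) (vBit (toℕ j) (toℕ i)) (wb (toℕ i)) w≢0)

      chain-lipschitz : ∀ k a i κ {v w} → (v , w) ∈ chain k a i κ → Close 1 (φ v) (φ w)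
      chain-lipschitz k a i κ e∈ = cases (closed a i κ) refl e∈
        where
        A B : ℕ
        A = headφ k a i κ
        B = tailφ k a i κ
        I : Fin (suc l) → Vtx
        I = ii k a i κ
        open-φ : closed a i κ ≡ 0 → ∀ s → φI k a i κ s ≡ A
        open-φ eq s = pick-zero eq
        closed-φ : closed a i κ ≢ 0 → ∀ s → φI k a i κ s ≡ between l A B s
        closed-φ ne s = pick-suc ne
        same : ∀ {x y} → x ≡ A → y ≡ A → Close 1 x y
        same refl refl = n≤1+n _ , n≤1+n _
        cases : ∀ f {v w} → closed a i κ ≡ f → (v , w) ∈ chainS k a i κ (heads k a i κ) (tails k a i κ) f → Close 1 (φ v) (φ w)
        cases zero eq (here refl) = same (φ-head k a i κ) (open-φ eq 0)
        cases zero eq (there e∈) with ∈-++⁻ (tabulate (λ (s : Fin l) → I (inject₁ s) , I (suc s))) e∈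
        ... | inj₁ e∈′ with s , refl ← ∈-tabulate⁻ e∈′ = same (open-φ eq (toℕ (inject₁ s))) (open-φ eq (suc (toℕ s)))
        cases (suc f) eq e∈ = via e∈
          where
          ne : closed a i κ ≢ 0
          ne z = case trans (sym z) eq of λ ()
          open Between l A B (proj₁ (chain-close k a i κ ne)) (proj₂ (chain-close k a i κ ne))
          to : ∀ {x x′ y y′} → x ≡ x′ → y ≡ y′ → Close 1 x′ y′ → Close 1 x y
          to refl refl c = c
          via : ∀ {v w} → (v , w) ∈ chainS k a i κ (heads k a i κ) (tails k a i κ) (suc f) → Close 1 (φ v) (φ w)
          via (here refl) = to (φ-head k a i κ) (closed-φ ne 0) (first-down , first-up)
          via (there e∈) with ∈-++⁻ (tabulate (λ (s : Fin l) → I (inject₁ s) , I (suc s))) e∈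
          ... | inj₁ e∈′ with s , refl ← ∈-tabulate⁻ e∈′ = to (trans (cong (φI k a i κ) (Finₚ.toℕ-inject₁ s)) (closed-φ ne (toℕ s))) (closed-φ ne (suc (toℕ s))) (step-down (toℕ s) , step-up (toℕ s))
          ... | inj₂ (here refl) = to (φ-tail k a i κ) (trans (cong (φI k a i κ) (Finₚ.toℕ-fromℕ l)) (closed-φ ne l)) (last-down , last-up)

      block-lipschitz : ∀ k a i {v w} → (v , w) ∈ blockS k a i → Close 1 (φ v) (φ w)
      block-lipschitz k a i e∈ with ∈-++⁻ (chain k a i zero) e∈
      ... | inj₁ e₀ = chain-lipschitz k a i zero e₀
      ... | inj₂ e∈ with ∈-++⁻ (chain k a i κ₁) e∈
      ...   | inj₁ e₁ = chain-lipschitz k a i κ₁ e₁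
      ...   | inj₂ e∈ with ∈-++⁻ (chain k a i κ₂) e∈
      ...     | inj₁ e₂ = chain-lipschitz k a i κ₂ e₂
      ...     | inj₂ e∈ with ∈-++⁻ (chain k a i κ₃) e∈
      ...       | inj₁ e₃ = chain-lipschitz k a i κ₃ e₃
      ...       | inj₂ e₄ = chain-lipschitz k a i κ₄ e₄

      module _ {H : EdgeList N} (isH : IsStageGraph H) where
        open IsStageGraph isH

        edge-lipschitz : ∀ {x y} → (x , y) ∈ H → Close 1 (φ (dec x)) (φ (dec y))
        edge-lipschitz e∈ with sound e∈
        ... | inj₁ (k , i , w≢0 , refl) = subst₂ (λ v w → Close 1 (φ v) (φ w)) (sym (dec-enc (C k i))) (sym (dec-enc (C′ k i))) (dynamic-close k i w≢0)
        ... | inj₂ (k , a , i , (v , w) , f∈ , refl) = subst₂ (λ v w → Close 1 (φ v) (φ w)) (sym (dec-enc v)) (sym (dec-enc w)) (block-lipschitz k a i f∈)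

        path-bound : ∀ v w {r} → Path H (enc v) (enc w) r → φ v ≤ r + φ w
        path-bound v w {r} p = subst₂ (λ x y → φ x ≤ r + φ y) (dec-enc v) (dec-enc w)
          (Path-potential H (φ ∘ dec) (λ { (inj₁ e∈) → proj₁ (edge-lipschitz e∈) ; (inj₂ e∈) → proj₂ (edge-lipschitz e∈) }) p)

open StageGraphs

-- The radius of a stage graph in both cases

module StageRadii where

  module StageRadius (n d l : ℕ) (1≤l : 1 ≤ l) (Ul Vl : List ℕ) (wb : ℕ → ℕ)
                     {H : EdgeList (Layout.N n d l)} (isH : StageGraph.IsStageGraph n d l 1≤l Ul Vl wb H) where
    open Layout n d l
    open Bits Ul Vl
    open Graph n d l Ul Vl using (Vtx; cc; yy; ff; uu; vv; mm; ss; ii; enc; enc-surjective; arith)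
    open Edges n d l Ul Vl using (C; C′; row; arith; heads; tails; closed; chain; κ₁; κ₂; κ₃; κ₄; blockS; closing; x; q; b)
    open StageGraph n d l 1≤l Ul Vl wb using (L; IsStageGraph; dynamic; blocks; Potential; own; uvw; good; good-false; fY; fS; fake; goodRow; fRow; φM; φV; φRow; φC; φC′; φS; headφ; tailφ; φ; zero; eq; ne; to; path-bound; module IsStageGraph; module Potential)
    open IsStageGraph isH

    Covers : Fin n → Fin (suc n) → Fin D → Set
    Covers a j i = uBit (toℕ a) (toℕ i) ≢ 0 × vBit (toℕ j) (toℕ i) ≢ 0 × wb (toℕ i) ≢ 0

    Misses : Fin n → Fin (suc n) → Fin D → Set
    Misses a j i = uBit (toℕ a) (toℕ i) ≡ 0 ⊎ vBit (toℕ j) (toℕ i) ≡ 0 ⊎ wb (toℕ i) ≡ 0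

    -- `No` is phrased positively, with a missed `j` for every vector of U, because `far` has to
    -- name a distant vertex.
    Yes No : Set
    Yes = ∃ λ a → ∀ j → ∃ λ i → Covers a j i
    No  = ∀ a → ∃ λ j → ∀ i → Misses a j i

    private
      other : Fin 2 → Fin 2
      other zero       = suc zero
      other (suc zero) = zero

      not-own : ∀ k → does (k Finₚ.≟ other k) ≡ false
      not-own zero       = refl
      not-own (suc zero) = refl

    module _ (none : No) where

      -- For the extra row any index will do: it is used against a target in the other copy, where
      -- the extra row has potential `6 * L` in any case.
      missed : Fin (suc n) → Fin (suc n)
      missed a with n ≟ toℕ a
      ... | yes _ = zero
      ... | no n≢ = proj₁ (none (lower₁ a n≢))

      missed-bad : ∀ k₀ a → Potential.goodRow k₀ (missed a) a ≡ false
      missed-bad k₀ a with n ≟ toℕ a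
      ... | yes n≡ rewrite dec-true (n ≟ toℕ a) n≡ = refl
      ... | no n≢ = trans (cong (not (does (n ≟ toℕ a)) ∧_) (Potential.good-false k₀ j (toℕ a) bad)) (∧-zeroʳ _)
        where
        j : Fin (suc n)
        j = proj₁ (none (lower₁ a n≢))
        bad : ∀ i → Potential.uvw k₀ j (toℕ a) i ≡ false
        bad i with proj₂ (none (lower₁ a n≢)) i
        ... | inj₁ u≡0 rewrite trans (cong (λ x → uBit x (toℕ i)) (sym (Finₚ.toℕ-lower₁ a n≢))) u≡0 = refl
        ... | inj₂ (inj₁ v≡0) rewrite v≡0 = ∧-zeroʳ _
        ... | inj₂ (inj₂ w≡0) rewrite w≡0 = trans (cong (nonzero (uBit (toℕ a) (toℕ i)) ∧_) (∧-zeroʳ _)) (∧-zeroʳ _)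

      Far : Vtx → Set
      Far v = ∃ λ k₀ → ∃ λ j → 6 * L ≤ Potential.φ k₀ j v

      module Other (k : Fin 2) (a : Fin (suc n)) where
        open Potential (other k) (missed a) public

        far-Y : 6 * L ≤ fY (own k)
        far-Y rewrite not-own k = ≤-refl
        far-M : ∀ i → 6 * L ≤ φM k a i
        far-M i rewrite not-own k | missed-bad (other k) a = ≤-refl
        far-V : 6 * L ≤ φV k a
        far-V rewrite not-own k = ≤-refl
        far-C : ∀ i → 6 * L ≤ φC k i
        far-C i rewrite not-own k = ≤-refl
        far-C′ : ∀ i → 6 * L ≤ φC′ k i
        far-C′ i rewrite not-own k = ≤-refl
        far-S : ∀ i → 6 * L ≤ φS k a i
        far-S i rewrite not-own k = ≤-refl
        far-Row : 6 * L ≤ φRow k a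
        far-Row = bound (fake a) (good (toℕ a)) (missed-bad (other k) a)
          where
          bound : ∀ e g → not e ∧ g ≡ false → 6 * L ≤ fRow (own k) e g
          bound true  g     _ = far-Y
          bound false false _ = ≤-refl

        far-head : ∀ i κ → 6 * L ≤ headφ k a i κ
        far-head i zero                         = far-Y
        far-head i (suc zero)                   = far-M i
        far-head i (suc (suc zero))             = far-M i
        far-head i (suc (suc (suc zero)))       = far-V
        far-head i (suc (suc (suc (suc zero)))) = far-V

        far-tail : ∀ i κ → 6 * L ≤ tailφ k a i κ
        far-tail i zero                         = far-M i
        far-tail i (suc zero)                   = far-Row
        far-tail i (suc (suc zero))             = far-C i
        far-tail i (suc (suc (suc zero)))       = far-C′ i
        far-tail i (suc (suc (suc (suc zero)))) = far-S i

      -- This is what the second copy is for. A vertex outside U is measured against a target in the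
      -- copy to which it does not belong, for midpoints and inner vertices one that their row
      -- misses. Within its own copy even Y has potential only `4 * L`. A vertex of U is measured
      -- against a vector that it misses.
      far : ∀ v → Far v
      far (cc κ i) with splitAt 2 κ
      ... | inj₁ k = other k , missed zero , Other.far-C k zero i
      ... | inj₂ k = other k , missed zero , Other.far-C′ k zero i
      far (yy k)         = other k , missed zero , Other.far-Y k zero
      far (ff k)         = other k , missed zero , Other.far-Y k zero
      far (uu a)         = zero , j , ≤-reflexive (cong (λ g → (if g then 4 else 6) * L) (sym (Potential.good-false zero j (toℕ a) bad)))
        where
        j : Fin (suc n)
        j = proj₁ (none a)
        bad : ∀ i → Potential.uvw zero j (toℕ a) i ≡ false
        bad i with proj₂ (none a) i
        ... | inj₁ u≡0 rewrite u≡0 = refl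
        ... | inj₂ (inj₁ v≡0) rewrite v≡0 = ∧-zeroʳ _
        ... | inj₂ (inj₂ w≡0) rewrite w≡0 = trans (cong (nonzero (uBit (toℕ a) (toℕ i)) ∧_) (∧-zeroʳ _)) (∧-zeroʳ _)
      far (vv k a)       = other k , missed a , Other.far-V k a
      far (mm k a i)     = other k , missed a , Other.far-M k a i
      far (ss k a i)     = other k , missed a , Other.far-S k a i
      far (ii k a i κ s) = other k , missed a , either (closed a i κ) (far-head i κ)
          (⊓-glb (≤-trans (far-head i κ) (m≤m+n _ _)) (≤-trans (far-tail i κ) (m≤m+n _ _)))
        where
        open Other k a
        either : ∀ f {x y b} → b ≤ x → b ≤ y → b ≤ pick f x y
        either zero    p q = p
        either (suc _) p q = q

      No-far : ∀ x → ∃ λ y → ∀ r → Path H x y r → 6 * L ≤ r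
      No-far x with v , refl ← enc-surjective x with k₀ , j , 6L≤ ← far v =
        enc (ss k₀ j zero) , λ r p → ≤-trans 6L≤ (≤-trans (path-bound isH v (ss k₀ j zero) p) (≤-reflexive (trans (cong (r +_) target) (+-identityʳ r))))
        where
        open Potential k₀ j
        target : φ (ss k₀ j zero) ≡ 0
        target = cong₂ (λ o e → fS o e true) (dec-true (k₀ Finₚ.≟ k₀) refl) (dec-true (j Finₚ.≟ j) refl)

    edge : ∀ {k a i v w} → (v , w) ∈ blockS k a i → Adjacent H (enc v) (enc w)
    edge f∈ = inj₁ (blocks _ _ _ f∈)

    chain⊆block : ∀ k a i κ {f} → f ∈ chain k a i κ → f ∈ blockS k a i
    chain⊆block k a i zero f∈ = ∈-++⁺ˡ f∈
    chain⊆block k a i (suc zero) f∈ = ∈-++⁺ʳ (chain k a i zero) (∈-++⁺ˡ f∈)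
    chain⊆block k a i (suc (suc zero)) f∈ = ∈-++⁺ʳ (chain k a i zero) (∈-++⁺ʳ (chain k a i κ₁) (∈-++⁺ˡ f∈))
    chain⊆block k a i (suc (suc (suc zero))) f∈ = ∈-++⁺ʳ (chain k a i zero) (∈-++⁺ʳ (chain k a i κ₁) (∈-++⁺ʳ (chain k a i κ₂) (∈-++⁺ˡ f∈)))
    chain⊆block k a i (suc (suc (suc (suc zero)))) f∈ = ∈-++⁺ʳ (chain k a i zero) (∈-++⁺ʳ (chain k a i κ₁) (∈-++⁺ʳ (chain k a i κ₂) (∈-++⁺ʳ (chain k a i κ₃) f∈)))

    inner-path : ∀ k a i κ s → Path H (enc (heads k a i κ)) (enc (ii k a i κ s)) (suc (toℕ s))
    inner-path k a i κ = <-weakInduction (λ s → Path H (enc (heads k a i κ)) (enc (ii k a i κ s)) (suc (toℕ s)))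
      (edge (chain⊆block k a i κ (here refl)) ∷ [])
      (λ s p → subst (Path H _ _) (cong suc (trans (+-comm (toℕ (inject₁ s)) 1) (cong suc (Finₚ.toℕ-inject₁ s))))
        (_◅◅_ H p (edge (chain⊆block k a i κ (there (∈-++⁺ˡ (∈-tabulate⁺ s)))) ∷ [])))

    chain-path : ∀ k a i κ → closed a i κ ≢ 0 → Path H (enc (heads k a i κ)) (enc (tails k a i κ)) L
    chain-path k a i κ ne = subst (Path H _ _) (trans (cong (λ x → suc x + 1) (Finₚ.toℕ-fromℕ l)) (cong suc (+-comm l 1)))
      (_◅◅_ H (inner-path k a i κ (lastFin l)) (Adjacent-sym H (edge (chain⊆block k a i κ (there (∈-++⁺ʳ (tabulate (λ (s : Fin l) → ii k a i κ (inject₁ s) , ii k a i κ (suc s))) (closing (closed a i κ) ne))))) ∷ []))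
      where
      closing : ∀ f → f ≢ 0 → (tails k a i κ , ii k a i κ (lastFin l)) ∈ pick f [] ((tails k a i κ , ii k a i κ (lastFin l)) ∷ [])
      closing zero    f≢0 = contradiction refl f≢0
      closing (suc _) f≢0 = here refl

    private
      last-row : Fin (suc n)
      last-row = lastFin n

      uBit-last : ∀ i → uBit (toℕ last-row) i ≢ 0
      uBit-last i eq = case trans (sym (pick-zero (trans (cong (n ∸_) (Finₚ.toℕ-fromℕ n)) (n∸n≡0 n)))) eq of λ ()
      vBit-last : ∀ i → vBit (toℕ last-row) i ≢ 0
      vBit-last i eq = case trans (sym (pick-zero (trans (cong (n ∸_) (Finₚ.toℕ-fromℕ n)) (n∸n≡0 n)))) eq of λ ()
      vBit-extra : ∀ a → vBit a (toℕ (lastFin d)) ≢ 0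
      vBit-extra a = either (n ∸ a) (d ∸ toℕ (lastFin d)) (trans (cong (d ∸_) (Finₚ.toℕ-fromℕ d)) (n∸n≡0 d))
        where
        either : ∀ x y {z} → y ≡ 0 → pick x 1 (pick y 1 z) ≢ 0
        either zero    y refl ()
        either (suc _) y refl ()

      row-uu : ∀ k a → row k (inject₁ a) ≡ uu a
      row-uu k a with n ≟ toℕ (inject₁ a)
      ... | yes n≡ = contradiction (trans n≡ (Finₚ.toℕ-inject₁ a)) (λ eq → <⇒≢ (Finₚ.toℕ<n a) (sym eq))
      ... | no n≢ = cong uu (Finₚ.lower₁-inject₁′ a n≢)

      row-ff : ∀ k → row k last-row ≡ ff k
      row-ff k with n ≟ toℕ last-row
      ... | yes _ = refl
      ... | no n≢ = contradiction (sym (Finₚ.toℕ-fromℕ n)) n≢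

    module _ (a₀ : Fin n) where

      data Near (v : Vtx) (r : ℕ) : Set where
        near : ∀ k → Path H (enc (uu a₀)) (enc v) k → k ≤ r → Near v r

      along : ∀ v w {r m} → Path H (enc v) (enc w) m → Near v r → Near w (r + m)
      along v w q (near k p k≤) = near _ (_◅◅_ H p q) (+-monoˡ-≤ _ k≤)

      within : ∀ {v r r′} → r ≤ r′ → Near v r → Near v r′
      within le (near k p k≤) = near k p (≤-trans k≤ le)

      forth : ∀ k a i κ {r} → closed a i κ ≢ 0 → Near (heads k a i κ) r → Near (tails k a i κ) (r + L)
      forth k a i κ ne = along (heads k a i κ) (tails k a i κ) (chain-path k a i κ ne)

      back : ∀ k a i κ {r} → closed a i κ ≢ 0 → Near (tails k a i κ) r → Near (heads k a i κ) (r + L)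
      back k a i κ ne = along (tails k a i κ) (heads k a i κ) (Path-sym H (chain-path k a i κ ne))

      near-start : ∀ k i → Near (mm k (inject₁ a₀) i) L
      near-start k i = back k (inject₁ a₀) i κ₁ {0} (λ ()) (near 0 (subst (λ v → Path H (enc (uu a₀)) (enc v) 0) (sym (row-uu k a₀)) []) z≤n)

      near-Y : ∀ k → Near (yy k) (2 * L)
      near-Y k = within (≤-reflexive (cong (L +_) (sym (+-identityʳ L)))) (back k (inject₁ a₀) zero zero (λ ()) (near-start k zero))

      near-M : ∀ k a i → Near (mm k a i) (3 * L)
      near-M k a i = within (≤-reflexive (+-comm (2 * L) L)) (forth k a i zero (λ ()) (near-Y k))

      near-row : ∀ k a → Near (row k a) (4 * L)
      near-row k a = within (≤-reflexive (+-comm (3 * L) L)) (forth k a zero κ₁ (λ ()) (near-M k a zero))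

      -- The extra row has all its bits set, so each C is attached to a midpoint of that row,
      -- whatever U contains.
      near-C : ∀ k i → Near (C k i) (4 * L)
      near-C k i = within (≤-reflexive (+-comm (3 * L) L)) (forth k last-row i κ₂ (uBit-last (toℕ i)) (near-M k last-row i))

      -- The distance to V is the only one that depends on covering. Leaving it as `ρ` serves both
      -- uses: `3 * L + 1` if `a₀` covers everything, and the cruder `5 * L + 1`, available in each
      -- stage, for connectedness.
      near-all : ∀ {ρ} → 3 * L ≤ ρ → (∀ k a → Near (vv k a) ρ) → ∀ v → Near v (ρ + L)
      near-all {ρ} 3L≤ near-V = all
        where
        4L≤ : 4 * L ≤ ρ + L
        4L≤ = ≤-trans (≤-reflexive (+-comm L (3 * L))) (+-monoˡ-≤ L 3L≤)
        2L≤ : 2 * L ≤ ρ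
        2L≤ = ≤-trans (m≤n+m (2 * L) L) 3L≤
        near-C′ : ∀ k i → Near (C′ k i) (ρ + L)
        -- The extra row of V plays the same part for C′ as that of U for C.
        near-C′ k i = forth k last-row i κ₃ (vBit-last (toℕ i)) (near-V k last-row)
        near-head : ∀ k a i κ → Near (heads k a i κ) ρ
        near-head k a i zero                         = within 2L≤ (near-Y k)
        near-head k a i (suc zero)                   = within 3L≤ (near-M k a i)
        near-head k a i (suc (suc zero))             = within 3L≤ (near-M k a i)
        near-head k a i (suc (suc (suc zero)))       = near-V k a
        near-head k a i (suc (suc (suc (suc zero)))) = near-V k a
        all : ∀ v → Near v (ρ + L)
        all (cc κ i) with splitAt 2 κ in eq
        ... | inj₁ k = subst (λ κ → Near (cc κ i) (ρ + L)) (Finₚ.splitAt⁻¹-↑ˡ eq) (within 4L≤ (near-C k i))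
        ... | inj₂ k = subst (λ κ → Near (cc κ i) (ρ + L)) (Finₚ.splitAt⁻¹-↑ʳ {2} eq) (near-C′ k i)
        all (yy k) = within (≤-trans 2L≤ (m≤m+n ρ L)) (near-Y k)
        all (ff k) = subst (λ v → Near v (ρ + L)) (row-ff k) (within 4L≤ (near-row k last-row))
        all (uu a) = subst (λ v → Near v (ρ + L)) (row-uu zero a) (within 4L≤ (near-row zero (inject₁ a)))
        all (vv k a) = within (m≤m+n ρ L) (near-V k a)
        all (mm k a i) = within (≤-trans 3L≤ (m≤m+n ρ L)) (near-M k a i)
        all (ss k a i) = forth k a i κ₄ (λ ()) (near-V k a)
        all (ii k a i κ s) = within (+-monoʳ-≤ ρ (≤-trans (s≤s (s≤s⁻¹ (Finₚ.toℕ<n s))) (n≤1+n (suc l)))) (along (heads k a i κ) (ii k a i κ s) (inner-path k a i κ s) (near-head k a i κ))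

      crossing : ∀ k i → wb (toℕ i) ≢ 0 → Path H (enc (C k i)) (enc (C′ k i)) 1
      crossing k i w≢0 = inj₁ (dynamic k i w≢0) ∷ []

      -- The edge C - C′ of the extra coordinate is present in every stage, and that coordinate
      -- belongs to every vector of V: `4 * L` lead to C, 1 across, `L` to V.
      near-connected : wb d ≢ 0 → ∀ v → Near v (5 * L + 1 + L)
      near-connected wd≢0 = near-all (≤-trans (m≤n+m (3 * L) (2 * L)) (≤-trans (≤-reflexive (sym (*-distribʳ-+ L 2 3))) (m≤m+n (5 * L) 1))) (λ k a →
        within (≤-reflexive (arith L)) (back k a e κ₃ (vBit-extra (toℕ a)) (along (C k e) (C′ k e) (crossing k e (subst (λ x → wb x ≢ 0) (sym (Finₚ.toℕ-fromℕ d)) wd≢0)) (near-C k e))))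
        where
        e : Fin D
        e = lastFin d
        arith : ∀ L → 4 * L + 1 + L ≡ 5 * L + 1
        arith = solve-∀

      -- A coordinate of the hit leads from u over M and C, across the edge for w, and from C′ to V:
      -- `L + L + 1 + L`. No detour over Y is made.
      near-covered : (∀ j → ∃ λ i → Covers a₀ j i) → ∀ v → Near v (3 * L + 1 + L)
      near-covered covers = near-all (m≤m+n (3 * L) 1) (λ k j → let (i , u≢0 , v≢0 , w≢0) = covers j in
        within (≤-reflexive (arith L)) (back k j i κ₃ v≢0 (along (C k i) (C′ k i) (crossing k i w≢0)
          (forth k (inject₁ a₀) i κ₂ (λ u≡0 → u≢0 (trans (cong (λ x → uBit x (toℕ i)) (sym (Finₚ.toℕ-inject₁ a₀))) u≡0)) (near-start k i)))))
        where
        arith : ∀ L → L + L + 1 + L ≡ 3 * L + 1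
        arith = solve-∀

      join : ∀ {v w r r′} → Near v r → Near w r′ → ∃ λ k → Path H (enc v) (enc w) k
      join (near _ p _) (near _ q _) = _ , _◅◅_ H (Path-sym H p) q

      connected : wb d ≢ 0 → Connected H
      connected wd≢0 x y = subst₂ (λ x y → ∃ λ k → Path H x y k) (proj₂ (enc-surjective x)) (proj₂ (enc-surjective y))
        (join (near-connected wd≢0 (proj₁ (enc-surjective x))) (near-connected wd≢0 (proj₁ (enc-surjective y))))

      Yes-near : (∀ j → ∃ λ i → Covers a₀ j i) → ∀ x → ∃ λ k → Path H (enc (uu a₀)) x k × k ≤ 4 * L + 1
      Yes-near covers x = subst (λ x → ∃ λ k → Path H (enc (uu a₀)) x k × k ≤ 4 * L + 1) (proj₂ (enc-surjective x))
        (bound (near-covered covers (proj₁ (enc-surjective x))))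
        where
        arith : ∀ L → 3 * L + 1 + L ≡ 4 * L + 1
        arith = solve-∀
        bound : ∀ {v} → Near v (3 * L + 1 + L) → ∃ λ k → Path H (enc (uu a₀)) (enc v) k × k ≤ 4 * L + 1
        bound (near k p k≤) = k , p , ≤-trans k≤ (≤-reflexive (arith L))

open StageRadii

-- Counting tapes: independence, Markov's inequality, union bound

module Chance where

  -- This is `2 ^ m` times the expectation of `f` under uniform coins. Probabilities are treated as
  -- such sums of indicators, without fractions.
  total : ℕ → (Tape → ℕ) → ℕ
  total zero    f = f []
  total (suc m) f = total m (f ∘ (false ∷_)) + total m (f ∘ (true ∷_))

  total-mono : ∀ m {f g} → (∀ ω → length ω ≡ m → f ω ≤ g ω) → total m f ≤ total m g
  total-mono zero    h = h [] refl
  total-mono (suc m) h = +-mono-≤ (total-mono m (λ ω e → h _ (cong suc e))) (total-mono m (λ ω e → h _ (cong suc e)))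

  total-cong : ∀ m {f g} → (∀ ω → length ω ≡ m → f ω ≡ g ω) → total m f ≡ total m g
  total-cong m h = ≤-antisym (total-mono m (λ ω e → ≤-reflexive (h ω e))) (total-mono m (λ ω e → ≤-reflexive (sym (h ω e))))

  total-const : ∀ m c → total m (λ _ → c) ≡ c * 2 ^ m
  total-const zero    c = sym (*-identityʳ c)
  total-const (suc m) c = trans (cong₂ _+_ (total-const m c) (total-const m c)) (arith c (2 ^ m))
    where
    arith : ∀ c x → c * x + c * x ≡ c * (2 * x)
    arith = solve-∀

  total-+ : ∀ m f g → total m (λ ω → f ω + g ω) ≡ total m f + total m g
  total-+ zero    f g = refl
  total-+ (suc m) f g = trans (cong₂ _+_ (total-+ m _ _) (total-+ m _ _)) (arith (total m (f ∘ (false ∷_))) (total m (g ∘ (false ∷_))) (total m (f ∘ (true ∷_))) (total m (g ∘ (true ∷_))))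
    where
    arith : ∀ a b c d → (a + b) + (c + d) ≡ (a + c) + (b + d)
    arith = solve-∀

  total-* : ∀ m c f → total m (λ ω → c * f ω) ≡ c * total m f
  total-* zero    c f = refl
  total-* (suc m) c f = trans (cong₂ _+_ (total-* m c _) (total-* m c _)) (sym (*-distribˡ-+ c _ _))

  total-++ : ∀ m k f → total (m + k) f ≡ total m (λ x → total k (λ y → f (x ++ y)))
  total-++ zero    k f = refl
  total-++ (suc m) k f = cong₂ _+_ (total-++ m k _) (total-++ m k _)

  take-++ : ∀ {m} (x y : Tape) → length x ≡ m → take m (x ++ y) ≡ x
  take-++ []      y refl = refl
  take-++ (b ∷ x) y refl = cong (b ∷_) (take-++ x y refl)

  total-take : ∀ m k f → total (m + k) (f ∘ take m) ≡ total m f * 2 ^ k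
  total-take m k f = trans (total-++ m k (f ∘ take m)) (trans (total-cong m (λ x e → trans (total-cong k (λ y _ → cong f (take-++ x y e))) (trans (total-const k (f x)) (*-comm (f x) (2 ^ k)))))
    (trans (total-* m (2 ^ k) f) (*-comm (2 ^ k) (total m f))))

  module _ where
    open DecMembership (Listₚ.≡-dec Boolₚ._≟_) using (_∈?_)

    outside : List Tape → Tape → ℕ
    outside xs ω = bit (not (does (ω ∈? xs)))

    private
      inside : List Tape → Tape → ℕ
      inside xs ω = bit (does (ω ∈? xs))

      is : Tape → Tape → ℕ
      is x ω = bit (does (Listₚ.≡-dec Boolₚ._≟_ ω x))

      is-cons : ∀ b x ω → is (b ∷ x) (b ∷ ω) ≡ is x ω
      is-cons b x ω = cong bit (agree (ω ≟ₜ x))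
        where
        _≟ₜ_ : (x y : Tape) → Dec (x ≡ y)
        _≟ₜ_ = Listₚ.≡-dec Boolₚ._≟_
        agree : Dec (ω ≡ x) → does ((b ∷ ω) ≟ₜ (b ∷ x)) ≡ does (ω ≟ₜ x)
        agree (yes eq) = trans (dec-true ((b ∷ ω) ≟ₜ (b ∷ x)) (cong (b ∷_) eq)) (sym (dec-true (ω ≟ₜ x) eq))
        agree (no ne)  = trans (dec-false ((b ∷ ω) ≟ₜ (b ∷ x)) (λ eq → ne (Listₚ.∷-injectiveʳ eq))) (sym (dec-false (ω ≟ₜ x) ne))

      total-is : ∀ x → 1 ≤ total (length x) (is x)
      total-is [] = ≤-refl
      total-is (false ∷ x) = ≤-trans (total-is x) (≤-trans (≤-reflexive (total-cong (length x) (λ ω _ → sym (is-cons false x ω)))) (m≤m+n _ _))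
      total-is (true ∷ x)  = ≤-trans (total-is x) (≤-trans (≤-reflexive (total-cong (length x) (λ ω _ → sym (is-cons true x ω)))) (m≤n+m _ _))

      inside-step : ∀ x xs ω → All (x ≢_) xs → is x ω + inside xs ω ≤ inside (x ∷ xs) ω
      inside-step x xs ω x∉ with Listₚ.≡-dec Boolₚ._≟_ ω x | ω ∈? xs
      ... | yes refl | yes x∈ = contradiction refl (All.lookup x∉ x∈)
      ... | yes refl | no _   = ≤-refl
      ... | no _     | yes _  = ≤-refl
      ... | no _     | no _   = z≤n

      length≤inside : ∀ m xs → Unique xs → All (λ x → length x ≡ m) xs → length xs ≤ total m (inside xs)
      length≤inside m []       _        _          = z≤n
      length≤inside m (x ∷ xs) (x∉ ∷ u) (refl ∷ l) =
        ≤-trans (+-mono-≤ (total-is x) (length≤inside m xs u l))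
          (≤-trans (≤-reflexive (sym (total-+ m (is x) (inside xs)))) (total-mono m (λ ω _ → inside-step x xs ω x∉)))

      inside+outside : ∀ xs ω → inside xs ω + outside xs ω ≡ 1
      inside+outside xs ω with ω ∈? xs
      ... | yes _ = refl
      ... | no _  = refl

    outside≤1 : ∀ xs ω → outside xs ω ≤ 1
    outside≤1 xs ω = ≤-trans (m≤n+m _ (inside xs ω)) (≤-reflexive (inside+outside xs ω))

    outside-zero : ∀ xs ω → outside xs ω ≡ 0 → ω ∈ xs
    outside-zero xs ω e with ω ∈? xs
    ... | yes ω∈ = ω∈

    -- A list of distinct good tapes becomes a bound on the number of bad ones, the quantity whose
    -- exponential can be multiplied over independent repetitions.
    Pr-outside : ∀ {m P} → Pr⅔ m P → ∃ λ xs → All P xs × 3 * total m (outside xs) ≤ 2 ^ m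
    Pr-outside {m} {P} (ωs , u , ps , many) = xs , Allₚ.map⁺ ps , +-cancelˡ-≤ (2 * 2 ^ m) _ _ bound
      where
      xs : List Tape
      xs = map Vec.toList ωs
      unique : Unique xs
      unique = AllPairsₚ.map⁺ (AllPairs-map (λ ne eq → ne (trans (sym (Vecₚ.cast-is-id refl _)) (Vecₚ.toList-injective refl _ _ eq))) u)
        where
        open import Data.List.Relation.Unary.AllPairs using () renaming (map to AllPairs-map)
      lengths : All (λ x → length x ≡ m) xs
      lengths = Allₚ.map⁺ (All.universal (λ ω → Vecₚ.length-toList ω) ωs)
      sum≡ : total m (inside xs) + total m (outside xs) ≡ 2 ^ m
      sum≡ = trans (sym (total-+ m (inside xs) (outside xs))) (trans (total-cong m (λ ω _ → inside+outside xs ω)) (trans (total-const m 1) (*-identityˡ _)))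
      bound : 2 * 2 ^ m + 3 * total m (outside xs) ≤ 2 * 2 ^ m + 2 ^ m
      bound = ≤-trans (+-monoˡ-≤ _ (≤-trans many (*-monoʳ-≤ 3 (≤-trans (≤-reflexive (sym (Listₚ.length-map Vec.toList ωs))) (length≤inside m xs unique lengths)))))
        (≤-reflexive (trans (sym (*-distribˡ-+ 3 (total m (inside xs)) _)) (trans (cong (3 *_) sum≡) (arith (2 ^ m)))))
        where
        arith : ∀ x → 3 * x ≡ 2 * x + x
        arith = solve-∀

  select : (m : ℕ) → (Tape → Bool) → List (Vec Bool m)
  select zero    g = if g [] then [] ∷ [] else []
  select (suc m) g = map (false ∷_) (select m (g ∘ (false ∷_))) ++ map (true ∷_) (select m (g ∘ (true ∷_)))

  length-select : ∀ m g → length (select m g) ≡ total m (bit ∘ g)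
  length-select zero g with g []
  ... | true  = refl
  ... | false = refl
  length-select (suc m) g = trans (length-++ (map (false ∷_) (select m (g ∘ (false ∷_)))))
    (cong₂ _+_ (trans (Listₚ.length-map (false ∷_) (select m (g ∘ (false ∷_)))) (length-select m _))
               (trans (Listₚ.length-map (true ∷_) (select m (g ∘ (true ∷_)))) (length-select m _)))

  select-Unique : ∀ m g → Unique (select m g)
  select-Unique zero g with g []
  ... | true  = [] ∷ []
  ... | false = []
  select-Unique (suc m) g = AllPairsₚ.++⁺
    (AllPairsₚ.map⁺ (AllPairs-map (λ ne eq → ne (Vecₚ.∷-injectiveʳ eq)) (select-Unique m (g ∘ (false ∷_)))))
    (AllPairsₚ.map⁺ (AllPairs-map (λ ne eq → ne (Vecₚ.∷-injectiveʳ eq)) (select-Unique m (g ∘ (true ∷_)))))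
    (Allₚ.map⁺ (All.universal (λ x → Allₚ.map⁺ (All.universal (λ y ()) (select m (g ∘ (true ∷_))))) (select m (g ∘ (false ∷_)))))
    where
    open import Data.List.Relation.Unary.AllPairs using () renaming (map to AllPairs-map)

  select-All : ∀ m g → All (λ ω → g (Vec.toList ω) ≡ true) (select m g)
  select-All zero g with g [] in eq
  ... | true  = eq ∷ []
  ... | false = []
  select-All (suc m) g = Allₚ.++⁺ (Allₚ.map⁺ (select-All m (g ∘ (false ∷_)))) (Allₚ.map⁺ (select-All m (g ∘ (true ∷_))))

  Pr-select : ∀ {m} {P : Tape → Set} (bad : Tape → Bool) → 3 * total m (bit ∘ bad) ≤ 2 ^ m →
              (∀ ω → length ω ≡ m → bad ω ≡ false → P ω) → Pr⅔ m P
  Pr-select {m} {P} bad few good =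
    select m (not ∘ bad) , select-Unique m (not ∘ bad) ,
    All.map (λ {ω} e → good (Vec.toList ω) (Vecₚ.length-toList ω) (not-true e)) (select-All m (not ∘ bad)) ,
    ≤-trans (+-cancelʳ-≤ (3 * total m (bit ∘ bad)) (2 * 2 ^ m) (3 * total m (bit ∘ not ∘ bad)) bound) (≤-reflexive (cong (3 *_) (sym (length-select m (not ∘ bad)))))
    where
    not-true : ∀ {b} → not b ≡ true → b ≡ false
    not-true {false} _ = refl
    complement : ∀ b → bit (not b) + bit b ≡ 1
    complement true  = refl
    complement false = refl
    bound : 2 * 2 ^ m + 3 * total m (bit ∘ bad) ≤ 3 * total m (bit ∘ not ∘ bad) + 3 * total m (bit ∘ bad)
    bound = ≤-trans (+-monoʳ-≤ (2 * 2 ^ m) few) (≤-reflexive (trans (arith (2 ^ m)) (trans (cong (3 *_) (sym (trans (sym (total-+ m (bit ∘ not ∘ bad) (bit ∘ bad)))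
      (trans (total-cong m (λ ω _ → complement (bad ω))) (trans (total-const m 1) (*-identityˡ _)))))) (*-distribˡ-+ 3 (total m (bit ∘ not ∘ bad)) _))))
      where
      arith : ∀ x → 2 * x + x ≡ 3 * x
      arith = solve-∀

  product : ℕ → (ℕ → ℕ) → ℕ
  product zero    g = 1
  product (suc R) g = g 0 * product R (g ∘ suc)

  product-cong : ∀ R {g h} → (∀ r → g r ≡ h r) → product R g ≡ product R h
  product-cong zero    e = refl
  product-cong (suc R) e = cong₂ _*_ (e 0) (product-cong R (e ∘ suc))

  product-≤ : ∀ R {g c} → (∀ r → g r ≤ c) → product R g ≤ c ^ R
  product-≤ zero    h = ≤-refl
  product-≤ (suc R) h = *-mono-≤ (h 0) (product-≤ R (h ∘ suc))

  product-scale : ∀ R c g → c ^ R * product R g ≡ product R (λ r → c * g r)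
  product-scale zero    c g = refl
  product-scale (suc R) c g = trans (arith c (c ^ R) (g 0) (product R (g ∘ suc))) (cong (c * g 0 *_) (product-scale R c (g ∘ suc)))
    where
    arith : ∀ c x y z → c * x * (y * z) ≡ c * y * (x * z)
    arith = solve-∀

  total-row : ∀ R (h : ℕ → Bool → ℕ) → total R (λ row → product R (λ r → h r (at false row r))) ≡ product R (λ r → h r false + h r true)
  total-row zero    h = refl
  total-row (suc R) h = trans (cong₂ _+_
      (trans (total-* R (h 0 false) _) (cong (h 0 false *_) (total-row R (h ∘ suc))))
      (trans (total-* R (h 0 true) _) (cong (h 0 true *_) (total-row R (h ∘ suc)))))
    (sym (*-distribʳ-+ (product R (λ r → h (suc r) false + h (suc r) true)) (h 0 false) (h 0 true)))

  at-++ˡ : ∀ {A : Set} {z : A} (x y : List A) k → k < length x → at z (x ++ y) k ≡ at z x k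
  at-++ˡ (b ∷ x) y zero    k< = refl
  at-++ˡ (b ∷ x) y (suc k) k< = at-++ˡ x y k (s≤s⁻¹ k<)

  at-++ʳ : ∀ {A : Set} {z : A} (x y : List A) k → at z (x ++ y) (length x + k) ≡ at z y k
  at-++ʳ []      y k = refl
  at-++ʳ (b ∷ x) y k = at-++ʳ x y k

  column-++ : ∀ {R} r (x y : Tape) i n → length x ≡ R → column R r (x ++ y) (suc i) n ≡ column R r y i n
  column-++ r x y i zero    e    = refl
  column-++ r x y i (suc n) refl = cong₂ _∷_ (trans (cong (at false (x ++ y)) (+-assoc (length x) (i * length x) r)) (at-++ʳ x y (i * length x + r))) (column-++ r x y (suc i) n refl)

  product-cong< : ∀ R {g h} → (∀ r → r < R → g r ≡ h r) → product R g ≡ product R h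
  product-cong< zero    e = refl
  product-cong< (suc R) e = cong₂ _*_ (e 0 (s≤s z≤n)) (product-cong< R (λ r r< → e (suc r) (s≤s r<)))

  -- Independence: the columns of a uniform tape are independent uniform tapes. Splitting off the
  -- first row, one coin for each column, leaves the distributive law `total-row`.
  total-columns : ∀ R m (f : ℕ → Tape → ℕ) →
    total (m * R) (λ Ω → product R (λ r → f r (column R r Ω 0 m))) ≡ product R (λ r → total m (f r))
  total-columns R zero    f = refl
  total-columns R (suc m) f = trans (total-++ R (m * R) _) (trans (total-cong R (λ row len → trans
      (total-cong (m * R) (λ Ω _ → product-cong< R (λ r r< → cong (f r) (cong₂ _∷_ (at-++ˡ row Ω r (≤-trans r< (≤-reflexive (sym len)))) (column-++ r row Ω 0 m len)))))
      (total-columns R m (λ r → f r ∘ (at false row r ∷_)))))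
    (total-row R (λ r b → total m (f r ∘ (b ∷_)))))

  sumTo : ℕ → (ℕ → ℕ) → ℕ
  sumTo zero    g = 0
  sumTo (suc R) g = g 0 + sumTo R (g ∘ suc)

  product-^ : ∀ R g → product R (λ r → 2 ^ g r) ≡ 2 ^ sumTo R g
  product-^ zero    g = refl
  product-^ (suc R) g = trans (cong (2 ^ g 0 *_) (product-^ R (g ∘ suc))) (sym (^-distribˡ-+-* 2 (g 0) _))

  *-^-distrib : ∀ k m n → (m * n) ^ k ≡ m ^ k * n ^ k
  *-^-distrib zero    m n = refl
  *-^-distrib (suc k) m n = trans (cong (m * n *_) (*-^-distrib k m n)) (arith m n (m ^ k) (n ^ k))
    where
    arith : ∀ m n x y → m * n * (x * y) ≡ m * x * (n * y)
    arith = solve-∀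

  -- Markov's inequality for 2 ^ (the number of failures): its expectation is at
  -- most (4 / 3) ^ R if each of the R independent trials fails with probability at
  -- most 1 / 3.
  majority-fails : ∀ h m (fail : Tape → ℕ) → (∀ ω → fail ω ≤ 1) → 3 * total m fail ≤ 2 ^ m →
    18 ^ h * total (m * (2 * h)) (λ Ω → bit (h ≤ᵇ sumTo (2 * h) (λ r → fail (column (2 * h) r Ω 0 m)))) ≤ 16 ^ h * 2 ^ (m * (2 * h))
  majority-fails h m fail ≤1 few = begin
    18 ^ h * total M (λ Ω → bit (h ≤ᵇ failures Ω))            ≡⟨ cong (_* total M (λ Ω → bit (h ≤ᵇ failures Ω))) (*-^-distrib h 9 2) ⟩
    9 ^ h * 2 ^ h * total M (λ Ω → bit (h ≤ᵇ failures Ω))     ≡⟨ *-assoc (9 ^ h) (2 ^ h) _ ⟩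
    9 ^ h * (2 ^ h * total M (λ Ω → bit (h ≤ᵇ failures Ω)))   ≡⟨ cong (9 ^ h *_) (sym (total-* M (2 ^ h) _)) ⟩
    9 ^ h * total M (λ Ω → 2 ^ h * bit (h ≤ᵇ failures Ω))     ≤⟨ *-monoʳ-≤ (9 ^ h) (total-mono M (λ Ω _ → markov (failures Ω))) ⟩
    9 ^ h * total M (λ Ω → 2 ^ failures Ω)                    ≡⟨ cong (9 ^ h *_) (trans (total-cong M (λ Ω _ → sym (product-^ (2 * h) (λ r → fail (column (2 * h) r Ω 0 m))))) (total-columns (2 * h) m (λ _ ω → 2 ^ fail ω))) ⟩
    (3 ^ 2) ^ h * product (2 * h) (λ _ → total m (λ ω → 2 ^ fail ω)) ≡⟨ cong (_* product (2 * h) (λ _ → total m (λ ω → 2 ^ fail ω))) (^-*-assoc 3 2 h) ⟩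
    3 ^ (2 * h) * product (2 * h) (λ _ → total m (λ ω → 2 ^ fail ω)) ≡⟨ product-scale (2 * h) 3 _ ⟩
    product (2 * h) (λ _ → 3 * total m (λ ω → 2 ^ fail ω))    ≤⟨ product-≤ (2 * h) (λ _ → trial) ⟩
    (4 * 2 ^ m) ^ (2 * h)                                     ≡⟨ *-^-distrib (2 * h) 4 (2 ^ m) ⟩
    4 ^ (2 * h) * (2 ^ m) ^ (2 * h)                           ≡⟨ cong₂ _*_ (sym (^-*-assoc 4 2 h)) (^-*-assoc 2 m (2 * h)) ⟩
    16 ^ h * 2 ^ (m * (2 * h))                                ∎
    where
    open ≤-Reasoning
    M : ℕ
    M = m * (2 * h)
    failures : Tape → ℕ
    failures Ω = sumTo (2 * h) (λ r → fail (column (2 * h) r Ω 0 m))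
    markov : ∀ k → 2 ^ h * bit (h ≤ᵇ k) ≤ 2 ^ k
    markov k with h ≤ᵇ k in eq
    ... | true  = ≤-trans (≤-reflexive (*-identityʳ (2 ^ h))) (^-monoʳ-≤ 2 (≤ᵇ⇒≤ h k (subst T (sym eq) tt)))
    ... | false = ≤-trans (≤-reflexive (*-zeroʳ (2 ^ h))) z≤n
    power : ∀ x → x ≤ 1 → 2 ^ x ≡ 1 + x
    power zero          _ = refl
    power (suc zero)    _ = refl
    power (suc (suc _)) (s≤s ())
    trial : 3 * total m (λ ω → 2 ^ fail ω) ≤ 4 * 2 ^ m
    trial = ≤-trans (≤-reflexive (trans (cong (3 *_) (trans (total-cong m (λ ω _ → power (fail ω) (≤1 ω))) (trans (total-+ m (λ _ → 1) fail) (cong (_+ total m fail) (total-const m 1))))) (*-distribˡ-+ 3 (1 * 2 ^ m) (total m fail))))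
      (≤-trans (+-monoʳ-≤ (3 * (1 * 2 ^ m)) few) (≤-reflexive (arith (2 ^ m))))
      where
      arith : ∀ x → 3 * (1 * x) + x ≡ 4 * x
      arith = solve-∀

  anyTo : ℕ → (ℕ → Bool) → Bool
  anyTo zero    p = false
  anyTo (suc J) p = p 0 ∨ anyTo J (p ∘ suc)

  anyTo-false : ∀ J {p} → anyTo J p ≡ false → ∀ j → j < J → p j ≡ false
  anyTo-false (suc J) {p} e j j< with p 0 in eq
  anyTo-false (suc J) {p} e zero    j<       | false = eq
  anyTo-false (suc J) {p} e (suc j) (s≤s j<) | false = anyTo-false J e j j<

  -- Union bound over `J`. One majority fails with probability at most `(16 / 18) ^ h`, which for
  -- `h = 6 * g` is below `1 / 2 ^ g`, and `4 * J ≤ 2 ^ g` leaves at most 1/4 in total. A tie, `h`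
  -- failures among `2 * h`, counts as a failed majority.
  all-majorities : ∀ g J m (fail : ℕ → Tape → ℕ) → 4 * J ≤ 2 ^ g → (∀ j ω → fail j ω ≤ 1) → (∀ j → j < J → 3 * total m (fail j) ≤ 2 ^ m) →
    let h = 6 * g in
    3 * total (m * (2 * h)) (λ Ω → bit (anyTo J (λ j → h ≤ᵇ sumTo (2 * h) (λ r → fail j (column (2 * h) r Ω 0 m))))) ≤ 2 ^ (m * (2 * h))
  all-majorities g J m fail 4J≤ ≤1 few = *-cancelˡ-≤ (18 ^ h) {{m^n≢0 18 h}} (begin
    18 ^ h * (3 * total M any)      ≡⟨ arith₁ (18 ^ h) (total M any) ⟩
    3 * (18 ^ h * total M any)      ≤⟨ *-monoʳ-≤ 3 scaled ⟩
    3 * (J * (16 ^ h * 2 ^ M))      ≡⟨ arith₂ J (16 ^ h) (2 ^ M) ⟩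
    3 * J * 16 ^ h * 2 ^ M          ≤⟨ *-monoˡ-≤ (2 ^ M) (≤-trans (*-monoˡ-≤ (16 ^ h) (≤-trans (*-monoˡ-≤ J (n≤1+n 3)) 4J≤)) powers) ⟩
    18 ^ h * 2 ^ M                  ∎)
    where
    open ≤-Reasoning
    h M : ℕ
    h = 6 * g
    M = m * (2 * h)
    heavy : ℕ → Tape → Bool
    heavy j Ω = h ≤ᵇ sumTo (2 * h) (λ r → fail j (column (2 * h) r Ω 0 m))
    any : Tape → ℕ
    any Ω = bit (anyTo J (λ j → heavy j Ω))
    arith₁ : ∀ x y → x * (3 * y) ≡ 3 * (x * y)
    arith₁ = solve-∀
    arith₂ : ∀ J x y → 3 * (J * (x * y)) ≡ 3 * J * x * y
    arith₂ = solve-∀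
    -- 18 ^ 6 = 34012224 and 2 * 16 ^ 6 = 33554432
    powers : 2 ^ g * 16 ^ h ≤ 18 ^ h
    powers = begin
      2 ^ g * 16 ^ h        ≡⟨ cong (2 ^ g *_) (sym (^-*-assoc 16 6 g)) ⟩
      2 ^ g * (16 ^ 6) ^ g  ≡⟨ sym (*-^-distrib g 2 (16 ^ 6)) ⟩
      (2 * 16 ^ 6) ^ g      ≤⟨ ^-monoˡ-≤ g (≤ᵇ⇒≤ (2 * 16 ^ 6) (18 ^ 6) tt) ⟩
      (18 ^ 6) ^ g          ≡⟨ ^-*-assoc 18 6 g ⟩
      18 ^ h                ∎
    weighted : ∀ K (p : ℕ → Tape → Bool) → (∀ j → j < K → 18 ^ h * total M (bit ∘ p j) ≤ 16 ^ h * 2 ^ M) →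
               18 ^ h * total M (λ Ω → bit (anyTo K (λ j → p j Ω))) ≤ K * (16 ^ h * 2 ^ M)
    weighted zero    p b = ≤-reflexive (trans (cong (18 ^ h *_) (total-const M 0)) (*-zeroʳ (18 ^ h)))
    weighted (suc K) p b = ≤-trans (*-monoʳ-≤ (18 ^ h) (≤-trans (total-mono M (λ Ω _ → ∨-sum (p 0 Ω) _)) (≤-reflexive (total-+ M (bit ∘ p 0) _))))
      (≤-trans (≤-reflexive (*-distribˡ-+ (18 ^ h) (total M (bit ∘ p 0)) _)) (+-mono-≤ (b 0 (s≤s z≤n)) (weighted K (p ∘ suc) (λ j j< → b (suc j) (s≤s j<)))))
      where
      ∨-sum : ∀ a b → bit (a ∨ b) ≤ bit a + bit b
      ∨-sum true  b = s≤s z≤n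
      ∨-sum false b = ≤-refl
    scaled : 18 ^ h * total M any ≤ J * (16 ^ h * 2 ^ M)
    scaled = weighted J heavy (λ j j< → majority-fails h m (fail j) (≤1 j) (few j j<))

open Chance

-- The updates of a stage and their effect on the graph

module DynamicStages where

  settingOf : Variant → Setting
  settingOf fully = fullyDynamic
  settingOf incr  = incremental
  settingOf decr  = decremental

  timingOf : Variant → Timing
  timingOf fully = amortized
  timingOf _     = worstCase

  module _ {N : ℕ} where

    private
      _≟ₑ_ : (e f : Edge N) → Dec (e ≡ f)
      _≟ₑ_ = ≡-dec Finₚ._≟_ Finₚ._≟_

    ∈-remove⁺ : ∀ {e f : Edge N} {G} → f ≢ e → f ∈ G → f ∈ remove e G
    ∈-remove⁺ {e} f≢ f∈ = ∈-filter⁺ (λ e′ → ¬? (e′ ≟ₑ e)) f∈ f≢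

    ∈-remove⁻ : ∀ {e f : Edge N} {G} → f ∈ remove e G → f ∈ G × f ≢ e
    ∈-remove⁻ {e} = ∈-filter⁻ (λ e′ → ¬? (e′ ≟ₑ e))

    effect : Bool → List (Edge N) → EdgeList N → EdgeList N
    effect deleting []       G = G
    effect deleting (e ∷ es) G = effect deleting es (if deleting then remove e G else e ∷ G)

    ∈-inserted⁻ : ∀ es {G f} → f ∈ effect false es G → f ∈ es ⊎ f ∈ G
    ∈-inserted⁻ []       f∈ = inj₂ f∈
    ∈-inserted⁻ (e ∷ es) f∈ with ∈-inserted⁻ es f∈
    ... | inj₁ f∈es        = inj₁ (there f∈es)
    ... | inj₂ (here eq)   = inj₁ (here eq)
    ... | inj₂ (there f∈G) = inj₂ f∈G

    ∈-inserted⁺ : ∀ es {G f} → f ∈ es ⊎ f ∈ G → f ∈ effect false es G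
    ∈-inserted⁺ []       (inj₂ f∈)         = f∈
    ∈-inserted⁺ (e ∷ es) (inj₁ (here eq))  = ∈-inserted⁺ es (inj₂ (here eq))
    ∈-inserted⁺ (e ∷ es) (inj₁ (there f∈)) = ∈-inserted⁺ es (inj₁ f∈)
    ∈-inserted⁺ (e ∷ es) (inj₂ f∈)         = ∈-inserted⁺ es (inj₂ (there f∈))

    ∈-deleted⁻ : ∀ es {G f} → f ∈ effect true es G → f ∈ G × f ∉ es
    ∈-deleted⁻ []       f∈ = f∈ , λ ()
    ∈-deleted⁻ (e ∷ es) f∈ with f∈′ , f∉ ← ∈-deleted⁻ es f∈ with f∈G , f≢ ← ∈-remove⁻ f∈′ =
      f∈G , λ { (here eq) → f≢ eq ; (there f∈es) → f∉ f∈es }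

    ∈-deleted⁺ : ∀ es {G f} → f ∈ G → f ∉ es → f ∈ effect true es G
    ∈-deleted⁺ []       f∈ f∉ = f∈
    ∈-deleted⁺ (e ∷ es) f∈ f∉ = ∈-deleted⁺ es (∈-remove⁺ (λ eq → f∉ (here eq)) f∈) (λ f∈es → f∉ (there f∈es))

    private
      remove-absent : ∀ e G → e ∉ G → remove e G ≡ G
      remove-absent e G e∉ = Listₚ.filter-all (λ e′ → ¬? (e′ ≟ₑ e)) (All.tabulate (λ {f} f∈ eq → e∉ (subst (_∈ G) eq f∈)))

      remove-inserted : ∀ e es G → e ∉ es → e ∉ G → remove e (effect false es (e ∷ G)) ≡ effect false es G
      remove-inserted e es G e∉es e∉G = trans (commute es (e ∷ G) e∉es) (cong (effect false es) (trans (Listₚ.filter-reject (λ e′ → ¬? (e′ ≟ₑ e)) (λ ne → ne refl)) (remove-absent e G e∉G)))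
        where
        commute : ∀ es G → e ∉ es → remove e (effect false es G) ≡ effect false es (remove e G)
        commute []       G e∉ = refl
        commute (f ∷ es) G e∉ = trans (commute es (f ∷ G) (λ e∈ → e∉ (there e∈)))
          (cong (effect false es) (Listₚ.filter-accept (λ e′ → ¬? (e′ ≟ₑ e)) (λ eq → e∉ (here (sym eq)))))

    -- Equality of lists and not only of sets, because the next stage must start from literally the
    -- same graph. Deleting in the order of insertion is possible since `remove` is a filter and
    -- commutes with inserting other edges.
    delete-inserted : ∀ es G → Unique es → All (_∉ G) es → effect true es (effect false es G) ≡ G
    delete-inserted []       G _        _          = refl
    delete-inserted (e ∷ es) G (e∉ ∷ u) (e∉G ∷ ds) = trans (cong (effect true es) (remove-inserted e es G (λ e∈ → All.lookup e∉ e∈ refl) e∉G)) (delete-inserted es G u ds)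

    Legal-insert : ∀ {σ M G ops H} es → (∀ e → Supports {N} σ (insert e)) → Unique es → All Ordered es → All (_∉ G) es →
      length G + length es ≤ M → Legal σ M (effect false es G) ops H → Legal σ M G (map insert es ++ ops) H
    Legal-insert []       sup _        _        _          _  leg = leg
    Legal-insert {M = M} {G} (e ∷ es) sup (e∉ ∷ u) (o ∷ os) (e∉G ∷ ds) le leg =
      ins (sup e) o e∉G (≤-trans (s≤s (m≤m+n _ (length es))) le′)
        (Legal-insert es sup u os (All.zipWith (λ (e≢ , f∉) → λ { (here eq) → e≢ (sym eq) ; (there f∈) → f∉ f∈ }) (e∉ , ds)) le′ leg)
      where
      le′ : suc (length G) + length es ≤ M
      le′ = ≤-trans (≤-reflexive (sym (+-suc (length G) (length es)))) le

    Legal-delete : ∀ {σ M G ops H} es → (∀ e → Supports {N} σ (delete e)) → Unique es → All (_∈ G) es →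
      Legal σ M (effect true es G) ops H → Legal σ M G (map delete es ++ ops) H
    Legal-delete []       sup _        _         leg = leg
    Legal-delete (e ∷ es) sup (e∉ ∷ u) (e∈ ∷ es∈) leg =
      del (sup e) e∈ (Legal-delete es sup u (All.zipWith (λ (e≢ , f∈) → ∈-remove⁺ (λ eq → e≢ (sym eq)) f∈) (e∉ , es∈)) leg)

  module StageOps (B : ℕ) (A : DynamicProg) (v : Variant) (n d l : ℕ) (1≤l : 1 ≤ l) (Ul Vl Wl : List ℕ) where
    open Layout n d l using (N)
    open Graph n d l Ul Vl using (enc; dec; dec-enc; num)
    open Edges n d l Ul Vl using (C; C′; num-C; num-C′)
    open InitialGraph n d l 1≤l Ul Vl using (fin; toℕ-fin; fin-num; 4D≤N; encE; initialGraph)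
    open Stages B A v d Wl fin (λ x x< → toℕ-fin (<-≤-trans x< 4D≤N)) hiding (module Run-stages) public

    q₀ : ℕ
    q₀ = if decremental? v then 2 * D else 0

    q₀≤ : q₀ ≤ 2 * D
    q₀≤ = bounded (decremental? v)
      where
      bounded : ∀ b → (if b then 2 * D else 0) ≤ 2 * D
      bounded true  = ≤-refl
      bounded false = z≤n

    G₀ : EdgeList N
    G₀ = initialGraph q₀

    edgesAt : (j i : ℕ) → List (Edge N)
    edgesAt j i = pick (triggered j i) [] (dynamicEdge 0 i ∷ dynamicEdge D i ∷ [])

    edgesFrom : (j i c : ℕ) → List (Edge N)
    edgesFrom j i zero    = []
    edgesFrom j i (suc c) = edgesAt j i ++ edgesFrom j (suc i) c

    edges : ℕ → List (Edge N)
    edges j = edgesFrom j 0 D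

    opsFrom-edges : ∀ b j i c → opsFrom b j i c ≡ map (mkOp b) (edgesFrom j i c)
    opsFrom-edges b j i zero    = refl
    opsFrom-edges b j i (suc c) = trans (cong₂ _++_ (one (triggered j i)) (opsFrom-edges b j (suc i) c)) (sym (map-++ (mkOp b) (edgesAt j i) _))
      where
      one : ∀ w → pick w [] (mkOp b (dynamicEdge 0 i) ∷ mkOp b (dynamicEdge D i) ∷ []) ≡ map (mkOp b) (pick w [] (dynamicEdge 0 i ∷ dynamicEdge D i ∷ []))
      one zero    = refl
      one (suc _) = refl

    dynE : Fin 2 → Fin D → Edge N
    dynE k i = encE (C k i , C′ k i)

    dynamicEdge-dynE : ∀ k i → dynamicEdge (D * toℕ k) (toℕ i) ≡ dynE k i
    dynamicEdge-dynE k i = cong₂ _,_ (trans (cong fin (trans (+-comm (toℕ i) _) (sym (num-C k i)))) (fin-num (C k i)))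
      (trans (cong fin (trans (+-comm _ (2 * D)) (trans (cong (2 * D +_) (+-comm (toℕ i) _)) (sym (num-C′ k i))))) (fin-num (C′ k i)))

    private
      cc-injective : ∀ {κ i κ′ i′} → Graph.cc {n} {d} {l} {Ul} {Vl} κ i ≡ Graph.cc κ′ i′ → κ ≡ κ′ × i ≡ i′
      cc-injective refl = refl , refl

    dynE-injective : ∀ {k i k′ i′} → dynE k i ≡ dynE k′ i′ → k ≡ k′ × i ≡ i′
    dynE-injective {k} {i} {k′} {i′} eq with κ≡ , i≡ ← cc-injective (trans (sym (dec-enc (C k i))) (trans (cong (dec ∘ proj₁) eq) (dec-enc (C k′ i′)))) =
      Finₚ.↑ˡ-injective 2 k k′ κ≡ , i≡

    private
      dynamicEdge₀ : ∀ i → dynamicEdge 0 (toℕ i) ≡ dynE zero i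
      dynamicEdge₀ i = trans (cong (λ z → dynamicEdge z (toℕ i)) (sym (*-zeroʳ D))) (dynamicEdge-dynE zero i)

      dynamicEdge₁ : ∀ i → dynamicEdge D (toℕ i) ≡ dynE (suc zero) i
      dynamicEdge₁ i = trans (cong (λ z → dynamicEdge z (toℕ i)) (sym (*-identityʳ D))) (dynamicEdge-dynE (suc zero) i)

      edgesAt⁻ : ∀ j i {e} → e ∈ edgesAt j (toℕ i) → triggered j (toℕ i) ≢ 0 × ∃ λ k → e ≡ dynE k i
      edgesAt⁻ j i {e} = cases (triggered j (toℕ i))
        where
        cases : ∀ w → e ∈ pick w [] (dynamicEdge 0 (toℕ i) ∷ dynamicEdge D (toℕ i) ∷ []) → w ≢ 0 × ∃ λ k → e ≡ dynE k i
        cases (suc w) (here eq)         = (λ ()) , zero , trans eq (dynamicEdge₀ i)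
        cases (suc w) (there (here eq)) = (λ ()) , suc zero , trans eq (dynamicEdge₁ i)

      edgesAt⁺ : ∀ j i k → triggered j (toℕ i) ≢ 0 → dynE k i ∈ edgesAt j (toℕ i)
      edgesAt⁺ j i k = cases (triggered j (toℕ i)) k
        where
        cases : ∀ w k → w ≢ 0 → dynE k i ∈ pick w [] (dynamicEdge 0 (toℕ i) ∷ dynamicEdge D (toℕ i) ∷ [])
        cases zero    k          w≢0 = contradiction refl w≢0
        cases (suc w) zero       w≢0 = here (sym (dynamicEdge₀ i))
        cases (suc w) (suc zero) w≢0 = there (here (sym (dynamicEdge₁ i)))

      edgesAt-Unique : ∀ j i → Unique (edgesAt j (toℕ i))
      edgesAt-Unique j i = cases (triggered j (toℕ i))
        where
        cases : ∀ w → Unique (pick w [] (dynamicEdge 0 (toℕ i) ∷ dynamicEdge D (toℕ i) ∷ []))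
        cases zero    = []
        cases (suc _) = ((λ eq → case proj₁ (dynE-injective {zero} {i} {suc zero} {i} (trans (sym (dynamicEdge₀ i)) (trans eq (dynamicEdge₁ i)))) of λ ()) ∷ []) ∷ [] ∷ []

    edgesFrom⁻ : ∀ j i c {e} → i + c ≤ D → e ∈ edgesFrom j i c → ∃ λ k → ∃ λ i′ → i ≤ toℕ i′ × triggered j (toℕ i′) ≢ 0 × e ≡ dynE k i′
    edgesFrom⁻ j i (suc c) {e} i+c≤ e∈ with ∈-++⁻ (edgesAt j i) e∈
    ... | inj₂ e∈′ with k , i′ , i< , t , eq ← edgesFrom⁻ j (suc i) c (≤-trans (≤-reflexive (sym (+-suc i c))) i+c≤) e∈′ = k , i′ , <⇒≤ i< , t , eq
    ... | inj₁ e∈′ = found (edgesAt⁻ j i′ (subst (λ i → e ∈ edgesAt j i) (sym i≡) e∈′))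
      where
      i< : i < D
      i< = ≤-trans (s≤s (m≤m+n i c)) (≤-trans (≤-reflexive (sym (+-suc i c))) i+c≤)
      i′ : Fin D
      i′ = fromℕ< i<
      i≡ : toℕ i′ ≡ i
      i≡ = Finₚ.toℕ-fromℕ< i<
      found : triggered j (toℕ i′) ≢ 0 × (∃ λ k → e ≡ dynE k i′) → ∃ λ k → ∃ λ i″ → i ≤ toℕ i″ × triggered j (toℕ i″) ≢ 0 × e ≡ dynE k i″
      found (t , k , eq) = k , i′ , ≤-reflexive (sym i≡) , t , eq

    edgesFrom⁺ : ∀ j i c k i′ → i ≤ toℕ i′ → toℕ i′ < i + c → triggered j (toℕ i′) ≢ 0 → dynE k i′ ∈ edgesFrom j i c
    edgesFrom⁺ j i zero    k i′ i≤ i< t = contradiction (≤-trans i< (≤-reflexive (+-identityʳ i))) (≤⇒≯ i≤)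
    edgesFrom⁺ j i (suc c) k i′ i≤ i< t with i ≟ toℕ i′
    ... | yes refl = ∈-++⁺ˡ (edgesAt⁺ j i′ k t)
    ... | no i≢ = ∈-++⁺ʳ (edgesAt j i) (edgesFrom⁺ j (suc i) c k i′ (≤∧≢⇒< i≤ i≢) (≤-trans i< (≤-reflexive (+-suc i c))) t)

    edgesFrom-Unique : ∀ j i c → i + c ≤ D → Unique (edgesFrom j i c)
    edgesFrom-Unique j i zero    i+c≤ = []
    edgesFrom-Unique j i (suc c) i+c≤ = AllPairsₚ.++⁺
      (subst (λ i → Unique (edgesAt j i)) i≡ (edgesAt-Unique j i′)) (edgesFrom-Unique j (suc i) c i+c≤′)
      (All.tabulate (λ {e} e∈ → All.tabulate (λ f∈ → apart (edgesAt⁻ j i′ (subst (λ i → e ∈ edgesAt j i) (sym i≡) e∈)) (edgesFrom⁻ j (suc i) c i+c≤′ f∈))))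
      where
      i+c≤′ : suc i + c ≤ D
      i+c≤′ = ≤-trans (≤-reflexive (sym (+-suc i c))) i+c≤
      i< : i < D
      i< = ≤-trans (s≤s (m≤m+n i c)) i+c≤′
      i′ : Fin D
      i′ = fromℕ< i<
      i≡ : toℕ i′ ≡ i
      i≡ = Finₚ.toℕ-fromℕ< i<
      apart : ∀ {e f} → triggered j (toℕ i′) ≢ 0 × (∃ λ k → e ≡ dynE k i′) →
              (∃ λ k → ∃ λ i″ → suc i ≤ toℕ i″ × triggered j (toℕ i″) ≢ 0 × f ≡ dynE k i″) → e ≢ f
      apart (_ , k , refl) (k′ , i″ , i<″ , _ , refl) eq = <⇒≢ i<″ (trans (sym i≡) (cong toℕ (proj₂ (dynE-injective {k} {i′} {k′} {i″} eq))))

    length-edgesFrom : ∀ j i c → length (edgesFrom j i c) ≤ c * 2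
    length-edgesFrom j i zero    = z≤n
    length-edgesFrom j i (suc c) = ≤-trans (≤-reflexive (length-++ (edgesAt j i))) (+-mono-≤ (two (triggered j i)) (length-edgesFrom j (suc i) c))
      where
      two : ∀ w {x y : Edge N} → length (pick w [] (x ∷ y ∷ [])) ≤ 2
      two zero    = z≤n
      two (suc _) = ≤-refl

    edges⁻ : ∀ j {e} → e ∈ edges j → ∃ λ k → ∃ λ i → triggered j (toℕ i) ≢ 0 × e ≡ dynE k i
    edges⁻ j e∈ with k , i , _ , t , eq ← edgesFrom⁻ j 0 D ≤-refl e∈ = k , i , t , eq

    edges⁺ : ∀ j k i → triggered j (toℕ i) ≢ 0 → dynE k i ∈ edges j
    edges⁺ j k i t = edgesFrom⁺ j 0 D k i z≤n (Finₚ.toℕ<n i) t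

    edges-Unique : ∀ j → Unique (edges j)
    edges-Unique j = edgesFrom-Unique j 0 D ≤-refl

    dynE-Ordered : ∀ k i → Ordered (dynE k i)
    dynE-Ordered k i = subst₂ _<_ (sym (num-C k i)) (sym (num-C′ k i)) (m<n+m (D * toℕ k + toℕ i) {2 * D} (s≤s z≤n))

    edges-Ordered : ∀ j → All Ordered (edges j)
    edges-Ordered j = All.tabulate (λ e∈ → let (k , i , _ , eq) = edges⁻ j e∈ in subst Ordered (sym eq) (dynE-Ordered k i))

open DynamicStages

-- Operation sequences: legality, length, budget and answers

module LegalStages where

  ExecOps-extend : ∀ {B B′ A N} {ops : List (Op N)} {s ω s′ ω′ τs} → B ≤ B′ → ∀ ζ →
    ExecOps B A ops s ω s′ ω′ τs → ExecOps B′ A ops s (ω ++ ζ) s′ (ω′ ++ ζ) τs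
  ExecOps-extend le ζ []      = []
  ExecOps-extend le ζ (e ∷ r) = Exec-extend le ζ e ∷ ExecOps-extend le ζ r

  ExecOps-deterministic : ∀ {B B′ A N} {ops : List (Op N)} {s ω s₁ ω₁ τ₁ s₂ ω₂ τ₂} →
    ExecOps B A ops s ω s₁ ω₁ τ₁ → ExecOps B′ A ops s ω s₂ ω₂ τ₂ → s₁ ≡ s₂ × ω₁ ≡ ω₂
  ExecOps-deterministic []      []        = refl , refl
  ExecOps-deterministic (e ∷ r) (e′ ∷ r′) with refl , refl ← Exec-deterministic e e′ = ExecOps-deterministic r r′

  ExecOps-rest : ∀ {B A N} {xs ys : List (Op N)} {s ω s₁ ω₁ τs₁ s₂ ω₂ τs₂} → ExecOps B A xs s ω s₁ ω₁ τs₁ →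
    ExecOps B A (xs ++ ys) s ω s₂ ω₂ τs₂ → ∃ λ τs → ExecOps B A ys s₁ ω₁ s₂ ω₂ τs
  ExecOps-rest []      r        = _ , r
  ExecOps-rest (e ∷ r) (e′ ∷ r′) with refl , refl ← Exec-deterministic e e′ = ExecOps-rest r r′

  -- The guarantee speaks of the last query of a sequence only. Determinism makes the answer given
  -- amid a session the answer to the last query of a shorter sequence.
  ExecOps-last : ∀ {B A N} {ops : List (Op N)} {s ω s₁ ω₁ τs₁ σ₁ w₁ τ₁ s₂ ω₂ τs₂} → ExecOps B A ops s ω s₁ ω₁ τs₁ →
    Exec B (DynamicProg.onQuery A) s₁ ω₁ σ₁ w₁ τ₁ → ExecOps B A (ops ++ query ∷ []) s ω s₂ ω₂ τs₂ → var σ₁ 0 ≡ var s₂ 0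
  ExecOps-last r q r′ with _ , q′ ∷ [] ← ExecOps-rest r r′ with refl , refl ← Exec-deterministic q q′ = refl

  module StageLegal (B : ℕ) (A : DynamicProg) (v : Variant) (n d l : ℕ) (1≤l : 1 ≤ l) (Ul Vl Wl : List ℕ) where
    open Layout n d l using (N; X)
    open Graph n d l Ul Vl using (enc; dec; dec-enc; num; ii)
    open Edges n d l Ul Vl using (C; C′; num-C; num-C′; blockS)
    open InitialGraph n d l 1≤l Ul Vl using (fin; fin-num; 4D≤N; dynamicF; encE; indexℕ<X; rawE; initialGraph; initialGraph-raw; ∈-dynamicF⁻; ∈-dynamicF⁺; ∈-staticF⁻; ∈-staticF-dynamic; ∈-staticF-block; block-target)
    open StageOps B A v n d l 1≤l Ul Vl Wl public

    private
      fin-dynE : ∀ k i → (fin (D * toℕ k + toℕ i) , fin (2 * D + (D * toℕ k + toℕ i))) ≡ dynE k i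
      fin-dynE k i = cong₂ _,_ (trans (cong fin (sym (num-C k i))) (fin-num (C k i))) (trans (cong fin (sym (num-C′ k i))) (fin-num (C′ k i)))

      dynE-∈ : ∀ k i → dynE k i ∈ dynamicF (2 * D)
      dynE-∈ k i = subst (_∈ dynamicF (2 * D)) (fin-dynE k i) (∈-dynamicF⁺ (2 * D) (subst (_< 2 * D) (Finₚ.toℕ-combine k i) (Finₚ.toℕ<n (combine k i))))

      dynamicF-dynE : ∀ {e} → e ∈ dynamicF (2 * D) → ∃ λ k → ∃ λ i → e ≡ dynE k i
      dynamicF-dynE e∈ with y , y< , refl ← ∈-dynamicF⁻ (2 * D) e∈ =
        k , i , trans (cong (λ y → fin y , fin (2 * D + y)) y≡) (fin-dynE k i)
        where
        k : Fin 2
        k = proj₁ (remQuot {2} D (fromℕ< y<))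
        i : Fin D
        i = proj₂ (remQuot {2} D (fromℕ< y<))
        y≡ : y ≡ D * toℕ k + toℕ i
        y≡ = trans (sym (Finₚ.toℕ-fromℕ< y<)) (trans (cong toℕ (sym (Finₚ.combine-remQuot {2} D (fromℕ< y<)))) (Finₚ.toℕ-combine k i))

      dynE-∉-block : ∀ k i {k′ a i′ f} → f ∈ blockS k′ a i′ → dynE k i ≢ encE f
      dynE-∉-block k i {k′} {a} {i′} {f} f∈ eq with κ , s , f≡ ← block-target k′ a i′ f∈ =
        case trans (sym (dec-enc (C′ k i))) (trans (cong (dec ∘ proj₂) eq) (trans (dec-enc (proj₂ f)) f≡)) of λ ()

      q₀-case : ∀ {b} → decremental? v ≡ b → q₀ ≡ (if b then 2 * D else 0)
      q₀-case = cong (λ b → if b then 2 * D else 0)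

      triggered-case : ∀ {b} → decremental? v ≡ b → ∀ j i → triggered j i ≡ trigger b (wBit j i)
      triggered-case eq j i = cong (λ b → trigger b (wBit j i)) eq

      G₀⁻ : ∀ {b e} → decremental? v ≡ b → e ∈ G₀ → e ∈ dynamicF (if b then 2 * D else 0) ⊎ (∃ λ k → ∃ λ a → ∃ λ i → ∃ λ f → f ∈ blockS k a i × e ≡ encE f)
      G₀⁻ {b} eq e∈ = ∈-staticF⁻ _ X ≤-refl (subst (λ q → _ ∈ initialGraph q) (q₀-case eq) e∈)

    edges-fresh : decremental? v ≡ false → ∀ j → All (_∉ G₀) (edges j)
    edges-fresh dec≡ j = All.tabulate λ {e} e∈ e∈G₀ → fresh (edges⁻ j e∈) (G₀⁻ dec≡ e∈G₀)
      where
      fresh : ∀ {e} → (∃ λ k → ∃ λ i → triggered j (toℕ i) ≢ 0 × e ≡ dynE k i) →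
              e ∈ [] ⊎ (∃ λ k → ∃ λ a → ∃ λ i → ∃ λ f → f ∈ blockS k a i × e ≡ encE f) → ⊥
      fresh (k , i , _ , refl) (inj₂ (k′ , a , i′ , f , f∈ , eq)) = dynE-∉-block k i {k′} {a} {i′} f∈ eq

    edges-present : decremental? v ≡ true → ∀ j → All (_∈ G₀) (edges j)
    edges-present dec≡ j = All.tabulate λ e∈ → present (edges⁻ j e∈)
      where
      present : ∀ {e} → (∃ λ k → ∃ λ i → triggered j (toℕ i) ≢ 0 × e ≡ dynE k i) → e ∈ G₀
      present (k , i , _ , refl) = ∈-staticF-dynamic q₀ X (subst (λ q → dynE k i ∈ dynamicF q) (sym (q₀-case dec≡)) (dynE-∈ k i))

    stageGraph : ℕ → EdgeList N
    stageGraph j = effect (decremental? v) (edges j) G₀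

    -- Inserting the edges of w into a graph without edges C - C′ and deleting all others from a
    -- graph with all of them leave the same set.
    isStageGraph : ∀ j → StageGraph.IsStageGraph n d l 1≤l Ul Vl (wBit j) (stageGraph j)
    isStageGraph j = by-case (decremental? v) refl
      where
      open StageGraph n d l 1≤l Ul Vl (wBit j) using (IsStageGraph)
      dec-0 : ∀ w → 1 ∸ w ≢ 0 → w ≡ 0
      dec-0 zero    _ = refl
      dec-0 (suc w) h = contradiction (0∸n≡0 w) h
      block-∈ : ∀ k a i {f} → f ∈ blockS k a i → encE f ∈ G₀
      block-∈ k a i f∈ = ∈-staticF-block q₀ X k a i ≤-refl (indexℕ<X k a i) f∈
      by-case : ∀ b → decremental? v ≡ b → IsStageGraph (effect b (edges j) G₀)
      by-case false eq = record { sound = sound′ ; dynamic = dynamic′ ; blocks = blocks′ }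
        where
        sound′ : ∀ {e} → e ∈ effect false (edges j) G₀ → (∃ λ k → ∃ λ i → wBit j (toℕ i) ≢ 0 × e ≡ encE (C k i , C′ k i)) ⊎
                                  (∃ λ k → ∃ λ a → ∃ λ i → ∃ λ f → f ∈ blockS k a i × e ≡ encE f)
        sound′ e∈ with ∈-inserted⁻ (edges j) e∈
        ... | inj₁ e∈es with k , i , t , e≡ ← edges⁻ j e∈es = inj₁ (k , i , subst (_≢ 0) (triggered-case eq j (toℕ i)) t , e≡)
        ... | inj₂ e∈G with G₀⁻ eq e∈G
        ...   | inj₂ b = inj₂ b
        dynamic′ : ∀ k i → wBit j (toℕ i) ≢ 0 → encE (C k i , C′ k i) ∈ effect false (edges j) G₀
        dynamic′ k i w≢0 = ∈-inserted⁺ (edges j) (inj₁ (edges⁺ j k i (subst (_≢ 0) (sym (triggered-case eq j (toℕ i))) w≢0)))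
        blocks′ : ∀ k a i {f} → f ∈ blockS k a i → encE f ∈ effect false (edges j) G₀
        blocks′ k a i f∈ = ∈-inserted⁺ (edges j) (inj₂ (block-∈ k a i f∈))
      by-case true eq = record { sound = sound′ ; dynamic = dynamic′ ; blocks = blocks′ }
        where
        sound′ : ∀ {e} → e ∈ effect true (edges j) G₀ → (∃ λ k → ∃ λ i → wBit j (toℕ i) ≢ 0 × e ≡ encE (C k i , C′ k i)) ⊎
                                  (∃ λ k → ∃ λ a → ∃ λ i → ∃ λ f → f ∈ blockS k a i × e ≡ encE f)
        sound′ e∈ with e∈G , e∉ ← ∈-deleted⁻ (edges j) e∈ with G₀⁻ eq e∈G
        ... | inj₂ b = inj₂ b
        ... | inj₁ e∈F with k , i , refl ← dynamicF-dynE e∈F = inj₁ (k , i , (λ w≡0 → e∉ (edges⁺ j k i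
                (subst (_≢ 0) (sym (trans (triggered-case eq j (toℕ i)) (cong (1 ∸_) w≡0))) λ ()))) , refl)
        dynamic′ : ∀ k i → wBit j (toℕ i) ≢ 0 → encE (C k i , C′ k i) ∈ effect true (edges j) G₀
        dynamic′ k i w≢0 = ∈-deleted⁺ (edges j) (∈-staticF-dynamic q₀ X (subst (λ q → dynE k i ∈ dynamicF q) (sym (q₀-case eq)) (dynE-∈ k i)))
          (λ e∈ → absent (edges⁻ j e∈))
          where
          absent : (∃ λ k′ → ∃ λ i′ → triggered j (toℕ i′) ≢ 0 × dynE k i ≡ dynE k′ i′) → ⊥
          absent (k′ , i′ , t , e≡) with refl , refl ← dynE-injective {k} {i} {k′} {i′} e≡ =
            w≢0 (dec-0 (wBit j (toℕ i)) (subst (_≢ 0) (triggered-case eq j (toℕ i)) t))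
        blocks′ : ∀ k a i {f} → f ∈ blockS k a i → encE f ∈ effect true (edges j) G₀
        blocks′ k a i {f} f∈ = ∈-deleted⁺ (edges j) (block-∈ k a i f∈) (λ e∈ → absent (edges⁻ j e∈))
          where
          absent : (∃ λ k′ → ∃ λ i′ → triggered j (toℕ i′) ≢ 0 × encE f ≡ dynE k′ i′) → ⊥
          absent (k′ , i′ , _ , e≡) = dynE-∉-block k′ i′ {k} {a} {i} f∈ (sym e≡)

    stageOps : ℕ → List (Op N)
    stageOps j = pre j ++ query ∷ post j

    allOps : (j c : ℕ) → List (Op N)
    allOps j zero    = []
    allOps j (suc c) = stageOps j ++ allOps (suc j) c

    -- With rollback the algorithm is in its state right after preprocessing when stage `j` begins,
    -- so the guarantee is invoked for a sequence without earlier stages.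
    history : ℕ → List (Op N)
    history j = if rollsBack v then [] else allOps 0 j

    prefixOps : ℕ → List (Op N)
    prefixOps j = history j ++ pre j ++ query ∷ []

    length-G₀ : length G₀ ≤ 3 * N
    length-G₀ = subst (_≤ 3 * N) (trans (cong length (sym (initialGraph-raw q₀≤))) (Listₚ.length-map rawE G₀))
      (Build.staticE-bound (suc N) n 0 d l Ul Vl ≤-refl q₀≤ ≤-refl)

    private
      -- The origin of the 4 in the bound on the number of edges: at most `3 * N` at the start and
      -- at most `2 * D`, hence at most `N`, inserted during a stage.
      room : ∀ {M} → 4 * N ≤ M → ∀ j → length G₀ + length (edges j) ≤ M
      room {M} 4N≤M j = ≤-trans (+-mono-≤ length-G₀ (length-edgesFrom j 0 D)) (≤-trans (≤-trans (+-monoʳ-≤ (3 * N) (≤-trans (≤-reflexive (*-comm D 2)) (≤-trans (*-monoˡ-≤ D {2} {4} (s≤s (s≤s z≤n))) 4D≤N))) (≤-reflexive (arith N))) 4N≤M)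
        where
        arith : ∀ N → 3 * N + N ≡ 4 * N
        arith = solve-∀

    Legal-pre : ∀ {M ops H} → 4 * N ≤ M → ∀ j → Legal (settingOf v) M (stageGraph j) ops H → Legal (settingOf v) M G₀ (pre j ++ ops) H
    Legal-pre {M} {ops} {H} 4N≤M j leg = subst (λ xs → Legal (settingOf v) M G₀ (xs ++ ops) H) (sym (opsFrom-edges (decremental? v) j 0 D)) (by-variant v refl leg)
      where
      by-variant : ∀ v′ → v ≡ v′ → Legal (settingOf v′) M (effect (decremental? v′) (edges j) G₀) ops H → Legal (settingOf v′) M G₀ (map (mkOp (decremental? v′)) (edges j) ++ ops) H
      by-variant fully eq leg = Legal-insert (edges j) (λ _ → tt) (edges-Unique j) (edges-Ordered j) (edges-fresh (cong decremental? eq) j) (room 4N≤M j) leg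
      by-variant incr  eq leg = Legal-insert (edges j) (λ _ → tt) (edges-Unique j) (edges-Ordered j) (edges-fresh (cong decremental? eq) j) (room 4N≤M j) leg
      by-variant decr  eq leg = Legal-delete (edges j) (λ _ → tt) (edges-Unique j) (edges-present (cong decremental? eq) j) leg

    Legal-allOps : ∀ {M ops H} → 4 * N ≤ M → v ≡ fully → ∀ j c → Legal (settingOf v) M G₀ ops H → Legal (settingOf v) M G₀ (allOps j c ++ ops) H
    Legal-allOps _ _ j zero leg = leg
    Legal-allOps {M} {ops} {H} 4N≤M eq j (suc c) leg =
      subst (λ xs → Legal (settingOf v) M G₀ xs H) (sym (trans (++-assoc (stageOps j) (allOps (suc j) c) ops) (++-assoc (pre j) (query ∷ post j) _)))
        (Legal-pre 4N≤M j (qry (undo (Legal-allOps 4N≤M eq (suc j) c leg))))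
      where
      undo : ∀ {ops} → Legal (settingOf v) M G₀ ops H → Legal (settingOf v) M (stageGraph j) (post j ++ ops) H
      undo {ops} leg = subst (λ xs → Legal (settingOf v) M (stageGraph j) (xs ++ ops) H) (sym post≡)
        (Legal-delete (edges j) sup (edges-Unique j) present (subst (λ G → Legal (settingOf v) M G ops H) (sym restored) leg))
        where
        post≡ : post j ≡ map delete (edges j)
        post≡ = trans (cong (λ b → if b then opsFrom true j 0 D else []) (cong undoes eq)) (opsFrom-edges true j 0 D)
        sup : ∀ e → Supports {N} (settingOf v) (delete e)
        sup e = subst (λ v → Supports (settingOf v) (delete e)) (sym eq) tt
        inserted : stageGraph j ≡ effect false (edges j) G₀
        inserted = cong (λ v → effect (decremental? v) (edges j) G₀) eq
        present : All (_∈ stageGraph j) (edges j)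
        present = All.tabulate (λ {e} e∈ → subst (e ∈_) (sym inserted) (∈-inserted⁺ (edges j) (inj₁ e∈)))
        restored : effect true (edges j) (stageGraph j) ≡ G₀
        restored = trans (cong (effect true (edges j)) inserted) (delete-inserted (edges j) G₀ (edges-Unique j) (edges-fresh (cong decremental? eq) j))

    Legal-history : ∀ {M ops H} → 4 * N ≤ M → ∀ j → Legal (settingOf v) M G₀ ops H → Legal (settingOf v) M G₀ (history j ++ ops) H
    Legal-history {M} {ops} {H} 4N≤M j leg = by-variant v refl
      where
      by-variant : ∀ v′ → v ≡ v′ → Legal (settingOf v) M G₀ ((if rollsBack v′ then [] else allOps 0 j) ++ ops) H
      by-variant fully eq = Legal-allOps 4N≤M eq 0 j leg
      by-variant incr  eq = leg
      by-variant decr  eq = leg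

    Legal-prefixOps : ∀ {M} → 4 * N ≤ M → ∀ j → Legal (settingOf v) M G₀ (prefixOps j) (stageGraph j)
    Legal-prefixOps 4N≤M j = Legal-history 4N≤M j (Legal-pre 4N≤M j (qry done))

    private
      length-pre : ∀ b j → length (opsFrom b j 0 D) ≤ D * 2
      length-pre b j = ≤-trans (≤-reflexive (trans (cong length (opsFrom-edges b j 0 D)) (Listₚ.length-map (mkOp b) (edges j)))) (length-edgesFrom j 0 D)

      length-post : ∀ j → length (post j) ≤ D * 2
      length-post j = by-case (undoes v)
        where
        by-case : ∀ b → length (if b then opsFrom true j 0 D else []) ≤ D * 2
        by-case true  = length-pre true j
        by-case false = z≤n

      budget-mkOps : ∀ u q b es → sum (map (budget {N} u q) (map (mkOp b) es)) ≡ length es * u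
      budget-mkOps u q b     []       = refl
      budget-mkOps u q true  (e ∷ es) = cong (u +_) (budget-mkOps u q true es)
      budget-mkOps u q false (e ∷ es) = cong (u +_) (budget-mkOps u q false es)

      budget-opsFrom : ∀ u q b j → sum (map (budget {N} u q) (opsFrom b j 0 D)) ≤ D * 2 * u
      budget-opsFrom u q b j = ≤-trans (≤-reflexive (trans (cong (λ xs → sum (map (budget u q) xs)) (opsFrom-edges b j 0 D)) (budget-mkOps u q b (edges j)))) (*-monoˡ-≤ u (length-edgesFrom j 0 D))

    budget-pre : ∀ u q j → sum (map (budget {N} u q) (pre j)) ≤ D * 2 * u
    budget-pre u q j = budget-opsFrom u q (decremental? v) j

    private
      budget-post : ∀ u q j → sum (map (budget {N} u q) (post j)) ≤ D * 2 * u
      budget-post u q j = by-case (undoes v)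
        where
        by-case : ∀ b → sum (map (budget {N} u q) (if b then opsFrom true j 0 D else [])) ≤ D * 2 * u
        by-case true  = budget-opsFrom u q true j
        by-case false = z≤n

    stageBudget : (u q : ℕ) → ℕ
    stageBudget u q = D * 2 * u + (q + D * 2 * u)

    private
      sum-map-++ : ∀ u q (xs ys : List (Op N)) → sum (map (budget u q) (xs ++ ys)) ≡ sum (map (budget u q) xs) + sum (map (budget u q) ys)
      sum-map-++ u q xs ys = trans (cong sum (map-++ (budget u q) xs ys)) (sum-++ (map (budget u q) xs) _)

    budget-allOps : ∀ u q j c → sum (map (budget {N} u q) (allOps j c)) ≤ c * stageBudget u q
    budget-allOps u q j zero    = z≤n
    budget-allOps u q j (suc c) = ≤-trans (≤-reflexive (sum-map-++ u q (stageOps j) (allOps (suc j) c))) (+-mono-≤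
      (≤-trans (≤-reflexive (sum-map-++ u q (pre j) (query ∷ post j))) (+-mono-≤ (budget-pre u q j) (+-monoʳ-≤ q (budget-post u q j)))) (budget-allOps u q (suc j) c))

    length-allOps : ∀ j c → length (allOps j c) ≤ c * (4 * D + 1)
    length-allOps j zero    = z≤n
    length-allOps j (suc c) = ≤-trans (≤-reflexive (trans (length-++ (stageOps j)) (cong (_+ length (allOps (suc j) c)) (length-++ (pre j)))))
      (+-mono-≤ (≤-trans (+-mono-≤ (length-pre (decremental? v) j) (s≤s (length-post j))) (≤-reflexive (arith D))) (length-allOps (suc j) c))
      where
      arith : ∀ D → D * 2 + suc (D * 2) ≡ 4 * D + 1
      arith = solve-∀

    length-history : ∀ j → length (history j) ≤ j * (4 * D + 1)
    length-history j = by-case (rollsBack v)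
      where
      by-case : ∀ b → length (if b then [] else allOps 0 j) ≤ j * (4 * D + 1)
      by-case true  = z≤n
      by-case false = length-allOps 0 j

    length-prefixOps : ∀ j → length (prefixOps j) ≤ suc j * (4 * D + 1)
    length-prefixOps j = ≤-trans (≤-reflexive (trans (length-++ (history j)) (cong (length (history j) +_) (length-++ (pre j))))) (≤-trans (+-mono-≤ (length-history j)
      (+-monoˡ-≤ 1 (≤-trans (length-pre (decremental? v) j) (≤-trans (≤-reflexive (*-comm D 2)) (*-monoˡ-≤ D {2} {4} (s≤s (s≤s z≤n))))))) (≤-reflexive (+-comm _ (4 * D + 1))))

    session-forward : rollsBack v ≡ false → ∀ {σ₀ ω₀} j c {σ ω σ′ ω′ τs} → ExecOps B A (allOps j c) σ ω σ′ ω′ τs →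
      ∃ λ outs → Session σ₀ ω₀ j c σ ω outs (sum τs)
    session-forward _ j zero [] = [] , []
    session-forward eq {σ₀} {ω₀} j (suc c) {σ} {ω} ex = outer (ExecOps-++ (stageOps j) ex)
      where
      times : ∀ xs y ys zs → sum xs + (y + (sum ys + sum zs)) ≡ sum ((xs ++ y ∷ ys) ++ zs)
      times xs y ys zs = sym (trans (sum-++ (xs ++ y ∷ ys) zs) (trans (cong (_+ sum zs) (sum-++ xs (y ∷ ys))) (arith (sum xs) y (sum ys) (sum zs))))
        where
        arith : ∀ a b c d → a + (b + c) + d ≡ a + (b + (c + d))
        arith = solve-∀
      inner : ∀ {σ₁ ω₁ τs₁ τs₂ outs} → (∃ λ σ₃ → ∃ λ ω₃ → ∃ λ τs₃ → ∃ λ τs₄ →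
        ExecOps B A (pre j) σ ω σ₃ ω₃ τs₃ × ExecOps B A (query ∷ post j) σ₃ ω₃ σ₁ ω₁ τs₄ × τs₁ ≡ τs₃ ++ τs₄) →
        Session σ₀ ω₀ (suc j) c σ₁ ω₁ outs (sum τs₂) → ∃ λ outs → Session σ₀ ω₀ j (suc c) σ ω outs (sum (τs₁ ++ τs₂))
      inner {σ₁} {ω₁} {τs₂ = τs₂} {outs} (σ₃ , ω₃ , τs₃ , (τ ∷ τs₄) , e , (_∷_ {s′ = σ₄} q e′) , refl) S =
        _ , subst (Session σ₀ ω₀ j (suc c) σ ω (var σ₄ 0 ∷ outs)) (times τs₃ τ τs₄ τs₂)
            (stage (subst₂ (λ s w → ExecOps B A (pre j) s w σ₃ ω₃ τs₃) (sym (cong (λ b → if b then σ₀ else σ) eq)) (sym (cong (λ b → if b then ω₀ else ω) eq)) e) q e′ S)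
      outer : ∀ {σ′ ω′ τs} → (∃ λ σ₁ → ∃ λ ω₁ → ∃ λ τs₁ → ∃ λ τs₂ →
        ExecOps B A (stageOps j) σ ω σ₁ ω₁ τs₁ × ExecOps B A (allOps (suc j) c) σ₁ ω₁ σ′ ω′ τs₂ × τs ≡ τs₁ ++ τs₂) →
        ∃ λ outs → Session σ₀ ω₀ j (suc c) σ ω outs (sum τs)
      outer (σ₁ , ω₁ , τs₁ , τs₂ , ex₁ , ex₂ , refl) = inner {σ₁} {ω₁} {τs₁} {τs₂} (ExecOps-++ (pre j) ex₁) (proj₂ (session-forward eq {σ₀} {ω₀} (suc j) c ex₂))

    -- All stages start from the same `σ₀` and `ω₀`, so their runs are granted independently and
    -- each needs a time bound `b` of its own. Worst-case bounds supply it; an amortized one would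
    -- charge the preprocessing budget to every stage anew.
    session-rollback : rollsBack v ≡ true → undoes v ≡ false → ∀ {σ₀ ω₀ b} j c →
      (∀ i → j ≤ i → i < j + c → ∃ λ σ → ∃ λ ω → ∃ λ τs → ExecOps B A (pre i ++ query ∷ []) σ₀ ω₀ σ ω τs × sum τs ≤ b) →
      ∀ {σ ω} → ∃ λ outs → ∃ λ t → Session σ₀ ω₀ j c σ ω outs t × t ≤ c * b
    session-rollback _ _ j zero runs = _ , _ , [] , z≤n
    session-rollback eq eq′ {σ₀} {ω₀} {b} j (suc c) runs {σ} {ω} = first (runs j ≤-refl (m<m+n j (s≤s z≤n)))
      where
      inner : ∀ {σ₂ ω₂ τs} → sum τs ≤ b → (∃ λ σ₃ → ∃ λ ω₃ → ∃ λ τs₃ → ∃ λ τs₄ →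
        ExecOps B A (pre j) σ₀ ω₀ σ₃ ω₃ τs₃ × ExecOps B A (query ∷ []) σ₃ ω₃ σ₂ ω₂ τs₄ × τs ≡ τs₃ ++ τs₄) →
        (∃ λ outs → ∃ λ t → Session σ₀ ω₀ (suc j) c σ₂ ω₂ outs t × t ≤ c * b) → ∃ λ outs → ∃ λ t → Session σ₀ ω₀ j (suc c) σ ω outs t × t ≤ b + c * b
      inner {σ₂} {ω₂} le (σ₃ , ω₃ , τs₃ , (τ ∷ []) , e , (q ∷ []) , refl) (outs , t , S , t≤) =
        _ , _ , stage (subst₂ (λ s w → ExecOps B A (pre j) s w σ₃ ω₃ τs₃) (sym (cong (λ b → if b then σ₀ else σ) eq)) (sym (cong (λ b → if b then ω₀ else ω) eq)) e) q
                  (subst (λ ops → ExecOps B A ops σ₂ ω₂ σ₂ ω₂ []) (sym (cong (λ b → if b then opsFrom true j 0 D else []) eq′)) []) S ,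
        ≤-trans (≤-reflexive (sym (+-assoc (sum τs₃) τ t))) (+-mono-≤ (≤-trans (≤-reflexive (trans (cong (sum τs₃ +_) (sym (+-identityʳ τ))) (sym (sum-++ τs₃ (τ ∷ []))))) le) t≤)
      first : (∃ λ σ₂ → ∃ λ ω₂ → ∃ λ τs → ExecOps B A (pre j ++ query ∷ []) σ₀ ω₀ σ₂ ω₂ τs × sum τs ≤ b) → ∃ λ outs → ∃ λ t → Session σ₀ ω₀ j (suc c) σ ω outs t × t ≤ b + c * b
      first (σ₂ , ω₂ , τs , ex , le) = inner {σ₂} {ω₂} {τs} le (ExecOps-++ (pre j) ex)
        (session-rollback eq eq′ {σ₀} {ω₀} {b} (suc j) c (λ i j< i< → runs i (<⇒≤ j<) (≤-trans i< (≤-reflexive (sym (+-suc j c))))) {σ₂} {ω₂})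

    answer-rollback : rollsBack v ≡ true → ∀ {σ₀ ω₀ j c σ ω outs t} → Session σ₀ ω₀ j c σ ω outs t → ∀ i → i < c →
      ∀ {σ′ ω′ τs} → ExecOps B A (pre (j + i) ++ query ∷ []) σ₀ ω₀ σ′ ω′ τs → at 0 outs i ≡ var σ′ 0
    answer-rollback eq {σ₀} {ω₀} {j} {σ = σ} {ω} (stage {τs = τs} e q _ _) zero _ {σ′} {ω′} {τs′} ex =
      ExecOps-last {ops = pre j} (subst₂ (λ s w → ExecOps B A (pre j) s w _ _ τs) (cong (λ b → if b then σ₀ else σ) eq) (cong (λ b → if b then ω₀ else ω) eq) e) q
        (subst (λ j → ExecOps B A (pre j ++ query ∷ []) σ₀ ω₀ σ′ ω′ τs′) (+-identityʳ j) ex)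
    answer-rollback eq {σ₀} {ω₀} {j} (stage _ _ _ S) (suc i) i< {σ′} {ω′} {τs} ex =
      answer-rollback eq S i (s≤s⁻¹ i<) (subst (λ j → ExecOps B A (pre j ++ query ∷ []) σ₀ ω₀ σ′ ω′ τs) (+-suc j i) ex)

    answer-forward : rollsBack v ≡ false → ∀ {σ₀ ω₀ j c σ ω outs t} → Session σ₀ ω₀ j c σ ω outs t → ∀ i → i < c →
      ∀ {σ′ ω′ τs} → ExecOps B A (allOps j i ++ pre (j + i) ++ query ∷ []) σ ω σ′ ω′ τs → at 0 outs i ≡ var σ′ 0
    answer-forward eq {σ₀} {ω₀} {j} {σ = σ} {ω} (stage {τs = τs} e q _ _) zero _ {σ′} {ω′} {τs′} ex =
      ExecOps-last {ops = pre j} (subst₂ (λ s w → ExecOps B A (pre j) s w _ _ τs) (cong (λ b → if b then σ₀ else σ) eq) (cong (λ b → if b then ω₀ else ω) eq) e) q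
        (subst (λ j → ExecOps B A (pre j ++ query ∷ []) σ ω σ′ ω′ τs′) (+-identityʳ j) ex)
    answer-forward eq {σ₀} {ω₀} {j} {σ = σ} {ω} (stage {σ₁ = σ₁} {ω₁} {τs} {σ₃ = σ₃} {ω₃} e q p S) (suc i) i< {σ′} {ω′} {τs′} ex =
      answer-forward eq S i (s≤s⁻¹ i<) (subst (λ k → ExecOps B A (allOps (suc j) i ++ pre k ++ query ∷ []) σ₃ ω₃ σ′ ω′ (proj₁ rest₃)) (+-suc j i) (proj₂ rest₃))
      where
      later : List (Op N)
      later = allOps (suc j) i ++ pre (j + suc i) ++ query ∷ []
      reassociate : (stageOps j ++ allOps (suc j) i) ++ pre (j + suc i) ++ query ∷ [] ≡ pre j ++ query ∷ post j ++ later
      reassociate = trans (++-assoc (stageOps j) (allOps (suc j) i) _) (++-assoc (pre j) (query ∷ post j) later)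
      rest₁ : ∃ λ τs → ExecOps B A (query ∷ post j ++ later) σ₁ ω₁ σ′ ω′ τs
      rest₁ = ExecOps-rest {xs = pre j} (subst₂ (λ s w → ExecOps B A (pre j) s w σ₁ ω₁ τs) (cong (λ b → if b then σ₀ else σ) eq) (cong (λ b → if b then ω₀ else ω) eq) e)
        (subst (λ ops → ExecOps B A ops σ ω σ′ ω′ τs′) reassociate ex)
      rest₂ : ∃ λ τs → ExecOps B A (post j ++ later) _ _ σ′ ω′ τs
      rest₂ = ExecOps-rest {xs = query ∷ []} (q ∷ []) (proj₂ rest₁)
      rest₃ : ∃ λ τs → ExecOps B A later σ₃ ω₃ σ′ ω′ τs
      rest₃ = ExecOps-rest {xs = post j} p (proj₂ rest₂)

open LegalStages

-- Merging the runs granted for different operation sequences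

module Oracles where

  as-Vec : ∀ {m} (ω : Tape) → length ω ≡ m → ∃ λ (xs : Vec Bool m) → Vec.toList xs ≡ ω
  as-Vec ω refl = Vec.fromList ω , Vecₚ.toList∘fromList ω

  DynamicRun-extend : ∀ {B B′ A N} {G : EdgeList N} {ops ω s τ₀ τs} → B ≤ B′ → ∀ ζ →
    DynamicRun B A G ops ω s τ₀ τs → DynamicRun B′ A G ops (ω ++ ζ) s τ₀ τs
  DynamicRun-extend le ζ (s₀ , ω₀ , ω′ , e , r) = s₀ , ω₀ ++ ζ , ω′ ++ ζ , Exec-extend le ζ e , ExecOps-extend le ζ r

  DynamicRun-take : ∀ {B B′ A N} {G : EdgeList N} {ops s τ₀ τs} k ω → B ≤ B′ →
    DynamicRun B A G ops (take k ω) s τ₀ τs → DynamicRun B′ A G ops ω s τ₀ τs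
  DynamicRun-take {B′ = B′} {A} {G = G} {ops} {s} {τ₀} {τs} k ω le r =
    subst (λ ω → DynamicRun B′ A G ops ω s τ₀ τs) (Listₚ.take++drop≡id k ω) (DynamicRun-extend le (drop k ω) r)

  all-tapes : ∀ {m ω} (P : Tape → Set) {Q : Set} → m ≤ length ω → (P (take m ω) → Q) → (∀ (xs : Vec Bool m) → P (Vec.toList xs)) → Q
  all-tapes {m} {ω} P m≤ f h with xs , eq ← as-Vec (take m ω) (trans (Listₚ.length-take m ω) (m≤n⇒m⊓n≡m m≤)) = f (subst P eq (h xs))

  Exec-transport : ∀ {B B′ p s ω s₁ ω₁ τ₁ s₂ ω₂ τ₂} → Exec B p s ω s₁ ω₁ τ₁ → Exec B′ p s ω s₂ ω₂ τ₂ → (P : State → Tape → Set) → P s₂ ω₂ → P s₁ ω₁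
  Exec-transport e e′ P x with refl , refl ← Exec-deterministic e e′ = x

  ≤-sumTo : ∀ J g j → j < J → g j ≤ sumTo J g
  ≤-sumTo (suc J) g zero    _        = m≤m+n (g 0) _
  ≤-sumTo (suc J) g (suc j) (s≤s j<) = ≤-trans (≤-sumTo J (g ∘ suc) j j<) (m≤n+m _ (g 0))

  timing-cases : ∀ v → (rollsBack v ≡ false × timingOf v ≡ amortized) ⊎ (rollsBack v ≡ true × undoes v ≡ false × timingOf v ≡ worstCase)
  timing-cases fully = inj₁ (refl , refl)
  timing-cases incr  = inj₂ (refl , refl , refl)
  timing-cases decr  = inj₂ (refl , refl , refl)

  sum-Pointwise : ∀ {xs ys : List ℕ} → Pointwise _≤_ xs ys → sum xs ≤ sum ys
  sum-Pointwise []       = z≤n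
  sum-Pointwise (p ∷ ps) = +-mono-≤ p (sum-Pointwise ps)

  module Oracle (v : Variant) {α : ℚ} {M p u q : ℕ → ℕ} (alg : DynamicRadius (settingOf v) (timingOf v) α M p u q)
                (n d l : ℕ) (1≤l : 1 ≤ l) (Ul Vl Wl : List ℕ) (J B : ℕ) where
    open DynamicRadius alg renaming (prog to A)
    open Layout n d l using (N)
    open InitialGraph n d l 1≤l Ul Vl using (initialGraph-simple)
    open StageLegal B A v n d l 1≤l Ul Vl Wl public

    T′ : ℕ
    T′ = p N + J * stageBudget (u N) (q N)

    module _ (4N≤M : 4 * N ≤ M N) (B-room : (2 + N + J * (4 * D + 1)) ^ wordExponent ≤ B) where

      private
        len≤ : length G₀ ≤ M N
        len≤ = ≤-trans length-G₀ (≤-trans (*-monoˡ-≤ N (n≤1+n 3)) 4N≤M)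

        room : ∀ {ops : List (Op N)} → length ops ≤ J * (4 * D + 1) → (2 + N + length ops) ^ wordExponent ≤ B
        room le = ≤-trans (^-monoˡ-≤ wordExponent (+-monoʳ-≤ (2 + N) le)) B-room

        room-prefix : ∀ {j} → j < J → (2 + N + length (prefixOps j)) ^ wordExponent ≤ B
        room-prefix {j} j< = room {prefixOps j} (≤-trans (length-prefixOps j) (*-monoˡ-≤ (4 * D + 1) j<))

        legal-base : Legal (settingOf v) (M N) G₀ (history J) G₀
        legal-base = subst (λ ops → Legal (settingOf v) (M N) G₀ ops G₀) (++-identityʳ (history J)) (Legal-history 4N≤M J done)

        Answer : ℕ → Tape → Set
        Answer j ω = ∃ λ s → ∃ λ τ₀ → ∃ λ τs →
          DynamicRun ((2 + N + length (prefixOps j)) ^ wordExponent) A G₀ (prefixOps j) ω s τ₀ τs × ApproximatesRadius α (stageGraph j) (var s 0)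

        Base-raw : Tape → Set
        Base-raw ω = ∃ λ s → ∃ λ τ₀ → ∃ λ τs →
          DynamicRun ((2 + N + length (history J)) ^ wordExponent) A G₀ (history J) ω s τ₀ τs × WithinTime (timingOf v) (p N) (u N) (q N) (history J) τ₀ τs

        Prefix-raw : ℕ → Tape → Set
        Prefix-raw j ω = ∃ λ s → ∃ λ τ₀ → ∃ λ τs →
          DynamicRun ((2 + N + length (prefixOps j)) ^ wordExponent) A G₀ (prefixOps j) ω s τ₀ τs × WithinTime (timingOf v) (p N) (u N) (q N) (prefixOps j) τ₀ τs

      abstract
        coins-base : ℕ
        coins-base = proj₁ (solves N G₀ G₀ (history J) (initialGraph-simple q₀≤) len≤ legal-base)

        runs-base : ∀ (ω : Vec Bool coins-base) → Base-raw (Vec.toList ω)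
        runs-base = proj₁ (proj₂ (solves N G₀ G₀ (history J) (initialGraph-simple q₀≤) len≤ legal-base))

        coins-prefix : ℕ → ℕ
        coins-prefix j = proj₁ (solves N G₀ (stageGraph j) (prefixOps j) (initialGraph-simple q₀≤) len≤ (Legal-prefixOps 4N≤M j))

        runs-prefix : ∀ j (ω : Vec Bool (coins-prefix j)) → Prefix-raw j (Vec.toList ω)
        runs-prefix j = proj₁ (proj₂ (solves N G₀ (stageGraph j) (prefixOps j) (initialGraph-simple q₀≤) len≤ (Legal-prefixOps 4N≤M j)))

        correct-prefix : ∀ j → ∃ λ xs → All (Answer j) xs × 3 * total (coins-prefix j) (outside xs) ≤ 2 ^ coins-prefix j
        correct-prefix j = Pr-outside {P = Answer j} (proj₂ (proj₂ (solves N G₀ (stageGraph j) (prefixOps j) (initialGraph-simple q₀≤) len≤ (Legal-prefixOps 4N≤M j)))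
          (history j ++ pre j) (sym (++-assoc (history j) (pre j) (query ∷ []))))

      -- The number of coins depends on the operation sequence. The sum dominates all of them, and a
      -- run leaves the surplus unread.
      coins : ℕ
      coins = coins-base + sumTo J coins-prefix

      -- Failure is a property of the tape alone: its relevant initial part lies outside the list of
      -- tapes with a right answer. It can therefore be counted without mentioning runs.
      fail : ℕ → Tape → ℕ
      fail j ω = outside (proj₁ (correct-prefix j)) (take (coins-prefix j) ω)

      fail≤1 : ∀ j ω → fail j ω ≤ 1
      fail≤1 j ω = outside≤1 (proj₁ (correct-prefix j)) (take (coins-prefix j) ω)

      -- Surplus coins multiply the number of all tapes and of failing tapes by the same power of 2.
      fail-rare : ∀ j → j < J → 3 * total coins (fail j) ≤ 2 ^ coins
      fail-rare j j< = subst (λ m → 3 * total m (fail j) ≤ 2 ^ m) (m+[n∸m]≡n le) (begin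
        3 * total (c + (coins ∸ c)) (fail j)              ≡⟨ cong (3 *_) (total-take c (coins ∸ c) f) ⟩
        3 * (total c f * 2 ^ (coins ∸ c))       ≡⟨ sym (*-assoc 3 (total c f) _) ⟩
        3 * total c f * 2 ^ (coins ∸ c)         ≤⟨ *-monoˡ-≤ (2 ^ (coins ∸ c)) (proj₂ (proj₂ (correct-prefix j))) ⟩
        2 ^ c * 2 ^ (coins ∸ c)                           ≡⟨ sym (^-distribˡ-+-* 2 c _) ⟩
        2 ^ (c + (coins ∸ c))                             ∎)
        where
        open ≤-Reasoning
        f : Tape → ℕ
        f = outside (proj₁ (correct-prefix j))
        c : ℕ
        c = coins-prefix j
        le : c ≤ coins
        le = ≤-trans (≤-sumTo J coins-prefix j j<) (m≤n+m _ coins-base)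

      -- Each operation sequence comes with a run of its own. By determinism these are parts of one
      -- session, whose time comes from the whole history or from the single stages, and whose
      -- answer at `j` is that of the run on `prefixOps j`.
      record Outcome (ω : Tape) : Set where
        field
          {σ₀}    : State
          {ω₀}    : Tape
          {τ₀ t}  : ℕ
          outs    : List ℕ
          pre-run : Exec B (DynamicProg.preprocess A) (inputGraph G₀) ω σ₀ ω₀ τ₀
          session : Session σ₀ ω₀ 0 J σ₀ ω₀ outs t
          within  : τ₀ + t ≤ T′
          correct : ∀ j → j < J → fail j ω ≡ 0 → ApproximatesRadius α (stageGraph j) (at 0 outs j)

      private
        Base-run : Tape → Set
        Base-run ω = ∃ λ s → ∃ λ τ₀ → ∃ λ τs →
          DynamicRun B A G₀ (history J) ω s τ₀ τs × WithinTime (timingOf v) (p N) (u N) (q N) (history J) τ₀ τs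

        Prefix-run : ℕ → Tape → Set
        Prefix-run j ω = ∃ λ s → ∃ λ τ₀ → ∃ λ τs →
          DynamicRun B A G₀ (prefixOps j) ω s τ₀ τs × WithinTime (timingOf v) (p N) (u N) (q N) (prefixOps j) τ₀ τs

        Good-run : ℕ → Tape → Set
        Good-run j ω = ∃ λ s → ∃ λ τ₀ → ∃ λ τs →
          DynamicRun B A G₀ (prefixOps j) ω s τ₀ τs × ApproximatesRadius α (stageGraph j) (var s 0)

        base-run : ∀ ω → length ω ≡ coins → Base-run ω
        base-run ω len = all-tapes Base-raw (≤-trans (m≤m+n coins-base _) (≤-reflexive (sym len)))
          (λ (s , τ₀ , τs , r , w) → s , τ₀ , τs , DynamicRun-take coins-base ω (room {history J} (length-history J)) r , w) runs-base

        prefix-run : ∀ ω → length ω ≡ coins → ∀ j → j < J → Prefix-run j ω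
        prefix-run ω len j j< = all-tapes (Prefix-raw j) (≤-trans (≤-sumTo J coins-prefix j j<) (≤-trans (m≤n+m _ coins-base) (≤-reflexive (sym len))))
          (λ (s , τ₀ , τs , r , w) → s , τ₀ , τs , DynamicRun-take (coins-prefix j) ω (room-prefix j<) r , w) (runs-prefix j)

        good-run : ∀ ω j → j < J → fail j ω ≡ 0 → Good-run j ω
        good-run ω j j< ok = extend (All.lookup (proj₁ (proj₂ (correct-prefix j))) (outside-zero (proj₁ (correct-prefix j)) (take (coins-prefix j) ω) ok))
          where
          extend : Answer j (take (coins-prefix j) ω) → Good-run j ω
          extend (s , τ₀ , τs , r , a) = s , τ₀ , τs , DynamicRun-take (coins-prefix j) ω (room-prefix j<) r , a

        history-forward : rollsBack v ≡ false → ∀ j → history j ≡ allOps 0 j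
        history-forward rb≡ j = cong (λ b → if b then [] else allOps 0 j) rb≡

        prefix-rollback : rollsBack v ≡ true → ∀ j → prefixOps j ≡ pre j ++ query ∷ []
        prefix-rollback rb≡ j = cong (λ b → (if b then [] else allOps 0 j) ++ pre j ++ query ∷ []) rb≡

        answered : ∀ {ω σ₀ ω₀ τ₀} j out → Exec B (DynamicProg.preprocess A) (inputGraph G₀) ω σ₀ ω₀ τ₀ →
          (∀ {σ ω τs} → ExecOps B A (prefixOps j) σ₀ ω₀ σ ω τs → out ≡ var σ 0) → Good-run j ω → ApproximatesRadius α (stageGraph j) out
        answered j out e answers (s , _ , τs , (σ₀ , ω₀ , ω′ , e′ , r) , a) =
          subst (ApproximatesRadius α (stageGraph j)) (sym (answers (Exec-transport e e′ (λ σ ω → ExecOps B A (prefixOps j) σ ω s ω′ τs) r))) a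

        outcome-amortized : rollsBack v ≡ false → timingOf v ≡ amortized → ∀ {ω} → Base-run ω → (∀ j → j < J → fail j ω ≡ 0 → Good-run j ω) → Outcome ω
        outcome-amortized rb≡ t≡ {ω} (s , τ₀ , τs , (σ₀ , ω₀ , ω′ , e , r) , w) good = record
          { outs = outs ; pre-run = e ; session = proj₂ session
          ; within = ≤-trans (subst (λ t → WithinTime t (p N) (u N) (q N) (history J) τ₀ τs) t≡ w)
                       (+-monoʳ-≤ (p N) (≤-trans (≤-reflexive (cong (λ ops → sum (map (budget (u N) (q N)) ops)) (history-forward rb≡ J))) (budget-allOps (u N) (q N) 0 J)))
          ; correct = λ j j< ok → answered {ω} j (at 0 outs j) e
              (λ {σ} {ω″} {τs} r → answer-forward rb≡ (proj₂ session) j j< (subst (λ ops → ExecOps B A (ops ++ pre j ++ query ∷ []) σ₀ ω₀ σ ω″ τs) (history-forward rb≡ j) r)) (good j j< ok)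
          }
          where
          session : ∃ λ outs → Session σ₀ ω₀ 0 J σ₀ ω₀ outs (sum τs)
          session = session-forward rb≡ {σ₀} {ω₀} 0 J (subst (λ ops → ExecOps B A ops σ₀ ω₀ s ω′ τs) (history-forward rb≡ J) r)
          outs : List ℕ
          outs = proj₁ session

        stage-time : timingOf v ≡ worstCase → rollsBack v ≡ true → ∀ j {τ₀ τs} → WithinTime (timingOf v) (p N) (u N) (q N) (prefixOps j) τ₀ τs → sum τs ≤ stageBudget (u N) (q N)
        stage-time t≡ rb≡ j {τ₀} {τs} w = ≤-trans (sum-Pointwise (proj₂ (subst₂ (λ t ops → WithinTime t (p N) (u N) (q N) ops τ₀ τs) t≡ (prefix-rollback rb≡ j) w)))
          (≤-trans (≤-reflexive (trans (cong sum (map-++ (budget (u N) (q N)) (pre j) _)) (sum-++ (map (budget (u N) (q N)) (pre j)) _)))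
            (+-mono-≤ (budget-pre (u N) (q N) j) (+-monoʳ-≤ (q N) z≤n)))

        outcome-worstCase : rollsBack v ≡ true → undoes v ≡ false → timingOf v ≡ worstCase → ∀ {ω} → Base-run ω → (∀ j → j < J → Prefix-run j ω) →
          (∀ j → j < J → fail j ω ≡ 0 → Good-run j ω) → Outcome ω
        outcome-worstCase rb≡ un≡ t≡ {ω} (s , τ₀ , τs , (σ₀ , ω₀ , ω′ , e , r) , w) runs good = record
          { outs = outs ; pre-run = e ; session = proj₁ (proj₂ (proj₂ session))
          ; within = +-mono-≤ (proj₁ (subst (λ t → WithinTime t (p N) (u N) (q N) (history J) τ₀ τs) t≡ w)) (proj₂ (proj₂ (proj₂ session)))
          ; correct = λ j j< ok → answered {ω} j (at 0 outs j) e
              (λ {σ} {ω″} {τs} r → answer-rollback rb≡ (proj₁ (proj₂ (proj₂ session))) j j< (subst (λ ops → ExecOps B A ops σ₀ ω₀ σ ω″ τs) (prefix-rollback rb≡ j) r)) (good j j< ok)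
          }
          where
          Stage-run : ℕ → Set
          Stage-run j = ∃ λ σ → ∃ λ ω → ∃ λ τs → ExecOps B A (pre j ++ query ∷ []) σ₀ ω₀ σ ω τs × sum τs ≤ stageBudget (u N) (q N)
          stage-run : ∀ j → Prefix-run j ω → Stage-run j
          stage-run j (s′ , τ₀′ , τs′ , (σ₀′ , ω₀′ , ω″ , e′ , r′) , w′) =
            s′ , ω″ , τs′ , Exec-transport e e′ (λ σ ω → ExecOps B A (pre j ++ query ∷ []) σ ω s′ ω″ τs′) (subst (λ ops → ExecOps B A ops σ₀′ ω₀′ s′ ω″ τs′) (prefix-rollback rb≡ j) r′) ,
            stage-time t≡ rb≡ j {τ₀′} w′
          session : ∃ λ outs → ∃ λ t → Session σ₀ ω₀ 0 J σ₀ ω₀ outs t × t ≤ J * stageBudget (u N) (q N)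
          session = session-rollback rb≡ un≡ 0 J (λ j _ j< → stage-run j (runs j j<))
          outs : List ℕ
          outs = proj₁ session

      outcome : ∀ ω → length ω ≡ coins → Outcome ω
      outcome ω len = [ (λ (rb≡ , t≡) → outcome-amortized rb≡ t≡ {ω} (base-run ω len) (good-run ω)) ,
                        (λ (rb≡ , un≡ , t≡) → outcome-worstCase rb≡ un≡ t≡ {ω} (base-run ω len) (prefix-run ω len) (good-run ω)) ]′ (timing-cases v)

open Oracles

-- Polynomial bounds and rational exponents

module Bounds where

  infixl 6 _⊕_
  infixl 7 _⊗_
  infixr 8 _⊛_

  -- Bounds as syntax. The word exponent and the factor poly (d) must be fixed before the instance
  -- is known; they are computed from the form of the bound.
  data Poly : Set where
    con     : ℕ → Poly
    𝐧 𝐝     : Poly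
    _⊕_ _⊗_ : Poly → Poly → Poly
    _⊛_     : Poly → ℕ → Poly

  ⟦_⟧ₚ : Poly → ℕ → ℕ → ℕ
  ⟦ con c ⟧ₚ n d = c
  ⟦ 𝐧 ⟧ₚ     n d = n
  ⟦ 𝐝 ⟧ₚ     n d = d
  ⟦ p ⊕ q ⟧ₚ n d = ⟦ p ⟧ₚ n d + ⟦ q ⟧ₚ n d
  ⟦ p ⊗ q ⟧ₚ n d = ⟦ p ⟧ₚ n d * ⟦ q ⟧ₚ n d
  ⟦ p ⊛ k ⟧ₚ n d = ⟦ p ⟧ₚ n d ^ k

  -- An exponent for the base `2 + n + d` and not the usual degree: as the base is at least 2, its
  -- `c`-th power exceeds the constant `c`, and one more factor absorbs a sum.
  degree : Poly → ℕ
  degree (con c) = c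
  degree 𝐧       = 1
  degree 𝐝       = 1
  degree (p ⊕ q) = suc (degree p + degree q)
  degree (p ⊗ q) = degree p + degree q
  degree (p ⊛ k) = degree p * k

  n<2^n : ∀ n → n < 2 ^ n
  n<2^n zero    = s≤s z≤n
  n<2^n (suc n) = ≤-trans (+-mono-≤ (m^n>0 2 n) (n<2^n n)) (≤-reflexive (cong (2 ^ n +_) (sym (+-identityʳ (2 ^ n)))))

  Poly-bound : ∀ p n d → ⟦ p ⟧ₚ n d ≤ (2 + n + d) ^ degree p
  Poly-bound (con c) n d = ≤-trans (<⇒≤ (n<2^n c)) (^-monoˡ-≤ c {2} {2 + n + d} (s≤s (s≤s z≤n)))
  Poly-bound 𝐧       n d = ≤-trans (≤-trans (m≤n+m n 2) (m≤m+n (2 + n) d)) (≤-reflexive (sym (*-identityʳ _)))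
  Poly-bound 𝐝       n d = ≤-trans (m≤n+m d (2 + n)) (≤-reflexive (sym (*-identityʳ _)))
  Poly-bound (p ⊕ q) n d = begin
    ⟦ p ⟧ₚ n d + ⟦ q ⟧ₚ n d           ≤⟨ +-mono-≤ (≤-trans (Poly-bound p n d) (^-monoʳ-≤ (2 + n + d) (m≤m+n (degree p) (degree q)))) (≤-trans (Poly-bound q n d) (^-monoʳ-≤ (2 + n + d) (m≤n+m (degree q) (degree p)))) ⟩
    x + x                             ≡⟨ cong (λ y → x + y) (sym (+-identityʳ x)) ⟩
    2 * x                             ≤⟨ *-monoˡ-≤ x {2} {2 + n + d} (s≤s (s≤s z≤n)) ⟩
    (2 + n + d) * x                   ∎
    where
    open ≤-Reasoning
    x : ℕ
    x = (2 + n + d) ^ (degree p + degree q)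
  Poly-bound (p ⊗ q) n d = ≤-trans (*-mono-≤ (Poly-bound p n d) (Poly-bound q n d)) (≤-reflexive (sym (^-distribˡ-+-* (2 + n + d) (degree p) (degree q))))
  Poly-bound (p ⊛ k) n d = ≤-trans (^-monoˡ-≤ k (Poly-bound p n d)) (≤-reflexive (^-*-assoc (2 + n + d) (degree p) k))

  Poly-bound-< : ∀ p n d → ⟦ p ⟧ₚ n d < (2 + n + d) ^ suc (degree p)
  Poly-bound-< p n d = ≤-<-trans (Poly-bound p n d) (^-monoʳ-< (2 + n + d) (s≤s (s≤s z≤n)) (n<1+n (degree p)))

  -- The evaluation at 0 reflects that polynomials in `𝐝` alone are meant. The power of `n` in the
  -- running time is split off separately.
  Poly-bound-𝐝 : ∀ p d → ⟦ p ⟧ₚ 0 d ≤ 2 ^ degree p * suc d ^ degree p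
  Poly-bound-𝐝 p d = ≤-trans (Poly-bound p 0 d) (≤-trans (^-monoˡ-≤ (degree p) double) (≤-reflexive (*-^-distrib (degree p) 2 (suc d))))
    where
    double : 2 + d ≤ 2 * suc d
    double = ≤-trans (+-monoʳ-≤ 2 (m≤m+n d d)) (≤-reflexive (arith d))
      where
      arith : ∀ d → 2 + (d + d) ≡ 2 * suc d
      arith = solve-∀

  ^-cancelʳ-≤ : ∀ k .{{_ : NonZero k}} {x y} → x ^ k ≤ y ^ k → x ≤ y
  ^-cancelʳ-≤ k {x} {y} le with x ≤? y
  ... | yes x≤y = x≤y
  ... | no x≰y  = contradiction le (<⇒≱ (^-monoˡ-< k (≰⇒> x≰y)))

  private
    ^-swap : ∀ x a b → (x ^ a) ^ b ≡ (x ^ b) ^ a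
    ^-swap x a b = trans (^-*-assoc x a b) (trans (cong (x ^_) (*-comm a b)) (sym (^-*-assoc x b a)))

  -- x ≤ K · n ^ (E / (1 + q))
  infix 4 _≤_·_^[_/1+_]
  _≤_·_^[_/1+_] : ℕ → ℕ → ℕ → ℕ → ℕ → Set
  x ≤ K · n ^[ E /1+ q ] = x ^ suc q ≤ K ^ suc q * n ^ E

  module _ {n : ℕ} .{{_ : NonZero n}} where

    -- Premise and conclusion are inequalities raised to the powers `Q` and `suc q`; they are
    -- compared after raising to the product of both. The factor `n ^ (c * suc q)` accounts for a
    -- negative exponent.
    ^ℚ⇒^/ : ∀ {e E q x K} → toℚᵘ e ℚᵘ.≤ mkℚᵘ (ℤ.+ E) q → x ≤ K · n ^ℚ e → x ≤ K · n ^[ E /1+ q ]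
    ^ℚ⇒^/ {mkℚ z dq _} {E} {q} {x} {K} (ℚᵘ.*≤* le) h = ^-cancelʳ-≤ Q (*-cancelʳ-≤ _ _ (n ^ (c * suc q)) {{m^n≢0 n (c * suc q)}} (begin
      (x ^ suc q) ^ Q * n ^ (c * suc q)                ≡⟨ cong₂ _*_ (^-swap x (suc q) Q) (sym (^-*-assoc n c (suc q))) ⟩
      (x ^ Q) ^ suc q * (n ^ c) ^ suc q                ≡⟨ sym (*-^-distrib (suc q) (x ^ Q) (n ^ c)) ⟩
      (x ^ Q * n ^ c) ^ suc q                          ≤⟨ ^-monoˡ-≤ (suc q) h ⟩
      (K ^ Q * n ^ a) ^ suc q                          ≡⟨ *-^-distrib (suc q) (K ^ Q) (n ^ a) ⟩
      (K ^ Q) ^ suc q * (n ^ a) ^ suc q                ≡⟨ cong₂ _*_ (^-swap K Q (suc q)) (^-*-assoc n a (suc q)) ⟩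
      (K ^ suc q) ^ Q * n ^ (a * suc q)                ≤⟨ *-monoʳ-≤ ((K ^ suc q) ^ Q) (^-monoʳ-≤ n (clear z le)) ⟩
      (K ^ suc q) ^ Q * n ^ (E * Q + c * suc q)        ≡⟨ cong ((K ^ suc q) ^ Q *_) (trans (^-distribˡ-+-* n (E * Q) (c * suc q)) (cong (_* n ^ (c * suc q)) (sym (^-*-assoc n E Q)))) ⟩
      (K ^ suc q) ^ Q * ((n ^ E) ^ Q * n ^ (c * suc q)) ≡⟨ sym (*-assoc ((K ^ suc q) ^ Q) _ _) ⟩
      (K ^ suc q) ^ Q * (n ^ E) ^ Q * n ^ (c * suc q)  ≡⟨ cong (_* n ^ (c * suc q)) (sym (*-^-distrib Q (K ^ suc q) (n ^ E))) ⟩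
      (K ^ suc q * n ^ E) ^ Q * n ^ (c * suc q)        ∎))
      where
      open ≤-Reasoning
      Q a c : ℕ
      Q = suc dq
      a = posPart z
      c = negPart z
      clear : ∀ z → z ℤ.* ℤ.+ suc q ℤ.≤ ℤ.+ E ℤ.* ℤ.+ Q → posPart z * suc q ≤ E * Q + negPart z * suc q
      clear (ℤ.+ m) le    = ≤-trans (ℤₚ.drop‿+≤+ (subst₂ ℤ._≤_ (sym (ℤₚ.pos-* m (suc q))) (sym (ℤₚ.pos-* E Q)) le)) (m≤m+n (E * Q) _)
      clear -[1+ m ] le = z≤n

    ^/⇒^ℚ : ∀ {e E q x K} → mkℚᵘ (ℤ.+ E) q ℚᵘ.≤ toℚᵘ e → x ≤ K · n ^[ E /1+ q ] → x ≤ K · n ^ℚ e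
    ^/⇒^ℚ {mkℚ z dq _} {E} {q} {x} {K} (ℚᵘ.*≤* le) h = ^-cancelʳ-≤ (suc q) (begin
      (x ^ Q * n ^ c) ^ suc q                          ≡⟨ *-^-distrib (suc q) (x ^ Q) (n ^ c) ⟩
      (x ^ Q) ^ suc q * (n ^ c) ^ suc q                ≡⟨ cong₂ _*_ (^-swap x Q (suc q)) (^-*-assoc n c (suc q)) ⟩
      (x ^ suc q) ^ Q * n ^ (c * suc q)                ≤⟨ *-monoˡ-≤ (n ^ (c * suc q)) (^-monoˡ-≤ Q h) ⟩
      (K ^ suc q * n ^ E) ^ Q * n ^ (c * suc q)        ≡⟨ cong (_* n ^ (c * suc q)) (*-^-distrib Q (K ^ suc q) (n ^ E)) ⟩
      (K ^ suc q) ^ Q * (n ^ E) ^ Q * n ^ (c * suc q)  ≡⟨ *-assoc ((K ^ suc q) ^ Q) _ _ ⟩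
      (K ^ suc q) ^ Q * ((n ^ E) ^ Q * n ^ (c * suc q)) ≡⟨ cong ((K ^ suc q) ^ Q *_) (trans (cong (_* n ^ (c * suc q)) (^-*-assoc n E Q)) (sym (^-distribˡ-+-* n (E * Q) (c * suc q)))) ⟩
      (K ^ suc q) ^ Q * n ^ (E * Q + c * suc q)        ≤⟨ *-monoʳ-≤ ((K ^ suc q) ^ Q) (^-monoʳ-≤ n (clear z le)) ⟩
      (K ^ suc q) ^ Q * n ^ (a * suc q)                ≡⟨ cong₂ _*_ (^-swap K (suc q) Q) (sym (^-*-assoc n a (suc q))) ⟩
      (K ^ Q) ^ suc q * (n ^ a) ^ suc q                ≡⟨ sym (*-^-distrib (suc q) (K ^ Q) (n ^ a)) ⟩
      (K ^ Q * n ^ a) ^ suc q                          ∎)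
      where
      open ≤-Reasoning
      Q a c : ℕ
      Q = suc dq
      a = posPart z
      c = negPart z
      clear : ∀ z → ℤ.+ E ℤ.* ℤ.+ Q ℤ.≤ z ℤ.* ℤ.+ suc q → E * Q + negPart z * suc q ≤ posPart z * suc q
      clear (ℤ.+ m) le    = ≤-trans (≤-reflexive (+-identityʳ (E * Q))) (ℤₚ.drop‿+≤+ (subst₂ ℤ._≤_ (sym (ℤₚ.pos-* E Q)) (sym (ℤₚ.pos-* m (suc q))) le))
      clear -[1+ m ] le = contradiction (subst (ℤ._≤ -[1+ m ] ℤ.* ℤ.+ suc q) (sym (ℤₚ.pos-* E Q)) le) λ ()

  natℚ : ℕ → ℚ
  natℚ b = mkℚ (ℤ.+ b) 0 (coprime-sym (1-coprimeTo b))

  unitℚ : ℕ → ℚ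
  unitℚ q = mkℚ (ℤ.+ 1) q (1-coprimeTo (suc q))

  0<natℚ : ∀ b → 0ℚ ℚ.< natℚ (suc b)
  0<natℚ b = ℚ.*<* (subst (ℤ.+0 ℤ.<_) (sym (ℤₚ.*-identityʳ (ℤ.+ suc b))) (ℤ.+<+ (s≤s z≤n)))

  0<unitℚ : ∀ q → 0ℚ ℚ.< unitℚ q
  0<unitℚ q = ℚ.*<* (ℤ.+<+ (s≤s z≤n))

  -- The numerator of a positive rational is at least 1. Both `ε` and `ε′` are thereby weakened to
  -- unit fractions, which keeps the arithmetic of exponents integral.
  unitℚ≤ : ∀ {ε} → 0ℚ ℚ.< ε → unitℚ (ℚ.ℚ.denominator-1 ε) ℚ.≤ ε
  unitℚ≤ {mkℚ (ℤ.+ zero) _ _} (ℚ.*<* (ℤ.+<+ ()))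
  unitℚ≤ {mkℚ (ℤ.+ suc m) d _} _ = ℚ.*≤* (subst₂ ℤ._≤_ (ℤₚ.pos-* 1 (suc d)) (ℤₚ.pos-* (suc m) (suc d)) (ℤ.+≤+ (*-monoˡ-≤ (suc d) {1} {suc m} (s≤s z≤n))))
  unitℚ≤ {mkℚ -[1+ m ] d _} (ℚ.*<* ())

  private
    nat-unit : ∀ c q → toℚᵘ (natℚ (suc c) ℚ.- unitℚ q) ℚᵘ.≃ mkℚᵘ (ℤ.+ (q + c * suc q)) q
    nat-unit c q = ℚᵘₚ.≃-trans (ℚₚ.toℚᵘ-homo-+ (natℚ (suc c)) (ℚ.- unitℚ q))
      (ℚᵘₚ.≃-trans (ℚᵘₚ.+-congʳ (toℚᵘ (natℚ (suc c))) (ℚₚ.toℚᵘ-homo‿- (unitℚ q))) (ℚᵘ.*≡* (cong₂ ℤ._*_ numerators (cong (λ x → ℤ.+ suc x) (sym (+-identityʳ q))))))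
      where
      numerators : ℤ.+ suc c ℤ.* ℤ.+ suc q ℤ.+ -[1+ 0 ] ℤ.* ℤ.+ 1 ≡ ℤ.+ (q + c * suc q)
      numerators = cong (ℤ._+ -[1+ 0 ]) (sym (ℤₚ.pos-* (suc c) (suc q)))

  nat-sum : ∀ b → 1ℚ ℚ.+ 1ℚ ℚ.+ natℚ b ≡ natℚ (2 + b)
  nat-sum b = ℚₚ.toℚᵘ-injective (ℚᵘₚ.≃-trans (ℚₚ.toℚᵘ-homo-+ (1ℚ ℚ.+ 1ℚ) (natℚ b)) (ℚᵘ.*≡* (cong (ℤ._* ℤ.+ 1) (cong (λ x → ℤ.+ 2 ℤ.+ x) (ℤₚ.*-identityʳ (ℤ.+ b))))))

  nat-unit-upper : ∀ {ε} c → 0ℚ ℚ.< ε → toℚᵘ (natℚ (suc c) ℚ.- ε) ℚᵘ.≤ mkℚᵘ (ℤ.+ (ℚ.ℚ.denominator-1 ε + c * suc (ℚ.ℚ.denominator-1 ε))) (ℚ.ℚ.denominator-1 ε)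
  nat-unit-upper {ε} c 0<ε = ℚᵘₚ.≤-respʳ-≃ (nat-unit c (ℚ.ℚ.denominator-1 ε)) (ℚₚ.toℚᵘ-mono-≤ (ℚₚ.+-monoʳ-≤ (natℚ (suc c)) (ℚₚ.neg-antimono-≤ (unitℚ≤ 0<ε))))

  nat-unit-lower : ∀ b q → mkℚᵘ (ℤ.+ (q + suc b * suc q)) q ℚᵘ.≤ toℚᵘ (1ℚ ℚ.+ 1ℚ ℚ.+ natℚ b ℚ.- unitℚ q)
  nat-unit-lower b q = subst (λ x → mkℚᵘ (ℤ.+ (q + suc b * suc q)) q ℚᵘ.≤ toℚᵘ (x ℚ.- unitℚ q)) (sym (nat-sum b)) (ℚᵘₚ.≤-reflexive (ℚᵘₚ.≃-sym (nat-unit (suc b) q)))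

  -- The numerator alone bounds the fraction. One more makes the bound, which becomes the exponent
  -- `b`, positive whatever `t` is.
  ceiling : ∀ t → toℚᵘ t ℚᵘ.≤ mkℚᵘ (ℤ.+ suc (posPart (ℚ.↥ t))) 0
  ceiling (mkℚ (ℤ.+ m) d _)    = ℚᵘ.*≤* (ℤₚ.≤-trans (ℤₚ.≤-reflexive (ℤₚ.*-identityʳ (ℤ.+ m))) (subst (ℤ.+ m ℤ.≤_) (ℤₚ.pos-* (suc m) (suc d)) (ℤ.+≤+ (≤-trans (n≤1+n m) (m≤m*n (suc m) (suc d))))))
  ceiling (mkℚ -[1+ m ] d _) = ℚᵘ.*≤* (subst (-[1+ m ] ℤ.* ℤ.+ 1 ℤ.≤_) (ℤₚ.pos-* 1 (suc d)) ℤ.-≤+)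

  floor-natℚ : ∀ {n b k} → IsFloorPower n (natℚ b) k → k ≡ n ^ b
  floor-natℚ {n} {b} {k} (below , ¬above) = ≤-antisym (subst₂ _≤_ (unit k) (*-identityˡ (n ^ b)) below)
    (≮⇒≥ λ k< → ¬above (subst₂ _≤_ (sym (unit (suc k))) (sym (*-identityˡ (n ^ b))) k<))
    where
    unit : ∀ k → k ^ 1 * n ^ 0 ≡ k
    unit k = trans (*-identityʳ (k * 1)) (*-identityʳ k)

  ^ℚ-mono : ∀ {x y K n e} → x ≤ y → y ≤ K · n ^ℚ e → x ≤ K · n ^ℚ e
  ^ℚ-mono {n = n} {e} x≤y h = ≤-trans (*-monoˡ-≤ (n ^ negPart (ℚ.↥ e)) (^-monoˡ-≤ (ℚ.↧ₙ e) x≤y)) h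

  Poly-word : ∀ p → ∃ λ k → ∀ n d → ⟦ p ⟧ₚ n d < (2 + n + d) ^ k
  Poly-word p = suc (degree p) , Poly-bound-< p

  Poly-factor : ∀ p → ∃₂ λ C k → ∀ d → ⟦ p ⟧ₚ 0 d ≤ C * suc d ^ k
  Poly-factor p = 2 ^ degree p , degree p , Poly-bound-𝐝 p

open Bounds

-- From 3-HS to covered rows, and from answers to votes

module Instances where

  flatten-∷ : ∀ {d k} (x : Vector d) (X : Vec (Vector d) k) → flatten (x ∷ X) ≡ map toℕ (Vec.toList x) ++ flatten X
  flatten-∷ x X = trans (cong (map toℕ) (Vecₚ.toList-++ x (Vec.concat X))) (map-++ toℕ (Vec.toList x) _)

  at-toList : ∀ {d} (x : Vector d) i → at 0 (map toℕ (Vec.toList x)) (toℕ i) ≡ toℕ (Vec.lookup x i)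
  at-toList (b ∷ x) zero    = refl
  at-toList (b ∷ x) (suc i) = at-toList x i

  at-flatten : ∀ {d k} (X : Vec (Vector d) k) a i → at 0 (flatten X) (toℕ a * d + toℕ i) ≡ toℕ (Vec.lookup (Vec.lookup X a) i)
  at-flatten {d} (x ∷ X) zero    i = trans (cong (λ xs → at 0 xs (toℕ i)) (flatten-∷ x X))
    (trans (at-++ˡ (map toℕ (Vec.toList x)) (flatten X) (toℕ i) (≤-trans (Finₚ.toℕ<n i) (≤-reflexive (sym (trans (Listₚ.length-map toℕ (Vec.toList x)) (Vecₚ.length-toList x)))))) (at-toList x i))
  at-flatten {d} (x ∷ X) (suc a) i = trans (cong₂ (at 0) (flatten-∷ x X) (trans (+-assoc d (toℕ a * d) (toℕ i)) (cong (_+ (toℕ a * d + toℕ i)) (sym (trans (Listₚ.length-map toℕ (Vec.toList x)) (Vecₚ.length-toList x))))))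
    (trans (at-++ʳ (map toℕ (Vec.toList x)) (flatten X) (toℕ a * d + toℕ i)) (at-flatten X a i))

  sum-tabulate-zero : ∀ {d} (f : Fin d → ℕ) → Vec.sum (Vec.tabulate f) ≡ 0 → ∀ i → f i ≡ 0
  sum-tabulate-zero f eq zero    = m+n≡0⇒m≡0 (f zero) eq
  sum-tabulate-zero f eq (suc i) = sum-tabulate-zero (f ∘ suc) (m+n≡0⇒n≡0 (f zero) eq) i

  sum-tabulate-nonzero : ∀ {d} (f : Fin d → ℕ) → Vec.sum (Vec.tabulate f) ≢ 0 → ∃ λ i → f i ≢ 0
  sum-tabulate-nonzero {zero}  f ne = contradiction refl ne
  sum-tabulate-nonzero {suc d} f ne with f zero ≟ 0
  ... | no f≢ = zero , f≢
  ... | yes f≡ with i , f≢ ← sum-tabulate-nonzero (f ∘ suc) (λ eq → ne (cong₂ _+_ f≡ eq)) = suc i , f≢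

  module Instance {n d nw : ℕ} (U V : Vec (Vector d) (suc n)) (W : Vec (Vector d) nw) (l : ℕ) (1≤l : 1 ≤ l) where

    private
      n′ : ℕ
      n′ = suc n
      entry : ∀ {k} → Vec (Vector d) k → Fin k → Fin d → ℕ
      entry X a i = toℕ (Vec.lookup (Vec.lookup X a) i)

    open Layout n′ d l
    open Bits (flatten U) (flatten V)

    wBitₛ : (j i : ℕ) → ℕ
    wBitₛ j i = pick (d ∸ i) 1 (at 0 (flatten W) (j * d + i))

    private
      at-entry : ∀ {k} (X : Vec (Vector d) k) a {i} (i< : i < d) → at 0 (flatten X) (toℕ a * d + i) ≡ entry X a (fromℕ< i<)
      at-entry X a i< = trans (cong (λ i → at 0 (flatten X) (toℕ a * d + i)) (sym (Finₚ.toℕ-fromℕ< i<))) (at-flatten X a (fromℕ< i<))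

      inside≢0 : ∀ {k} (a : Fin k) → k ∸ toℕ a ≢ 0
      inside≢0 a = m>n⇒m∸n≢0 (Finₚ.toℕ<n a)

      uBit-entry : ∀ a {i} (i< : i < d) → uBit (toℕ a) i ≡ entry U a (fromℕ< i<)
      uBit-entry a i< = trans (pick-suc (inside≢0 a)) (trans (pick-suc (m>n⇒m∸n≢0 i<)) (at-entry U a i<))

      vBit-entry : ∀ a {i} (i< : i < d) → vBit (toℕ a) i ≡ entry V a (fromℕ< i<)
      vBit-entry a i< = trans (pick-suc (inside≢0 a)) (trans (pick-suc (m>n⇒m∸n≢0 i<)) (at-entry V a i<))

      wBit-entry : ∀ a {i} (i< : i < d) → wBitₛ (toℕ a) i ≡ entry W a (fromℕ< i<)
      wBit-entry a i< = trans (pick-suc (m>n⇒m∸n≢0 i<)) (at-entry W a i<)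

      uBit-extra : ∀ a {i} → d ≤ i → uBit (toℕ a) i ≡ 0
      uBit-extra a d≤i = trans (pick-suc (inside≢0 a)) (pick-zero (m≤n⇒m∸n≡0 d≤i))

    -- The connectedness of every stage graph rests on this bit, which stands for no coordinate of
    -- w.
    wBit-extra : ∀ j → wBitₛ j d ≢ 0
    wBit-extra j eq = case trans (sym (pick-zero {y = at 0 (flatten W) (j * d + d)} (n∸n≡0 d))) eq of λ ()

    private
      vBit-extra : ∀ i → vBit n′ i ≢ 0
      vBit-extra i eq = case trans (sym (pick-zero {y = pick (d ∸ i) 1 (at 0 (flatten V) (n′ * d + i))} (n∸n≡0 n′))) eq of λ ()

      Hit : Fin n′ → ℕ → Fin nw → Fin D → Set
      Hit a j w i = uBit (toℕ a) (toℕ i) ≢ 0 × vBit j (toℕ i) ≢ 0 × wBitₛ (toℕ w) (toℕ i) ≢ 0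

      Miss : Fin n′ → ℕ → Fin nw → Fin D → Set
      Miss a j w i = uBit (toℕ a) (toℕ i) ≡ 0 ⊎ vBit j (toℕ i) ≡ 0 ⊎ wBitₛ (toℕ w) (toℕ i) ≡ 0

      dot : Fin n′ → Fin n′ → Fin nw → ℕ
      dot a j w = dot₃ (Vec.lookup U a) (Vec.lookup V j) (Vec.lookup W w)

      factors : ∀ x y z → x * y * z ≢ 0 → x ≢ 0 × y ≢ 0 × z ≢ 0
      factors x y z ne = (λ { refl → ne refl }) , (λ { refl → ne (cong (_* z) (*-zeroʳ x)) }) , (λ { refl → ne (*-zeroʳ (x * y)) })

      vanishes : ∀ x y z → x * y * z ≡ 0 → x ≡ 0 ⊎ y ≡ 0 ⊎ z ≡ 0
      vanishes zero    y       z       _ = inj₁ refl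
      vanishes (suc x) zero    z       _ = inj₂ (inj₁ refl)
      vanishes (suc x) (suc y) zero    _ = inj₂ (inj₂ refl)

      hit : ∀ a j w → dot a j w ≢ 0 → ∃ λ i → Hit a (toℕ j) w i
      hit a j w ne with i , f≢ ← sum-tabulate-nonzero (λ i → entry U a i * entry V j i * entry W w i) ne
        with x , y , z ← factors (entry U a i) (entry V j i) (entry W w i) f≢ =
        Fin.inject₁ i , to uBit U uBit-entry a x , to vBit V vBit-entry j y , to wBitₛ W wBit-entry w z
        where
        i< : toℕ (Fin.inject₁ i) < d
        i< = ≤-trans (s≤s (≤-reflexive (Finₚ.toℕ-inject₁ i))) (Finₚ.toℕ<n i)
        to : ∀ {k} (bits : ℕ → ℕ → ℕ) (X : Vec (Vector d) k) → (∀ a {i} (i< : i < d) → bits (toℕ a) i ≡ entry X a (fromℕ< i<)) →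
             ∀ a → entry X a i ≢ 0 → bits (toℕ a) (toℕ (Fin.inject₁ i)) ≢ 0
        to bits X h a ne eq = ne (trans (cong (entry X a) (Finₚ.toℕ-injective (sym (trans (Finₚ.toℕ-fromℕ< i<) (Finₚ.toℕ-inject₁ i))))) (trans (sym (h a i<)) eq))

      miss : ∀ a j w → dot a j w ≡ 0 → ∀ i → Miss a (toℕ j) w i
      miss a j w eq i with toℕ i <? d
      ... | no i≮ = inj₁ (uBit-extra a (≮⇒≥ i≮))
      ... | yes i< = [ (λ e → inj₁ (trans (uBit-entry a i<) e)) , [ (λ e → inj₂ (inj₁ (trans (vBit-entry j i<) e))) , (λ e → inj₂ (inj₂ (trans (wBit-entry w i<) e))) ]′ ]′
        (vanishes _ _ _ (sum-tabulate-zero (λ i → entry U a i * entry V j i * entry W w i) eq (fromℕ< i<)))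

    stage-yes : 3HS U V W → ∃ λ (w : Fin nw) → ∃ λ (a : Fin n′) → ∀ (j : Fin (suc n′)) → ∃ λ i → Hit a (toℕ j) w i
    stage-yes (u , u∈ , ω , ω∈ , orth) = w , a , λ j → covered j (n′ ≟ toℕ j)
      where
      a : Fin n′
      a = VecAny.index u∈
      w : Fin nw
      w = VecAny.index ω∈
      real : ∀ j → ∃ λ i → Hit a (toℕ j) w i
      real j = hit a j w (subst₂ (λ u ω → dot₃ u (Vec.lookup V j) ω ≢ 0) (VecAnyₚ.lookup-index u∈) (VecAnyₚ.lookup-index ω∈) (orth _ (VecMembershipₚ.∈-lookup j V)))
      covered : ∀ (j : Fin (suc n′)) → Dec (n′ ≡ toℕ j) → ∃ λ i → Hit a (toℕ j) w i
      covered j (no j≢)  = let (i , h) = real (Fin.lower₁ j j≢) in i , subst (λ j → Hit a j w i) (Finₚ.toℕ-lower₁ j j≢) h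
      -- The extra row of V consists of ones, so any coordinate common to u and w will do; the first
      -- vector of V provides one.
      covered j (yes j≡) = let (i , hu , _ , hw) = real zero in i , hu , subst (λ j → vBit j (toℕ i) ≢ 0) j≡ (vBit-extra (toℕ i)) , hw

    -- A search through the finite V decides whether a given pair works, so the negation yields a
    -- concrete missed vector.
    stage-no : ¬ 3HS U V W → ∀ (w : Fin nw) (a : Fin n′) → ∃ λ (j : Fin (suc n′)) → ∀ i → Miss a (toℕ j) w i
    stage-no ¬3hs w a with Finₚ.any? (λ j → dot a j w ≟ 0)
    ... | yes (j , eq) = Fin.inject₁ j , λ i → subst (λ j → Miss a j w i) (sym (Finₚ.toℕ-inject₁ j)) (miss a j w eq i)
    ... | no none = contradiction (Vec.lookup U a , VecMembershipₚ.∈-lookup a U , Vec.lookup W w , VecMembershipₚ.∈-lookup w W ,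
        λ v v∈ eq → none (VecAny.index v∈ , trans (cong (λ v → dot₃ (Vec.lookup U a) v (Vec.lookup W w)) (sym (VecAnyₚ.lookup-index v∈))) eq)) ¬3hs

  sumTo-suc : ∀ R g → sumTo (suc R) g ≡ sumTo R g + g R
  sumTo-suc zero    g = +-comm (g 0) 0
  sumTo-suc (suc R) g = trans (cong (g 0 +_) (sumTo-suc R (g ∘ suc))) (sym (+-assoc (g 0) _ _))

  module Count {t b f : ℕ → ℕ} (t-0 : t 0 ≡ 0) (t-suc : ∀ r → t (suc r) ≡ t r + b r) where

    count-≥ : ∀ R → (∀ r → r < R → 1 ≤ b r + f r) → R ≤ t R + sumTo R f
    count-≥ zero    h = z≤n
    count-≥ (suc R) h = ≤-trans (≤-trans (≤-reflexive (+-comm 1 R)) (+-mono-≤ (count-≥ R (λ r r< → h r (m≤n⇒m≤1+n r<))) (h R ≤-refl)))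
      (≤-reflexive (trans (arith (t R) (sumTo R f) (b R) (f R)) (cong₂ _+_ (sym (t-suc R)) (sym (sumTo-suc R f)))))
      where
      arith : ∀ t s b f → t + s + (b + f) ≡ t + b + (s + f)
      arith = solve-∀

    count-≤ : ∀ R → (∀ r → r < R → b r ≤ f r) → t R ≤ sumTo R f
    count-≤ zero    h = ≤-reflexive t-0
    count-≤ (suc R) h = ≤-trans (≤-reflexive (t-suc R)) (≤-trans (+-mono-≤ (count-≤ R (λ r r< → h r (m≤n⇒m≤1+n r<))) (h R ≤-refl)) (≤-reflexive (sym (sumTo-suc R f))))

  module Disjunction {v x : ℕ → ℕ} (v-0 : v 0 ≡ 0) (v-suc : ∀ j → v (suc j) ≡ pick (x j) (v j) 1) where

    disjunction-0 : ∀ J → (∀ j → j < J → x j ≡ 0) → v J ≡ 0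
    disjunction-0 zero    h = v-0
    disjunction-0 (suc J) h = trans (v-suc J) (trans (pick-zero (h J ≤-refl)) (disjunction-0 J (λ j j< → h j (m≤n⇒m≤1+n j<))))

    disjunction-1 : ∀ J j → j < J → x j ≢ 0 → v J ≡ 1
    disjunction-1 (suc J) j j< xj with x J in eq
    ... | suc _ = trans (v-suc J) (cong (λ x → pick x (v J) 1) eq)
    ... | zero  = trans (v-suc J) (trans (pick-zero eq) (disjunction-1 J j (≤∧≢⇒< (s≤s⁻¹ j<) (λ { refl → xj eq })) xj))

  module _ {ε : ℚ} (0<ε : 0ℚ ℚ.< ε) {N : ℕ} {G : EdgeList N} {out P : ℕ}
           (approx : ApproximatesRadius (ℤ.+ 3 ℚ./ 2 ℚ.- ε) G out) (isR : IsRadius G P) where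

    private
      q L : ℕ
      q = ℚ.ℚ.denominator-1 ε
      L = 3 + q

      fromℕ≡ : ∀ k → fromℕ k ≡ natℚ k
      fromℕ≡ k = ℚₚ.normalize-coprime {k} {0} (coprime-sym (1-coprimeTo k))

      bound : natℚ out ℚ.≤ (ℤ.+ 3 ℚ./ 2 ℚ.- unitℚ q) ℚ.* natℚ P
      bound = ℚₚ.≤-trans (subst₂ ℚ._≤_ (fromℕ≡ out) (cong ((ℤ.+ 3 ℚ./ 2 ℚ.- ε) ℚ.*_) (fromℕ≡ P)) (proj₂ (approx P isR)))
        (ℚₚ.*-monoʳ-≤-nonNeg (natℚ P) (ℚₚ.+-monoʳ-≤ (ℤ.+ 3 ℚ./ 2) (ℚₚ.neg-antimono-≤ (unitℚ≤ 0<ε))))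

      boundᵘ : mkℚᵘ (ℤ.+ out) 0 ℚᵘ.≤ (mkℚᵘ (ℤ.+ 3) 1 ℚᵘ.+ ℚᵘ.- mkℚᵘ (ℤ.+ 1) q) ℚᵘ.* mkℚᵘ (ℤ.+ P) 0
      boundᵘ = ℚᵘₚ.≤-respʳ-≃ (ℚᵘₚ.≃-trans (ℚₚ.toℚᵘ-homo-* (ℤ.+ 3 ℚ./ 2 ℚ.- unitℚ q) (natℚ P))
          (ℚᵘₚ.*-congʳ {mkℚᵘ (ℤ.+ P) 0} (ℚᵘₚ.≃-trans (ℚₚ.toℚᵘ-homo-+ (ℤ.+ 3 ℚ./ 2) (ℚ.- unitℚ q)) (ℚᵘₚ.+-congʳ (mkℚᵘ (ℤ.+ 3) 1) (ℚₚ.toℚᵘ-homo‿- (unitℚ q))))))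
        (ℚₚ.toℚᵘ-mono-≤ bound)

      -- The factor `3 / 2 - 1 / (1 + q)` is the fraction `(3 * suc q ∸ 2) / (2 * suc q)`; here its
      -- denominator is cleared.
      boundₙ : out * (2 * suc q) ≤ (3 * suc q ∸ 2) * P
      boundₙ = unfold boundᵘ
        where
        unfold : mkℚᵘ (ℤ.+ out) 0 ℚᵘ.≤ (mkℚᵘ (ℤ.+ 3) 1 ℚᵘ.+ ℚᵘ.- mkℚᵘ (ℤ.+ 1) q) ℚᵘ.* mkℚᵘ (ℤ.+ P) 0 → out * (2 * suc q) ≤ (3 * suc q ∸ 2) * P
        unfold (ℚᵘ.*≤* le) = ℤₚ.drop‿+≤+ (subst₂ ℤ._≤_
          (trans (sym (ℤₚ.pos-* out (2 * suc q * 1))) (cong (λ x → ℤ.+ (out * x)) (*-identityʳ (2 * suc q))))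
          (trans (ℤₚ.*-identityʳ _) (trans (cong (ℤ._* ℤ.+ P) (ℤₚ.⊖-≥ {3 * suc q} {2} (≤-trans (s≤s (s≤s z≤n)) (*-monoʳ-≤ 3 (s≤s (z≤n {q})))))) (sym (ℤₚ.pos-* (3 * suc q ∸ 2) P)))) le)

    -- This fixes the length `L`. Multiplying `4 * L + 1` by 3/2 exceeds `6 * L` by 3/2, and the
    -- saving `(4 * L + 1) / (1 + q)` must be larger; with `L = 3 + q` it is above 4. After
    -- multiplication by `2 * suc q` the gap is `5 * q + 23`.
    near-answer : P ≤ 4 * L + 1 → out < 6 * L
    near-answer P≤ = ≰⇒> λ 6L≤ → <⇒≱ (m<m+n ((3 * suc q ∸ 2) * (4 * L + 1)) {5 * q + 23} (≤-trans (s≤s z≤n) (m≤n+m 23 (5 * q)))) (begin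
      (3 * suc q ∸ 2) * (4 * L + 1) + (5 * q + 23)   ≡⟨ cong (λ x → x * (4 * L + 1) + (5 * q + 23)) (trans (cong (_∸ 2) (arith₁ q)) (m+n∸m≡n 2 (1 + 3 * q))) ⟩
      (1 + 3 * q) * (4 * L + 1) + (5 * q + 23)       ≡⟨ arith₂ q ⟩
      6 * L * (2 * suc q)                            ≤⟨ *-monoˡ-≤ (2 * suc q) 6L≤ ⟩
      out * (2 * suc q)                              ≤⟨ boundₙ ⟩
      (3 * suc q ∸ 2) * P                            ≤⟨ *-monoʳ-≤ (3 * suc q ∸ 2) P≤ ⟩
      (3 * suc q ∸ 2) * (4 * L + 1)                  ∎)
      where
      open ≤-Reasoning
      arith₁ : ∀ q → 3 * suc q ≡ 2 + (1 + 3 * q)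
      arith₁ = solve-∀
      arith₂ : ∀ q → (1 + 3 * q) * (4 * (3 + q) + 1) + (5 * q + 23) ≡ 6 * (3 + q) * (2 * suc q)
      arith₂ = solve-∀

    far-answer : 6 * L ≤ P → 6 * L ≤ out
    far-answer 6L≤ = ≤-trans 6L≤ (proj₁ (approx P isR))

open Instances

-- The running time of the reduction

module TimeBounds where

  -- Pigeonhole on the codes of the vectors in `Fin (2 ^ d)`. It lets `d` stand in for the logarithm
  -- of `n` in the number of repetitions.
  Unique-size : ∀ {d n} (U : Vec (Vector d) n) → VecUnique.Unique U → n ≤ 2 ^ d
  Unique-size {d} {n} U uniq = ≮⇒≥ λ 2^d<n → distinct (Finₚ.pigeonhole 2^d<n (λ i → Fin.funToFin (Vec.lookup (Vec.lookup U i))))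
    where
    distinct : ¬ (∃₂ λ (i j : Fin n) → i Fin.< j × Fin.funToFin (Vec.lookup (Vec.lookup U i)) ≡ Fin.funToFin (Vec.lookup (Vec.lookup U j)))
    distinct (i , j , i<j , eq) = <⇒≢ i<j (cong toℕ (VecUniqueₚ.lookup-injective uniq i j
      (trans (sym (Vecₚ.tabulate∘lookup (Vec.lookup U i))) (trans (Vecₚ.tabulate-cong (λ k →
        trans (sym (Finₚ.finToFun-funToFin (Vec.lookup (Vec.lookup U i)) k)) (trans (cong (λ f → Fin.finToFun f k) eq) (Finₚ.finToFun-funToFin (Vec.lookup (Vec.lookup U j)) k))))
        (Vecₚ.tabulate∘lookup (Vec.lookup U j))))))

  -- A crude bound without fractional exponent, for the sizes of words; the time analysis keeps the
  -- sharp one.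
  root-bound : ∀ {x K n q} .{{_ : NonZero n}} → x ≤ K · n ^[ q + 1 * suc q /1+ q ] → x ≤ K * n ^ 2
  root-bound {x} {K} {n} {q} h = ^-cancelʳ-≤ (suc q) (≤-trans h (≤-trans (*-monoʳ-≤ (K ^ suc q) (≤-trans (^-monoʳ-≤ n le) (≤-reflexive (sym (^-*-assoc n 2 (suc q)))))) (≤-reflexive (sym (*-^-distrib (suc q) K (n ^ 2))))))
    where
    le : q + 1 * suc q ≤ 2 * suc q
    le = +-monoˡ-≤ (1 * suc q) (n≤1+n q)

  module Growth {n : ℕ} .{{_ : NonZero n}} (b q : ℕ) where

    infix 4 _≼_
    -- The exponent is `2 + b - 1 / (1 + q)`, since `q + suc b * suc q` is one less than
    -- `(2 + b) * suc q`: just what the hypothesis excludes for |U| = |V| = n and |W| = n ^ b.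
    _≼_ : ℕ → ℕ → Set
    x ≼ K = x ≤ K · n ^[ q + suc b * suc q /1+ q ]

    ≼-mono : ∀ {x y K} → x ≤ y → y ≼ K → x ≼ K
    ≼-mono x≤y h = ≤-trans (^-monoˡ-≤ (suc q) x≤y) h

    ≼-weaken : ∀ {x K L} → K ≤ L → x ≼ K → x ≼ L
    ≼-weaken K≤L h = ≤-trans h (*-monoˡ-≤ _ (^-monoˡ-≤ (suc q) K≤L))

    ≼-* : ∀ {x K} c → x ≼ K → c * x ≼ c * K
    ≼-* {x} {K} c h = begin
      (c * x) ^ suc q                   ≡⟨ *-^-distrib (suc q) c x ⟩
      c ^ suc q * x ^ suc q             ≤⟨ *-monoʳ-≤ (c ^ suc q) h ⟩
      c ^ suc q * (K ^ suc q * _)       ≡⟨ sym (*-assoc (c ^ suc q) (K ^ suc q) _) ⟩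
      c ^ suc q * K ^ suc q * _         ≡⟨ cong (_* n ^ (q + suc b * suc q)) (sym (*-^-distrib (suc q) c K)) ⟩
      (c * K) ^ suc q * n ^ (q + suc b * suc q) ∎
      where open ≤-Reasoning

    -- Replacing a sum by twice its larger term costs a constant and avoids expanding the power of a
    -- sum.
    ≼-+ : ∀ {x y K L} → x ≼ K → y ≼ L → x + y ≼ 2 * (K + L)
    ≼-+ {x} {y} {K} {L} hx hy with ≤-total x y
    ... | inj₁ x≤y = ≼-mono {K = 2 * (K + L)} (≤-trans (+-monoˡ-≤ y x≤y) (≤-reflexive (cong (λ z → y + z) (sym (+-identityʳ y))))) (≼-* {y} {K + L} 2 (≼-weaken {y} {L} {K + L} (m≤n+m L K) hy))
    ... | inj₂ y≤x = ≼-mono {K = 2 * (K + L)} (≤-trans (+-monoʳ-≤ x y≤x) (≤-reflexive (cong (λ z → x + z) (sym (+-identityʳ x))))) (≼-* {x} {K + L} 2 (≼-weaken {x} {K} {K + L} (m≤m+n K L) hx))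

    ≼-power : ∀ {x K} → x ≤ K * n ^ suc b → x ≼ K
    ≼-power {x} {K} h = ≤-trans (^-monoˡ-≤ (suc q) h) (≤-trans (≤-reflexive (*-^-distrib (suc q) K (n ^ suc b)))
      (*-monoʳ-≤ (K ^ suc q) (≤-trans (≤-reflexive (^-*-assoc n (suc b) (suc q))) (^-monoʳ-≤ n (m≤n+m (suc b * suc q) q)))))

    -- n ^ b updates on graphs with O (n) vertices, each in time O (n ^ (2 − 1 / (1 + q))).
    ≼-updates : ∀ {u Cu N w} .{{_ : NonZero w}} → N ≤ w * n → u ≤ Cu · N ^[ q + 1 * suc q /1+ q ] → n ^ b * u ≼ Cu * w ^ 2
    ≼-updates {u} {Cu} {N} {w} N≤ h = begin
      (n ^ b * u) ^ Q                                       ≡⟨ *-^-distrib Q (n ^ b) u ⟩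
      (n ^ b) ^ Q * u ^ Q                                   ≤⟨ *-mono-≤ (≤-reflexive (^-*-assoc n b Q)) h ⟩
      n ^ (b * Q) * (Cu ^ Q * N ^ (q + 1 * Q))              ≤⟨ *-monoʳ-≤ (n ^ (b * Q)) (*-monoʳ-≤ (Cu ^ Q) (≤-trans (^-monoˡ-≤ (q + 1 * Q) N≤) (≤-reflexive (*-^-distrib (q + 1 * Q) w n)))) ⟩
      n ^ (b * Q) * (Cu ^ Q * (w ^ (q + 1 * Q) * n ^ (q + 1 * Q))) ≤⟨ *-monoʳ-≤ (n ^ (b * Q)) (*-monoʳ-≤ (Cu ^ Q) (*-monoˡ-≤ (n ^ (q + 1 * Q)) (^-monoʳ-≤ w (+-monoˡ-≤ (1 * Q) (n≤1+n q))))) ⟩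
      n ^ (b * Q) * (Cu ^ Q * (w ^ (2 * Q) * n ^ (q + 1 * Q))) ≡⟨ arith₁ (n ^ (b * Q)) (Cu ^ Q) (w ^ (2 * Q)) (n ^ (q + 1 * Q)) ⟩
      Cu ^ Q * w ^ (2 * Q) * (n ^ (q + 1 * Q) * n ^ (b * Q)) ≡⟨ cong₂ _*_ (trans (cong (Cu ^ Q *_) (sym (^-*-assoc w 2 Q))) (sym (*-^-distrib Q Cu (w ^ 2)))) (trans (sym (^-distribˡ-+-* n (q + 1 * Q) (b * Q))) (cong (n ^_) (arith₂ q Q b))) ⟩
      (Cu * w ^ 2) ^ Q * n ^ (q + suc b * Q)                ∎
      where
      open ≤-Reasoning
      Q : ℕ
      Q = suc q
      arith₁ : ∀ a c x y → a * (c * (x * y)) ≡ c * x * (y * a)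
      arith₁ = solve-∀
      arith₂ : ∀ q Q b → q + 1 * Q + b * Q ≡ q + suc b * Q
      arith₂ = solve-∀

  module Budget (b l q Cp Cu Cq : ℕ) where

    -- `wₚ` bounds `N / n`, `Tₚ` the simulated time of a repetition, `κₚ` the slowdown and `Aₚ` the
    -- time outside the simulation, where the times are divided by their powers of `n`.
    Dₚ Rₚ κₚ wₚ Aₚ Tₚ timePoly : Poly
    Dₚ = con 1 ⊕ 𝐝
    Rₚ = 𝐝 ⊗ con (12 * b) ⊕ con 24
    κₚ = con 60 ⊕ con 10 ⊗ Rₚ
    wₚ = con (41 + 20 * l) ⊗ Dₚ
    Aₚ = con 28 ⊕ con 2 ⊗ Dₚ ⊗ con 7 ⊕ con 4 ⊗ Dₚ ⊗ con (3 + (32 + 5 * (10 + 5 * l))) ⊕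
         (con 20 ⊕ Rₚ ⊗ con 12 ⊕ Rₚ ⊗ (con 29 ⊕ con 2 ⊗ (Dₚ ⊗ con 27)))
    Tₚ = con 2 ⊗ (con Cp ⊗ wₚ ⊛ b ⊕ con 2 ⊗ (Dₚ ⊗ con 4 ⊗ (con Cu ⊗ wₚ ⊛ 2) ⊕ con Cq ⊗ wₚ ⊛ 2))
    timePoly = con 2 ⊗ (Aₚ ⊕ Rₚ ⊗ κₚ ⊗ Tₚ)

    module _ (m d : ℕ) where
      private
        n : ℕ
        n = suc m
      open Layout n d l using (D; X; N)
      open Growth {n} b q

      private
        R κ w J : ℕ
        R = d * (12 * b) + 24
        κ = 60 + 10 * R
        w = (41 + 20 * l) * D
        J = n ^ b

      N≤wn : N ≤ w * n
      -- The polynomial added to `N` is the exact difference of both sides, which turns the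
      -- inequality into a ring identity.
      N≤wn = ≤-trans (m≤m+n N (9 * d + (24 + 10 * l) * m + (27 + 10 * l) * m * d)) (≤-reflexive (arith m d l))
        where
        arith : ∀ m d l → 4 * suc d + 2 + (suc m + 2) + 2 * suc (suc m) + 2 * suc (suc m) * suc d + 2 * suc (suc m) * suc d + 2 * suc (suc m) * suc d * (5 * suc l) +
                          (9 * d + (24 + 10 * l) * m + (27 + 10 * l) * m * d) ≡ (41 + 20 * l) * suc d * suc m
        arith = solve-∀

      module _ {pN uN qN : ℕ} (p≤ : pN ≤ Cp * N ^ b) (u≤ : uN ≤ Cu · N ^[ q + 1 * suc q /1+ q ]) (q≤ : qN ≤ Cq · N ^[ q + 1 * suc q /1+ q ]) where

        total-budget : ℕ
        total-budget = pN + J * (D * 2 * uN + (qN + D * 2 * uN))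

        total-budget-≼ : total-budget ≼ ⟦ Tₚ ⟧ₚ 0 d
        total-budget-≼ = ≼-mono {K = ⟦ Tₚ ⟧ₚ 0 d} (≤-reflexive (arith pN J D uN qN))
          (≼-+ {pN} {D * 4 * (J * uN) + J * qN} {Cp * w ^ b} {2 * (D * 4 * (Cu * w ^ 2) + Cq * w ^ 2)} (≼-power {pN} {Cp * w ^ b} p≤′)
            (≼-+ {D * 4 * (J * uN)} {J * qN} {D * 4 * (Cu * w ^ 2)} {Cq * w ^ 2} (≼-* {J * uN} {Cu * w ^ 2} (D * 4) (≼-updates {uN} {Cu} {N} {w} N≤wn u≤)) (≼-updates {qN} {Cq} {N} {w} N≤wn q≤)))
          where
          arith : ∀ p J D u q → p + J * (D * 2 * u + (q + D * 2 * u)) ≡ p + (D * 4 * (J * u) + J * q)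
          arith = solve-∀
          p≤′ : pN ≤ Cp * w ^ b * n ^ suc b
          p≤′ = ≤-trans p≤ (≤-trans (*-monoʳ-≤ Cp (≤-trans (^-monoˡ-≤ b N≤wn) (≤-trans (≤-reflexive (*-^-distrib b w n)) (*-monoʳ-≤ (w ^ b) (^-monoʳ-≤ n (n≤1+n b))))))
            (≤-reflexive (sym (*-assoc Cp (w ^ b) (n ^ suc b)))))

        -- Shaped like `solverTime`, so that the two agree by computation where the bound is
        -- applied.
        time : ℕ → ℕ
        time q₀ = 28 + q₀ * 7 + X * (3 + (32 + 5 * (10 + 5 * l))) +
          (4 + (3 + R * (3 + (9 + J * (3 + (26 + 2 * (D * 27))) + κ * total-budget)) + (1 + (3 + J * 9))))

        time-≼ : ∀ {q₀} → q₀ ≤ 2 * D → time q₀ ≼ ⟦ timePoly ⟧ₚ 0 d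
        time-≼ {q₀} q₀≤ = ≼-mono {K = ⟦ timePoly ⟧ₚ 0 d} bound (≼-+ {⟦ Aₚ ⟧ₚ 0 d * H} {R * κ * T₀} {⟦ Aₚ ⟧ₚ 0 d} {R * κ * ⟦ Tₚ ⟧ₚ 0 d}
          (≼-power {⟦ Aₚ ⟧ₚ 0 d * H} {⟦ Aₚ ⟧ₚ 0 d} ≤-refl) (≼-* {T₀} {⟦ Tₚ ⟧ₚ 0 d} (R * κ) total-budget-≼))
          where
          H bt T₀ : ℕ
          H  = n ^ suc b
          bt = 3 + (32 + 5 * (10 + 5 * l))
          T₀ = total-budget
          H≥1 : 1 ≤ H
          H≥1 = m^n>0 n (suc b)
          H≥n : n ≤ H
          H≥n = ≤-trans (≤-reflexive (sym (*-identityʳ n))) (*-monoʳ-≤ n (m^n>0 n b))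
          H≥J : J ≤ H
          H≥J = ^-monoʳ-≤ n (n≤1+n b)
          c* : ∀ c → c ≤ c * H
          c* c = ≤-trans (≤-reflexive (sym (*-identityʳ c))) (*-monoʳ-≤ c H≥1)
          X≤ : X ≤ 4 * D * H
          X≤ = ≤-trans (*-monoˡ-≤ D (*-monoʳ-≤ 2 (+-mono-≤ H≥1 H≥n))) (≤-reflexive (arith D H))
            where
            arith : ∀ D H → 2 * (H + H) * D ≡ 4 * D * H
            arith = solve-∀
          arith : ∀ D H bt R κ T → 28 * H + 2 * D * H * 7 + 4 * D * H * bt + (4 * H + (3 * H + R * (3 * H + (9 * H + H * (3 + (26 + 2 * (D * 27))) + κ * T)) + (1 * H + (3 * H + H * 9)))) ≡
                  (28 + 2 * D * 7 + 4 * D * bt + (20 + R * 12 + R * (29 + 2 * (D * 27)))) * H + R * κ * T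
          arith = solve-∀
          bound : time q₀ ≤ ⟦ Aₚ ⟧ₚ 0 d * H + R * κ * T₀
          bound = ≤-trans (+-mono-≤ (+-mono-≤ (+-mono-≤ (c* 28) (*-monoˡ-≤ 7 (≤-trans q₀≤ (c* (2 * D))))) (*-monoˡ-≤ bt X≤))
              (+-mono-≤ (c* 4) (+-mono-≤ (+-mono-≤ (c* 3) (*-monoʳ-≤ R (+-mono-≤ (c* 3) (+-monoˡ-≤ (κ * T₀) (+-mono-≤ (c* 9) (*-monoˡ-≤ (3 + (26 + 2 * (D * 27))) H≥J))))))
                (+-mono-≤ (c* 1) (+-mono-≤ (c* 3) (*-monoˡ-≤ 9 H≥J))))))
            (≤-reflexive (arith D H bt R κ T₀))

open TimeBounds

-- The reduction

module Reductions where

  length-column : ∀ R r Ω i n → length (column R r Ω i n) ≡ n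
  length-column R r Ω i zero    = refl
  length-column R r Ω i (suc n) = cong suc (length-column R r Ω (suc i) n)

  private
    majority-yes : ∀ {h t f} → 2 * h ≤ t + f → f < h → t + t ∸ 2 * h ≢ 0
    majority-yes {h} {t} {f} R≤ f< = m>n⇒m∸n≢0 {t + t} {2 * h} (≤-<-trans (≤-reflexive (cong (h +_) (+-identityʳ h))) (+-mono-< h<t h<t))
      where
      h<t : h < t
      h<t = ≰⇒> λ t≤h → <⇒≱ (≤-<-trans (+-monoˡ-≤ f t≤h) (+-monoʳ-< h f<)) (≤-trans (≤-reflexive (cong (h +_) (sym (+-identityʳ h)))) R≤)

    majority-no : ∀ {h t f} → t ≤ f → f < h → t + t ∸ 2 * h ≡ 0
    majority-no {h} t≤ f< = m≤n⇒m∸n≡0 (≤-trans (+-mono-≤ t≤h t≤h) (≤-reflexive (cong (h +_) (sym (+-identityʳ h)))))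
      where
      t≤h : _ ≤ h
      t≤h = <⇒≤ (≤-<-trans t≤ f<)

    ≤ᵇ-true : ∀ {x y} → x ≤ y → (x ≤ᵇ y) ≡ true
    ≤ᵇ-true {x} {y} le with x ≤ᵇ y in eq
    ... | true  = refl
    ... | false = ⊥-elim (subst T eq (≤⇒≤ᵇ le))

    -- A failing repetition is charged to `f`, so nothing is claimed about its vote.
    vote-yes : ∀ {f thr out} → (f ≡ 0 → out < thr) → 1 ≤ pick (thr ∸ out) 0 1 + f
    vote-yes {suc f} {thr} {out} h = ≤-trans (s≤s z≤n) (m≤n+m (suc f) (pick (thr ∸ out) 0 1))
    vote-yes {zero}  h = ≤-trans (≤-reflexive (sym (pick-suc (m>n⇒m∸n≢0 (h refl))))) (m≤m+n _ 0)

    vote-no : ∀ {f thr out} → (f ≡ 0 → thr ≤ out) → pick (thr ∸ out) 0 1 ≤ f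
    vote-no {zero}  h = ≤-reflexive (pick-zero (m≤n⇒m∸n≡0 (h refl)))
    vote-no {suc f} {thr} {out} h = ≤-trans (one (thr ∸ out)) (s≤s z≤n)
      where
      one : ∀ x → pick x 0 1 ≤ 1
      one zero    = z≤n
      one (suc _) = ≤-refl

  module Reduction {t ε ε′ : ℚ} (0<ε : 0ℚ ℚ.< ε) (0<ε′ : 0ℚ ℚ.< ε′) (v : Variant) {p u qt : ℕ → ℕ}
                   (p-O : IsO p t) (u-O : IsO u (ℤ.+ 2 ℚ./ 1 ℚ.- ε′)) (q-O : IsO qt (ℤ.+ 2 ℚ./ 1 ℚ.- ε′))
                   (alg : DynamicRadius (settingOf v) (timingOf v) (ℤ.+ 3 ℚ./ 2 ℚ.- ε) (λ n → 4 * n * suc ⌊log₂ n ⌋ ^ 0) p u qt) where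
    open DynamicRadius alg renaming (prog to A; wordExponent to exponent) using ()

    -- `b` exceeds `t`, and `1 / (1 + q)` is at most `ε′`. `L = l + 2` is 3 plus `denominator-1 ε`,
    -- the length on which `near-answer` relies, and the threshold is `6 * L`.
    b q l Cp Cu Cq threshold : ℕ
    b = suc (posPart (ℚ.↥ t))
    q = ℚ.ℚ.denominator-1 ε′
    l = suc (ℚ.ℚ.denominator-1 ε)
    Cp = proj₁ p-O
    Cu = proj₁ u-O
    Cq = proj₁ q-O
    threshold = 6 * suc (suc l)

    1≤l : 1 ≤ l
    1≤l = s≤s z≤n

    open Budget b l q Cp Cu Cq

    p-bound : ∀ N .{{_ : NonZero N}} → p N ≤ Cp * N ^ b
    p-bound N = subst₂ _≤_ (*-identityʳ (p N)) (cong (_* N ^ b) (*-identityʳ Cp)) (^ℚ⇒^/ {N} {t} {b} {0} {p N} {Cp} (ceiling t) (proj₂ p-O N))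

    u-bound : ∀ N .{{_ : NonZero N}} → u N ≤ Cu · N ^[ q + 1 * suc q /1+ q ]
    u-bound N = ^ℚ⇒^/ {N} {ℤ.+ 2 ℚ./ 1 ℚ.- ε′} {q + 1 * suc q} {q} {u N} {Cu} (nat-unit-upper 1 0<ε′) (proj₂ u-O N)

    q-bound : ∀ N .{{_ : NonZero N}} → qt N ≤ Cq · N ^[ q + 1 * suc q /1+ q ]
    q-bound N = ^ℚ⇒^/ {N} {ℤ.+ 2 ℚ./ 1 ℚ.- ε′} {q + 1 * suc q} {q} {qt N} {Cq} (nat-unit-upper 1 0<ε′) (proj₂ q-O N)

    Jₚ Xₚ Nₚ Uₚ Qₚ fuelₚ roomₚ : Poly
    Jₚ = 𝐧 ⊛ b
    Xₚ = con 2 ⊗ (con 1 ⊕ 𝐧) ⊗ Dₚ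
    Nₚ = con 4 ⊗ Dₚ ⊕ con 2 ⊕ (𝐧 ⊕ con 2) ⊕ con 2 ⊗ (con 1 ⊕ 𝐧) ⊕ Xₚ ⊕ Xₚ ⊕ Xₚ ⊗ con (5 * suc l)
    Uₚ = con Cu ⊗ Nₚ ⊛ 2
    Qₚ = con Cq ⊗ Nₚ ⊛ 2
    fuelₚ = con Cp ⊗ Nₚ ⊛ b ⊕ Jₚ ⊗ (Dₚ ⊗ con 2 ⊗ Uₚ ⊕ (Qₚ ⊕ Dₚ ⊗ con 2 ⊗ Uₚ))
    roomₚ = (con 2 ⊕ Nₚ ⊕ Jₚ ⊗ (con 4 ⊗ Dₚ ⊕ con 1)) ⊛ exponent
    -- The sum of all quantities that have to fit into a word, so that a single exponent serves for
    -- all of them; the summands are peeled off one by one.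
    w₁ w₂ w₃ w₄ w₅ w₆ w₇ w₈ : Poly
    w₈ = (Rₚ ⊕ fuelₚ ⊗ Rₚ) ⊕ roomₚ
    w₇ = (con 1 ⊕ Rₚ ⊗ (Jₚ ⊕ con 2)) ⊕ w₈
    w₆ = con 2 ⊗ Rₚ ⊕ w₇
    w₅ = con (12 * b + 24) ⊕ w₆
    w₄ = con threshold ⊕ w₅
    w₃ = Jₚ ⊕ w₄
    w₂ = (Jₚ ⊗ 𝐝 ⊕ 𝐝) ⊕ w₃
    w₁ = con 4 ⊗ Nₚ ⊕ w₂

    abstract
      wordLimit : ∃ λ k → ∀ n d → ⟦ w₁ ⟧ₚ n d < (2 + n + d) ^ k
      wordLimit = Poly-word w₁

      timeLimit : ∃₂ λ C k → ∀ d → ⟦ timePoly ⟧ₚ 0 d ≤ C * suc d ^ k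
      timeLimit = Poly-factor timePoly

    wordLength timeFactor timeDegree : ℕ
    wordLength = proj₁ wordLimit
    timeFactor = proj₁ timeLimit
    timeDegree = proj₁ (proj₂ timeLimit)

    module _ (m d : ℕ) (U V : Vec (Vector d) (suc m)) (W : Vec (Vector d) (suc m ^ b)) (U-Unique : VecUnique.Unique U) where
      private
        n J B : ℕ
        n = suc m
        J = n ^ b
        B = (2 + n + d) ^ wordLength
        Ul Vl Wl : List ℕ
        Ul = flatten U
        Vl = flatten V
        Wl = flatten W

      open Layout n d l using (N)
      open InitialGraph n d l 1≤l Ul Vl using (fin; toℕ-fin; rawE; initialGraph-raw)
      open Instance {m} {d} {J} U V W l 1≤l using (wBit-extra; stage-yes; stage-no)
      open Oracle v alg n d l 1≤l Ul Vl Wl J B using (T′; coins; outcome; Outcome; module Outcome; fail; fail≤1; fail-rare; G₀; q₀≤; stageGraph; isStageGraph; wBit)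
      open Solver B A v n J d l b threshold Ul Vl Wl using (R; Es)

      private
        summands : ∀ r s {P} → ⟦ r ⊕ s ⟧ₚ n d < P → ⟦ r ⟧ₚ n d < P × ⟦ s ⟧ₚ n d < P
        summands r s lt = ≤-<-trans (m≤m+n (⟦ r ⟧ₚ n d) _) lt , ≤-<-trans (m≤n+m (⟦ s ⟧ₚ n d) (⟦ r ⟧ₚ n d)) lt

        s₁ : ⟦ con 4 ⊗ Nₚ ⟧ₚ n d < B × ⟦ w₂ ⟧ₚ n d < B
        s₁ = summands (con 4 ⊗ Nₚ) w₂ (proj₂ wordLimit n d)
        s₂ : ⟦ Jₚ ⊗ 𝐝 ⊕ 𝐝 ⟧ₚ n d < B × ⟦ w₃ ⟧ₚ n d < B
        s₂ = summands (Jₚ ⊗ 𝐝 ⊕ 𝐝) w₃ (proj₂ s₁)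
        s₃ : ⟦ Jₚ ⟧ₚ n d < B × ⟦ w₄ ⟧ₚ n d < B
        s₃ = summands Jₚ w₄ (proj₂ s₂)
        s₄ : ⟦ con threshold ⟧ₚ n d < B × ⟦ w₅ ⟧ₚ n d < B
        s₄ = summands (con threshold) w₅ (proj₂ s₃)
        s₅ : ⟦ con (12 * b + 24) ⟧ₚ n d < B × ⟦ w₆ ⟧ₚ n d < B
        s₅ = summands (con (12 * b + 24)) w₆ (proj₂ s₄)
        s₆ : ⟦ con 2 ⊗ Rₚ ⟧ₚ n d < B × ⟦ w₇ ⟧ₚ n d < B
        s₆ = summands (con 2 ⊗ Rₚ) w₇ (proj₂ s₅)
        s₇ : ⟦ con 1 ⊕ Rₚ ⊗ (Jₚ ⊕ con 2) ⟧ₚ n d < B × ⟦ w₈ ⟧ₚ n d < B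
        s₇ = summands (con 1 ⊕ Rₚ ⊗ (Jₚ ⊕ con 2)) w₈ (proj₂ s₆)
        s₈ : ⟦ Rₚ ⊕ fuelₚ ⊗ Rₚ ⟧ₚ n d < B × ⟦ roomₚ ⟧ₚ n d < B
        s₈ = summands (Rₚ ⊕ fuelₚ ⊗ Rₚ) roomₚ (proj₂ s₇)

        T≤ : T′ ≤ ⟦ fuelₚ ⟧ₚ n d
        T≤ = +-mono-≤ (p-bound N) (*-monoʳ-≤ J (+-mono-≤ (*-monoʳ-≤ (suc d * 2) uN) (+-mono-≤ (root-bound {qt N} {Cq} {N} {q} (q-bound N)) (*-monoʳ-≤ (suc d * 2) uN))))
          where
          uN : u N ≤ Cu * N ^ 2
          uN = root-bound {u N} {Cu} {N} {q} (u-bound N)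

        4N≤M : 4 * N ≤ 4 * N * suc ⌊log₂ N ⌋ ^ 0
        4N≤M = ≤-reflexive (sym (*-identityʳ (4 * N)))

        room : (2 + N + J * (4 * suc d + 1)) ^ exponent ≤ B
        room = <⇒≤ (proj₂ s₈)

      k : ℕ
      k = coins 4N≤M room

      private
        G-raw : map rawE G₀ ≡ Es
        G-raw = initialGraph-raw q₀≤

        src≡ : ∀ i → at 0 (map (toℕ ∘ proj₁) G₀) i ≡ at 0 (map proj₁ Es) i
        src≡ i = cong (λ xs → at 0 xs i) (trans (Listₚ.map-∘ G₀) (cong (map proj₁) G-raw))

        dst≡ : ∀ i → at 0 (map (toℕ ∘ proj₂) G₀) i ≡ at 0 (map proj₂ Es) i
        dst≡ i = cong (λ xs → at 0 xs i) (trans (Listₚ.map-∘ G₀) (cong (map proj₂) G-raw))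

        M≡ : length G₀ ≡ length Es
        M≡ = trans (sym (Listₚ.length-map rawE G₀)) (cong length G-raw)

        out : ∀ (Ω : Tape) r → Outcome 4N≤M room (column R r Ω 0 k)
        out Ω r = outcome 4N≤M room (column R r Ω 0 k) (length-column R r Ω 0 k)

        answers : Tape → ℕ → List ℕ
        answers Ω r = Outcome.outs (out Ω r)

      private
        module Solve (Ω : Tape) (length-Ω : length Ω ≡ k * R) where
          open Solver.Execution B A v n J d l b threshold Ul Vl Wl fin (λ x x< → toℕ-fin (<-≤-trans x< (InitialGraph.4D≤N n d l 1≤l Ul Vl))) (inputGraph G₀) refl M≡ (λ _ → refl) src≡ dst≡ (λ _ _ → refl)
              T′ k Ω length-Ω (answers Ω)
              (proj₁ s₁) (proj₁ s₂) (proj₁ s₃) (proj₁ s₄) (proj₁ s₅) (proj₁ s₆) (proj₁ s₇) (≤-<-trans (+-monoʳ-≤ R (*-monoˡ-≤ R T≤)) (proj₁ s₈)) using (Repetition; tallied; verdict; solverTime; solver-run) public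

      private
        repetitions : ∀ Ω (len : length Ω ≡ k * R) r → r < R → Solve.Repetition Ω len r
        repetitions Ω len r _ = record { pre-run = Outcome.pre-run (out Ω r) ; session = Outcome.session (out Ω r) ; within = Outcome.within (out Ω r) }

      solver-halts : ∀ Ω (len : length Ω ≡ k * R) → ∃ λ s → ∃ λ ω → ∃ λ τ →
        Exec B (solver A v l b threshold) (input3HS U V W) Ω s ω τ × τ ≤ Solve.solverTime Ω len × var s 0 ≡ Solve.verdict Ω len J
      solver-halts Ω len = Solve.solver-run Ω len (repetitions Ω len) refl refl refl (λ _ → refl) (λ _ → refl) (λ _ → refl) (λ _ → refl) (λ _ _ → refl)

      solver-fast : ∀ Ω (len : length Ω ≡ k * R) → Solve.solverTime Ω len ≤ timeFactor * suc d ^ timeDegree · n ^ℚ (1ℚ ℚ.+ 1ℚ ℚ.+ natℚ b ℚ.- unitℚ q)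
      solver-fast Ω len = ^/⇒^ℚ {n} {1ℚ ℚ.+ 1ℚ ℚ.+ natℚ b ℚ.- unitℚ q} {q + suc b * suc q} {q} {Solve.solverTime Ω len} {K} (nat-unit-lower b q)
        (Growth.≼-weaken {n} b q {Solve.solverTime Ω len} {⟦ timePoly ⟧ₚ 0 d} {K} (proj₂ (proj₂ timeLimit) d)
          (time-≼ m d {p N} {u N} {qt N} (p-bound N) (u-bound N) (q-bound N) q₀≤))
        where
        K : ℕ
        K = timeFactor * suc d ^ timeDegree

      private
        h : ℕ
        h = 6 * (d * b + 2)

        2h≡R : 2 * h ≡ R
        2h≡R = arith d b
          where
          arith : ∀ d b → 2 * (6 * (d * b + 2)) ≡ d * (12 * b) + 24
          arith = solve-∀

        failures : Tape → ℕ → ℕ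
        failures Ω j = sumTo R (λ r → fail 4N≤M room j (column R r Ω 0 k))

      -- Half of the repetitions failing for one vector of W is already bad; on all other tapes the
      -- majorities are strict.
      bad : Tape → Bool
      bad Ω = anyTo J (λ j → h ≤ᵇ failures Ω j)

      bad-rare : 3 * total (k * R) (bit ∘ bad) ≤ 2 ^ (k * R)
      bad-rare = subst (λ R → 3 * total (k * R) (λ Ω → bit (anyTo J (λ j → h ≤ᵇ sumTo R (λ r → fail 4N≤M room j (column R r Ω 0 k))))) ≤ 2 ^ (k * R)) 2h≡R
        (all-majorities (d * b + 2) J k (fail 4N≤M room) 4J≤ (fail≤1 4N≤M room) (fail-rare 4N≤M room))
        where
        4J≤ : 4 * J ≤ 2 ^ (d * b + 2)
        -- Here the distinctness of the vectors of U is used, through `n ≤ 2 ^ d`; the 2 added to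
        -- `d * b` provides the factor 4.
        4J≤ = ≤-trans (*-monoʳ-≤ 4 (≤-trans (^-monoˡ-≤ b (Unique-size U U-Unique)) (≤-reflexive (^-*-assoc 2 d b)))) (≤-reflexive (trans (*-comm 4 (2 ^ (d * b))) (sym (^-distribˡ-+-* 2 (d * b) 2))))

      private
        module _ (j : ℕ) where
          open StageRadius n d l 1≤l Ul Vl (wBit j) (isStageGraph j) using (Yes; No; Yes-near; No-far; connected)

          stage-connected : Connected (stageGraph j)
          stage-connected = connected zero (wBit-extra j)

          stage-radius : ∃ λ P → IsRadius (stageGraph j) P
          stage-radius = radius (stageGraph j) stage-connected

          near-out : Yes → ∀ {o} → ApproximatesRadius (ℤ.+ 3 ℚ./ 2 ℚ.- ε) (stageGraph j) o → o < threshold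
          near-out (a , covers) {o} ap = near-answer {ε} 0<ε {N} {stageGraph j} {o} {proj₁ stage-radius} ap (proj₂ stage-radius)
            (radius-upper (stageGraph j) stage-connected (proj₂ stage-radius) (Yes-near a covers))

          far-out : No → ∀ {o} → ApproximatesRadius (ℤ.+ 3 ℚ./ 2 ℚ.- ε) (stageGraph j) o → threshold ≤ o
          far-out none {o} ap = far-answer {ε} 0<ε {N} {stageGraph j} {o} {proj₁ stage-radius} ap (proj₂ stage-radius)
            (radius-lower (stageGraph j) (proj₂ stage-radius) (No-far none))

        few-failures : ∀ Ω → bad Ω ≡ false → ∀ j → j < J → failures Ω j < h
        few-failures Ω good j j< = ≰⇒> λ h≤ → case trans (sym (≤ᵇ-true h≤)) (anyTo-false J good j j<) of λ ()

      module _ (Ω : Tape) (len : length Ω ≡ k * R) (good : bad Ω ≡ false) where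
        private
          tallies : ℕ → ℕ
          tallies j = Solve.tallied Ω len R j

          approximates : ∀ j → j < J → ∀ r → fail 4N≤M room j (column R r Ω 0 k) ≡ 0 → ApproximatesRadius (ℤ.+ 3 ℚ./ 2 ℚ.- ε) (stageGraph j) (at 0 (answers Ω r) j)
          approximates j j< r ok = Outcome.correct (out Ω r) j j< ok

        accepts : 3HS U V W → Solve.verdict Ω len J ≡ 1
        accepts hs = Disjunction.disjunction-1 {Solve.verdict Ω len} {λ j → tallies j + tallies j ∸ R} refl (λ _ → refl) J j j<
          (subst (λ R → tallies j + tallies j ∸ R ≢ 0) 2h≡R (majority-yes {h} {tallies j} {failures Ω j} (≤-trans (≤-reflexive 2h≡R) counted) (few-failures Ω good j j<)))
          where
          w : Fin J
          w = proj₁ (stage-yes hs)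
          j : ℕ
          j = toℕ w
          j< : j < J
          j< = Finₚ.toℕ<n w
          counted : R ≤ tallies j + failures Ω j
          counted = Count.count-≥ {λ r → Solve.tallied Ω len r j} {λ r → pick (threshold ∸ at 0 (answers Ω r) j) 0 1} {λ r → fail 4N≤M room j (column R r Ω 0 k)} refl (λ _ → refl) R
            (λ r _ → vote-yes {thr = threshold} (λ ok → near-out j (proj₂ (stage-yes hs)) (approximates j j< r ok)))

        rejects : ¬ 3HS U V W → Solve.verdict Ω len J ≡ 0
        rejects ¬hs = Disjunction.disjunction-0 {Solve.verdict Ω len} {λ j → tallies j + tallies j ∸ R} refl (λ _ → refl) J (λ j j< →
          subst (λ R → tallies j + tallies j ∸ R ≡ 0) 2h≡R (majority-no {h} {tallies j} {failures Ω j} (counted j j<) (few-failures Ω good j j<)))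
          where
          none : ∀ j → j < J → StageRadius.No n d l 1≤l Ul Vl (wBit j) (isStageGraph j)
          none j j< a = subst (λ j → ∃ λ i → ∀ e → StageRadius.Misses n d l 1≤l Ul Vl (wBit j) (isStageGraph j) a i e) (Finₚ.toℕ-fromℕ< j<) (stage-no ¬hs (fromℕ< j<) a)
          counted : ∀ j → j < J → tallies j ≤ failures Ω j
          counted j j< = Count.count-≤ {λ r → Solve.tallied Ω len r j} {λ r → pick (threshold ∸ at 0 (answers Ω r) j) 0 1} {λ r → fail 4N≤M room j (column R r Ω 0 k)} refl (λ _ → refl) R
            (λ r _ → vote-no {thr = threshold} (λ ok → far-out j (none j j<) (approximates j j< r ok)))

      Solved : Set
      Solved = ∃ λ m →
        (∀ (ω : Vec Bool m) → ∃ λ s → ∃ λ ω′ → ∃ λ τ → Exec B (solver A v l b threshold) (input3HS U V W) (Vec.toList ω) s ω′ τ ×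
          (τ ≤ timeFactor * suc d ^ timeDegree · n ^ℚ (1ℚ ℚ.+ 1ℚ ℚ.+ natℚ b ℚ.- unitℚ q))) ×
        Pr⅔ m (λ ω → ∃ λ s → ∃ λ ω′ → ∃ λ τ → Exec B (solver A v l b threshold) (input3HS U V W) ω s ω′ τ × Decides3HS U V W (var s 0))

      solved : Solved
      solved = k * R , (λ ω → timed (Vec.toList ω) (Vecₚ.length-toList ω)) , Pr-select bad bad-rare decided
        where
        timed : ∀ Ω → length Ω ≡ k * R → ∃ λ s → ∃ λ ω′ → ∃ λ τ → Exec B (solver A v l b threshold) (input3HS U V W) Ω s ω′ τ ×
          (τ ≤ timeFactor * suc d ^ timeDegree · n ^ℚ (1ℚ ℚ.+ 1ℚ ℚ.+ natℚ b ℚ.- unitℚ q))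
        timed Ω len = let (s , ω , τ , e , τ≤ , _) = solver-halts Ω len in s , ω , τ , e , ^ℚ-mono {τ} {Solve.solverTime Ω len} {timeFactor * suc d ^ timeDegree} {n} {1ℚ ℚ.+ 1ℚ ℚ.+ natℚ b ℚ.- unitℚ q} τ≤ (solver-fast Ω len)
        decided : ∀ Ω → length Ω ≡ k * R → bad Ω ≡ false → ∃ λ s → ∃ λ ω′ → ∃ λ τ → Exec B (solver A v l b threshold) (input3HS U V W) Ω s ω′ τ × Decides3HS U V W (var s 0)
        decided Ω len good = let (s , ω , τ , e , _ , v≡) = solver-halts Ω len in
          s , ω , τ , e , (λ hs → trans v≡ (accepts Ω len good hs)) , (λ ¬hs → trans v≡ (rejects Ω len good ¬hs))

    -- Only W is made large: |V| stays n, and a large exponent `b` spreads the cost of a single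
    -- preprocessing over `n ^ b` stages.
    fast3HS : Fast3HS 1ℚ (natℚ b) (unitℚ q)
    fast3HS = record { prog = solver A v l b threshold ; wordExponent = wordLength ; C = timeFactor ; k = timeDegree
                     ; solves = λ n {d} {nv} {nw} fv fw → instances n {d} {nv} {nw} (trans (floor-natℚ {n} {1} {nv} fv) (*-identityʳ n)) (floor-natℚ {n} {b} {nw} fw) }
      where
      instances : ∀ n {d nv nw} .{{_ : NonZero n}} → nv ≡ n → nw ≡ n ^ b → (U : Vec (Vector d) n) (V : Vec (Vector d) nv) (W : Vec (Vector d) nw) →
        VecUnique.Unique U → VecUnique.Unique V → VecUnique.Unique W →
        let Run = Exec ((2 + n + d) ^ wordLength) (solver A v l b threshold) (input3HS U V W) in
        ∃ λ m → (∀ (ω : Vec Bool m) → ∃ λ s → ∃ λ ω′ → ∃ λ τ → Run (Vec.toList ω) s ω′ τ ×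
            (τ ≤ timeFactor * suc d ^ timeDegree · n ^ℚ (1ℚ ℚ.+ 1ℚ ℚ.+ natℚ b ℚ.- unitℚ q))) ×
          Pr⅔ m (λ ω → ∃ λ s → ∃ λ ω′ → ∃ λ τ → Run ω s ω′ τ × Decides3HS U V W (var s 0))
      instances zero = ⊥-elim (≢-nonZero⁻¹ 0 refl)
      instances (suc m) {d} refl refl U V W uU _ _ = solved m d U V W uU

open Reductions

theorem3p2 : (t ε ε′ : ℚ) → 0ℚ ℚ.< t → 0ℚ ℚ.< ε → 0ℚ ℚ.< ε′ →
  Unbalanced3HSHypothesis →
  ∃₂ λ (C k : ℕ) →
    let Exists = λ (σ : Setting) (T : Timing) →
          ∃ λ (p : ℕ → ℕ) → ∃ λ (u : ℕ → ℕ) → ∃ λ (q : ℕ → ℕ) →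
            IsO p t × IsO u (ℤ.+ 2 ℚ./ 1 ℚ.- ε′) × IsO q (ℤ.+ 2 ℚ./ 1 ℚ.- ε′) ×
            DynamicRadius σ T (ℤ.+ 3 ℚ./ 2 ℚ.- ε) (λ n → C * n * suc ⌊log₂ n ⌋ ^ k) p u q
    in ¬ Exists fullyDynamic amortized
       × ¬ Exists incremental worstCase
       × ¬ Exists decremental worstCase
-- The edge bound `4 * n` has no logarithmic factor: with all connections subdivided into paths, the
-- dimension shows in the number of vertices and not in the density.
theorem3p2 t ε ε′ 0<t 0<ε 0<ε′ hypothesis = 4 , 0 , refute fully , refute incr , refute decr
  where
  refute : ∀ v → ¬ (∃ λ (p : ℕ → ℕ) → ∃ λ (u : ℕ → ℕ) → ∃ λ (q : ℕ → ℕ) →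
    IsO p t × IsO u (ℤ.+ 2 ℚ./ 1 ℚ.- ε′) × IsO q (ℤ.+ 2 ℚ./ 1 ℚ.- ε′) ×
    DynamicRadius (settingOf v) (timingOf v) (ℤ.+ 3 ℚ./ 2 ℚ.- ε) (λ n → 4 * n * suc ⌊log₂ n ⌋ ^ 0) p u q)
  refute v (p , u , q , p-O , u-O , q-O , alg) =
    hypothesis 1ℚ (natℚ _) (unitℚ _) (0<natℚ 0) (0<natℚ _) (0<unitℚ _) (Reduction.fast3HS {t} {ε} {ε′} 0<ε 0<ε′ v {p} {u} {q} p-O u-O q-O alg)
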